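{- Let $q$ be a prime power and let $m,l,k$ be positive integers satisfying $3\le k\le\min\{m+1,l\}$. Let $w\in\{0,1\}$ and, for each $2\le r\le k-1$ and each positive divisor $u$ of $\gcd(r+1,l)$, let $w_{r,u}$ be an integer with $0\le w_{r,u}\le n_{r+1,u}^l$. Suppose there exists a $q$-PBD$(l,K,\lambda)$ admitting $H$ as an automorphism group, where $$\lambda=\sum_{r=2}^{k-1}\ \sum_{u\mid\gcd(r+1,l)} w_{r,u}\,\frac{(q^k-1)(q^k-q)\prod_{j=2}^{k-2}(q^{ml}-q^{jl})}{(q^{u}-1)\prod_{j=r+1}^{k-1}(q^k-q^j)}\;+\;w\,q^{(l-1)\left(\binom{k}{2}-1\right)}\prod_{j=2}^{k-1}\frac{q^{(m-j)l}-1}{q^{k-j}-1}.$$ Then there exists a $q$-PBD$(ml,K\cup\{k\},\lambda)$ admitting $G=\mathrm{GL}(m,q^l)$ as an automorphism group. If the original $q$-PBD$(l,K,\lambda)$ is simple, then the resulting $q$-PBD is also simple.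
   Context: Empty products equal $1$. A $q$-PBD$(v,K,\lambda)$ ($q$-analog of a pairwise balanced design, also called a $2$-$(v,K,\lambda)_q$ design) is a pair $(V,\mathcal B)$ where $V$ is a $v$-dimensional vector space over $\mathrm{GF}(q)$ and $\mathcal B$ is a collection, possibly with repetition, of subspaces of $V$ (blocks) with dimensions in $K$, such that every $2$-dimensional subspace of $V$ is contained in exactly $\lambda$ blocks. It is simple if there are no repeated blocks. It admits a subgroup of $\mathrm{GL}(V)$ as an automorphism group if every element of that subgroup maps $\mathcal B$ to itself. $H$ is a Singer cycle of $\mathrm{GF}(q^l)$: identifying $\mathrm{GF}(q)^l$ with $\mathrm{GF}(q^l)$, $H$ is the cyclic group of order $q^l-1$ of all multiplications by elements of $\mathrm{GF}(q^l)^*$. The group $G=\mathrm{GL}(m,q^l)$ acts on $\mathrm{GF}(q)^{ml}$, identified with $\mathrm{GF}(q^l)^m$, by $\mathrm{GF}(q^l)$-linear maps. For $u\mid\gcd(d,l)$, $$n_{d,u}^l=\frac{q^u-1}{q^l-1}\sum_{t:\,u\mid t\mid\gcd(d,l)}\mu(t/u)\begin{bmatrix} l/t\\ d/t\end{bmatrix}_{q^t},$$ where $\mu$ is the Möbius function and $\begin{bmatrix} a\\ b\end{bmatrix}_{Q}$ is the Gaussian binomial coefficient. It equals the number of $H$-orbits on the $d$-dimensional $\mathrm{GF}(q)$-subspaces of $\mathrm{GF}(q^l)$ for which the stabilizer in $H$ of a subspace in the orbit is isomorphic to $\mathrm{GF}(q^u)^*$. -}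

module Defs where

open import Level using (0ℓ)
open import Algebra.Bundles using (CommutativeRing)
open import Algebra.Module.Bundles using (LeftModule)
import Algebra.Module.Construct.TensorUnit as TensorUnit
open import Algebra.Module.Morphism.Structures using (module LeftModuleMorphisms)
open import Algebra.Morphism.Structures using (module RingMorphisms)
import Algebra.Properties.CommutativeMonoid.Sum as CommutativeMonoidSum
open import Data.Fin.Base using (Fin)
open import Data.Fin.Permutation using (Permutation′; _⟨$⟩ʳ_)
open import Data.Fin.Subset using (Subset; ∣_∣) renaming (_∈_ to _∈ₛ_)
open import Data.Integer.Base as ℤ using (ℤ; +_; -1ℤ; 0ℤ)
open import Data.List.Base using (List; applyUpTo; filter; foldr; length; map)
open import Data.List.Relation.Unary.Any using (any?)
open import Data.Nat.Base as ℕ using (ℕ; zero; suc; _∸_; _^_)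
open import Data.Nat.Combinatorics using (_C_)
open import Data.Nat.Divisibility using (_∣?_)
import Data.Nat.DivMod as ℕ
open import Data.Nat.GCD using (gcd)
open import Data.Nat.ListAction using (product)
open import Data.Nat.Primality using (Prime; prime?)
open import Data.Product.Base using (∃-syntax; ∃₂; Σ-syntax; _×_; _,_)
open import Data.Rational.Base as ℚ using (ℚ; 0ℚ; 1ℚ)
open import Data.Vec.Functional using (Vector)
open import Function.Bundles using (Inverse; _⇔_)
open import Relation.Binary.PropositionalEquality as ≡ using (_≡_)
open import Relation.Nullary using (¬_; yes; no)
open import Relation.Nullary.Decidable using (_×-dec_)
open import Relation.Unary using (Pred; _∈_; _⊆_; _≐_; U)

range : ℕ → ℕ → List ℕ            -- a, a+1, …, b; empty when b < a
range a b = applyUpTo (a ℕ.+_) (suc b ∸ a)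

divisors : ℕ → List ℕ
divisors n = filter (_∣? n) (range 1 n)

∑ : List ℕ → (ℕ → ℚ) → ℚ
∑ xs f = foldr ℚ._+_ 0ℚ (map f xs)

∏ : List ℕ → (ℕ → ℚ) → ℚ
∏ xs f = foldr ℚ._*_ 1ℚ (map f xs)

∏ℕ : List ℕ → (ℕ → ℕ) → ℕ
∏ℕ xs f = product (map f xs)

fromℤ : ℤ → ℚ
fromℤ z = z ℚ./ 1

fromℕ : ℕ → ℚ
fromℕ n = fromℤ (+ n)

-- Division made total by giving the value 0 at divisor 0. In λ-value and in
-- n[_,_,_,_], for the parameters they are used with, no divisor is 0, and
-- every ∸ has its second argument at most its first.
infixl 7 _//_ _quot_

_//_ : ℕ → ℕ → ℚ
a // zero      = 0ℚ
a // b@(suc _) = (+ a) ℚ./ b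

_quot_ : ℕ → ℕ → ℕ
a quot zero      = 0
a quot b@(suc _) = a ℕ./ b

IsPrimePower : ℕ → Set
IsPrimePower q = ∃₂ λ p e → Prime p × 1 ℕ.≤ e × q ≡ p ^ e

μ : ℕ → ℤ
μ n with any? (λ d → (d ℕ.* d) ∣? n) (range 2 n)
... | yes _ = 0ℤ
... | no  _ = -1ℤ ℤ.^ length (filter (λ p → prime? p ×-dec (p ∣? n)) (range 1 n))

gaussian : (Q a b : ℕ) → ℚ
gaussian Q a b =
  ∏ℕ (range 1 b) (λ i → Q ^ (suc a ∸ i) ∸ 1) // ∏ℕ (range 1 b) (λ i → Q ^ i ∸ 1)

-- n[ q , l , d , u ] is the number written n with indices d, u and exponent l.
n[_,_,_,_] : (q l d u : ℕ) → ℚ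
n[ q , l , d , u ] =
  ((q ^ u ∸ 1) // (q ^ l ∸ 1)) ℚ.*
  ∑ (filter (u ∣?_) (divisors (gcd d l)))
    (λ t → fromℤ (μ (t quot u)) ℚ.* gaussian (q ^ t) (l quot t) (d quot t))

-- The value of λ, where w r u stands for the integer with indices r, u and ε
-- for the one in {0,1}.
λ-value : (q m l k : ℕ) (w : ℕ → ℕ → ℕ) (ε : ℕ) → ℚ
λ-value q m l k w ε =
  ∑ (range 2 (k ∸ 1)) (λ r → ∑ (divisors (gcd (suc r) l)) (λ u →
      fromℕ (w r u) ℚ.*
      (((q ^ k ∸ 1) ℕ.* (q ^ k ∸ q) ℕ.*
          ∏ℕ (range 2 (k ∸ 2)) (λ j → q ^ (m ℕ.* l) ∸ q ^ (j ℕ.* l)))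
       // ((q ^ u ∸ 1) ℕ.* ∏ℕ (range (suc r) (k ∸ 1)) (λ j → q ^ k ∸ q ^ j)))))
  ℚ.+
  fromℕ ε ℚ.* fromℕ (q ^ ((l ∸ 1) ℕ.* ((k C 2) ∸ 1))) ℚ.*
    ∏ (range 2 (k ∸ 1)) (λ j → (q ^ ((m ∸ j) ℕ.* l) ∸ 1) // (q ^ (k ∸ j) ∸ 1))

record Field : Set₁ where
  field
    commutativeRing : CommutativeRing 0ℓ 0ℓ
  open CommutativeRing commutativeRing public
  field
    0≉1     : ¬ (0# ≈ 1#)
    inverse : ∀ x → ¬ (x ≈ 0#) → ∃[ y ] x * y ≈ 1#

HasOrder : Field → ℕ → Set
HasOrder F n = Inverse (Field.setoid F) (≡.setoid (Fin n))

record FieldHom (F E : Field) : Set where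
  field
    ⟦_⟧                : Field.Carrier F → Field.Carrier E
    isRingHomomorphism : RingMorphisms.IsRingHomomorphism (Field.rawRing F) (Field.rawRing E) ⟦_⟧
  open RingMorphisms.IsRingHomomorphism isRingHomomorphism public

VectorSpace : Field → Set₁
VectorSpace F = LeftModule (Field.ring F) 0ℓ 0ℓ

power : (F : Field) → VectorSpace F → ℕ → VectorSpace F
power F V m = record
  { Carrierᴹ = Vector Carrierᴹ m
  ; _≈ᴹ_ = λ x y → ∀ i → x i ≈ᴹ y i
  ; _+ᴹ_ = λ x y i → x i +ᴹ y i
  ; _*ₗ_ = λ a x i → a *ₗ x i
  ; 0ᴹ   = λ _ → 0ᴹ
  ; -ᴹ_  = λ x i → -ᴹ x i
  ; isLeftModule = record
    { isLeftSemimodule = record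
      { +ᴹ-isCommutativeMonoid = record
        { isMonoid = record
          { isSemigroup = record
            { isMagma = record
              { isEquivalence = record
                { refl  = λ _ → ≈ᴹ-refl
                ; sym   = λ p i → ≈ᴹ-sym (p i)
                ; trans = λ p q i → ≈ᴹ-trans (p i) (q i)
                }
              ; ∙-cong = λ p q i → +ᴹ-cong (p i) (q i)
              }
            ; assoc = λ x y z i → +ᴹ-assoc (x i) (y i) (z i)
            }
          ; identity = (λ x i → +ᴹ-identityˡ (x i)) , (λ x i → +ᴹ-identityʳ (x i))
          }
        ; comm = λ x y i → +ᴹ-comm (x i) (y i)
        }
      ; isPreleftSemimodule = record
        { *ₗ-cong      = λ p q i → *ₗ-cong p (q i)
        ; *ₗ-zeroˡ     = λ x i → *ₗ-zeroˡ (x i)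
        ; *ₗ-distribʳ  = λ x a b i → *ₗ-distribʳ (x i) a b
        ; *ₗ-identityˡ = λ x i → *ₗ-identityˡ (x i)
        ; *ₗ-assoc     = λ a b x i → *ₗ-assoc a b (x i)
        ; *ₗ-zeroʳ     = λ a i → *ₗ-zeroʳ a
        ; *ₗ-distribˡ  = λ a x y i → *ₗ-distribˡ a (x i) (y i)
        }
      }
    ; -ᴹ‿cong    = λ p i → -ᴹ‿cong (p i)
    ; -ᴹ‿inverse = (λ x i → -ᴹ‿inverseˡ (x i)) , (λ x i → -ᴹ‿inverseʳ (x i))
    }
  } where open LeftModule V

restrictScalars : {F E : Field} → FieldHom F E → VectorSpace E → VectorSpace F
restrictScalars ι V = record
  { Carrierᴹ = Carrierᴹ
  ; _≈ᴹ_ = _≈ᴹ_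
  ; _+ᴹ_ = _+ᴹ_
  ; _*ₗ_ = λ a x → ⟦ a ⟧ *ₗ x
  ; 0ᴹ   = 0ᴹ
  ; -ᴹ_  = -ᴹ_
  ; isLeftModule = record
    { isLeftSemimodule = record
      { +ᴹ-isCommutativeMonoid = +ᴹ-isCommutativeMonoid
      ; isPreleftSemimodule = record
        { *ₗ-cong      = λ p q → *ₗ-cong (⟦⟧-cong p) q
        ; *ₗ-zeroˡ     = λ x → ≈ᴹ-trans (*ₗ-congʳ 0#-homo) (*ₗ-zeroˡ x)
        ; *ₗ-distribʳ  = λ x a b → ≈ᴹ-trans (*ₗ-congʳ (+-homo a b)) (*ₗ-distribʳ x ⟦ a ⟧ ⟦ b ⟧)
        ; *ₗ-identityˡ = λ x → ≈ᴹ-trans (*ₗ-congʳ 1#-homo) (*ₗ-identityˡ x)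
        ; *ₗ-assoc     = λ a b x → ≈ᴹ-trans (*ₗ-congʳ (*-homo a b)) (*ₗ-assoc ⟦ a ⟧ ⟦ b ⟧ x)
        ; *ₗ-zeroʳ     = λ a → *ₗ-zeroʳ ⟦ a ⟧
        ; *ₗ-distribˡ  = λ a x y → *ₗ-distribˡ ⟦ a ⟧ x y
        }
      }
    ; -ᴹ‿cong    = -ᴹ‿cong
    ; -ᴹ‿inverse = -ᴹ‿inverse
    }
  }
  where
  open LeftModule V
  open FieldHom ι

lineOver : (E : Field) → VectorSpace E
lineOver E = TensorUnit.leftModule {R = Field.ring E}

module _ (F : Field) (V : VectorSpace F) where
  private module F = Field F
  open LeftModule V
  open CommutativeMonoidSum +ᴹ-commutativeMonoid using (sum)
  open LeftModuleMorphisms rawLeftModule rawLeftModule using (IsLeftModuleIsomorphism)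

  record Subspace : Set₁ where
    field
      carrier  : Pred Carrierᴹ 0ℓ
      resp     : ∀ {x y} → x ≈ᴹ y → x ∈ carrier → y ∈ carrier
      0-closed : 0ᴹ ∈ carrier
      +-closed : ∀ {x y} → x ∈ carrier → y ∈ carrier → (x +ᴹ y) ∈ carrier
      *-closed : ∀ a {x} → x ∈ carrier → (a *ₗ x) ∈ carrier

  combination : ∀ {n} → Vector F.Carrier n → Vector Carrierᴹ n → Carrierᴹ
  combination c b = sum (λ i → c i *ₗ b i)

  record IsBasisOf (P : Pred Carrierᴹ 0ℓ) {n : ℕ} (b : Vector Carrierᴹ n) : Set where
    field
      members     : ∀ i → b i ∈ P
      independent : ∀ c → combination c b ≈ᴹ 0ᴹ → ∀ i → c i F.≈ F.0#
      spanning    : ∀ x → x ∈ P → ∃[ c ] x ≈ᴹ combination c b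

  HasDimension : Pred Carrierᴹ 0ℓ → ℕ → Set
  HasDimension P n = ∃[ b ] IsBasisOf P {n} b

  record GL : Set where
    field
      apply         : Carrierᴹ → Carrierᴹ
      isIsomorphism : IsLeftModuleIsomorphism apply

  image : (Carrierᴹ → Carrierᴹ) → Pred Carrierᴹ 0ℓ → Pred Carrierᴹ 0ℓ
  image f P y = ∃[ x ] x ∈ P × f x ≈ᴹ y

  -- The multiset of blocks is a finite family, an index for each occurrence.
  record qPBD (v : ℕ) (K : Pred ℕ 0ℓ) (Λ : ℕ) : Set₁ where
    field
      dimension : HasDimension U v
      #blocks   : ℕ
      block     : Fin #blocks → Subspace

    blockSet : Fin #blocks → Pred Carrierᴹ 0ℓ
    blockSet i = Subspace.carrier (block i)

    field
      block-dimension : ∀ i → ∃[ d ] d ∈ K × HasDimension (blockSet i) d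
      balanced        : ∀ (S : Subspace) → HasDimension (Subspace.carrier S) 2 →
                        ∃[ I ] ∣ I ∣ ≡ Λ ×
                          (∀ i → i ∈ₛ I ⇔ Subspace.carrier S ⊆ blockSet i)

  module _ {v : ℕ} {K : Pred ℕ 0ℓ} {Λ : ℕ} (D : qPBD v K Λ) where
    open qPBD D

    IsSimple : Set
    IsSimple = ∀ i j → blockSet i ≐ blockSet j → i ≡ j

    -- g carries the multiset of blocks to itself, multiplicities included.
    Preserves : GL → Set
    Preserves g = Σ[ π ∈ Permutation′ #blocks ]
      (∀ i → image (GL.apply g) (blockSet i) ≐ blockSet (π ⟨$⟩ʳ i))

    Admits : Pred GL 0ℓ → Set
    Admits H = ∀ g → g ∈ H → Preserves g

module _ {F E : Field} (ι : FieldHom F E) where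
  private module E = Field E

  -- E and E ^ m, regarded as vector spaces over F.
  extension : VectorSpace F
  extension = restrictScalars ι (lineOver E)

  extensionPower : ℕ → VectorSpace F
  extensionPower m = restrictScalars ι (power E (lineOver E) m)

  SingerCycle : Pred (GL F extension) 0ℓ
  SingerCycle g = ∃[ a ] ¬ (a E.≈ E.0#) × (∀ x → GL.apply g x E.≈ a E.* x)

  -- GL(m , E) as a subset of the F-linear automorphisms of E ^ m.
  GLₘ : (m : ℕ) → Pred (GL F (extensionPower m)) 0ℓ
  GLₘ m g = LeftModuleMorphisms.IsLeftModuleIsomorphism Eᵐ Eᵐ (GL.apply g)
    where Eᵐ = LeftModule.rawLeftModule (power E (lineOver E) m)

{-# OPTIONS --safe #-}

-- Every E-line of E^m carries a copy of the given design, well defined because that design is invariant under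
-- the Singer cycle H. The copies cover a 2-dimensional F-subspace S of E-rank 1 exactly Λ times, and one of
-- E-rank 2 not at all.
--
-- The other blocks are the F-spans U of k-tuples v in E^m whose E-linear relations are exactly the multiples of
-- one vector a of E^k. Up to the choice of v in U and of a, the invariant of U under GL(m,E) is the H-orbit of
-- the F-span of a in E. If that span is zero or of dimension r + 1 ≥ 3, then U meets every E-line in dimension
-- at most 1, so U contains no S of E-rank 1; and the number of U through an S of E-rank 2 follows by counting
-- the tuples v that extend a basis of S, the vectors a with a given span, and the multiples of a. The term of
-- Λ with indices r and u comes from the orbits of subspaces with stabiliser GF(q^u)*, and its last term from
-- a = 0.
--
-- There are enough such orbits: the stabiliser of a subspace of E is the unit group of a subfield, the d-dimensional
-- subspaces whose stabiliser contains GF(q^t)* are the GF(q^t)-subspaces of dimension d/t, which a Gaussian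
-- binomial coefficient counts, and Möbius inversion gives n[ q , l , d , u ]. Here GF(q^t), the set of fixed
-- points of x ↦ x^(q^t), has q^t elements because x^(q^t) − x has at most q^t roots and its values are roots of
-- the trace polynomial.

module Submission where

open import Defs
open import Level using (0ℓ)
open import Data.Nat using (ℕ; suc; _+_; _*_; _^_; _∸_; _≤_; _⊓_)
open import Data.Nat.Divisibility using (_∣_)
open import Data.Nat.GCD using (gcd)
open import Data.Product using (Σ-syntax; _×_)
open import Data.Rational using () renaming (_≤_ to _≤ℚ_)
open import Data.Sum using (_⊎_)
open import Relation.Binary.PropositionalEquality using (_≡_)
open import Relation.Unary using (Pred; _∪_; ｛_｝)
open import Algebra.Bundles using (CommutativeMonoid; AbelianGroup; CommutativeRing)
open import Algebra.Bundles.Raw using (RawRing)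
import Algebra.Definitions.RawMonoid as RawMonoidDefinitions
open import Algebra.Module.Bundles using (LeftModule)
open import Algebra.Module.Morphism.Structures using (module LeftModuleMorphisms)
import Algebra.Morphism.RingMonomorphism as RingMonomorphism
open import Algebra.Morphism.Structures using (module RingMorphisms)
import Algebra.Properties.AbelianGroup as AbelianGroupProperties
import Algebra.Properties.CommutativeMonoid.Sum as CMSum
import Algebra.Properties.CommutativeSemiring.Binomial as Binomial
import Algebra.Properties.CommutativeSemiring.Exp as CSExp
import Algebra.Properties.Ring as RingProperties
import Algebra.Properties.Semiring.Mult as SRMult
import Algebra.Properties.Semiring.Sum as SRSum
open import Algebra.Structures using (IsAbelianGroup; IsCommutativeRing)
open import Data.Bool.Base using (Bool; true; false)
import Data.Bool.Properties as Bool
open import Data.Empty using (⊥; ⊥-elim)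
open import Data.Fin.Base as Fin using (Fin; zero; suc; toℕ; inject₁; fromℕ<)
open import Data.Fin.Permutation using (Permutation′; permutation; _⟨$⟩ʳ_)
import Data.Fin.Properties as Fin
open import Data.Fin.Subset using (Subset) renaming (_∈_ to _∈ˢ_; ∣_∣ to card)
open import Data.Fin.Subset.Properties using () renaming (_∈?_ to _∈ˢ?_)
open import Data.Integer.Base as ℤ using (ℤ; -1ℤ; 0ℤ)
import Data.Integer.Properties as ℤ
open import Data.List.Base using (List; []; _∷_; applyUpTo; filter; length; map)
open import Data.List.Relation.Unary.All as Allᴸ using () renaming (_∷_ to _∷ᴬ_; All to Allᴸ; [] to []ᴬ)
import Data.List.Relation.Unary.All.Properties as Allᴸ
open import Data.List.Relation.Unary.AllPairs using () renaming ([] to []ᵁ; _∷_ to _∷ᵁ_)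
open import Data.List.Relation.Unary.Any as Any using (Any; any?; here; there)
import Data.List.Relation.Unary.Any.Properties as Any
open import Data.List.Relation.Unary.Unique.Propositional using (Unique)
import Data.List.Relation.Unary.Unique.Propositional.Properties as Unique
open import Data.Nat.Base as ℕ using (zero; _<_; z≤n; s≤s; NonZero; _!)
open import Data.Nat.Combinatorics using (_C_; nCn≡1; nCk≡n!/k![n-k]!; k![n∸k]!∣n!; nC1≡n; nCk+nC[k+1]≡[n+1]C[k+1])
open import Data.Nat.Coprimality using (Coprime; coprime-divisor)
open import Data.Nat.DivMod using (m/n*n≡m; m*n/n≡m)
open import Data.Nat.Divisibility using (_∣?_; divides; ∣⇒≤; ∣-refl; ∣-trans; m∣m*n; n∣m*n; _∤_; ∣1⇒≡1; *-monoʳ-∣; *-cancelˡ-∣; *-cancelʳ-∣; 0∣⇒≡0)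
open import Data.Nat.GCD using (gcd[m,n]∣m; gcd[m,n]∣n; gcd-greatest; gcd[m,n]≡0⇒m≡0)
open import Data.Nat.ListAction using (product)
open import Data.Nat.Primality using (Prime; euclidsLemma; prime⇒nonTrivial; prime⇒nonZero; prime?; prime⇒irreducible)
open import Data.Nat.Primality.Factorisation using (PrimeFactorisation; factorise)
import Data.Nat.Properties as ℕ
open import Data.Nat.Tactic.RingSolver using (solve-∀)
open import Data.Product.Base using (∃; ∃-syntax; Σ; _,_; proj₁; proj₂)
open import Data.Rational.Base as ℚ using (ℚ; 0ℚ; 1ℚ)
import Data.Rational.Properties as ℚ
open import Data.Rational.Unnormalised.Base as ℚᵘ using (mkℚᵘ; *≡*; *≤*)
import Data.Rational.Unnormalised.Properties as ℚᵘ
open import Data.Sum.Base as Sum using (inj₁; inj₂; [_,_]′)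
open import Data.Sum.Properties using (inj₁-injective; inj₂-injective)
open import Data.Unit.Base using (⊤; tt)
open import Data.Vec.Base as Vec using (Vec; []; _∷_; _++_; there)
open import Data.Vec.Functional using (Vector)
import Data.Vec.Properties as Vec
open import Data.Vec.Relation.Unary.All as All using (All; []; _∷_)
import Data.Vec.Relation.Unary.All.Properties as All
open import Function.Base using (_∘_; id)
open import Function.Bundles using (Inverse; Equivalence; mk⇔; _⇔_)
open import Relation.Binary.Definitions using (DecidableEquality)
open import Relation.Binary.PropositionalEquality using (_≢_; refl; sym; trans; cong; cong₂; subst; module ≡-Reasoning; subst₂)
open import Relation.Nullary using (¬_; Dec; yes; no; contradiction; does)
open import Relation.Nullary.Decidable using (map′; _×-dec_; ¬?; dec-true; _⊎-dec_)
open import Relation.Unary using (_⊆_)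

-- Finite types and double counting

-- A basis of `U` identifies `U` with F^k and extends to an E-linear map from E^k to E^m with kernel
-- E·a. If `U` meets an E-line in dimension 2, some nonzero `d − βc` with `c`, `d` over F lies in
-- this kernel, and its coordinates span at most two dimensions over F. This is the reason for r ≥
-- 2.
--
-- The summands of λ arise as follows. An orbit with stabiliser GF(q^u)* has (q^l - 1)/(q^u - 1)
-- members, each the span of ∏ (q^k - q^j), j ≤ r, vectors `a`; dividing by the q^l - 1 multiples of
-- `a` leaves 1/(q^u - 1). Of the k vectors of a tuple two are given and one is forced by the
-- relation, so ∏ (q^(ml) - q^(jl)), 2 ≤ j ≤ k - 2, counts the other k - 3. Dividing by the ∏ (q^k -
-- q^j), 2 ≤ j < k, completions of the pair to a basis of `U` leaves (q^k - 1)(q^k - q) over the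
-- factors with j > r.
--
-- Counts are equations of natural numbers with denominators multiplied out, on finite types with
-- propositional equality; the setoids of the statement are translated only at the end.

record Finite (A : Set) : Set where
  field
    size       : ℕ
    index      : A → Fin size
    elem       : Fin size → A
    elem-index : ∀ a → elem (index a) ≡ a
    index-elem : ∀ i → index (elem i) ≡ i

open Finite ⦃ ... ⦄ public

finite-↔ : {A B : Set} → Finite A → (to : A → B) (from : B → A) →
           (∀ b → to (from b) ≡ b) → (∀ a → from (to a) ≡ a) → Finite B
finite-↔ fin to from to-from from-to = record
  { size       = F.size
  ; index      = F.index ∘ from
  ; elem       = to ∘ F.elem
  ; elem-index = λ b → trans (cong to (F.elem-index (from b))) (to-from b)
  ; index-elem = λ i → trans (cong F.index (from-to (F.elem i))) (F.index-elem i)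
  } where module F = Finite fin

instance
  finite-Fin : ∀ {n} → Finite (Fin n)
  finite-Fin {n} = record
    { size = n ; index = id ; elem = id ; elem-index = λ _ → refl ; index-elem = λ _ → refl }

  finite-Bool : Finite Bool
  finite-Bool = finite-↔ finite-Fin to from (λ { true → refl ; false → refl }) (λ { zero → refl ; (suc zero) → refl })
    where
    to : Fin 2 → Bool
    to zero    = true
    to (suc _) = false
    from : Bool → Fin 2
    from true  = zero
    from false = suc zero

  finite-× : {A B : Set} ⦃ _ : Finite A ⦄ ⦃ _ : Finite B ⦄ → Finite (A × B)
  finite-× {A} {B} ⦃ a ⦄ ⦃ b ⦄ = record
    { size       = Finite.size a * Finite.size b
    ; index      = λ (x , y) → Fin.combine (index x) (index y)
    ; elem       = λ k → elem (proj₁ (Fin.remQuot {Finite.size a} (Finite.size b) k)) , elem (proj₂ (Fin.remQuot {Finite.size a} (Finite.size b) k))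
    ; elem-index = λ (x , y) → cong₂ _,_
        (trans (cong (elem ∘ proj₁) (Fin.remQuot-combine (index x) (index y))) (elem-index x))
        (trans (cong (elem ∘ proj₂) (Fin.remQuot-combine (index x) (index y))) (elem-index y))
    ; index-elem = λ k → trans (cong₂ Fin.combine (Finite.index-elem a _) (Finite.index-elem b _))
        (Fin.combine-remQuot {Finite.size a} (Finite.size b) k)
    }

  finite-⊎ : {A B : Set} ⦃ _ : Finite A ⦄ ⦃ _ : Finite B ⦄ → Finite (A ⊎ B)
  finite-⊎ {A} {B} ⦃ a ⦄ ⦃ b ⦄ = record
    { size       = Finite.size a + Finite.size b
    ; index      = λ x → Fin.join (Finite.size a) (Finite.size b) (from x)
    ; elem       = λ k → to (Fin.splitAt (Finite.size a) k)
    ; elem-index = λ x → trans (cong to (Fin.splitAt-join (Finite.size a) (Finite.size b) (from x))) (to-from x)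
    ; index-elem = λ k → trans (cong (Fin.join (Finite.size a) (Finite.size b)) (from-to (Fin.splitAt (Finite.size a) k)))
                               (Fin.join-splitAt (Finite.size a) (Finite.size b) k)
    }
    where
    to : Fin (Finite.size a) ⊎ Fin (Finite.size b) → A ⊎ B
    to = Sum.map elem elem
    from : A ⊎ B → Fin (Finite.size a) ⊎ Fin (Finite.size b)
    from = Sum.map index index
    to-from : ∀ x → to (from x) ≡ x
    to-from (inj₁ x) = cong inj₁ (elem-index x)
    to-from (inj₂ x) = cong inj₂ (elem-index x)
    from-to : ∀ x → from (to x) ≡ x
    from-to (inj₁ x) = cong inj₁ (Finite.index-elem a x)
    from-to (inj₂ x) = cong inj₂ (Finite.index-elem b x)

  finite-Vec : {A : Set} ⦃ _ : Finite A ⦄ → ∀ {n} → Finite (Vec A n)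
  finite-Vec {n = zero}  = finite-↔ (finite-Fin {1}) (λ _ → []) (λ _ → zero) (λ { [] → refl }) (λ { zero → refl })
  finite-Vec {n = suc n} = finite-↔ finite-× (λ (x , xs) → x ∷ xs) (λ { (x ∷ xs) → x , xs })
                             (λ { (x ∷ xs) → refl }) (λ _ → refl)

size-Vec : {A : Set} ⦃ fin : Finite A ⦄ → ∀ n → Finite.size (finite-Vec {A} {n}) ≡ size {A} ^ n
size-Vec zero = refl
size-Vec {A} (suc n) = cong (size {A} *_) (size-Vec n)

index-injective : {A : Set} ⦃ _ : Finite A ⦄ {a b : A} → index a ≡ index b → a ≡ b
index-injective {a = a} {b} eq = trans (sym (elem-index a)) (trans (cong elem eq) (elem-index b))

elem-injective : {A : Set} ⦃ _ : Finite A ⦄ {i j : Fin (size {A})} → elem {A} i ≡ elem j → i ≡ j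
elem-injective {A} {i = i} {j} eq = trans (sym (index-elem {A} i)) (trans (cong index eq) (index-elem {A} j))

infix 4 _≟_
_≟_ : {A : Set} ⦃ _ : Finite A ⦄ → DecidableEquality A
a ≟ b = map′ index-injective (cong index) (index a Fin.≟ index b)

∃? : {A : Set} ⦃ _ : Finite A ⦄ {P : A → Set} → (∀ a → Dec (P a)) → Dec (∃ P)
∃? {P = P} P? = map′ (λ (i , p) → elem i , p) (λ (a , p) → index a , subst P (sym (elem-index a)) p)
                     (Fin.any? (P? ∘ elem))

∀? : {A : Set} ⦃ _ : Finite A ⦄ {P : A → Set} → (∀ a → Dec (P a)) → Dec (∀ a → P a)
∀? {P = P} P? = map′ (λ f a → subst P (elem-index a) (f (index a))) (λ f → f ∘ elem) (Fin.all? (P? ∘ elem))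

infixr 2 _→?_
_→?_ : {P Q : Set} → Dec P → Dec Q → Dec (P → Q)
yes p →? yes q = yes λ _ → q
yes p →? no ¬q = no λ f → ¬q (f p)
no ¬p →? _     = yes λ p → ⊥-elim (¬p p)

-- Sums over finite types in a commutative monoid

module Summation (M : CommutativeMonoid 0ℓ 0ℓ) where
  private module M = CommutativeMonoid M
  open M using (_≈_; ε; _∙_) renaming (Carrier to C)
  open CMSum M using (sum; sum-remove; ∑-distrib-+; ∑-comm; sum-cong-≋; sum-replicate-zero)

  opaque
    total : {A : Set} ⦃ _ : Finite A ⦄ → (A → C) → C
    total f = sum (f ∘ elem)

  when : {P : Set} → Dec P → C → C
  when (yes _) x = x
  when (no _)  x = ε

  when-yes : {P : Set} (d : Dec P) {x : C} → P → when d x ≈ x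
  when-yes (yes _) p = M.refl
  when-yes (no ¬p) p = ⊥-elim (¬p p)

  when-no : {P : Set} (d : Dec P) {x : C} → ¬ P → when d x ≈ ε
  when-no (yes p) ¬p = ⊥-elim (¬p p)
  when-no (no _)  ¬p = M.refl

  when-cong : {P Q : Set} (d : Dec P) (e : Dec Q) {x y : C} → (P → Q) → (Q → P) → (P → x ≈ y) → when d x ≈ when e y
  when-cong (yes p) (yes q) f g h = h p
  when-cong (yes p) (no ¬q) f g h = ⊥-elim (¬q (f p))
  when-cong (no ¬p) (yes q) f g h = ⊥-elim (¬p (g q))
  when-cong (no ¬p) (no ¬q) f g h = M.refl

  module _ {A : Set} ⦃ _ : Finite A ⦄ where

    opaque
      unfolding total

      total-cong : {f g : A → C} → (∀ a → f a ≈ g a) → total f ≈ total g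
      total-cong eq = sum-cong-≋ (eq ∘ elem)

      total-ε : {f : A → C} → (∀ a → f a ≈ ε) → total f ≈ ε
      total-ε eq = M.trans (total-cong eq) (sum-replicate-zero (size {A}))

      total-∙ : (f g : A → C) → total (λ a → f a ∙ g a) ≈ total f ∙ total g
      total-∙ f g = ∑-distrib-+ (f ∘ elem) (g ∘ elem)

    private
      sum-single : ∀ {n} (t : Fin n → C) i → (∀ j → j ≢ i → t j ≈ ε) → sum t ≈ t i
      sum-single {suc n} t i eq = M.trans (sum-remove {i = i} t) (M.trans
        (M.∙-congˡ (M.trans (sum-cong-≋ (λ j → eq (Fin.punchIn i j) (Fin.punchInᵢ≢i i j))) (sum-replicate-zero n)))
        (M.identityʳ (t i)))

    opaque
      unfolding total

      total-single : {f : A → C} (a : A) → (∀ b → b ≢ a → f b ≈ ε) → total f ≈ f a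
      total-single {f} a eq = M.trans
        (sum-single (f ∘ elem) (index a)
          (λ j j≢ → eq (elem j) (λ p → j≢ (trans (sym (index-elem {A} j)) (cong index p)))))
        (M.reflexive (cong f (elem-index a)))


  opaque
    unfolding total

    total-swap : {A B : Set} ⦃ _ : Finite A ⦄ ⦃ _ : Finite B ⦄ (f : A → B → C) →
                 total (λ a → total (f a)) ≈ total (λ b → total (λ a → f a b))
    total-swap f = ∑-comm (λ i j → f (elem i) (elem j))

  -- Both sides are rewritten as the sum over the pairs in `R`. The hypotheses on rows and columns
  -- are stated for values instead of asking `R` to be a bijection, so that an element whose summand
  -- is `ε` need not have a partner.
  total-transfer : {A B : Set} ⦃ _ : Finite A ⦄ ⦃ _ : Finite B ⦄ {R : A → B → Set} (R? : ∀ a b → Dec (R a b))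
                   {f : A → C} {g : B → C} → (∀ {a b} → R a b → f a ≈ g b) →
                   (∀ a → total (λ b → when (R? a b) (f a)) ≈ f a) →
                   (∀ b → total (λ a → when (R? a b) (g b)) ≈ g b) → total f ≈ total g
  total-transfer R? {f} {g} f≈g row col = M.trans
    (M.sym (total-cong row)) (M.trans
    (total-cong (λ a → total-cong (λ b → when-cong (R? a b) (R? a b) id id f≈g))) (M.trans
    (total-swap (λ a b → when (R? a b) (g b))) (total-cong col)))

  total-bij : {A B : Set} ⦃ _ : Finite A ⦄ ⦃ _ : Finite B ⦄ {f : A → C} {g : B → C} (h : A → B) (k : B → A) →
              (∀ b → h (k b) ≡ b) → (∀ a → k (h a) ≡ a) → (∀ a → f a ≈ g (h a)) → total f ≈ total g
  total-bij {f = f} {g} h k hk kh eq = total-transfer (λ a b → h a ≟ b) {f} {g} (λ { {a} refl → eq a })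
    (λ a → M.trans (total-single (h a) (λ b b≢ → when-no (h a ≟ b) (b≢ ∘ sym))) (when-yes (h a ≟ h a) refl))
    (λ b → M.trans (total-single (k b) (λ a a≢ → when-no (h a ≟ b) (λ p → a≢ (trans (sym (kh a)) (cong k p)))))
                   (when-yes (h (k b) ≟ b) (hk b)))

module Summationℕ = Summation ℕ.+-0-commutativeMonoid
open Summationℕ public using (total; total-cong; total-single; total-swap; total-bij)
  renaming (total-ε to total-0; total-∙ to total-+)

ind : {P : Set} → Dec P → ℕ
ind (yes _) = 1
ind (no _)  = 0

ind-yes : {P : Set} (d : Dec P) → P → ind d ≡ 1
ind-yes (yes _) p = refl
ind-yes (no ¬p) p = ⊥-elim (¬p p)

ind-no : {P : Set} (d : Dec P) → ¬ P → ind d ≡ 0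
ind-no (yes p) ¬p = ⊥-elim (¬p p)
ind-no (no _)  ¬p = refl

ind-mono : {P Q : Set} (d : Dec P) (e : Dec Q) → (P → Q) → ind d ≤ ind e
ind-mono (no _)  e       f = z≤n
ind-mono (yes p) (yes q) f = ℕ.≤-refl
ind-mono (yes p) (no ¬q) f = ⊥-elim (¬q (f p))

ind-cong : {P Q : Set} (d : Dec P) (e : Dec Q) → (P → Q) → (Q → P) → ind d ≡ ind e
ind-cong d e f g = ℕ.≤-antisym (ind-mono d e f) (ind-mono e d g)

ind-× : {P Q : Set} (d : Dec P) (e : Dec Q) → ind (d ×-dec e) ≡ ind d * ind e
ind-× (yes p) (yes q) = refl
ind-× (yes p) (no ¬q) = refl
ind-× (no ¬p) e       = refl

ind-split : {P Q : Set} (d : Dec P) (e : Dec Q) → ind d ≡ ind (d ×-dec e) + ind (d ×-dec ¬? e)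
ind-split (yes p) (yes q) = refl
ind-split (yes p) (no ¬q) = refl
ind-split (no ¬p) e       = refl

opaque
  unfolding Summation.total

  total-*ˡ : {A : Set} ⦃ _ : Finite A ⦄ (c : ℕ) (f : A → ℕ) → total (λ a → c * f a) ≡ c * total f
  total-*ˡ c f = sym (SRSum.*-distribˡ-sum ℕ.+-*-semiring c (f ∘ elem))

  total-*ʳ : {A : Set} ⦃ _ : Finite A ⦄ (c : ℕ) (f : A → ℕ) → total (λ a → f a * c) ≡ total f * c
  total-*ʳ c f = sym (SRSum.*-distribʳ-sum ℕ.+-*-semiring c (f ∘ elem))

  total-mono : {A : Set} ⦃ _ : Finite A ⦄ {f g : A → ℕ} → (∀ a → f a ≤ g a) → total f ≤ total g
  total-mono {A} f≤g = go (f≤g ∘ elem)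
    where
    open CMSum ℕ.+-0-commutativeMonoid using (sum)
    go : ∀ {n} {s t : Fin n → ℕ} → (∀ i → s i ≤ t i) → sum s ≤ sum t
    go {zero}  h = z≤n
    go {suc n} h = ℕ.+-mono-≤ (h zero) (go (h ∘ suc))

count : {A : Set} ⦃ _ : Finite A ⦄ {P : A → Set} → (∀ a → Dec (P a)) → ℕ
count P? = total (λ a → ind (P? a))

module _ {A : Set} ⦃ _ : Finite A ⦄ {P : A → Set} (P? : ∀ a → Dec (P a)) where

  count-none : (∀ a → ¬ P a) → count P? ≡ 0
  count-none ¬P = total-0 (λ a → ind-no (P? a) (¬P a))

  count-unique : ∀ a → P a → (∀ b → P b → b ≡ a) → count P? ≡ 1
  count-unique a p uniq = trans (total-single a (λ b b≢a → ind-no (P? b) (b≢a ∘ uniq b))) (ind-yes (P? a) p)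

  count-ind : {Q : Set} (Q? : Dec Q) → (∀ a → P a → Q) → (Q → ∃[ a ] P a) → (∀ a b → P a → P b → a ≡ b) →
              count P? ≡ ind Q?
  count-ind (yes q) f g uniq = count-unique (proj₁ (g q)) (proj₂ (g q)) (λ b pb → uniq b _ pb (proj₂ (g q)))
  count-ind (no ¬q) f g uniq = count-none (λ a p → ¬q (f a p))

  count-split : {Q : A → Set} (Q? : ∀ a → Dec (Q a)) →
                count P? ≡ count (λ a → P? a ×-dec Q? a) + count (λ a → P? a ×-dec ¬? (Q? a))
  count-split Q? = trans (total-cong (λ a → ind-split (P? a) (Q? a))) (total-+ _ _)

  opaque
    count-pos : 0 < count P? → ∃[ a ] P a
    count-pos pos with ∃? P?
    ... | yes ∃P = ∃P
    ... | no ¬∃P = contradiction (count-none (λ a p → ¬∃P (a , p))) (ℕ.<⇒≢ pos ∘ sym)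

  count-scale : {Q : Set} (Q? : Dec Q) → count (λ a → Q? ×-dec P? a) ≡ ind Q? * count P?
  count-scale Q? = trans (total-cong (λ a → ind-× Q? (P? a))) (total-*ˡ (ind Q?) _)

module _ {A : Set} ⦃ _ : Finite A ⦄ {P Q : A → Set} (P? : ∀ a → Dec (P a)) (Q? : ∀ a → Dec (Q a)) where

  count-mono : (∀ a → P a → Q a) → count P? ≤ count Q?
  count-mono P⊆Q = total-mono (λ a → ind-mono (P? a) (Q? a) (P⊆Q a))

  count-cong : (∀ a → P a → Q a) → (∀ a → Q a → P a) → count P? ≡ count Q?
  count-cong f g = total-cong (λ a → ind-cong (P? a) (Q? a) (f a) (g a))

opaque
  count-⊆-< : {A : Set} ⦃ _ : Finite A ⦄ {P Q : A → Set} (P? : ∀ a → Dec (P a)) (Q? : ∀ a → Dec (Q a)) →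
              count P? < count Q? → ∃[ a ] Q a × ¬ P a
  count-⊆-< P? Q? lt = count-pos (λ a → Q? a ×-dec ¬? (P? a)) (ℕ.n≢0⇒n>0 λ z → ℕ.<⇒≱ lt (begin
    count Q?                                                                  ≡⟨ count-split Q? P? ⟩
    count (λ a → Q? a ×-dec P? a) + count (λ a → Q? a ×-dec ¬? (P? a))        ≡⟨ cong (count (λ a → Q? a ×-dec P? a) +_) z ⟩
    count (λ a → Q? a ×-dec P? a) + 0                                         ≡⟨ ℕ.+-identityʳ _ ⟩
    count (λ a → Q? a ×-dec P? a)                                             ≤⟨ count-mono (λ a → Q? a ×-dec P? a) P? (λ _ → proj₂) ⟩
    count P?                                                                  ∎))
    where open ℕ.≤-Reasoning

count-nonempty : {A : Set} ⦃ _ : Finite A ⦄ {P : A → Set} (P? : ∀ a → Dec (P a)) → ∀ a → P a → 0 < count P?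
count-nonempty P? a p = ℕ.≤-trans (ℕ.≤-reflexive (sym (count-unique (λ b → b ≟ a) a refl (λ _ eq → eq))))
                                  (count-mono (λ b → b ≟ a) P? (λ { _ refl → p }))

opaque
  -- Stands in for dimension arguments: independent tuples are shown to span, rows to fill F^d and
  -- subfields of the same order to coincide by comparing cardinalities.
  count-⊇ : {A : Set} ⦃ _ : Finite A ⦄ {P Q : A → Set} (P? : ∀ a → Dec (P a)) (Q? : ∀ a → Dec (Q a)) →
            (∀ a → P a → Q a) → count Q? ≤ count P? → ∀ a → Q a → P a
  count-⊇ {P = P} {Q} P? Q? P⊆Q le a q with P? a
  ... | yes p = p
  ... | no ¬p = contradiction le (ℕ.<⇒≱ (begin-strict
    count P?                                ≡⟨ count-cong P? Q∧P? (λ a p → P⊆Q a p , p) (λ _ → proj₂) ⟩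
    count Q∧P?                              <⟨ ℕ.m<m+n _ (count-nonempty Q∖P? a (q , ¬p)) ⟩
    count Q∧P? + count Q∖P?                 ≡⟨ sym (count-split Q? P?) ⟩
    count Q?                                ∎))
    where
    open ℕ.≤-Reasoning
    Q∧P? : ∀ a → Dec (Q a × P a)
    Q∧P? a = Q? a ×-dec P? a
    Q∖P? : ∀ a → Dec (Q a × ¬ P a)
    Q∖P? a = Q? a ×-dec ¬? (P? a)

-- Both sides count the pairs in R.
double-count : {A B : Set} ⦃ _ : Finite A ⦄ ⦃ _ : Finite B ⦄ {P : A → Set} {Q : B → Set} {R : A → B → Set}
               (P? : ∀ a → Dec (P a)) (Q? : ∀ b → Dec (Q b)) (R? : ∀ a b → Dec (R a b)) (c d : ℕ) →
               (∀ a → count (R? a) ≡ c * ind (P? a)) → (∀ b → count (λ a → R? a b) ≡ d * ind (Q? b)) →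
               c * count P? ≡ d * count Q?
double-count P? Q? R? c d rows cols = begin
  c * count P?                             ≡⟨ sym (total-*ˡ c _) ⟩
  total (λ a → c * ind (P? a))             ≡⟨ sym (total-cong rows) ⟩
  total (λ a → count (R? a))               ≡⟨ total-swap _ ⟩
  total (λ b → count (λ a → R? a b))       ≡⟨ total-cong cols ⟩
  total (λ b → d * ind (Q? b))             ≡⟨ total-*ˡ d _ ⟩
  d * count Q?                             ∎
  where open ≡-Reasoning

count-bij : {A B : Set} ⦃ _ : Finite A ⦄ ⦃ _ : Finite B ⦄ {P : A → Set} {Q : B → Set}
            (P? : ∀ a → Dec (P a)) (Q? : ∀ b → Dec (Q b)) {R : A → B → Set} (R? : ∀ a b → Dec (R a b)) →
            (∀ a b → R a b → P a × Q b) →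
            (∀ a → P a → ∃[ b ] R a b) → (∀ a b b′ → R a b → R a b′ → b ≡ b′) →
            (∀ b → Q b → ∃[ a ] R a b) → (∀ a a′ b → R a b → R a′ b → a ≡ a′) →
            count P? ≡ count Q?
count-bij P? Q? R? dom f f! g g! = trans (sym (ℕ.+-identityʳ _)) (trans (double-count P? Q? R? 1 1
  (λ a → trans (count-ind (R? a) (P? a) (λ b r → proj₁ (dom a b r)) (f a) (f! a)) (sym (ℕ.+-identityʳ _)))
  (λ b → trans (count-ind (λ a → R? a b) (Q? b) (λ a r → proj₂ (dom a b r)) (g b) (λ a a′ → g! a a′ b)) (sym (ℕ.+-identityʳ _))))
  (ℕ.+-identityʳ _))

count-inj : {A B : Set} ⦃ _ : Finite A ⦄ ⦃ _ : Finite B ⦄ {P : A → Set} {Q : B → Set}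
            (P? : ∀ a → Dec (P a)) (Q? : ∀ b → Dec (Q b)) (h : A → B) → (∀ a → P a → Q (h a)) →
            (∀ a a′ → P a → P a′ → h a ≡ h a′ → a ≡ a′) → count P? ≤ count Q?
count-inj P? Q? h PQ inj = ℕ.≤-trans
  (ℕ.≤-reflexive (count-bij P? I? (λ a b → P? a ×-dec (h a ≟ b))
    (λ { a b (p , refl) → p , (a , p , refl) }) (λ a p → h a , p , refl) (λ { a b b′ (_ , refl) (_ , refl) → refl })
    (λ b i → i) (λ { a a′ b (p , refl) (p′ , eq) → inj a a′ p p′ (sym eq) })))
  (count-mono I? Q? (λ { b (a , p , refl) → PQ a p }))
  where I? = λ b → ∃? (λ a → P? a ×-dec (h a ≟ b))

opaque
  unfolding Summation.total

  count-all : {A : Set} ⦃ _ : Finite A ⦄ → count {A} (λ _ → yes tt) ≡ size {A}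
  count-all {A} = go (size {A})
    where
    open CMSum ℕ.+-0-commutativeMonoid using (sum)
    go : ∀ n → sum {n} (λ _ → 1) ≡ n
    go zero    = refl
    go (suc n) = cong suc (go n)

total-Vec : {A : Set} ⦃ _ : Finite A ⦄ {n : ℕ} (f : Vec A (suc n) → ℕ) →
            total f ≡ total (λ x → total (λ xs → f (x ∷ xs)))
total-Vec {A} {n} f = trans (total-bij {g = λ xxs → f (proj₁ xxs ∷ proj₂ xxs)} (λ { (x ∷ xs) → x , xs }) (λ (x , xs) → x ∷ xs)
                             (λ _ → refl) (λ { (x ∷ xs) → refl }) (λ { (x ∷ xs) → refl }))
                           (total-× (λ (x , xs) → f (x ∷ xs)))
  where
  open Summationℕ using (when; when-yes; when-no)
  total-× : {A B : Set} ⦃ _ : Finite A ⦄ ⦃ _ : Finite B ⦄ (f : A × B → ℕ) → total f ≡ total (λ a → total (λ b → f (a , b)))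
  total-× {A} {B} f = begin
    total f
      ≡⟨ total-cong (λ p → sym (trans (total-single (proj₁ p) (λ a a≢ → total-0 (λ b → when-no (p ≟ (a , b)) (a≢ ∘ sym ∘ cong proj₁))))
           (trans (total-single (proj₂ p) (λ b b≢ → when-no (p ≟ (proj₁ p , b)) (b≢ ∘ sym ∘ cong proj₂))) (when-yes (p ≟ p) refl)))) ⟩
    total (λ p → total (λ a → total (λ b → when (p ≟ (a , b)) (f p))))
      ≡⟨ trans (total-swap _) (total-cong (λ a → total-swap _)) ⟩
    total (λ a → total (λ b → total (λ p → when (p ≟ (a , b)) (f p))))
      ≡⟨ total-cong (λ a → total-cong (λ b → trans (total-single (a , b) (λ p p≢ → when-no (p ≟ (a , b)) p≢))
           (when-yes ((a , b) ≟ (a , b)) refl))) ⟩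
    total (λ a → total (λ b → f (a , b))) ∎
    where open ≡-Reasoning

injective⇒permutation : ∀ {n} (f : Fin n → Fin n) → (∀ i j → f i ≡ f j → i ≡ j) →
                        Σ[ π ∈ Permutation′ n ] (∀ i → Data.Fin.Permutation._⟨$⟩ʳ_ π i ≡ f i)
injective⇒permutation {n} f inj = permutation f g f∘g (λ i → inj _ _ (f∘g (f i))) , λ _ → refl
  where
  image? : ∀ j → Dec (∃[ i ] f i ≡ j)
  image? j = ∃? (λ i → f i ≟ j)
  surj : ∀ j → ∃[ i ] f i ≡ j
  surj j = count-⊇ image? (λ _ → yes tt) (λ _ _ → tt)
    (count-inj (λ _ → yes tt) image? f (λ i _ → i , refl) (λ i i′ _ _ → inj i i′)) j tt
  g = λ j → proj₁ (surj j)
  f∘g = λ j → proj₂ (surj j)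

record Enumeration {A : Set} ⦃ _ : Finite A ⦄ {P : A → Set} (P? : ∀ a → Dec (P a)) : Set where
  field
    at           : Fin (count P?) → A
    at-sound     : ∀ i → P (at i)
    at-injective : ∀ i j → at i ≡ at j → i ≡ j
    at-complete  : ∀ a → P a → ∃[ i ] at i ≡ a

opaque
  unfolding Summation.total

  enumerate : {A : Set} ⦃ _ : Finite A ⦄ {P : A → Set} (P? : ∀ a → Dec (P a)) → Enumeration P?
  enumerate {A} {P} P? = record
    { at = elem ∘ pick (P? ∘ elem)
    ; at-sound = pick-sound (P? ∘ elem)
    ; at-injective = λ i j eq → pick-injective (P? ∘ elem) i j (elem-injective {A} eq)
    ; at-complete = λ a p → let i , eq = pick-complete (P? ∘ elem) (index a) (subst P (sym (elem-index a)) p)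
                            in i , trans (cong elem eq) (elem-index a)
    }
    where
    open CMSum ℕ.+-0-commutativeMonoid using (sum)
    #_ : ∀ {n} {Q : Fin n → Set} → (∀ i → Dec (Q i)) → ℕ
    # Q? = sum (λ i → ind (Q? i))
    pick : ∀ {n} {Q : Fin n → Set} (Q? : ∀ i → Dec (Q i)) → Fin (# Q?) → Fin n
    pick {suc n} Q? k with Q? zero
    pick {suc n} Q? zero    | yes _ = zero
    pick {suc n} Q? (suc k) | yes _ = suc (pick (Q? ∘ suc) k)
    pick {suc n} Q? k       | no _  = suc (pick (Q? ∘ suc) k)
    pick-sound : ∀ {n} {Q : Fin n → Set} (Q? : ∀ i → Dec (Q i)) k → Q (pick Q? k)
    pick-sound {suc n} Q? k with Q? zero
    pick-sound {suc n} Q? zero    | yes q = q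
    pick-sound {suc n} Q? (suc k) | yes _ = pick-sound (Q? ∘ suc) k
    pick-sound {suc n} Q? k       | no _  = pick-sound (Q? ∘ suc) k
    pick-injective : ∀ {n} {Q : Fin n → Set} (Q? : ∀ i → Dec (Q i)) k k′ → pick Q? k ≡ pick Q? k′ → k ≡ k′
    pick-injective {suc n} Q? k k′ eq with Q? zero
    pick-injective {suc n} Q? zero    zero     eq | yes _ = refl
    pick-injective {suc n} Q? (suc k) (suc k′) eq | yes _ = cong suc (pick-injective (Q? ∘ suc) k k′ (Fin.suc-injective eq))
    pick-injective {suc n} Q? k       k′       eq | no _  = pick-injective (Q? ∘ suc) k k′ (Fin.suc-injective eq)
    pick-complete : ∀ {n} {Q : Fin n → Set} (Q? : ∀ i → Dec (Q i)) i → Q i → ∃[ k ] pick Q? k ≡ i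
    pick-complete {suc n} Q? i q with Q? zero
    pick-complete {suc n} Q? zero    q | yes _ = zero , refl
    pick-complete {suc n} Q? zero    q | no ¬q = ⊥-elim (¬q q)
    pick-complete {suc n} Q? (suc i) q | yes _ = let k , eq = pick-complete (Q? ∘ suc) i q in suc k , cong suc eq
    pick-complete {suc n} Q? (suc i) q | no _  = let k , eq = pick-complete (Q? ∘ suc) i q in k , cong suc eq

-- Linear algebra over the subfields of a finite field

-- Bit vectors instead of predicates: sets with the same elements are then equal, and sets of
-- subspaces, needed for unions of orbits, are again elements of a finite type.
record Powerset (A : Set) ⦃ _ : Finite A ⦄ : Set where
  constructor fromBits
  field
    bits : Vec Bool (size {A})

open Powerset

instance
  finite-Powerset : {A : Set} ⦃ _ : Finite A ⦄ → Finite (Powerset A)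
  finite-Powerset = finite-↔ finite-Vec fromBits bits (λ _ → refl) (λ _ → refl)

module _ {A : Set} ⦃ _ : Finite A ⦄ where

  infix 4 _∈ᴾ_ _∈ᴾ?_
  opaque
    _∈ᴾ_ : A → Powerset A → Set
    a ∈ᴾ U = Vec.lookup (bits U) (index a) ≡ true

    _∈ᴾ?_ : ∀ a U → Dec (a ∈ᴾ U)
    a ∈ᴾ? U = Vec.lookup (bits U) (index a) Bool.≟ true

    ⟦_⟧ᴾ : {P : A → Set} → (∀ a → Dec (P a)) → Powerset A
    ⟦ P? ⟧ᴾ = fromBits (Vec.tabulate (does ∘ P? ∘ elem))

    private
      lookup-⟦⟧ᴾ : {P : A → Set} (P? : ∀ a → Dec (P a)) (a : A) → Vec.lookup (bits ⟦ P? ⟧ᴾ) (index a) ≡ does (P? a)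
      lookup-⟦⟧ᴾ P? a = trans (Vec.lookup∘tabulate (does ∘ P? ∘ elem) (index a)) (cong (does ∘ P?) (elem-index a))

    ∈-⟦⟧ᴾ⁺ : {P : A → Set} (P? : ∀ a → Dec (P a)) {a : A} → P a → a ∈ᴾ ⟦ P? ⟧ᴾ
    ∈-⟦⟧ᴾ⁺ P? {a} p = trans (lookup-⟦⟧ᴾ P? a) (dec-true (P? a) p)

    ∈-⟦⟧ᴾ⁻ : {P : A → Set} (P? : ∀ a → Dec (P a)) {a : A} → a ∈ᴾ ⟦ P? ⟧ᴾ → P a
    ∈-⟦⟧ᴾ⁻ P? {a} a∈ with P? a | trans (sym (lookup-⟦⟧ᴾ P? a)) a∈
    ... | yes p | _ = p

    Powerset-ext : {U U′ : Powerset A} → (∀ a → a ∈ᴾ U → a ∈ᴾ U′) → (∀ a → a ∈ᴾ U′ → a ∈ᴾ U) → U ≡ U′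
    Powerset-ext {U} {U′} f g = cong fromBits (trans (sym (Vec.tabulate∘lookup (bits U)))
      (trans (Vec.tabulate-cong eq) (Vec.tabulate∘lookup (bits U′))))
      where
      bool : (b c : Bool) → (b ≡ true → c ≡ true) → (c ≡ true → b ≡ true) → b ≡ c
      bool true  true  f g = refl
      bool true  false f g = sym (f refl)
      bool false true  f g = g refl
      bool false false f g = refl
      eq : ∀ i → Vec.lookup (bits U) i ≡ Vec.lookup (bits U′) i
      eq i = bool _ _ (λ p → subst (λ j → Vec.lookup (bits U′) j ≡ true) (index-elem {A} i)
                         (f (elem i) (subst (λ j → Vec.lookup (bits U) j ≡ true) (sym (index-elem {A} i)) p)))
                      (λ p → subst (λ j → Vec.lookup (bits U) j ≡ true) (index-elem {A} i)
                         (g (elem i) (subst (λ j → Vec.lookup (bits U′) j ≡ true) (sym (index-elem {A} i)) p)))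

prod : (ℕ → ℕ) → ℕ → ℕ
prod f zero    = 1
prod f (suc n) = prod f n * f n

-- The number of ways to add `n` vectors to `r` independent ones, keeping independence, in a space
-- of `X` elements over a field of order `Q`: after `j` additions the next vector avoids the
-- `Q ^ (j + r)` elements already spanned.
fall : (Q X r n : ℕ) → ℕ
fall Q X r = prod (λ j → X ∸ Q ^ (j + r))

-- The tuple is built from its last entry to its first. The number `f n` of admissible heads may
-- depend on the length of the tuple being extended but not on the tuple, which is what makes the
-- count a product.
count-tower : {A : Set} ⦃ _ : Finite A ⦄ {I : ∀ {n} → Vec A n → Set} (I? : ∀ {n} (xs : Vec A n) → Dec (I xs)) (f : ℕ → ℕ) →
              I [] → (∀ {n x} {xs : Vec A n} → I (x ∷ xs) → I xs) →
              (∀ {n} (xs : Vec A n) → I xs → count (λ x → I? (x ∷ xs)) ≡ f n) → ∀ n → count (I? {n}) ≡ prod f n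
count-tower {A} {I} I? f i[] pop step zero = count-unique I? [] i[] (λ { [] _ → refl })
count-tower {A} {I} I? f i[] pop step (suc n) = begin
  count (I? {suc n})                                                   ≡⟨ total-Vec _ ⟩
  total (λ x → total (λ (xs : Vec A n) → ind (I? (x ∷ xs))))            ≡⟨ total-swap _ ⟩
  total (λ (xs : Vec A n) → count (λ x → I? (x ∷ xs)))                 ≡⟨ total-cong fibre ⟩
  total (λ (xs : Vec A n) → ind (I? xs) * f n)                         ≡⟨ total-*ʳ (f n) _ ⟩
  count (I? {n}) * f n                                                 ≡⟨ cong (_* f n) (count-tower I? f i[] pop step n) ⟩
  prod f n * f n                                                       ∎
  where
  open ≡-Reasoning
  fibre : ∀ xs → count (λ x → I? (x ∷ xs)) ≡ ind (I? xs) * f n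
  fibre xs with I? xs
  ... | yes i = trans (step xs i) (sym (ℕ.+-identityʳ (f n)))
  ... | no ¬i = count-none (λ x → I? (x ∷ xs)) (λ x → ¬i ∘ pop)

prod-const : ∀ c n → prod (λ _ → c) n ≡ c ^ n
prod-const c zero    = refl
prod-const c (suc n) = trans (cong (_* c) (prod-const c n)) (ℕ.*-comm (c ^ n) c)

count-All : {A : Set} ⦃ _ : Finite A ⦄ {P : A → Set} (P? : ∀ a → Dec (P a)) → ∀ n → count (λ (xs : Vec A n) → All.all? P? xs) ≡ count P? ^ n
count-All P? n = trans (count-tower (λ xs → All.all? P? xs) (λ _ → count P?) [] (λ { (_ ∷ ps) → ps })
  (λ xs ps → count-cong (λ x → All.all? P? (x ∷ xs)) P? (λ { x (p ∷ _) → p }) (λ x p → p ∷ ps)) n) (prod-const _ n)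

count-diff : {A : Set} ⦃ _ : Finite A ⦄ {P Q : A → Set} (P? : ∀ a → Dec (P a)) (Q? : ∀ a → Dec (Q a)) →
             (∀ a → P a → Q a) → count (λ a → Q? a ×-dec ¬? (P? a)) ≡ count Q? ∸ count P?
count-diff P? Q? P⊆Q = sym (trans (cong₂ _∸_ (count-split Q? P?)
  (count-cong P? (λ a → Q? a ×-dec P? a) (λ a p → P⊆Q a p , p) (λ _ → proj₂))) (ℕ.m+n∸m≡n (count (λ a → Q? a ×-dec P? a)) _))

-- Finite fields, vector spaces and subfields

record FiniteField : Set₁ where
  infixl 6 _+ᴱ_
  infixl 7 _*ᴱ_
  infix  8 -ᴱ_
  field
    Carrierᴱ : Set
    _+ᴱ_ _*ᴱ_ : Carrierᴱ → Carrierᴱ → Carrierᴱ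
    -ᴱ_ : Carrierᴱ → Carrierᴱ
    0ᴱ 1ᴱ : Carrierᴱ
    isCommutativeRing : IsCommutativeRing _≡_ _+ᴱ_ _*ᴱ_ -ᴱ_ 0ᴱ 1ᴱ
    0≢1 : 0ᴱ ≢ 1ᴱ
    recip : ∀ x → x ≢ 0ᴱ → ∃[ y ] x *ᴱ y ≡ 1ᴱ
    ⦃ finiteᴱ ⦄ : Finite Carrierᴱ

  commutativeRing : CommutativeRing 0ℓ 0ℓ
  commutativeRing = record { isCommutativeRing = isCommutativeRing }
  module R = CommutativeRing commutativeRing
  module RP = RingProperties R.ring

module Spaces (E : FiniteField) where
  open FiniteField E

  record Space : Set₁ where
    infixl 6 _+ᴹ_
    infixr 7 _·_
    infix  8 -ᴹ_
    field
      Carrierᴹ : Set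
      _+ᴹ_ : Carrierᴹ → Carrierᴹ → Carrierᴹ
      0ᴹ : Carrierᴹ
      -ᴹ_ : Carrierᴹ → Carrierᴹ
      _·_ : Carrierᴱ → Carrierᴹ → Carrierᴹ
      isAbelianGroup : IsAbelianGroup _≡_ _+ᴹ_ 0ᴹ -ᴹ_
      ·-distribˡ : ∀ a x y → a · (x +ᴹ y) ≡ a · x +ᴹ a · y
      ·-distribʳ : ∀ a b x → (a +ᴱ b) · x ≡ a · x +ᴹ b · x
      ·-assoc    : ∀ a b x → (a *ᴱ b) · x ≡ a · b · x
      ·-identity : ∀ x → 1ᴱ · x ≡ x
      ⦃ finiteᴹ ⦄ : Finite Carrierᴹ

    abelianGroup : AbelianGroup 0ℓ 0ℓ
    abelianGroup = record { isAbelianGroup = isAbelianGroup }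
    module A = AbelianGroup abelianGroup
    module AP = AbelianGroupProperties abelianGroup

    +ᴹ-interchange : ∀ x y z w → (x +ᴹ y) +ᴹ (z +ᴹ w) ≡ (x +ᴹ z) +ᴹ (y +ᴹ w)
    +ᴹ-interchange x y z w = begin
      (x +ᴹ y) +ᴹ (z +ᴹ w)  ≡⟨ A.assoc x y (z +ᴹ w) ⟩
      x +ᴹ (y +ᴹ (z +ᴹ w))  ≡⟨ cong (x +ᴹ_) (sym (A.assoc y z w)) ⟩
      x +ᴹ ((y +ᴹ z) +ᴹ w)  ≡⟨ cong (λ t → x +ᴹ (t +ᴹ w)) (A.comm y z) ⟩
      x +ᴹ ((z +ᴹ y) +ᴹ w)  ≡⟨ cong (x +ᴹ_) (A.assoc z y w) ⟩
      x +ᴹ (z +ᴹ (y +ᴹ w))  ≡⟨ sym (A.assoc x z (y +ᴹ w)) ⟩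
      (x +ᴹ z) +ᴹ (y +ᴹ w)  ∎
      where open ≡-Reasoning

    ·-zeroˡ : ∀ x → 0ᴱ · x ≡ 0ᴹ
    ·-zeroˡ x = AP.identityʳ-unique (0ᴱ · x) (0ᴱ · x) (trans (sym (·-distribʳ 0ᴱ 0ᴱ x)) (cong (_· x) (R.+-identityˡ 0ᴱ)))

    ·-zeroʳ : ∀ a → a · 0ᴹ ≡ 0ᴹ
    ·-zeroʳ a = AP.identityʳ-unique (a · 0ᴹ) (a · 0ᴹ) (trans (sym (·-distribˡ a 0ᴹ 0ᴹ)) (cong (a ·_) (A.identityˡ 0ᴹ)))

    0·x+y≡y : ∀ x y → 0ᴱ · x +ᴹ y ≡ y
    0·x+y≡y x y = trans (cong (_+ᴹ y) (·-zeroˡ x)) (A.identityˡ y)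

    -·-inverse : ∀ a x → a · x +ᴹ (-ᴱ a) · x ≡ 0ᴹ
    -·-inverse a x = trans (sym (·-distribʳ a (-ᴱ a) x)) (trans (cong (_· x) (R.-‿inverseʳ a)) (·-zeroˡ x))

    -·≡- : ∀ a x → (-ᴱ a) · x ≡ -ᴹ (a · x)
    -·≡- a x = AP.inverseʳ-unique (a · x) ((-ᴱ a) · x) (-·-inverse a x)

    -1·≡- : ∀ x → (-ᴱ 1ᴱ) · x ≡ -ᴹ x
    -1·≡- x = trans (-·≡- 1ᴱ x) (cong -ᴹ_ (·-identity x))

    x+y≡0⇒x≡-y : ∀ x y → x +ᴹ y ≡ 0ᴹ → x ≡ -ᴹ y
    x+y≡0⇒x≡-y = AP.inverseˡ-unique

    ·-cancel : ∀ {a} → a ≢ 0ᴱ → ∀ {x} → a · x ≡ 0ᴹ → x ≡ 0ᴹ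
    ·-cancel {a} a≢0 {x} ax≡0 with y , ay≡1 ← recip a a≢0 = begin
      x               ≡⟨ sym (·-identity x) ⟩
      1ᴱ · x          ≡⟨ cong (_· x) (sym (trans (R.*-comm y a) ay≡1)) ⟩
      (y *ᴱ a) · x    ≡⟨ ·-assoc y a x ⟩
      y · a · x       ≡⟨ cong (y ·_) ax≡0 ⟩
      y · 0ᴹ          ≡⟨ ·-zeroʳ y ⟩
      0ᴹ              ∎
      where open ≡-Reasoning

  Points : Space → Set
  Points = Space.Carrierᴹ

  regular : Space
  regular = record
    { Carrierᴹ = Carrierᴱ ; _+ᴹ_ = _+ᴱ_ ; 0ᴹ = 0ᴱ ; -ᴹ_ = -ᴱ_ ; _·_ = _*ᴱ_
    ; isAbelianGroup = R.+-isAbelianGroup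
    ; ·-distribˡ = R.distribˡ ; ·-distribʳ = λ a b x → R.distribʳ x a b
    ; ·-assoc = R.*-assoc ; ·-identity = R.*-identityˡ }

  infixl 8 _^ˢ_
  _^ˢ_ : Space → ℕ → Space
  V ^ˢ n = record
    { Carrierᴹ = Vec Carrierᴹ n
    ; _+ᴹ_ = Vec.zipWith _+ᴹ_ ; 0ᴹ = Vec.replicate n 0ᴹ ; -ᴹ_ = Vec.map -ᴹ_ ; _·_ = λ a → Vec.map (a ·_)
    ; isAbelianGroup = record
      { isGroup = record
        { isMonoid = record
          { isSemigroup = record
            { isMagma = record { isEquivalence = Relation.Binary.PropositionalEquality.isEquivalence ; ∙-cong = cong₂ (Vec.zipWith _+ᴹ_) }
            ; assoc = Vec.zipWith-assoc A.assoc }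
          ; identity = Vec.zipWith-identityˡ A.identityˡ , Vec.zipWith-identityʳ A.identityʳ }
        ; inverse = Vec.zipWith-inverseˡ A.inverseˡ , Vec.zipWith-inverseʳ A.inverseʳ
        ; ⁻¹-cong = cong (Vec.map -ᴹ_) }
      ; comm = Vec.zipWith-comm A.comm }
    ; ·-distribˡ = λ a x y → distˡ a x y ; ·-distribʳ = distʳ ; ·-assoc = assoc ; ·-identity = ident }
    where
    open Space V
    distˡ : ∀ {n} a (x y : Vec Carrierᴹ n) → Vec.map (a ·_) (Vec.zipWith _+ᴹ_ x y) ≡ Vec.zipWith _+ᴹ_ (Vec.map (a ·_) x) (Vec.map (a ·_) y)
    distˡ a []       []       = refl
    distˡ a (x ∷ xs) (y ∷ ys) = cong₂ _∷_ (·-distribˡ a x y) (distˡ a xs ys)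
    distʳ : ∀ {n} a b (x : Vec Carrierᴹ n) → Vec.map ((a +ᴱ b) ·_) x ≡ Vec.zipWith _+ᴹ_ (Vec.map (a ·_) x) (Vec.map (b ·_) x)
    distʳ a b []       = refl
    distʳ a b (x ∷ xs) = cong₂ _∷_ (·-distribʳ a b x) (distʳ a b xs)
    assoc : ∀ {n} a b (x : Vec Carrierᴹ n) → Vec.map ((a *ᴱ b) ·_) x ≡ Vec.map (a ·_) (Vec.map (b ·_) x)
    assoc a b []       = refl
    assoc a b (x ∷ xs) = cong₂ _∷_ (·-assoc a b x) (assoc a b xs)
    ident : ∀ {n} (x : Vec Carrierᴹ n) → Vec.map (1ᴱ ·_) x ≡ x
    ident []       = refl
    ident (x ∷ xs) = cong₂ _∷_ (·-identity x) (ident xs)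

  module _ (n : ℕ) where
    open Space (regular ^ˢ n) public using () renaming (_+ᴹ_ to add; _·_ to scale; 0ᴹ to zeros)

  record Linear (V W : Space) (f : Points V → Points W) : Set where
    private
      module V = Space V
      module W = Space W
    field
      +-homo : ∀ x y → f (x V.+ᴹ y) ≡ f x W.+ᴹ f y
      ·-homo : ∀ a x → f (a V.· x) ≡ a W.· f x

    0-homo : f V.0ᴹ ≡ W.0ᴹ
    0-homo = trans (cong f (sym (V.·-zeroˡ V.0ᴹ))) (trans (·-homo 0ᴱ V.0ᴹ) (W.·-zeroˡ _))

  comb : (V : Space) → ∀ {n} → Vec Carrierᴱ n → Vec (Points V) n → Points V
  comb V []       []       = Space.0ᴹ V
  comb V (c ∷ cs) (v ∷ vs) = Space._+ᴹ_ V (Space._·_ V c v) (comb V cs vs)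

  comb-map : {V W : Space} {f : Points V → Points W} → Linear V W f →
             ∀ {n} (c : Vec Carrierᴱ n) vs → comb W c (Vec.map f vs) ≡ f (comb V c vs)
  comb-map lin []       []       = sym (Linear.0-homo lin)
  comb-map {V} {W} {f} lin (c ∷ cs) (v ∷ vs) = sym (trans (Linear.+-homo lin (Space._·_ V c v) (comb V cs vs))
    (cong₂ (Space._+ᴹ_ W) (Linear.·-homo lin c v) (sym (comb-map {V} {W} lin cs vs))))

  module _ (V : Space) where
    open Space V

    comb-linear : ∀ {n} (vs : Vec Carrierᴹ n) → Linear (regular ^ˢ n) V (λ c → comb V c vs)
    comb-linear {n} vs = record { +-homo = λ c d → +-homo c d vs ; ·-homo = λ a c → ·-homo a c vs }
      where
      +-homo : ∀ {n} c d (vs : Vec Carrierᴹ n) → comb V (add n c d) vs ≡ comb V c vs +ᴹ comb V d vs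
      +-homo []       []       []       = sym (A.identityˡ 0ᴹ)
      +-homo (c ∷ cs) (d ∷ ds) (v ∷ vs) = trans (cong₂ _+ᴹ_ (·-distribʳ c d v) (+-homo cs ds vs)) (+ᴹ-interchange _ _ _ _)
      ·-homo : ∀ {n} a c (vs : Vec Carrierᴹ n) → comb V (scale n a c) vs ≡ a · comb V c vs
      ·-homo a []       []       = sym (·-zeroʳ a)
      ·-homo a (c ∷ cs) (v ∷ vs) = trans (cong₂ _+ᴹ_ (·-assoc a c v) (·-homo a cs vs)) (sym (·-distribˡ a _ _))

    comb-linearʳ : ∀ {n} (c : Vec Carrierᴱ n) → Linear (V ^ˢ n) V (comb V c)
    comb-linearʳ c = record { +-homo = +-homo c ; ·-homo = λ a → ·-homo a c }
      where
      +-homo : ∀ {n} (c : Vec Carrierᴱ n) vs ws → comb V c (Space._+ᴹ_ (V ^ˢ n) vs ws) ≡ comb V c vs +ᴹ comb V c ws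
      +-homo []       []       []       = sym (A.identityˡ 0ᴹ)
      +-homo (c ∷ cs) (v ∷ vs) (w ∷ ws) = trans (cong₂ _+ᴹ_ (·-distribˡ c v w) (+-homo cs vs ws)) (+ᴹ-interchange _ _ _ _)
      ·-homo : ∀ {n} a (c : Vec Carrierᴱ n) vs → comb V c (Space._·_ (V ^ˢ n) a vs) ≡ a · comb V c vs
      ·-homo a []       []       = sym (·-zeroʳ a)
      ·-homo a (c ∷ cs) (v ∷ vs) = trans (cong₂ _+ᴹ_ (trans (sym (·-assoc c a v)) (trans (cong (_· v) (R.*-comm c a)) (·-assoc a c v)))
        (·-homo a cs vs)) (sym (·-distribˡ a _ _))

    comb-0 : ∀ {n} (vs : Vec Carrierᴹ n) → comb V (zeros n) vs ≡ 0ᴹ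
    comb-0 vs = Linear.0-homo (comb-linear vs)

    comb-comb : ∀ {m n} (c : Vec Carrierᴱ m) (P : Vec (Vec Carrierᴱ n) m) (vs : Vec Carrierᴹ n) →
                comb V c (Vec.map (λ p → comb V p vs) P) ≡ comb V (comb (regular ^ˢ n) c P) vs
    comb-comb {n = n} c P vs = comb-map {regular ^ˢ n} {V} (comb-linear vs) c P

  unit : ∀ n → Vec (Vec Carrierᴱ n) n
  unit zero    = []
  unit (suc n) = (1ᴱ ∷ zeros n) ∷ Vec.map (0ᴱ ∷_) (unit n)

  0∷-linear : ∀ n → Linear (regular ^ˢ n) (regular ^ˢ suc n) (0ᴱ ∷_)
  0∷-linear n = record { +-homo = λ x y → cong (_∷ add n x y) (sym (R.+-identityˡ 0ᴱ)) ; ·-homo = λ a x → cong (_∷ scale n a x) (sym (R.zeroʳ a)) }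

  comb-unit : ∀ {n} (c : Vec Carrierᴱ n) → comb (regular ^ˢ n) c (unit n) ≡ c
  comb-unit []       = refl
  comb-unit {suc n} (c ∷ cs) = trans
    (cong (add (suc n) (scale (suc n) c (1ᴱ ∷ zeros n)))
      (trans (comb-map {regular ^ˢ n} {regular ^ˢ suc n} (0∷-linear n) cs (unit n)) (cong (0ᴱ ∷_) (comb-unit cs))))
    (cong₂ _∷_ (trans (R.+-identityʳ _) (R.*-identityʳ c))
      (trans (cong (λ z → add n z cs) (Space.·-zeroʳ (regular ^ˢ n) c)) (Space.A.identityˡ (regular ^ˢ n) cs)))

  comb-comm : ∀ {n} (c d : Vec Carrierᴱ n) → comb regular c d ≡ comb regular d c
  comb-comm []       []       = refl
  comb-comm (c ∷ cs) (d ∷ ds) = cong₂ _+ᴱ_ (R.*-comm c d) (comb-comm cs ds)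

  record Subfield : Set₁ where
    field
      _∈K  : Carrierᴱ → Set
      _∈K? : ∀ a → Dec (a ∈K)
      0∈K  : 0ᴱ ∈K
      1∈K  : 1ᴱ ∈K
      +∈K  : ∀ {a b} → a ∈K → b ∈K → (a +ᴱ b) ∈K
      *∈K  : ∀ {a b} → a ∈K → b ∈K → (a *ᴱ b) ∈K
      -∈K  : ∀ {a} → a ∈K → (-ᴱ a) ∈K
      recip∈K : ∀ {a b} → a ∈K → a *ᴱ b ≡ 1ᴱ → b ∈K

    order : ℕ
    order = count _∈K?

    1<order : 1 < order
    1<order = subst (_< order) (count-unique (λ a → a ≟ 0ᴱ) 0ᴱ refl (λ _ p → p))
      (ℕ.≰⇒> λ le → 0≢1 (sym (count-⊇ (λ a → a ≟ 0ᴱ) _∈K? (λ { _ refl → 0∈K }) le 1ᴱ 1∈K)))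

  everything : Subfield
  everything = record { _∈K = λ _ → ⊤ ; _∈K? = λ _ → yes tt ; 0∈K = tt ; 1∈K = tt ; +∈K = λ _ _ → tt ; *∈K = λ _ _ → tt
                      ; -∈K = λ _ → tt ; recip∈K = λ _ _ → tt }

  -- Linear algebra over `K` takes place inside E-spaces, with the coefficients restricted to `K`.
  -- One and the same space is thereby a space over F, over each intermediate field and, with
  -- `everything`, over E.
  module Over (K : Subfield) where
    open Subfield K

    AllK : ∀ {n} → Vec Carrierᴱ n → Set
    AllK = All _∈K

    allK? : ∀ {n} (c : Vec Carrierᴱ n) → Dec (AllK c)
    allK? = All.all? _∈K?

    zeros∈K : ∀ n → AllK (zeros n)
    zeros∈K zero    = []
    zeros∈K (suc n) = 0∈K ∷ zeros∈K n

    add∈K : ∀ {n} {c d : Vec Carrierᴱ n} → AllK c → AllK d → AllK (add n c d)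
    add∈K []       []       = []
    add∈K (p ∷ ps) (q ∷ qs) = +∈K p q ∷ add∈K ps qs

    scale∈K : ∀ {n a} {c : Vec Carrierᴱ n} → a ∈K → AllK c → AllK (scale n a c)
    scale∈K p []       = []
    scale∈K p (q ∷ qs) = *∈K p q ∷ scale∈K p qs

    0∷∈K : ∀ {m n} {P : Vec (Vec Carrierᴱ n) m} → All AllK P → All AllK (Vec.map (0ᴱ ∷_) P)
    0∷∈K []       = []
    0∷∈K (p ∷ ps) = (0∈K ∷ p) ∷ 0∷∈K ps

    unit∈K : ∀ n → All AllK (unit n)
    unit∈K zero    = []
    unit∈K (suc n) = (1∈K ∷ zeros∈K n) ∷ 0∷∈K (unit∈K n)

    module _ (V : Space) where
      open Space V

      Span : ∀ {n} → Vec Carrierᴹ n → Carrierᴹ → Set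
      Span vs x = ∃[ c ] AllK c × comb V c vs ≡ x

      Span? : ∀ {n} (vs : Vec Carrierᴹ n) x → Dec (Span vs x)
      Span? vs x = ∃? (λ c → allK? c ×-dec (comb V c vs ≟ x))

      Indep : ∀ {n} → Vec Carrierᴹ n → Set
      Indep {n} vs = ∀ c → AllK c → comb V c vs ≡ 0ᴹ → c ≡ zeros n

      Indep? : ∀ {n} (vs : Vec Carrierᴹ n) → Dec (Indep vs)
      Indep? vs = ∀? (λ c → allK? c →? ((comb V c vs ≟ 0ᴹ) →? (c ≟ zeros _)))

      IsSubspace : (Carrierᴹ → Set) → Set
      IsSubspace W = W 0ᴹ × (∀ x y → W x → W y → W (x +ᴹ y)) × (∀ a x → a ∈K → W x → W (a · x))

      IsSubspace? : {W : Carrierᴹ → Set} → (∀ x → Dec (W x)) → Dec (IsSubspace W)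
      IsSubspace? W? = W? 0ᴹ ×-dec (∀? (λ x → ∀? (λ y → W? x →? (W? y →? W? (x +ᴹ y)))) ×-dec
                                    ∀? (λ a → ∀? (λ x → (a ∈K?) →? (W? x →? W? (a · x)))))

      IsBasis : (Carrierᴹ → Set) → ∀ {n} → Vec Carrierᴹ n → Set
      IsBasis W vs = All W vs × Indep vs × (∀ x → W x → Span vs x)

      comb∈ : {W : Carrierᴹ → Set} → IsSubspace W → ∀ {n} {c : Vec Carrierᴱ n} {vs} → AllK c → All W vs → W (comb V c vs)
      comb∈ sub@(0∈ , _)         []       []       = 0∈
      comb∈ sub@(_ , +∈ , ·∈) (p ∷ ps) (w ∷ ws) = +∈ _ _ (·∈ _ _ p w) (comb∈ sub ps ws)

      Span⊆ : {W : Carrierᴹ → Set} → IsSubspace W → ∀ {n} {vs : Vec Carrierᴹ n} → All W vs → ∀ x → Span vs x → W x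
      Span⊆ sub ws x (c , cK , refl) = comb∈ sub cK ws

      Span-isSubspace : ∀ {n} (vs : Vec Carrierᴹ n) → IsSubspace (Span vs)
      Span-isSubspace {n} vs = (zeros n , zeros∈K n , comb-0 V vs)
        , (λ { _ _ (c , cK , refl) (d , dK , refl) → add n c d , add∈K cK dK , Linear.+-homo (comb-linear V vs) c d })
        , (λ { a _ aK (c , cK , refl) → scale n a c , scale∈K aK cK , Linear.·-homo (comb-linear V vs) a c })

      Span-∷ : ∀ {n} {v} {vs : Vec Carrierᴹ n} {x} → Span vs x → Span (v ∷ vs) x
      Span-∷ {v = v} (c , cK , refl) = 0ᴱ ∷ c , 0∈K ∷ cK , 0·x+y≡y v _

      Span-head : ∀ {n} {v} {vs : Vec Carrierᴹ n} → Span (v ∷ vs) v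
      Span-head {n} {v} {vs} = 1ᴱ ∷ zeros n , 1∈K ∷ zeros∈K n , trans (cong₂ _+ᴹ_ (·-identity v) (comb-0 V vs)) (A.identityʳ v)

      All-Span : ∀ {n} (vs : Vec Carrierᴹ n) → All (Span vs) vs
      All-Span []       = []
      All-Span (v ∷ vs) = Span-head ∷ All.map Span-∷ (All-Span vs)

      indep-unique : ∀ {n} {vs : Vec Carrierᴹ n} → Indep vs → ∀ {c d} → AllK c → AllK d → comb V c vs ≡ comb V d vs → c ≡ d
      indep-unique {n} {vs} ind {c} {d} cK dK eq = begin
        c                                          ≡⟨ x+y≡0⇒x≡-y′ c (scale n (-ᴱ 1ᴱ) d) (ind _ (add∈K cK (scale∈K (-∈K 1∈K) dK)) sum≡0) ⟩
        Eⁿ.-ᴹ (scale n (-ᴱ 1ᴱ) d)                   ≡⟨ cong Eⁿ.-ᴹ_ (Eⁿ.-1·≡- d) ⟩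
        Eⁿ.-ᴹ (Eⁿ.-ᴹ d)                             ≡⟨ Eⁿ.AP.⁻¹-involutive d ⟩
        d                                          ∎
        where
        open ≡-Reasoning
        module Eⁿ = Space (regular ^ˢ n)
        x+y≡0⇒x≡-y′ = Eⁿ.x+y≡0⇒x≡-y
        sum≡0 : comb V (add n c (scale n (-ᴱ 1ᴱ) d)) vs ≡ 0ᴹ
        sum≡0 = trans (Linear.+-homo (comb-linear V vs) c _) (trans (cong₂ _+ᴹ_ eq
          (trans (Linear.·-homo (comb-linear V vs) (-ᴱ 1ᴱ) d) (-1·≡- _))) (A.inverseʳ _))

      indep-∷ : ∀ {n} {v} {vs : Vec Carrierᴹ n} → Indep vs → ¬ Span vs v → Indep (v ∷ vs)
      indep-∷ {n} {v} {vs} indep v∉ (c ∷ cs) (cK ∷ csK) eq with c ≟ 0ᴱ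
      ... | yes refl = cong (0ᴱ ∷_) (indep cs csK (trans (sym (0·x+y≡y v (comb V cs vs))) eq))
      ... | no c≢0 with y , cy≡1 ← recip c c≢0 = ⊥-elim (v∉
        ( scale n (-ᴱ y) cs , scale∈K (-∈K (recip∈K cK cy≡1)) csK
        , trans (Linear.·-homo (comb-linear V vs) (-ᴱ y) cs) (trans (-·≡- y _) (sym (x+y≡0⇒x≡-y v _ v+yw≡0)))))
        where
        v+yw≡0 : v +ᴹ y · comb V cs vs ≡ 0ᴹ
        v+yw≡0 = begin
          v +ᴹ y · comb V cs vs             ≡⟨ cong (_+ᴹ y · comb V cs vs) (sym (·-identity v)) ⟩
          1ᴱ · v +ᴹ y · comb V cs vs        ≡⟨ cong (λ t → t · v +ᴹ y · comb V cs vs) (sym (trans (R.*-comm y c) cy≡1)) ⟩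
          (y *ᴱ c) · v +ᴹ y · comb V cs vs  ≡⟨ cong (_+ᴹ y · comb V cs vs) (·-assoc y c v) ⟩
          y · c · v +ᴹ y · comb V cs vs     ≡⟨ sym (·-distribˡ y _ _) ⟩
          y · (c · v +ᴹ comb V cs vs)       ≡⟨ cong (y ·_) eq ⟩
          y · 0ᴹ                            ≡⟨ ·-zeroʳ y ⟩
          0ᴹ                                ∎
          where open ≡-Reasoning

      indep-tail : ∀ {n} {v} {vs : Vec Carrierᴹ n} → Indep (v ∷ vs) → Indep vs
      indep-tail {v = v} indep c cK eq = cong Vec.tail (indep (0ᴱ ∷ c) (0∈K ∷ cK)
        (trans (0·x+y≡y v _) eq))

      indep-head : ∀ {n} {v} {vs : Vec Carrierᴹ n} → Indep (v ∷ vs) → ¬ Span vs v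
      indep-head {n} {v} {vs} indep (c , cK , refl) = 0≢1 (sym (begin
        1ᴱ            ≡⟨ sym (RP.-‿involutive 1ᴱ) ⟩
        -ᴱ (-ᴱ 1ᴱ)    ≡⟨ cong (-ᴱ_ ∘ Vec.head) (indep (-ᴱ 1ᴱ ∷ c) (-∈K 1∈K ∷ cK) (trans (cong (_+ᴹ v) (-1·≡- v)) (A.inverseˡ v))) ⟩
        -ᴱ 0ᴱ         ≡⟨ RP.-0#≈0# ⟩
        0ᴱ            ∎))
        where open ≡-Reasoning

      indep-[] : Indep []
      indep-[] [] _ _ = refl

      count-Span : ∀ {n} {vs : Vec Carrierᴹ n} → Indep vs → count (Span? vs) ≡ order ^ n
      count-Span {n} {vs} indep = trans
        (count-bij (Span? vs) allK? (λ x c → allK? c ×-dec (comb V c vs ≟ x))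
          (λ { x c (cK , eq) → (c , cK , eq) , cK }) (λ x s → s)
          (λ { x c d (cK , refl) (dK , eq) → indep-unique indep cK dK (sym eq) })
          (λ c cK → comb V c vs , cK , refl) (λ { x y c (_ , refl) (_ , refl) → refl }))
        (count-All _∈K? n)

      count-Span-≤ : ∀ {n} (vs : Vec Carrierᴹ n) → count (Span? vs) ≤ order ^ n
      count-Span-≤ {n} vs = ℕ.≤-trans (count-inj (Span? vs) (allK? {n}) coeffs coeffs∈K
          (λ x y sx sy eq → trans (sym (coeffs-comb x sx)) (trans (cong (λ c → comb V c vs) eq) (coeffs-comb y sy))))
        (ℕ.≤-reflexive (count-All _∈K? n))
        where
        coeffs : Carrierᴹ → Vec Carrierᴱ n
        coeffs x with Span? vs x
        ... | yes (c , _) = c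
        ... | no _        = zeros n
        coeffs∈K : ∀ x → Span vs x → AllK (coeffs x)
        coeffs∈K x s with Span? vs x
        ... | yes (c , cK , _) = cK
        ... | no _             = zeros∈K n
        coeffs-comb : ∀ x → Span vs x → comb V (coeffs x) vs ≡ x
        coeffs-comb x s with Span? vs x
        ... | yes (c , _ , eq) = eq
        ... | no ¬s            = ⊥-elim (¬s s)

      module _ {W : Carrierᴹ → Set} (W? : ∀ x → Dec (W x)) (sub : IsSubspace W) where

        count-extensions : ∀ {r} {us : Vec Carrierᴹ r} → Indep us → All W us → ∀ n →
          count (λ (vs : Vec Carrierᴹ n) → All.all? W? vs ×-dec Indep? (vs ++ us)) ≡ fall order (count W?) r n
        count-extensions {r} {us} indep-us W-us = count-tower (λ vs → All.all? W? vs ×-dec Indep? (vs ++ us)) _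
          ([] , indep-us) (λ { (_ ∷ ws , ind) → ws , indep-tail ind })
          (λ {n} vs (ws , ind) → trans
            (count-cong (λ v → All.all? W? (v ∷ vs) ×-dec Indep? (v ∷ vs ++ us)) (λ v → W? v ×-dec ¬? (Span? (vs ++ us) v))
              (λ { v (w ∷ _ , ind′) → w , indep-head ind′ }) (λ v (w , v∉) → w ∷ ws , indep-∷ ind v∉))
            (trans (count-diff (Span? (vs ++ us)) W? (Span⊆ sub (All-++ ws W-us)))
              (cong (count W? ∸_) (count-Span ind))))
          where
          All-++ : ∀ {m n} {xs : Vec Carrierᴹ m} {ys : Vec Carrierᴹ n} → All W xs → All W ys → All W (xs ++ ys)
          All-++ []       qs = qs
          All-++ (p ∷ ps) qs = p ∷ All-++ ps qs

        count-independent : ∀ n → count (λ (vs : Vec Carrierᴹ n) → All.all? W? vs ×-dec Indep? vs) ≡ fall order (count W?) 0 n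
        count-independent = count-tower (λ vs → All.all? W? vs ×-dec Indep? vs) _
          ([] , indep-[]) (λ { (_ ∷ ws , ind) → ws , indep-tail ind })
          (λ {n} vs (ws , ind) → trans
            (count-cong (λ v → All.all? W? (v ∷ vs) ×-dec Indep? (v ∷ vs)) (λ v → W? v ×-dec ¬? (Span? vs v))
              (λ { v (w ∷ _ , ind′) → w , indep-head ind′ }) (λ v (w , v∉) → w ∷ ws , indep-∷ ind v∉))
            (trans (count-diff (Span? vs) W? (Span⊆ sub ws))
              (cong (count W? ∸_) (trans (count-Span ind) (cong (order ^_) (sym (ℕ.+-identityʳ n)))))))

        opaque
          basis : ∃[ n ] Σ[ vs ∈ Vec Carrierᴹ n ] IsBasis W vs
          -- The fuel bounds the number of members of `W` not yet spanned. It drops with every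
          -- vector added, because that vector itself leaves the set of missing ones.
          basis = go (count (missing? [])) [] [] indep-[] ℕ.≤-refl
            where
            missing? : ∀ {n} (vs : Vec Carrierᴹ n) x → Dec (W x × ¬ Span vs x)
            missing? vs x = W? x ×-dec ¬? (Span? vs x)
            go : ∀ fuel {n} (vs : Vec Carrierᴹ n) → All W vs → Indep vs → count (missing? vs) ≤ fuel →
                 ∃[ n ] Σ[ vs ∈ Vec Carrierᴹ n ] IsBasis W vs
            go fuel vs ws ind le with ∃? (missing? vs)
            go fuel vs ws ind le | no none = _ , vs , ws , ind , λ x w → Relation.Nullary.Decidable.decidable-stable (Span? vs x) (λ ¬s → none (x , w , ¬s))
            go zero vs ws ind le | yes (v , w , v∉) = contradiction le (ℕ.<⇒≱ (count-nonempty (missing? vs) v (w , v∉)))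
            go (suc fuel) vs ws ind le | yes (v , w , v∉) = go fuel (v ∷ vs) (w ∷ ws) (indep-∷ ind v∉)
              (ℕ.s≤s⁻¹ (ℕ.≤-trans (ℕ.≰⇒> λ ge → proj₂ (count-⊇ (missing? (v ∷ vs)) (missing? vs)
                (λ x (wx , x∉) → wx , x∉ ∘ Span-∷) ge v (w , v∉)) Span-head) le))

        basis-size : ∀ {n} {vs : Vec Carrierᴹ n} → IsBasis W vs → count W? ≡ order ^ n
        basis-size {vs = vs} (ws , ind , spans) = trans (count-cong W? (Span? vs) spans (Span⊆ sub ws)) (count-Span ind)

        indep⇒basis : ∀ {n} {vs : Vec Carrierᴹ n} → All W vs → Indep vs → count W? ≡ order ^ n → IsBasis W vs
        indep⇒basis {vs = vs} ws ind eq = ws , ind , count-⊇ (Span? vs) W? (Span⊆ sub ws) (ℕ.≤-reflexive (trans eq (sym (count-Span ind))))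

        basis-of-size : ∀ d → count W? ≡ order ^ d → Σ[ vs ∈ Vec Carrierᴹ d ] IsBasis W vs
        basis-of-size d eq with basis
        ... | n , vs , bas = subst (λ d → Σ[ vs ∈ Vec Carrierᴹ d ] IsBasis W vs) (ℕ.≤-antisym (exp≤ n d (trans (sym (basis-size bas)) eq))
                 (exp≤ d n (trans (sym eq) (basis-size bas)))) (vs , bas)
          where
          exp≤ : ∀ m n → order ^ m ≡ order ^ n → m ≤ n
          exp≤ m n eq = ℕ.≮⇒≥ λ n<m → ℕ.<⇒≢ (ℕ.^-monoʳ-< order 1<order n<m) (sym eq)

      SubspaceOfSize : ℕ → Powerset Carrierᴹ → Set
      SubspaceOfSize X U = IsSubspace (_∈ᴾ U) × count (_∈ᴾ? U) ≡ X

      SubspaceOfSize? : ∀ X U → Dec (SubspaceOfSize X U)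
      SubspaceOfSize? X U = IsSubspace? (_∈ᴾ? U) ×-dec (count (_∈ᴾ? U) ℕ.≟ X)

      -- Counts the pairs of a subspace and an ordered basis of it: the first factor is the number
      -- of ordered bases of one subspace, and an independent `d`-tuple lies in exactly one subspace
      -- of that size, its span. This is the Gaussian binomial coefficient with its denominator
      -- multiplied out.
      count-subspaces : ∀ d → fall order (order ^ d) 0 d * count (SubspaceOfSize? (order ^ d)) ≡ fall order (size {Carrierᴹ}) 0 d
      count-subspaces d = trans (double-count (SubspaceOfSize? (order ^ d)) (Indep? {d}) R? (fall order (order ^ d) 0 d) 1 rows cols)
        (trans (ℕ.+-identityʳ _) (trans (count-cong Indep? (λ vs → All.all? (λ _ → yes tt) vs ×-dec Indep? vs) (λ vs ind → all-tt vs , ind) (λ _ → proj₂))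
          (trans (count-independent (λ _ → yes tt) (tt , (λ _ _ _ _ → tt) , (λ _ _ _ _ → tt)) d) (cong (λ X → fall order X 0 d) count-all))))
        where
        all-tt : ∀ {n} (vs : Vec Carrierᴹ n) → All (λ _ → ⊤) vs
        all-tt []       = []
        all-tt (_ ∷ vs) = tt ∷ all-tt vs
        R? : ∀ U (vs : Vec Carrierᴹ d) → Dec (SubspaceOfSize (order ^ d) U × (All (_∈ᴾ U) vs × Indep vs))
        R? U vs = SubspaceOfSize? (order ^ d) U ×-dec (All.all? (_∈ᴾ? U) vs ×-dec Indep? vs)
        rows : ∀ U → count (R? U) ≡ fall order (order ^ d) 0 d * ind (SubspaceOfSize? (order ^ d) U)
        rows U with SubspaceOfSize? (order ^ d) U
        ... | yes (sub , eq) = trans (count-cong (λ vs → yes (sub , eq) ×-dec (All.all? (_∈ᴾ? U) vs ×-dec Indep? vs)) (λ vs → All.all? (_∈ᴾ? U) vs ×-dec Indep? vs) (λ _ → proj₂) (λ _ → (sub , eq) ,_))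
                 (trans (count-independent (_∈ᴾ? U) sub d) (trans (cong (λ X → fall order X 0 d) eq) (sym (ℕ.*-identityʳ _))))
        ... | no ¬s = trans (count-none (λ vs → no ¬s ×-dec (All.all? (_∈ᴾ? U) vs ×-dec Indep? vs)) (λ _ → ¬s ∘ proj₁)) (sym (ℕ.*-zeroʳ (fall order (order ^ d) 0 d)))
        cols : ∀ vs → count (λ U → R? U vs) ≡ 1 * ind (Indep? vs)
        cols vs = trans (count-ind (λ U → R? U vs) (Indep? vs) (λ U → proj₂ ∘ proj₂)
          (λ ind → ⟦ Span? vs ⟧ᴾ , ((∈⁺ (proj₁ sub) , (λ x y x∈ y∈ → ∈⁺ (proj₁ (proj₂ sub) x y (∈⁻ x∈) (∈⁻ y∈)))
                                     , λ a x aK x∈ → ∈⁺ (proj₂ (proj₂ sub) a x aK (∈⁻ x∈)))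
               , trans (count-cong (_∈ᴾ? ⟦ Span? vs ⟧ᴾ) (Span? vs) (λ _ → ∈⁻) (λ _ → ∈⁺)) (count-Span ind))
               , All.map ∈⁺ (All-Span vs) , ind)
          (λ { U U′ ((s , eq) , ws , ind) ((s′ , eq′) , ws′ , _) → Powerset-ext
            (λ x x∈ → Span⊆ s′ ws′ x (proj₂ (proj₂ (indep⇒basis (_∈ᴾ? U) s ws ind eq)) x x∈))
            (λ x x∈ → Span⊆ s ws x (proj₂ (proj₂ (indep⇒basis (_∈ᴾ? U′) s′ ws′ ind eq′)) x x∈)) }))
          (sym (ℕ.+-identityʳ _))
          where
          sub = Span-isSubspace vs
          ∈⁺ : ∀ {x} → Span vs x → x ∈ᴾ ⟦ Span? vs ⟧ᴾ
          ∈⁺ = ∈-⟦⟧ᴾ⁺ (Span? vs)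
          ∈⁻ : ∀ {x} → x ∈ᴾ ⟦ Span? vs ⟧ᴾ → Span vs x
          ∈⁻ = ∈-⟦⟧ᴾ⁻ (Span? vs)

-- Frobenius map and roots of polynomials

module _ (M : CommutativeMonoid 0ℓ 0ℓ) where
  open CommutativeMonoid M using (_∙_; ε; rawMonoid; ∙-congˡ; identityˡ)
  private module M = CommutativeMonoid M
  private module Σᴹ = Summation M
  open CommutativeMonoid M using (_≈_) renaming (Carrier to C)
  open RawMonoidDefinitions rawMonoid using () renaming (_×_ to _×ᴹ_)
  open CMSum M using (sum)

  opaque
    unfolding Summation.total

    -- Used in two readings: in the multiplicative monoid of a field the multiple on the right is a
    -- power of `x`, in the additive group it is an integer multiple.
    total-when : {A : Set} ⦃ _ : Finite A ⦄ {P : A → Set} (P? : ∀ a → Dec (P a)) (x : C) →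
                 Σᴹ.total (λ a → Σᴹ.when (P? a) x) ≈ count P? ×ᴹ x
    total-when {A} P? x = go (P? ∘ elem)
      where
      go : ∀ {n} {Q : Fin n → Set} (Q? : ∀ i → Dec (Q i)) →
           sum (λ i → Σᴹ.when (Q? i) x) ≈ CMSum.sum ℕ.+-0-commutativeMonoid (λ i → ind (Q? i)) ×ᴹ x
      go {zero}  Q? = M.refl
      go {suc n} Q? with Q? zero
      ... | yes _ = ∙-congˡ (go (Q? ∘ suc))
      ... | no _  = M.trans (identityˡ _) (go (Q? ∘ suc))

    total-closed : {A : Set} ⦃ _ : Finite A ⦄ (X : C → Set) → X ε → (∀ {x y} → X x → X y → X (x ∙ y)) →
                   {f : A → C} → (∀ a → X (f a)) → X (Σᴹ.total f)
    total-closed {A} X Xε X∙ {f} Xf = go (Xf ∘ elem)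
      where
      go : ∀ {n} {g : Fin n → C} → (∀ i → X (g i)) → X (sum g)
      go {zero}  Xg = Xε
      go {suc n} Xg = X∙ (Xg zero) (go (Xg ∘ suc))

-- `p` divides `p !`, the product of the binomial coefficient with `k ! * (p ∸ k) !`, but it divides
-- neither of these factorials, whose factors are all smaller than `p`.
prime∣C : ∀ {p k} → Prime p → 0 < k → k < p → p ∣ p C k
prime∣C {p} {k} pr 0<k k<p with euclidsLemma (p C k) (k ! * (p ∸ k) !) pr (subst (p ∣_) (sym C*d≡p!) (p∣p! (ℕ.<⇒≢ (ℕ.<-trans 0<k k<p) ∘ sym)))
  where
  k≤p = ℕ.<⇒≤ k<p
  C*d≡p! : (p C k) * (k ! * (p ∸ k) !) ≡ p !
  C*d≡p! = trans (cong (_* (k ! * (p ∸ k) !)) (nCk≡n!/k![n-k]! k≤p))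
                 (m/n*n≡m {{ℕ._!*_!≢0 k (p ∸ k)}} (k![n∸k]!∣n! k≤p))
  p∣p! : ∀ {p} → p ≢ 0 → p ∣ p !
  p∣p! {zero}  p≢0 = contradiction refl p≢0
  p∣p! {suc p} p≢0 = m∣m*n (p !)
... | inj₁ p∣C = p∣C
... | inj₂ p∣d = ⊥-elim ([ p∤n! k<p , p∤n! (ℕ.∸-monoʳ-< 0<k (ℕ.<⇒≤ k<p)) ]′ (euclidsLemma (k !) ((p ∸ k) !) pr p∣d))
  where
  1<p : 1 < p
  1<p = ℕ.nonTrivial⇒n>1 p {{prime⇒nonTrivial pr}}
  p∤n! : ∀ {n} → n < p → p ∤ n !
  p∤n! {zero}  _ p∣1 = ℕ.<⇒≢ 1<p (sym (∣1⇒≡1 p∣1))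
  p∤n! {suc n} n<p p∣n! with euclidsLemma (suc n) (n !) pr p∣n!
  ... | inj₁ p∣n = ℕ.<⇒≱ n<p (∣⇒≤ p∣n)
  ... | inj₂ p∣n! = p∤n! (ℕ.<-trans (ℕ.n<1+n n) n<p) p∣n!

module FieldTheory (E : FiniteField) where
  open FiniteField E
  open Spaces E
  open CSExp R.commutativeSemiring public using () renaming (_^_ to _^ᴱ_)
  private
    module X = CSExp R.commutativeSemiring
    module M = SRMult R.semiring
  open M using () renaming (_×_ to _×ᴱ_)

  ^ᴱ-mul : ∀ x m n → (x ^ᴱ m) ^ᴱ n ≡ x ^ᴱ (m * n)
  ^ᴱ-mul = X.^-assocʳ

  1^ᴱ : ∀ n → 1ᴱ ^ᴱ n ≡ 1ᴱ
  1^ᴱ zero    = refl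
  1^ᴱ (suc n) = trans (R.*-identityˡ _) (1^ᴱ n)

  zero-product : ∀ {x y} → x ≢ 0ᴱ → x *ᴱ y ≡ 0ᴱ → y ≡ 0ᴱ
  zero-product x≢0 = Space.·-cancel regular x≢0

  *ᴱ-cancelˡ : ∀ {x y z} → x ≢ 0ᴱ → x *ᴱ y ≡ x *ᴱ z → y ≡ z
  *ᴱ-cancelˡ {x} {y} {z} x≢0 eq = Space.AP.x∙y⁻¹≈ε⇒x≈y regular y z (zero-product x≢0 (begin
    x *ᴱ (y +ᴱ -ᴱ z)           ≡⟨ R.distribˡ x y (-ᴱ z) ⟩
    x *ᴱ y +ᴱ x *ᴱ -ᴱ z        ≡⟨ cong₂ _+ᴱ_ eq (sym (RP.-‿distribʳ-* x z)) ⟩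
    x *ᴱ z +ᴱ -ᴱ (x *ᴱ z)      ≡⟨ R.-‿inverseʳ _ ⟩
    0ᴱ                         ∎))
    where open ≡-Reasoning

  ^ᴱ≡0 : ∀ n {x} → x ^ᴱ n ≡ 0ᴱ → x ≡ 0ᴱ
  ^ᴱ≡0 zero    eq = ⊥-elim (0≢1 (sym eq))
  ^ᴱ≡0 (suc n) {x} eq with x ≟ 0ᴱ
  ... | yes x≡0 = x≡0
  ... | no x≢0  = ^ᴱ≡0 n (zero-product x≢0 eq)

  module _ (K : Subfield) where
    open Subfield K
    private
      module Π = Summation R.*-commutativeMonoid
      unit? : ∀ y → Dec ((y ∈K) × y ≢ 0ᴱ)
      unit? y = (y ∈K?) ×-dec ¬? (y ≟ 0ᴱ)
      unitProduct : Carrierᴱ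
      unitProduct = Π.total (λ y → Π.when (unit? y) y)

      unitProduct≢0 : unitProduct ≢ 0ᴱ
      unitProduct≢0 = total-closed R.*-commutativeMonoid (_≢ 0ᴱ) (0≢1 ∘ sym) (λ x≢0 y≢0 → y≢0 ∘ zero-product x≢0) nz
        where
        nz : ∀ y → Π.when (unit? y) y ≢ 0ᴱ
        nz y with unit? y
        ... | yes (_ , y≢0) = y≢0
        ... | no _          = 0≢1 ∘ sym

    -- Multiplication by a unit x permutes the units, so it multiplies their product by 1.
    unit-power : ∀ {x} → x ∈K → x ≢ 0ᴱ → x ^ᴱ count unit? ≡ 1ᴱ
    unit-power {x} xK x≢0 with x⁻¹ , xx⁻¹≡1 ← recip x x≢0 = *ᴱ-cancelˡ unitProduct≢0 (begin
      unitProduct *ᴱ x ^ᴱ count unit?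
        ≡⟨ R.*-comm unitProduct _ ⟩
      x ^ᴱ count unit? *ᴱ unitProduct
        ≡⟨ cong (_*ᴱ unitProduct) (sym (total-when R.*-commutativeMonoid unit? x)) ⟩
      Π.total (λ y → Π.when (unit? y) x) *ᴱ unitProduct
        ≡⟨ sym (Π.total-∙ (λ y → Π.when (unit? y) x) (λ y → Π.when (unit? y) y)) ⟩
      Π.total (λ y → Π.when (unit? y) x *ᴱ Π.when (unit? y) y)
        ≡⟨ Π.total-bij (x *ᴱ_) (x⁻¹ *ᴱ_) (λ y → trans (sym (R.*-assoc x x⁻¹ y)) (trans (cong (_*ᴱ y) xx⁻¹≡1) (R.*-identityˡ y)))
             (λ y → trans (sym (R.*-assoc x⁻¹ x y)) (trans (cong (_*ᴱ y) (trans (R.*-comm x⁻¹ x) xx⁻¹≡1)) (R.*-identityˡ y))) shift ⟩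
      unitProduct
        ≡⟨ sym (R.*-identityʳ unitProduct) ⟩
      unitProduct *ᴱ 1ᴱ ∎)
      where
      open ≡-Reasoning
      x⁻¹K = recip∈K xK xx⁻¹≡1
      cancel : ∀ y → x⁻¹ *ᴱ (x *ᴱ y) ≡ y
      cancel y = trans (sym (R.*-assoc x⁻¹ x y)) (trans (cong (_*ᴱ y) (trans (R.*-comm x⁻¹ x) xx⁻¹≡1)) (R.*-identityˡ y))
      shift : ∀ y → Π.when (unit? y) x *ᴱ Π.when (unit? y) y ≡ Π.when (unit? (x *ᴱ y)) (x *ᴱ y)
      shift y with unit? y | unit? (x *ᴱ y)
      ... | yes _         | yes _           = refl
      ... | yes (yK , y≢) | no ¬u           = ⊥-elim (¬u (*∈K xK yK , y≢ ∘ zero-product x≢0))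
      ... | no ¬u         | yes (xyK , xy≢) = ⊥-elim (¬u (subst _∈K (cancel y) (*∈K x⁻¹K xyK) ,
                                                λ { refl → xy≢ (R.zeroʳ x) }))
      ... | no _          | no _            = R.*-identityˡ 1ᴱ

    order-units : order ≡ suc (count unit?)
    order-units = trans (count-split _∈K? (λ y → y ≟ 0ᴱ)) (cong (_+ count unit?)
      (count-unique (λ y → (y ∈K?) ×-dec (y ≟ 0ᴱ)) 0ᴱ (0∈K , refl) (λ _ → proj₂)))

    fermat : ∀ {x} → x ∈K → x ^ᴱ order ≡ x
    fermat {x} xK = trans (cong (x ^ᴱ_) order-units) (by-cases (x ≟ 0ᴱ))
      where
      by-cases : Dec (x ≡ 0ᴱ) → x ^ᴱ suc (count unit?) ≡ x
      by-cases (yes refl) = R.zeroˡ _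
      by-cases (no x≢0)   = trans (cong (x *ᴱ_) (unit-power xK x≢0)) (R.*-identityʳ x)

  order-everything : Subfield.order everything ≡ size {Carrierᴱ}
  order-everything = count-all

  private
    module Σᴱ = Summation R.+-commutativeMonoid

  -- Translation by 1 permutes the elements, so it does not change their sum.
  size×1≡0 : size {Carrierᴱ} ×ᴱ 1ᴱ ≡ 0ᴱ
  size×1≡0 = RP.+-identityʳ-unique (Σᴱ.total id) (size {Carrierᴱ} ×ᴱ 1ᴱ) (begin
    Σᴱ.total id +ᴱ size {Carrierᴱ} ×ᴱ 1ᴱ                  ≡⟨ cong (Σᴱ.total id +ᴱ_) (sym ones) ⟩
    Σᴱ.total id +ᴱ Σᴱ.total (λ _ → 1ᴱ)                    ≡⟨ sym (Σᴱ.total-∙ id (λ _ → 1ᴱ)) ⟩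
    Σᴱ.total (λ x → x +ᴱ 1ᴱ)                              ≡⟨ Σᴱ.total-bij (_+ᴱ 1ᴱ) (_+ᴱ -ᴱ 1ᴱ)
        (λ y → trans (R.+-assoc y (-ᴱ 1ᴱ) 1ᴱ) (trans (cong (y +ᴱ_) (R.-‿inverseˡ 1ᴱ)) (R.+-identityʳ y)))
        (λ y → trans (R.+-assoc y 1ᴱ (-ᴱ 1ᴱ)) (trans (cong (y +ᴱ_) (R.-‿inverseʳ 1ᴱ)) (R.+-identityʳ y))) (λ _ → refl) ⟩
    Σᴱ.total id                                           ∎)
    where
    open ≡-Reasoning
    ones : Σᴱ.total (λ (_ : Carrierᴱ) → 1ᴱ) ≡ size {Carrierᴱ} ×ᴱ 1ᴱ
    ones = trans (total-when R.+-commutativeMonoid {Carrierᴱ} (λ _ → yes tt) 1ᴱ) (cong (_×ᴱ 1ᴱ) count-all)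

  module Frobenius (p : ℕ) (prime : Prime p) (n : ℕ) (size≡ : size {Carrierᴱ} ≡ p ^ n) where

    -- The order p^n of the additive group annihilates 1, so the n-th power of p·1 is 0, and a field
    -- has no nonzero nilpotent elements.
    p×1≡0 : p ×ᴱ 1ᴱ ≡ 0ᴱ
    p×1≡0 = ^ᴱ≡0 n (trans (sym (×-^ n)) (trans (cong (_×ᴱ 1ᴱ) (sym size≡)) size×1≡0))
      where
      ×-^ : ∀ n → (p ^ n) ×ᴱ 1ᴱ ≡ (p ×ᴱ 1ᴱ) ^ᴱ n
      ×-^ zero    = R.+-identityʳ 1ᴱ
      ×-^ (suc n) = trans (M.×1-homo-* p (p ^ n)) (cong (p ×ᴱ 1ᴱ *ᴱ_) (×-^ n))

    multiple×≡0 : ∀ {m} → p ∣ m → ∀ x → m ×ᴱ x ≡ 0ᴱ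
    multiple×≡0 (divides k refl) x = begin
      (k * p) ×ᴱ x          ≡⟨ cong ((k * p) ×ᴱ_) (sym (R.*-identityˡ x)) ⟩
      (k * p) ×ᴱ (1ᴱ *ᴱ x)  ≡⟨ sym (M.×-assoc-* (k * p) 1ᴱ x) ⟩
      (k * p) ×ᴱ 1ᴱ *ᴱ x    ≡⟨ cong (_*ᴱ x) (trans (M.×1-homo-* k p) (trans (cong (k ×ᴱ 1ᴱ *ᴱ_) p×1≡0) (R.zeroʳ _))) ⟩
      0ᴱ *ᴱ x               ≡⟨ R.zeroˡ x ⟩
      0ᴱ                    ∎
      where open ≡-Reasoning

    freshman : ∀ x y → (x +ᴱ y) ^ᴱ p ≡ x ^ᴱ p +ᴱ y ^ᴱ p
    freshman x y = trans (Binomial.theorem R.commutativeSemiring p x y) (expand p refl)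
      where
      open CMSum R.+-commutativeMonoid using (sum; sum-init-last; sum-cong-≋; sum-replicate-zero)
      term = Binomial.binomialTerm R.commutativeSemiring x y p
      ends : ∀ m (t : Fin (suc (suc m)) → Carrierᴱ) → (∀ i → t (suc (inject₁ i)) ≡ 0ᴱ) → sum t ≡ t (Fin.fromℕ (suc m)) +ᴱ t zero
      ends m t mid = trans (R.+-comm (t zero) _) (cong (_+ᴱ t zero) (trans (sum-init-last (t ∘ suc))
        (trans (cong (_+ᴱ t (Fin.fromℕ (suc m))) (trans (sum-cong-≋ mid) (sum-replicate-zero m))) (R.+-identityˡ _))))
      expand : ∀ m → m ≡ p → sum term ≡ x ^ᴱ p +ᴱ y ^ᴱ p
      expand zero refl = ⊥-elim (ℕ.≢-nonZero⁻¹ 0 {{prime⇒nonZero prime}} refl)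
      expand (suc m) refl = trans (ends m term (λ i → multiple×≡0 (prime∣C prime (s≤s z≤n)
          (s≤s (subst (_< m) (sym (Fin.toℕ-inject₁ i)) (Fin.toℕ<n i)))) _)) (cong₂ _+ᴱ_ top bot)
        where
        top : term (Fin.fromℕ (suc m)) ≡ x ^ᴱ suc m
        top = begin
          (suc m C toℕ (Fin.fromℕ (suc m))) ×ᴱ (x ^ᴱ toℕ (Fin.fromℕ (suc m)) *ᴱ y ^ᴱ (suc m ∸ toℕ (Fin.fromℕ (suc m))))
            ≡⟨ cong (λ k → (suc m C k) ×ᴱ (x ^ᴱ k *ᴱ y ^ᴱ (suc m ∸ k))) (Fin.toℕ-fromℕ (suc m)) ⟩
          (suc m C suc m) ×ᴱ (x ^ᴱ suc m *ᴱ y ^ᴱ (m ∸ m))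
            ≡⟨ cong₂ (λ c k → c ×ᴱ (x ^ᴱ suc m *ᴱ y ^ᴱ k)) (nCn≡1 (suc m)) (ℕ.n∸n≡0 m) ⟩
          x ^ᴱ suc m *ᴱ 1ᴱ +ᴱ 0ᴱ
            ≡⟨ trans (R.+-identityʳ _) (R.*-identityʳ _) ⟩
          x ^ᴱ suc m ∎
          where open ≡-Reasoning
        bot : term zero ≡ y ^ᴱ suc m
        bot = trans (R.+-identityʳ _) (R.*-identityˡ _)

    frobenius-+ : ∀ k x y → (x +ᴱ y) ^ᴱ (p ^ k) ≡ x ^ᴱ (p ^ k) +ᴱ y ^ᴱ (p ^ k)
    frobenius-+ zero x y = trans (R.*-identityʳ _) (sym (cong₂ _+ᴱ_ (R.*-identityʳ x) (R.*-identityʳ y)))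
    frobenius-+ (suc k) x y = begin
      (x +ᴱ y) ^ᴱ (p * p ^ k)                          ≡⟨ sym (^ᴱ-mul (x +ᴱ y) p (p ^ k)) ⟩
      ((x +ᴱ y) ^ᴱ p) ^ᴱ (p ^ k)                       ≡⟨ cong (_^ᴱ (p ^ k)) (freshman x y) ⟩
      (x ^ᴱ p +ᴱ y ^ᴱ p) ^ᴱ (p ^ k)                    ≡⟨ frobenius-+ k (x ^ᴱ p) (y ^ᴱ p) ⟩
      (x ^ᴱ p) ^ᴱ (p ^ k) +ᴱ (y ^ᴱ p) ^ᴱ (p ^ k)       ≡⟨ cong₂ _+ᴱ_ (^ᴱ-mul x p (p ^ k)) (^ᴱ-mul y p (p ^ k)) ⟩
      x ^ᴱ (p * p ^ k) +ᴱ y ^ᴱ (p * p ^ k)             ∎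
      where open ≡-Reasoning

  -- A vector of coefficients stands for the polynomial c₀ + c₁x + … (poly), and for the monic one of
  -- degree its length (monic).
  poly monic : ∀ {n} → Vec Carrierᴱ n → Carrierᴱ → Carrierᴱ
  poly []       x = 0ᴱ
  poly (c ∷ cs) x = c +ᴱ x *ᴱ poly cs x
  monic []       x = 1ᴱ
  monic (c ∷ cs) x = c +ᴱ x *ᴱ monic cs x

  IsPoly IsMonic : ℕ → (Carrierᴱ → Carrierᴱ) → Set
  IsPoly n f  = Σ[ cs ∈ Vec Carrierᴱ n ] (∀ x → poly cs x ≡ f x)
  IsMonic n f = Σ[ cs ∈ Vec Carrierᴱ n ] (∀ x → monic cs x ≡ f x)

  power-monic : ∀ n → IsMonic n (_^ᴱ n)
  power-monic zero    = [] , λ _ → refl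
  power-monic (suc n) = let cs , eq = power-monic n in 0ᴱ ∷ cs , λ x → trans (R.+-identityˡ _) (cong (x *ᴱ_) (eq x))

  private
    horner-+ : ∀ c d x u v → (c +ᴱ d) +ᴱ x *ᴱ (u +ᴱ v) ≡ (c +ᴱ x *ᴱ u) +ᴱ (d +ᴱ x *ᴱ v)
    horner-+ c d x u v = trans (cong ((c +ᴱ d) +ᴱ_) (R.distribˡ x u v)) (Space.+ᴹ-interchange regular c d (x *ᴱ u) (x *ᴱ v))

  poly+monic : ∀ {n f g} → IsPoly n f → IsMonic n g → IsMonic n (λ x → f x +ᴱ g x)
  poly+monic {n} (cs , eq) (ds , eq′) = add n cs ds , λ x → trans (go cs ds x) (cong₂ _+ᴱ_ (eq x) (eq′ x))
    where
    go : ∀ {n} (cs ds : Vec Carrierᴱ n) x → monic (add n cs ds) x ≡ poly cs x +ᴱ monic ds x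
    go []       []       x = sym (R.+-identityˡ 1ᴱ)
    go (c ∷ cs) (d ∷ ds) x = trans (cong (λ t → (c +ᴱ d) +ᴱ x *ᴱ t) (go cs ds x)) (horner-+ c d x _ _)

  poly-zeros : ∀ n x → poly (zeros n) x ≡ 0ᴱ
  poly-zeros zero    x = refl
  poly-zeros (suc n) x = trans (R.+-identityˡ _) (trans (cong (x *ᴱ_) (poly-zeros n x)) (R.zeroʳ x))

  monic⇒poly : ∀ {m n f} → IsMonic m f → m < n → IsPoly n f
  monic⇒poly (cs , eq) m<n = let ds , eq′ = go cs m<n in ds , λ x → trans (eq′ x) (eq x)
    where
    go : ∀ {m n} (cs : Vec Carrierᴱ m) → m < n → Σ[ ds ∈ Vec Carrierᴱ n ] (∀ x → poly ds x ≡ monic cs x)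
    go {n = suc n} []       _         = 1ᴱ ∷ zeros n , λ x → trans (cong (λ t → 1ᴱ +ᴱ x *ᴱ t) (poly-zeros n x))
                                          (trans (cong (1ᴱ +ᴱ_) (R.zeroʳ x)) (R.+-identityʳ 1ᴱ))
    go {n = suc n} (c ∷ cs) (s≤s m<n) = let ds , eq = go cs m<n in c ∷ ds , λ x → cong (λ t → c +ᴱ x *ᴱ t) (eq x)

  -- This is f(x) - f(r) = (x - r) g(x) with the subtractions moved across. As in Horner's scheme,
  -- the constant coefficient of the quotient of c + x f is f(r), and the rest is the quotient of f.
  divide : ∀ {n} (cs : Vec Carrierᴱ (suc n)) r →
           Σ[ ds ∈ Vec Carrierᴱ n ] (∀ x → monic cs x +ᴱ r *ᴱ monic ds x ≡ monic cs r +ᴱ x *ᴱ monic ds x)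
  divide {zero} (c ∷ []) r = [] , λ x → trans (R.+-assoc c _ _) (trans (cong (c +ᴱ_) (R.+-comm _ _)) (sym (R.+-assoc c _ _)))
  divide {suc n} (c ∷ cs) r with ds , eq ← divide cs r = monic cs r ∷ ds , λ x → begin
    (c +ᴱ x *ᴱ monic cs x) +ᴱ r *ᴱ (monic cs r +ᴱ x *ᴱ monic ds x)
      ≡⟨ cong (λ t → (c +ᴱ x *ᴱ monic cs x) +ᴱ t) (trans (R.distribˡ r _ _) (R.+-comm _ _)) ⟩
    (c +ᴱ x *ᴱ monic cs x) +ᴱ (r *ᴱ (x *ᴱ monic ds x) +ᴱ r *ᴱ monic cs r)
      ≡⟨ cong (λ t → (c +ᴱ x *ᴱ monic cs x) +ᴱ (t +ᴱ r *ᴱ monic cs r))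
           (trans (sym (R.*-assoc r x _)) (trans (cong (_*ᴱ monic ds x) (R.*-comm r x)) (R.*-assoc x r _))) ⟩
    (c +ᴱ x *ᴱ monic cs x) +ᴱ (x *ᴱ (r *ᴱ monic ds x) +ᴱ r *ᴱ monic cs r)
      ≡⟨ trans (R.+-assoc c _ _) (cong (c +ᴱ_) (sym (R.+-assoc _ _ _))) ⟩
    c +ᴱ ((x *ᴱ monic cs x +ᴱ x *ᴱ (r *ᴱ monic ds x)) +ᴱ r *ᴱ monic cs r)
      ≡⟨ cong (λ t → c +ᴱ (t +ᴱ r *ᴱ monic cs r)) (sym (R.distribˡ x _ _)) ⟩
    c +ᴱ (x *ᴱ (monic cs x +ᴱ r *ᴱ monic ds x) +ᴱ r *ᴱ monic cs r)
      ≡⟨ cong₂ (λ t s → c +ᴱ (x *ᴱ t +ᴱ s)) (eq x) refl ⟩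
    c +ᴱ (x *ᴱ (monic cs r +ᴱ x *ᴱ monic ds x) +ᴱ r *ᴱ monic cs r)
      ≡⟨ trans (cong (c +ᴱ_) (R.+-comm _ _)) (sym (R.+-assoc c _ _)) ⟩
    (c +ᴱ r *ᴱ monic cs r) +ᴱ x *ᴱ (monic cs r +ᴱ x *ᴱ monic ds x) ∎
    where open ≡-Reasoning

  count-roots : ∀ {n f} → IsMonic n f → count (λ x → f x ≟ 0ᴱ) ≤ n
  count-roots {f = f} (cs , eq) = ℕ.≤-trans (count-mono (λ x → f x ≟ 0ᴱ) (λ x → monic cs x ≟ 0ᴱ) (λ x → trans (eq x))) (go cs)
    where
    go : ∀ {n} (cs : Vec Carrierᴱ n) → count (λ x → monic cs x ≟ 0ᴱ) ≤ n
    go {zero}  []  = ℕ.≤-reflexive (count-none (λ x → 1ᴱ ≟ 0ᴱ) (λ _ → 0≢1 ∘ sym))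
    go {suc n} cs with ∃? (λ x → monic cs x ≟ 0ᴱ)
    ... | no none = ℕ.≤-trans (ℕ.≤-reflexive (count-none (λ x → monic cs x ≟ 0ᴱ) (λ x p → none (x , p)))) z≤n
    ... | yes (r , root) with ds , eq ← divide cs r = begin
      count (λ x → monic cs x ≟ 0ᴱ)
        ≡⟨ count-split (λ x → monic cs x ≟ 0ᴱ) (λ x → x ≟ r) ⟩
      count (λ x → (monic cs x ≟ 0ᴱ) ×-dec (x ≟ r)) + count (λ x → (monic cs x ≟ 0ᴱ) ×-dec ¬? (x ≟ r))
        ≤⟨ ℕ.+-mono-≤ (ℕ.≤-reflexive (count-unique (λ x → (monic cs x ≟ 0ᴱ) ×-dec (x ≟ r)) r (root , refl) (λ _ → proj₂)))
                      (count-mono (λ x → (monic cs x ≟ 0ᴱ) ×-dec ¬? (x ≟ r)) (λ x → monic ds x ≟ 0ᴱ) other) ⟩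
      1 + count (λ x → monic ds x ≟ 0ᴱ)
        ≤⟨ s≤s (go ds) ⟩
      suc n ∎
      where
      open ℕ.≤-Reasoning
      other : ∀ x → monic cs x ≡ 0ᴱ × x ≢ r → monic ds x ≡ 0ᴱ
      other x (p , x≢r) with monic ds x ≟ 0ᴱ
      ... | yes d≡0 = d≡0
      ... | no d≢0  = ⊥-elim (x≢r (sym (*ᴱ-cancelˡ d≢0 (trans (R.*-comm _ r) (trans rd≡xd (R.*-comm x _))))))
        where
        rd≡xd : r *ᴱ monic ds x ≡ x *ᴱ monic ds x
        rd≡xd = trans (sym (R.+-identityˡ _)) (trans (cong (_+ᴱ _) (sym p)) (trans (eq x)
          (trans (cong (_+ᴱ _) root) (R.+-identityˡ _))))

-- Fixed fields and stabilisers

^-injectiveʳ : ∀ {q} → 1 < q → ∀ {m n} → q ^ m ≡ q ^ n → m ≡ n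
^-injectiveʳ {q} 1<q eq = ℕ.≤-antisym (exp≤ eq) (exp≤ (sym eq))
  where
  exp≤ : ∀ {m n} → q ^ m ≡ q ^ n → m ≤ n
  exp≤ eq = ℕ.≮⇒≥ λ n<m → ℕ.<⇒≢ (ℕ.^-monoʳ-< q 1<q n<m) (sym eq)

module Subfields (E : FiniteField) where
  open FiniteField E
  open Spaces E
  open FieldTheory E
  open Subfield using (order)

  -- By finiteness the inverse of `a` is a power of `a`, namely one less than the number of units,
  -- so closure under products suffices.
  recip-closed : {X : Carrierᴱ → Set} → X 1ᴱ → (∀ {a b} → X a → X b → X (a *ᴱ b)) →
                 ∀ {a b} → X a → a *ᴱ b ≡ 1ᴱ → X b
  recip-closed {X} X1 X* {a} {b} Xa ab≡1 = go _ (order-units everything) (unit-power everything {a} tt a≢0)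
    where
    a≢0 : a ≢ 0ᴱ
    a≢0 refl = 0≢1 (trans (sym (R.zeroˡ b)) ab≡1)
    X^ : ∀ n → X (a ^ᴱ n)
    X^ zero    = X1
    X^ (suc n) = X* Xa (X^ n)
    go : ∀ c → order everything ≡ suc c → a ^ᴱ c ≡ 1ᴱ → X b
    go zero    o≡1 _ = contradiction (Subfield.1<order everything) (ℕ.<-irrefl (sym o≡1))
    go (suc c) _ eq  = subst X (*ᴱ-cancelˡ a≢0 (trans eq (sym ab≡1))) (X^ c)

  module _ (W : Powerset Carrierᴱ) where

    Stabilises : Carrierᴱ → Set
    Stabilises a = ∀ x → x ∈ᴾ W → (a *ᴱ x) ∈ᴾ W

    Stabilises? : ∀ a → Dec (Stabilises a)
    Stabilises? a = ∀? (λ x → (x ∈ᴾ? W) →? ((a *ᴱ x) ∈ᴾ? W))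

    -- Closure of `W` under addition makes the multipliers that preserve it a ring; `recip-closed`
    -- then supplies the inverses.
    stabiliser : (F : Subfield) → Over.IsSubspace F regular (_∈ᴾ W) → Subfield
    stabiliser F (0∈ , +∈ , ·∈) = record
      { _∈K = Stabilises ; _∈K? = Stabilises?
      ; 0∈K = λ x x∈ → ·∈ 0ᴱ x (Subfield.0∈K F) x∈
      ; 1∈K = λ x x∈ → ·∈ 1ᴱ x (Subfield.1∈K F) x∈
      ; +∈K = λ {a} {b} sa sb x x∈ → subst (_∈ᴾ W) (sym (R.distribʳ x a b)) (+∈ _ _ (sa x x∈) (sb x x∈))
      ; *∈K = mul
      ; -∈K = λ {a} sa x x∈ → subst (_∈ᴾ W) (sym (trans (sym (RP.-‿distribˡ-* a x)) (sym (RP.-1*x≈-x (a *ᴱ x)))))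
                 (·∈ (-ᴱ 1ᴱ) _ (Subfield.-∈K F (Subfield.1∈K F)) (sa x x∈))
      ; recip∈K = recip-closed (λ x x∈ → ·∈ 1ᴱ x (Subfield.1∈K F) x∈) mul }
      where
      mul : ∀ {a b} → Stabilises a → Stabilises b → Stabilises (a *ᴱ b)
      mul {a} {b} sa sb x x∈ = subst (_∈ᴾ W) (sym (R.*-assoc a b x)) (sa _ (sb x x∈))

  module Tower (F : Subfield) (p e l : ℕ) (prime : Prime p) (1≤l : 1 ≤ l)
               (order-F : order F ≡ p ^ e) (size-E : size {Carrierᴱ} ≡ (p ^ e) ^ l) where

    q : ℕ
    q = p ^ e

    1<q : 1 < q
    1<q = subst (1 <_) order-F (Subfield.1<order F)

    open Frobenius p prime (e * l) (trans size-E (ℕ.^-*-assoc p e l))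

    frob-+ : ∀ t x y → (x +ᴱ y) ^ᴱ (q ^ t) ≡ x ^ᴱ (q ^ t) +ᴱ y ^ᴱ (q ^ t)
    frob-+ t rewrite ℕ.^-*-assoc p e t = frobenius-+ (e * t)

    frob-0 : ∀ t → 0ᴱ ^ᴱ (q ^ t) ≡ 0ᴱ
    frob-0 t = RP.+-identityʳ-unique (0ᴱ ^ᴱ (q ^ t)) (0ᴱ ^ᴱ (q ^ t))
      (trans (sym (frob-+ t 0ᴱ 0ᴱ)) (cong (_^ᴱ (q ^ t)) (R.+-identityˡ 0ᴱ)))

    frob-neg : ∀ t x → (-ᴱ x) ^ᴱ (q ^ t) ≡ -ᴱ (x ^ᴱ (q ^ t))
    frob-neg t x = Space.AP.inverseʳ-unique regular _ _
      (trans (sym (frob-+ t x (-ᴱ x))) (trans (cong (_^ᴱ (q ^ t)) (R.-‿inverseʳ x)) (frob-0 t)))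

    frob-iter : ∀ s t x → (x ^ᴱ (q ^ s)) ^ᴱ (q ^ t) ≡ x ^ᴱ (q ^ (s + t))
    frob-iter s t x = trans (^ᴱ-mul x (q ^ s) (q ^ t)) (cong (x ^ᴱ_) (sym (ℕ.^-distribˡ-+-* q s t)))

    fixed : ℕ → Subfield
    fixed t = record
      { _∈K = λ x → x ^ᴱ (q ^ t) ≡ x ; _∈K? = λ x → x ^ᴱ (q ^ t) ≟ x
      ; 0∈K = frob-0 t
      ; 1∈K = 1^ᴱ (q ^ t)
      ; +∈K = λ {a} {b} fa fb → trans (frob-+ t a b) (cong₂ _+ᴱ_ fa fb)
      ; *∈K = mul
      ; -∈K = λ {a} fa → trans (frob-neg t a) (cong -ᴱ_ fa)
      ; recip∈K = recip-closed {λ x → x ^ᴱ (q ^ t) ≡ x} (1^ᴱ (q ^ t)) mul }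
      where
      mul : ∀ {a b} → a ^ᴱ (q ^ t) ≡ a → b ^ᴱ (q ^ t) ≡ b → (a *ᴱ b) ^ᴱ (q ^ t) ≡ a *ᴱ b
      mul {a} {b} fa fb = trans (X.^-distrib-* a b (q ^ t)) (cong₂ _*ᴱ_ fa fb)
        where import Algebra.Properties.CommutativeSemiring.Exp R.commutativeSemiring as X

    fixed-multiple : ∀ {t s x} → t ∣ s → x ^ᴱ (q ^ t) ≡ x → x ^ᴱ (q ^ s) ≡ x
    fixed-multiple {t} {x = x} (divides k refl) fx = go k
      where
      go : ∀ k → x ^ᴱ (q ^ (k * t)) ≡ x
      go zero    = R.*-identityʳ x
      go (suc k) = trans (sym (frob-iter t (k * t) x)) (trans (cong (_^ᴱ (q ^ (k * t))) fx) (go k))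

    -- x^(q^t) − x, and the trace polynomial x + x^(q^t) + … which annihilates its values.
    private
      A : ℕ → Carrierᴱ → Carrierᴱ
      A t x = -ᴱ x +ᴱ x ^ᴱ (q ^ t)
      B : ℕ → ℕ → Carrierᴱ → Carrierᴱ
      B t zero    x = 0ᴱ
      B t (suc j) x = B t j x +ᴱ x ^ᴱ (q ^ (t * j))

      A-+ : ∀ t x y → A t (x +ᴱ y) ≡ A t x +ᴱ A t y
      A-+ t x y = trans (cong₂ _+ᴱ_ (sym (RP.-‿+-comm x y)) (frob-+ t x y)) (Space.+ᴹ-interchange regular _ _ _ _)

      -- The iterated Frobenius images of x^(q^t) - x telescope. For `t * j = l` the right-hand side
      -- is x^(q^l) - x, which vanishes by `fermat`; hence the values of `A t` are roots of `B t j`.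
      B∘A : ∀ t j x → B t j (A t x) ≡ A (t * j) x
      B∘A t zero    x = sym (trans (cong (λ k → -ᴱ x +ᴱ x ^ᴱ (q ^ k)) (ℕ.*-zeroʳ t))
        (trans (cong (-ᴱ x +ᴱ_) (R.*-identityʳ x)) (R.-‿inverseˡ x)))
      B∘A t (suc j) x = begin
        B t j (A t x) +ᴱ A t x ^ᴱ (q ^ (t * j))
          ≡⟨ cong₂ _+ᴱ_ (B∘A t j x) (trans (frob-+ (t * j) (-ᴱ x) _) (cong₂ _+ᴱ_ (frob-neg (t * j) x) (frob-iter t (t * j) x))) ⟩
        (-ᴱ x +ᴱ x ^ᴱ (q ^ (t * j))) +ᴱ (-ᴱ (x ^ᴱ (q ^ (t * j))) +ᴱ x ^ᴱ (q ^ (t + t * j)))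
          ≡⟨ trans (R.+-assoc _ _ _) (cong (-ᴱ x +ᴱ_) (sym (R.+-assoc _ _ _))) ⟩
        -ᴱ x +ᴱ ((x ^ᴱ (q ^ (t * j)) +ᴱ -ᴱ (x ^ᴱ (q ^ (t * j)))) +ᴱ x ^ᴱ (q ^ (t + t * j)))
          ≡⟨ cong (-ᴱ x +ᴱ_) (trans (cong (_+ᴱ x ^ᴱ (q ^ (t + t * j))) (R.-‿inverseʳ _)) (R.+-identityˡ _)) ⟩
        -ᴱ x +ᴱ x ^ᴱ (q ^ (t + t * j))
          ≡⟨ cong (λ k → -ᴱ x +ᴱ x ^ᴱ (q ^ k)) (sym (ℕ.*-suc t j)) ⟩
        A (t * suc j) x ∎
        where open ≡-Reasoning

      A-monic : ∀ {t} → 1 ≤ t → IsMonic (q ^ t) (A t)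
      A-monic {t} 1≤t = poly+monic neg (power-monic (q ^ t))
        where
        1<q^t : 1 < q ^ t
        1<q^t = ℕ.^-monoʳ-< q 1<q 1≤t
        neg : IsPoly (q ^ t) (λ x → -ᴱ x)
        neg with q ^ t | 1<q^t
        ... | suc zero | s≤s ()
        ... | suc (suc n) | _ = 0ᴱ ∷ -ᴱ 1ᴱ ∷ zeros n , λ x → trans (R.+-identityˡ _) (trans (cong (x *ᴱ_)
              (trans (cong (λ z → -ᴱ 1ᴱ +ᴱ x *ᴱ z) (poly-zeros n x)) (trans (cong (-ᴱ 1ᴱ +ᴱ_) (R.zeroʳ x)) (R.+-identityʳ _))))
              (trans (R.*-comm x _) (RP.-1*x≈-x x)))

      B-monic : ∀ {t} → 1 ≤ t → ∀ j → IsMonic (q ^ (t * j)) (B t (suc j))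
      B-monic {t} 1≤t j = poly+monic (B-poly j) (power-monic (q ^ (t * j)))
        where
        B-poly : ∀ j → IsPoly (q ^ (t * j)) (B t j)
        B-poly zero    = zeros (q ^ (t * 0)) , poly-zeros (q ^ (t * 0))
        B-poly (suc j) = monic⇒poly (B-monic 1≤t j) (ℕ.^-monoʳ-< q 1<q (ℕ.*-monoʳ-< t {{ℕ.>-nonZero 1≤t}} (ℕ.n<1+n j)))

      A≡0⇒fixed : ∀ t x → A t x ≡ 0ᴱ → x ^ᴱ (q ^ t) ≡ x
      A≡0⇒fixed t x eq = sym (Space.AP.x∙y⁻¹≈ε⇒x≈y regular x (x ^ᴱ (q ^ t)) (trans (cong (_+ᴱ -ᴱ (x ^ᴱ (q ^ t))) (sym (RP.-‿involutive x)))
         (trans (RP.-‿+-comm (-ᴱ x) _) (trans (cong -ᴱ_ eq) RP.-0#≈0#))))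

      fixed⇒A≡0 : ∀ t x → x ^ᴱ (q ^ t) ≡ x → A t x ≡ 0ᴱ
      fixed⇒A≡0 t x fx = trans (cong (-ᴱ x +ᴱ_) fx) (R.-‿inverseˡ x)

    order-fixed-≤ : ∀ {t} → 1 ≤ t → order (fixed t) ≤ q ^ t
    order-fixed-≤ {t} 1≤t = ℕ.≤-trans (count-mono (Subfield._∈K? (fixed t)) (λ x → A t x ≟ 0ᴱ) (fixed⇒A≡0 t)) (count-roots (A-monic 1≤t))

    -- For the lower bound E is split into the fibres of `A t`. This map is additive, so a nonempty
    -- fibre is a translate of its kernel, the fixed field. With l = t(j + 1) the values are roots
    -- of `B t (suc j)`, of degree q^(tj), so there are at most q^(tj) fibres.
    order-fixed : ∀ {t} → t ∣ l → order (fixed t) ≡ q ^ t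
    order-fixed {t} (divides zero refl) = contradiction 1≤l (λ ())
    order-fixed {t} (divides (suc j) l≡) = ℕ.≤-antisym (order-fixed-≤ 1≤t) (ℕ.*-cancelʳ-≤ _ _ (q ^ (t * j)) {{ℕ.m^n≢0 q (t * j) {{ℕ.>-nonZero (ℕ.<-trans (s≤s z≤n) 1<q)}}}} (begin
        q ^ t * q ^ (t * j)                 ≡⟨ sym (ℕ.^-distribˡ-+-* q t (t * j)) ⟩
        q ^ (t + t * j)                     ≡⟨ cong (q ^_) (trans (sym (ℕ.*-suc t j)) (trans (ℕ.*-comm t (suc j)) (sym l≡))) ⟩
        q ^ l                               ≡⟨ sym size-E ⟩
        size {Carrierᴱ}                     ≡⟨ sym count-all ⟩
        total (λ (x : Carrierᴱ) → 1)        ≡⟨ total-cong (λ x → sym (count-unique (λ y → A t x ≟ y) (A t x) refl (λ _ → sym))) ⟩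
        total (λ x → count (λ y → A t x ≟ y))  ≡⟨ total-swap _ ⟩
        total (λ y → count (λ x → A t x ≟ y))  ≤⟨ total-mono fibre ⟩
        total (λ y → order (fixed t) * ind (B t (suc j) y ≟ 0ᴱ))  ≡⟨ total-*ˡ (order (fixed t)) _ ⟩
        order (fixed t) * count (λ y → B t (suc j) y ≟ 0ᴱ)        ≤⟨ ℕ.*-monoʳ-≤ (order (fixed t)) (count-roots (B-monic 1≤t j)) ⟩
        order (fixed t) * q ^ (t * j)       ∎))
      where
      open ℕ.≤-Reasoning
      1≤t : 1 ≤ t
      1≤t = ℕ.n≢0⇒n>0 λ { refl → ℕ.<⇒≢ 1≤l (sym (trans l≡ (ℕ.*-zeroʳ (suc j)))) }
      tj≡l : t * suc j ≡ l
      tj≡l = trans (ℕ.*-comm t (suc j)) (sym l≡)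
      BA≡0 : ∀ x → B t (suc j) (A t x) ≡ 0ᴱ
      BA≡0 x = trans (B∘A t (suc j) x) (trans (cong (λ k → -ᴱ x +ᴱ x ^ᴱ k) (trans (cong (q ^_) tj≡l) (sym (trans order-everything size-E))))
        (trans (cong (-ᴱ x +ᴱ_) (fermat everything tt)) (R.-‿inverseˡ x)))
      fibre : ∀ y → count (λ x → A t x ≟ y) ≤ order (fixed t) * ind (B t (suc j) y ≟ 0ᴱ)
      fibre y with ∃? (λ x → A t x ≟ y)
      ... | no none = ℕ.≤-trans (ℕ.≤-reflexive (count-none (λ x → A t x ≟ y) (λ x eq → none (x , eq)))) z≤n
      ... | yes (x₀ , refl) = ℕ.≤-trans
          (count-inj (λ x → A t x ≟ A t x₀) (Subfield._∈K? (fixed t)) (_+ᴱ -ᴱ x₀)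
            (λ x eq → A≡0⇒fixed t (x +ᴱ -ᴱ x₀) (trans (A-+ t x (-ᴱ x₀)) (trans (cong (_+ᴱ A t (-ᴱ x₀)) eq)
              (trans (sym (A-+ t x₀ (-ᴱ x₀))) (trans (cong (A t) (R.-‿inverseʳ x₀)) (fixed⇒A≡0 t 0ᴱ (frob-0 t)))))))
            (λ x x′ _ _ → RP.+-cancelʳ (-ᴱ x₀) x x′))
          (ℕ.≤-reflexive (sym (trans (cong (order (fixed t) *_) (ind-yes (B t (suc j) (A t x₀) ≟ 0ᴱ) (BA≡0 x₀))) (ℕ.*-identityʳ _))))

    infix 4 _⊆ᶠ_
    _⊆ᶠ_ : Subfield → Subfield → Set
    K ⊆ᶠ L = ∀ a → Subfield._∈K K a → Subfield._∈K L a

    private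
      all-subspace : ∀ {K} → Over.IsSubspace K regular (λ _ → ⊤)
      all-subspace = tt , (λ _ _ _ _ → tt) , (λ _ _ _ _ → tt)

    F⊆fixed : ∀ t → F ⊆ᶠ fixed t
    F⊆fixed t a a∈F = fixed-multiple {1} {t} (divides t (sym (ℕ.*-identityʳ t)))
      (trans (cong (a ^ᴱ_) (trans (ℕ.*-identityʳ q) (sym order-F))) (fermat F a∈F))

    -- `W` is a vector space over `K`, so its size is a power of q^s; comparing exponents of q gives
    -- the divisibility.
    size-power : ∀ K {s} → order K ≡ q ^ s → {W : Carrierᴱ → Set} (W? : ∀ x → Dec (W x)) → Over.IsSubspace K regular W →
                 ∀ {d} → count W? ≡ q ^ d → s ∣ d
    size-power K {s} eq W? sub {d} W≡ with j , _ , bas ← Over.basis K regular W? sub =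
      divides j (^-injectiveʳ 1<q (trans (sym W≡) (trans (Over.basis-size K regular W? sub bas)
        (trans (cong (_^ j) eq) (trans (ℕ.^-*-assoc q s j) (cong (q ^_) (ℕ.*-comm s j)))))))

    order-power : ∀ K → F ⊆ᶠ K → ∃[ s ] order K ≡ q ^ s × s ∣ l
    order-power K F⊆K with s , _ , bas ← Over.basis F regular (Subfield._∈K? K) (Subfield.0∈K K , (λ _ _ → Subfield.+∈K K) , λ a _ a∈ x∈ → Subfield.*∈K K (F⊆K a a∈) x∈) =
      s , eq , size-power K eq (λ _ → yes tt) (all-subspace {K}) (trans count-all size-E)
      where
      eq : order K ≡ q ^ s
      eq = trans (Over.basis-size F regular (Subfield._∈K? K) (Subfield.0∈K K , (λ _ _ → Subfield.+∈K K) , λ a _ a∈ x∈ → Subfield.*∈K K (F⊆K a a∈) x∈) bas)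
             (cong (_^ s) order-F)

    fixed⊆⇒∣ : ∀ K {s t} → order K ≡ q ^ s → t ∣ l → fixed t ⊆ᶠ K → t ∣ s
    fixed⊆⇒∣ K {s} {t} eq t∣l f⊆ = size-power (fixed t) (order-fixed t∣l) (Subfield._∈K? K)
      (Subfield.0∈K K , (λ _ _ → Subfield.+∈K K) , λ a _ a∈ x∈ → Subfield.*∈K K (f⊆ a a∈) x∈) eq

    -- By `fermat` over `K`, the field `K` lies in `fixed s`, which has the same order. So `K`
    -- equals `fixed s`, and the fixed points of the q^t-power map are among those of its iterates.
    ∣⇒fixed⊆ : ∀ K {s t} → order K ≡ q ^ s → s ∣ l → t ∣ s → fixed t ⊆ᶠ K
    ∣⇒fixed⊆ K {s} {t} eq s∣l t∣s a fa = count-⊇ (Subfield._∈K? K) (Subfield._∈K? (fixed s))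
      (λ x x∈ → trans (cong (x ^ᴱ_) (sym eq)) (fermat K x∈)) (ℕ.≤-reflexive (trans (order-fixed s∣l) (sym eq)))
      a (fixed-multiple t∣s fa)

-- Rational numbers, Möbius function and Gaussian binomial coefficients

fromℤ-+ : ∀ x y → fromℤ (x ℤ.+ y) ≡ fromℤ x ℚ.+ fromℤ y
fromℤ-+ x y = ℚ.toℚᵘ-injective (ℚᵘ.≃-trans (ℚ.toℚᵘ-fromℚᵘ (mkℚᵘ (x ℤ.+ y) 0)) (ℚᵘ.≃-trans
  (*≡* (cong (ℤ._* ℤ.+ 1) (sym (cong₂ ℤ._+_ (ℤ.*-identityʳ x) (ℤ.*-identityʳ y)))))
  (ℚᵘ.≃-sym (ℚᵘ.≃-trans (ℚ.toℚᵘ-homo-+ (fromℤ x) (fromℤ y))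
    (ℚᵘ.+-cong (ℚ.toℚᵘ-fromℚᵘ (mkℚᵘ x 0)) (ℚ.toℚᵘ-fromℚᵘ (mkℚᵘ y 0)))))))

fromℤ-* : ∀ x y → fromℤ (x ℤ.* y) ≡ fromℤ x ℚ.* fromℤ y
fromℤ-* x y = ℚ.toℚᵘ-injective (ℚᵘ.≃-trans (ℚ.toℚᵘ-fromℚᵘ (mkℚᵘ (x ℤ.* y) 0))
  (ℚᵘ.≃-sym (ℚᵘ.≃-trans (ℚ.toℚᵘ-homo-* (fromℤ x) (fromℤ y))
    (ℚᵘ.*-cong (ℚ.toℚᵘ-fromℚᵘ (mkℚᵘ x 0)) (ℚ.toℚᵘ-fromℚᵘ (mkℚᵘ y 0))))))

fromℤ-neg : ∀ x → fromℤ (ℤ.- x) ≡ ℚ.- fromℤ x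
fromℤ-neg x = trans (cong fromℤ (sym (ℤ.-1*i≡-i x))) (trans (fromℤ-* -1ℤ x) (trans (sym (ℚ.neg-distribˡ-* 1ℚ (fromℤ x))) (cong ℚ.-_ (ℚ.*-identityˡ (fromℤ x)))))

fromℕ-+ : ∀ m n → fromℕ (m + n) ≡ fromℕ m ℚ.+ fromℕ n
fromℕ-+ m n = trans (cong fromℤ (ℤ.pos-+ m n)) (fromℤ-+ (ℤ.+ m) (ℤ.+ n))

fromℕ-* : ∀ m n → fromℕ (m * n) ≡ fromℕ m ℚ.* fromℕ n
fromℕ-* m n = trans (cong fromℤ (ℤ.pos-* m n)) (fromℤ-* (ℤ.+ m) (ℤ.+ n))

fromℕ-cancel-≤ : ∀ {m n} → fromℕ m ℚ.≤ fromℕ n → m ≤ n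
fromℕ-cancel-≤ {m} {n} le with ℚᵘ.≤-respˡ-≃ (ℚ.toℚᵘ-fromℚᵘ (mkℚᵘ (ℤ.+ m) 0)) (ℚᵘ.≤-respʳ-≃ (ℚ.toℚᵘ-fromℚᵘ (mkℚᵘ (ℤ.+ n) 0)) (ℚ.toℚᵘ-mono-≤ le))
... | *≤* p = ℤ.drop‿+≤+ (subst₂ ℤ._≤_ (ℤ.*-identityʳ (ℤ.+ m)) (ℤ.*-identityʳ (ℤ.+ n)) p)

fromℕ-injective : ∀ {m n} → fromℕ m ≡ fromℕ n → m ≡ n
fromℕ-injective eq = ℕ.≤-antisym (fromℕ-cancel-≤ (ℚ.≤-reflexive eq)) (fromℕ-cancel-≤ (ℚ.≤-reflexive (sym eq)))

fromℕ-nonNeg : ∀ n → ℚ.NonNegative (fromℕ n)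
fromℕ-nonNeg n = ℚ.normalize-nonNeg n 1

fromℕ-pos : ∀ n .{{_ : NonZero n}} → ℚ.Positive (fromℕ n)
fromℕ-pos n = ℚ.normalize-pos n 1

fromℕ-*-cancelʳ : ∀ {x y} n .{{_ : NonZero n}} → x ℚ.* fromℕ n ≡ y ℚ.* fromℕ n → x ≡ y
fromℕ-*-cancelʳ n eq = ℚ.≤-antisym (ℚ.*-cancelʳ-≤-pos (fromℕ n) {{fromℕ-pos n}} (ℚ.≤-reflexive eq))
                                   (ℚ.*-cancelʳ-≤-pos (fromℕ n) {{fromℕ-pos n}} (ℚ.≤-reflexive (sym eq)))

//-* : ∀ a b .{{_ : NonZero b}} → (a // b) ℚ.* fromℕ b ≡ fromℕ a
//-* a b@(suc b-1) = ℚ.toℚᵘ-injective (ℚᵘ.≃-trans (ℚ.toℚᵘ-homo-* (a // b) (fromℕ b)) (ℚᵘ.≃-trans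
  (ℚᵘ.*-cong (ℚ.toℚᵘ-fromℚᵘ (mkℚᵘ (ℤ.+ a) b-1)) (ℚ.toℚᵘ-fromℚᵘ (mkℚᵘ (ℤ.+ b) 0))) (ℚᵘ.≃-trans
  (*≡* (ℤ.*-assoc (ℤ.+ a) (ℤ.+ b) (ℤ.+ 1)))
  (ℚᵘ.≃-sym (ℚ.toℚᵘ-fromℚᵘ (mkℚᵘ (ℤ.+ a) 0))))))

//-unique : ∀ {x} a b .{{_ : NonZero b}} → x ℚ.* fromℕ b ≡ fromℕ a → a // b ≡ x
//-unique a b eq = fromℕ-*-cancelʳ b (trans (//-* a b) (sym eq))

module Σℚ = Summation ℚ.+-0-commutativeMonoid

opaque
  unfolding Summation.total

  foldr-applyUpTo : ∀ (f : ℕ → ℚ) (h : ℕ → ℕ) n → ∑ (applyUpTo h n) f ≡ Σℚ.total {Fin n} (λ i → f (h (toℕ i)))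
  foldr-applyUpTo f h zero    = refl
  foldr-applyUpTo f h (suc n) = cong (f (h 0) ℚ.+_) (foldr-applyUpTo f (h ∘ suc) n)

  fromℕ-total : {A : Set} ⦃ _ : Finite A ⦄ (f : A → ℕ) → fromℕ (total f) ≡ Σℚ.total (fromℕ ∘ f)
  fromℕ-total {A} f = go (f ∘ elem)
    where
    go : ∀ {n} (g : Fin n → ℕ) → fromℕ (CMSum.sum ℕ.+-0-commutativeMonoid g) ≡ CMSum.sum ℚ.+-0-commutativeMonoid (fromℕ ∘ g)
    go {zero}  g = refl
    go {suc n} g = trans (fromℕ-+ (g zero) _) (cong (fromℕ (g zero) ℚ.+_) (go (g ∘ suc)))

  Σℚ-*ˡ : {A : Set} ⦃ _ : Finite A ⦄ (c : ℚ) (f : A → ℚ) → Σℚ.total (λ a → c ℚ.* f a) ≡ c ℚ.* Σℚ.total f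
  Σℚ-*ˡ {A} c f = go (f ∘ elem)
    where
    go : ∀ {n} (g : Fin n → ℚ) → CMSum.sum ℚ.+-0-commutativeMonoid (λ i → c ℚ.* g i) ≡ c ℚ.* CMSum.sum ℚ.+-0-commutativeMonoid g
    go {zero}  g = sym (ℚ.*-zeroʳ c)
    go {suc n} g = trans (cong (c ℚ.* g zero ℚ.+_) (go (g ∘ suc))) (sym (ℚ.*-distribˡ-+ c _ _))

  length-filter-range : ∀ {P : ℕ → Set} (P? : ∀ n → Dec (P n)) h n →
                        length (filter P? (applyUpTo h n)) ≡ count {Fin n} (λ i → P? (h (toℕ i)))
  length-filter-range P? h zero = refl
  length-filter-range P? h (suc n) with P? (h 0)
  ... | yes _ = cong suc (length-filter-range P? (h ∘ suc) n)
  ... | no _  = length-filter-range P? (h ∘ suc) n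

∑-filter : ∀ {P : ℕ → Set} (P? : ∀ n → Dec (P n)) xs (f : ℕ → ℚ) → ∑ (filter P? xs) f ≡ ∑ xs (λ x → Σℚ.when (P? x) (f x))
∑-filter P? []       f = refl
∑-filter P? (x ∷ xs) f with P? x
... | yes _ = cong (f x ℚ.+_) (∑-filter P? xs f)
... | no _  = trans (∑-filter P? xs f) (sym (ℚ.+-identityˡ _))

∑-cong : ∀ xs {f g : ℕ → ℚ} → (∀ x → f x ≡ g x) → ∑ xs f ≡ ∑ xs g
∑-cong []       eq = refl
∑-cong (x ∷ xs) eq = cong₂ ℚ._+_ (eq x) (∑-cong xs eq)

∑-*ʳ : ∀ xs (f : ℕ → ℚ) c → ∑ xs (λ x → f x ℚ.* c) ≡ ∑ xs f ℚ.* c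
∑-*ʳ []       f c = sym (ℚ.*-zeroˡ c)
∑-*ʳ (x ∷ xs) f c = trans (cong (f x ℚ.* c ℚ.+_) (∑-*ʳ xs f c)) (sym (ℚ.*-distribʳ-+ c (f x) (∑ xs f)))

∑-total : {A : Set} ⦃ _ : Finite A ⦄ → ∀ xs (f : ℕ → A → ℚ) → ∑ xs (λ x → Σℚ.total (f x)) ≡ Σℚ.total (λ a → ∑ xs (λ x → f x a))
∑-total []       f = sym (Σℚ.total-ε (λ _ → refl))
∑-total (x ∷ xs) f = trans (cong (Σℚ.total (f x) ℚ.+_) (∑-total xs f)) (sym (Σℚ.total-∙ (f x) (λ a → ∑ xs (λ x → f x a))))

-- The list sums of the statement become sums over `Fin n`, where reindexing and splitting are
-- available. The index `i` stands for `suc i`, since divisors are sought from 1 on.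
sumUpTo : {P : ℕ → Set} (n : ℕ) → (∀ t → Dec (P t)) → (ℕ → ℚ) → ℚ
sumUpTo n P? f = Σℚ.total {Fin n} (λ i → Σℚ.when (P? (suc (toℕ i))) (f (suc (toℕ i))))

sumUpTo-∑ : {P : ℕ → Set} (n : ℕ) (P? : ∀ t → Dec (P t)) (f : ℕ → ℚ) → ∑ (filter P? (range 1 n)) f ≡ sumUpTo n P? f
sumUpTo-∑ n P? f = trans (∑-filter P? (range 1 n) f) (foldr-applyUpTo _ suc n)

fin-pred : ∀ {n t} → 1 ≤ t → t ≤ n → Fin n
fin-pred {t = suc t} _ t≤n = fromℕ< t≤n

suc-toℕ-fin-pred : ∀ {n t} (1≤t : 1 ≤ t) (t≤n : t ≤ n) → suc (toℕ (fin-pred 1≤t t≤n)) ≡ t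
suc-toℕ-fin-pred {t = suc t} _ t≤n = cong suc (Fin.toℕ-fromℕ< t≤n)

sumUpTo-transfer : {P Q : ℕ → Set} (m n : ℕ) (P? : ∀ t → Dec (P t)) (Q? : ∀ t → Dec (Q t)) {f g : ℕ → ℚ} (h k : ℕ → ℕ) →
  (∀ t → 1 ≤ t → P t → Q (k t) × 1 ≤ k t × k t ≤ n × h (k t) ≡ t) →
  (∀ d → 1 ≤ d → Q d → P (h d) × 1 ≤ h d × h d ≤ m × k (h d) ≡ d × f (h d) ≡ g d) →
  sumUpTo m P? f ≡ sumUpTo n Q? g
sumUpTo-transfer {P} {Q} m n P? Q? {f} {g} h k fwd bwd = Σℚ.total-transfer R? eq row col
  where
  R : Fin m → Fin n → Set
  R i j = Q (suc (toℕ j)) × h (suc (toℕ j)) ≡ suc (toℕ i)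
  R? : ∀ i j → Dec (R i j)
  R? i j = Q? (suc (toℕ j)) ×-dec (h (suc (toℕ j)) ℕ.≟ suc (toℕ i))
  eq : ∀ {i j} → R i j → Σℚ.when (P? (suc (toℕ i))) (f (suc (toℕ i))) ≡ Σℚ.when (Q? (suc (toℕ j))) (g (suc (toℕ j)))
  eq {i} {j} (Qj , h≡) with bwd (suc (toℕ j)) (s≤s z≤n) Qj
  ... | Ph , _ , _ , _ , fg = Σℚ.when-cong (P? (suc (toℕ i))) (Q? (suc (toℕ j))) (λ _ → Qj) (λ _ → subst P h≡ Ph) (λ _ → trans (cong f (sym h≡)) fg)
  row : ∀ i → Σℚ.total (λ j → Σℚ.when (R? i j) (Σℚ.when (P? (suc (toℕ i))) (f (suc (toℕ i))))) ≡ Σℚ.when (P? (suc (toℕ i))) (f (suc (toℕ i)))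
  row i with P? (suc (toℕ i))
  ... | no _ = Σℚ.total-ε (λ j → when-0 (R? i j))
    where
    when-0 : ∀ {S : Set} (d : Dec S) → Σℚ.when d 0ℚ ≡ 0ℚ
    when-0 (yes _) = refl
    when-0 (no _)  = refl
  ... | yes p with fwd (suc (toℕ i)) (s≤s z≤n) p
  ...   | Qk , 1≤k , k≤n , hk = trans (Σℚ.total-single j₀ (λ j j≢ → Σℚ.when-no (R? i j) (λ (Qj , h≡) → j≢ (Fin.toℕ-injective (ℕ.suc-injective
            (trans (sym (proj₁ (proj₂ (proj₂ (proj₂ (bwd (suc (toℕ j)) (s≤s z≤n) Qj)))))) (trans (cong k h≡) (sym j₀≡))))))))
          (Σℚ.when-yes (R? i j₀) (subst Q (sym j₀≡) Qk , trans (cong h j₀≡) hk))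
    where
    j₀ = fin-pred 1≤k k≤n
    j₀≡ = suc-toℕ-fin-pred 1≤k k≤n
  col : ∀ j → Σℚ.total (λ i → Σℚ.when (R? i j) (Σℚ.when (Q? (suc (toℕ j))) (g (suc (toℕ j))))) ≡ Σℚ.when (Q? (suc (toℕ j))) (g (suc (toℕ j)))
  col j = by-cases (Q? (suc (toℕ j)))
    where
    gj = g (suc (toℕ j))
    by-cases : (d : Dec (Q (suc (toℕ j)))) → Σℚ.total (λ i → Σℚ.when (R? i j) (Σℚ.when d gj)) ≡ Σℚ.when d gj
    by-cases (no ¬q) = Σℚ.total-ε {f = λ i → Σℚ.when (R? i j) 0ℚ} (λ i → Σℚ.when-no (R? i j) (¬q ∘ proj₁))
    by-cases (yes q) with bwd (suc (toℕ j)) (s≤s z≤n) q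
    ... | Ph , 1≤h , h≤m , _ = trans (Σℚ.total-single {f = λ i → Σℚ.when (R? i j) gj} i₀ (λ i i≢ → Σℚ.when-no (R? i j)
             (λ (_ , h≡) → i≢ (Fin.toℕ-injective (ℕ.suc-injective (trans (sym h≡) (sym i₀≡)))))))
          (Σℚ.when-yes (R? i₀ j) (q , sym i₀≡))
      where
      i₀ = fin-pred 1≤h h≤m
      i₀≡ = suc-toℕ-fin-pred 1≤h h≤m

sumUpTo-split : {P Q : ℕ → Set} (n : ℕ) (P? : ∀ t → Dec (P t)) (Q? : ∀ t → Dec (Q t)) (f : ℕ → ℚ) →
                sumUpTo n P? f ≡ sumUpTo n (λ t → P? t ×-dec Q? t) f ℚ.+ sumUpTo n (λ t → P? t ×-dec ¬? (Q? t)) f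
sumUpTo-split n P? Q? f = trans (Σℚ.total-cong (λ i → split (P? (suc (toℕ i))) (Q? (suc (toℕ i))))) (Σℚ.total-∙ _ _)
  where
  split : ∀ {A B : Set} (a : Dec A) (b : Dec B) {x} → Σℚ.when a x ≡ Σℚ.when (a ×-dec b) x ℚ.+ Σℚ.when (a ×-dec ¬? b) x
  split (yes _) (yes _) = sym (ℚ.+-identityʳ _)
  split (yes _) (no _)  = sym (ℚ.+-identityˡ _)
  split (no _)  _       = refl

sumUpTo-0 : {P : ℕ → Set} (n : ℕ) (P? : ∀ t → Dec (P t)) {f : ℕ → ℚ} → (∀ t → 1 ≤ t → P t → f t ≡ 0ℚ) → sumUpTo n P? f ≡ 0ℚ
sumUpTo-0 n P? eq = Σℚ.total-ε (λ i → zero′ (P? (suc (toℕ i))) (eq _ (s≤s z≤n)))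
  where
  zero′ : ∀ {A : Set} (a : Dec A) {x} → (A → x ≡ 0ℚ) → Σℚ.when a x ≡ 0ℚ
  zero′ (yes a) h = h a
  zero′ (no _)  h = refl

sumUpTo-neg : {P : ℕ → Set} (n : ℕ) (P? : ∀ t → Dec (P t)) (f : ℕ → ℚ) → sumUpTo n P? (λ t → ℚ.- f t) ≡ ℚ.- sumUpTo n P? f
sumUpTo-neg n P? f = trans (Σℚ.total-cong (λ i → neg (P? (suc (toℕ i))))) (trans (Σℚ-*ˡ (ℚ.- 1ℚ) term)
  (trans (sym (ℚ.neg-distribˡ-* 1ℚ (Σℚ.total term))) (cong ℚ.-_ (ℚ.*-identityˡ (Σℚ.total term)))))
  where
  term : Fin n → ℚ
  term i = Σℚ.when (P? (suc (toℕ i))) (f (suc (toℕ i)))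
  neg : ∀ {A : Set} (a : Dec A) {x} → Σℚ.when a (ℚ.- x) ≡ ℚ.- 1ℚ ℚ.* Σℚ.when a x
  neg (yes _) {x} = trans (cong ℚ.-_ (sym (ℚ.*-identityˡ x))) (ℚ.neg-distribˡ-* 1ℚ x)
  neg (no _)  = refl

quot-cancel : ∀ d u .{{_ : NonZero u}} → (d * u) quot u ≡ d
quot-cancel d u@(suc _) = m*n/n≡m d u

-- Möbius inversion over divisors

HasSquare : ℕ → Set
HasSquare n = Any (λ d → d * d ∣ n) (range 2 n)

hasSquare⁺ : ∀ {n d} → 1 ≤ n → 2 ≤ d → d * d ∣ n → HasSquare n
hasSquare⁺ {n@(suc n-1)} {suc zero} _ (s≤s ()) _
hasSquare⁺ {n@(suc n-1)} {d@(suc (suc d-2))} _ _ dd∣n = Any.applyUpTo⁺ (2 +_) dd∣n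
  (ℕ.s≤s⁻¹ (ℕ.≤-trans (ℕ.≤-trans (s≤s (s≤s (ℕ.≤-refl {d-2}))) (ℕ.m≤m*n d d)) (∣⇒≤ dd∣n)))

hasSquare⁻ : ∀ {n} → HasSquare n → ∃[ d ] 2 ≤ d × d * d ∣ n
hasSquare⁻ {n} sq with i , _ , dd∣n ← Any.applyUpTo⁻ (2 +_) {n = suc n ∸ 2} sq = 2 + i , s≤s (s≤s z≤n) , dd∣n

μ-square : ∀ {n} → HasSquare n → μ n ≡ 0ℤ
μ-square {n} sq with any? (λ d → (d * d) ∣? n) (range 2 n)
... | yes _   = refl
... | no ¬sq = contradiction sq ¬sq

#primes : ℕ → ℕ
#primes n = count {Fin n} (λ i → prime? (suc (toℕ i)) ×-dec (suc (toℕ i) ∣? n))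

μ-squarefree : ∀ {n} → ¬ HasSquare n → μ n ≡ -1ℤ ℤ.^ #primes n
μ-squarefree {n} ¬sq with any? (λ d → (d * d) ∣? n) (range 2 n)
... | yes sq = contradiction sq ¬sq
... | no _   = cong (-1ℤ ℤ.^_) (length-filter-range (λ p → prime? p ×-dec (p ∣? n)) suc n)

module _ {p : ℕ} (pr : Prime p) where
  private
    instance _ = prime⇒nonZero pr
    1<p : 1 < p
    1<p = ℕ.nonTrivial⇒n>1 p {{prime⇒nonTrivial pr}}

  coprime-prime : ∀ {n} → p ∤ n → Coprime n p
  coprime-prime p∤n {d} (d∣n , d∣p) with prime⇒irreducible pr d∣p
  ... | inj₁ d≡1 = d≡1
  ... | inj₂ refl = contradiction d∣n p∤n

  module _ {d : ℕ} (1≤d : 1 ≤ d) (p∤d : p ∤ d) where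

    private
      1≤pd : 1 ≤ p * d
      1≤pd = ℕ.*-mono-≤ (ℕ.<⇒≤ 1<p) 1≤d
      instance
        _ = ℕ.>-nonZero 1≤d
        _ = ℕ.>-nonZero 1≤pd

    -- The one new prime divisor is `p` itself, as any other prime that divides `p * d` divides `d`;
    -- it is new because of `p ∤ d`.
    #primes-* : #primes (p * d) ≡ suc (#primes d)
    #primes-* = trans (count-split Pd? (λ i → suc (toℕ i) ℕ.≟ p)) (cong₂ _+_
      (count-unique (λ i → Pd? i ×-dec (suc (toℕ i) ℕ.≟ p)) i₀ ((subst Prime (sym i₀≡) pr , subst (_∣ p * d) (sym i₀≡) (m∣m*n d)) , i₀≡)
        (λ i (_ , i≡) → Fin.toℕ-injective (ℕ.suc-injective (trans i≡ (sym i₀≡)))))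
      (count-bij (λ i → Pd? i ×-dec ¬? (suc (toℕ i) ℕ.≟ p)) D? (λ i j → D? j ×-dec (toℕ j ℕ.≟ toℕ i))
        dom
        (λ { i ((pi , i∣) , i≢p) → let i∣d = other pi i∣ i≢p ; j = fromℕ< (∣⇒≤ i∣d) ; j≡ = Fin.toℕ-fromℕ< (∣⇒≤ i∣d) in
              j , ((subst (Prime ∘ suc) (sym j≡) pi , subst (λ k → suc k ∣ d) (sym j≡) i∣d) , j≡) })
        (λ { i j j′ (_ , e) (_ , e′) → Fin.toℕ-injective (trans e (sym e′)) })
        (λ { j ((pj , j∣)) → let i≤ = ℕ.≤-trans (∣⇒≤ j∣) (ℕ.m≤n*m d p) ; i≡ = Fin.toℕ-fromℕ< i≤ in
              fromℕ< i≤ , (pj , j∣) , sym i≡ })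
        (λ { i i′ j (_ , e) (_ , e′) → Fin.toℕ-injective (trans (sym e) e′) })))
      where
      Pd? : ∀ i → Dec (Prime (suc (toℕ i)) × suc (toℕ i) ∣ p * d)
      Pd? i = prime? (suc (toℕ i)) ×-dec (suc (toℕ i) ∣? p * d)
      D? : (j : Fin d) → Dec (Prime (suc (toℕ j)) × suc (toℕ j) ∣ d)
      D? j = prime? (suc (toℕ j)) ×-dec (suc (toℕ j) ∣? d)
      p≤pd : p ≤ p * d
      p≤pd = ℕ.m≤m*n p d
      i₀ : Fin (p * d)
      i₀ = fin-pred (ℕ.<⇒≤ 1<p) p≤pd
      i₀≡ : suc (toℕ i₀) ≡ p
      i₀≡ = suc-toℕ-fin-pred (ℕ.<⇒≤ 1<p) p≤pd
      other : ∀ {x} → Prime x → x ∣ p * d → x ≢ p → x ∣ d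
      other px x∣ x≢p with euclidsLemma p d px x∣
      ... | inj₂ x∣d = x∣d
      ... | inj₁ x∣p with prime⇒irreducible pr x∣p
      ...   | inj₁ refl = contradiction (prime⇒nonTrivial px) (λ ())
      ...   | inj₂ x≡p  = contradiction x≡p x≢p
      dom : ∀ (i : Fin (p * d)) (j : Fin d) → (Prime (suc (toℕ j)) × suc (toℕ j) ∣ d) × toℕ j ≡ toℕ i →
            ((Prime (suc (toℕ i)) × suc (toℕ i) ∣ p * d) × suc (toℕ i) ≢ p) × (Prime (suc (toℕ j)) × suc (toℕ j) ∣ d)
      dom i j ((pj , j∣) , e) = ((subst (Prime ∘ suc) e pj , ∣-trans (subst (λ k → suc k ∣ d) e j∣) (n∣m*n p)) ,
        λ i≡p → p∤d (subst (_∣ d) (trans (cong suc e) i≡p) j∣)) , (pj , j∣)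

    -- If `p` divided `x`, then `p * p` would divide `p * d` and `p` would divide `d`. So `x * x` is
    -- coprime to `p` and already divides `d`.
    hasSquare-* : HasSquare (p * d) → HasSquare d
    hasSquare-* sq with x , 2≤x , xx∣ ← hasSquare⁻ sq = hasSquare⁺ 1≤d 2≤x (coprime-divisor (coprime-prime p∤xx) xx∣)
      where
      p∤xx : p ∤ x * x
      p∤xx p∣xx with p∣x ← [ id , id ]′ (euclidsLemma x x pr p∣xx) = p∤d (*-cancelˡ-∣ p
        (∣-trans (∣-trans (*-monoʳ-∣ p p∣x) (subst (_∣ x * x) (ℕ.*-comm x p) (*-monoʳ-∣ x p∣x))) xx∣))

    μ-prime-* : μ (p * d) ≡ ℤ.- μ d
    μ-prime-* with any? (λ x → (x * x) ∣? d) (range 2 d) in eq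
    ... | yes sq = let x , 2≤x , xx∣ = hasSquare⁻ {d} sq in
                   μ-square (hasSquare⁺ 1≤pd 2≤x (∣-trans xx∣ (n∣m*n p)))
    ... | no ¬sq = trans (μ-squarefree (¬sq ∘ hasSquare-*)) (trans (cong (-1ℤ ℤ.^_) #primes-*)
                     (trans (ℤ.-1*i≡-i _) (cong (λ z → ℤ.- (-1ℤ ℤ.^ z)) (sym (length-filter-range (λ p → prime? p ×-dec (p ∣? d)) suc d)))))

  μ-p²∣ : ∀ {n} → 1 ≤ n → p * p ∣ n → μ n ≡ 0ℤ
  μ-p²∣ 1≤n pp∣n = μ-square (hasSquare⁺ 1≤n 1<p pp∣n)

  -- Divisors d with p ∤ d cancel against the divisors p d; those divisible by p² contribute 0.
  μ-sum-vanishes : ∀ {n} → 1 ≤ n → p ∣ n → sumUpTo n (_∣? n) (fromℤ ∘ μ) ≡ 0ℚ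
  μ-sum-vanishes {n} 1≤n p∣n = begin
    sumUpTo n (_∣? n) f
      ≡⟨ sumUpTo-split n (_∣? n) (p ∣?_) f ⟩
    sumUpTo n (λ t → (t ∣? n) ×-dec (p ∣? t)) f ℚ.+ sumUpTo n prime-to? f
      ≡⟨ cong (ℚ._+ sumUpTo n prime-to? f) (sumUpTo-split n (λ t → (t ∣? n) ×-dec (p ∣? t)) (p * p ∣?_) f) ⟩
    (sumUpTo n (λ t → ((t ∣? n) ×-dec (p ∣? t)) ×-dec (p * p ∣? t)) f ℚ.+ sumUpTo n once? f) ℚ.+ sumUpTo n prime-to? f
      ≡⟨ cong (λ x → (x ℚ.+ sumUpTo n once? f) ℚ.+ sumUpTo n prime-to? f)
           (sumUpTo-0 n (λ t → ((t ∣? n) ×-dec (p ∣? t)) ×-dec (p * p ∣? t)) (λ t 1≤t (_ , pp∣t) → cong fromℤ (μ-p²∣ 1≤t pp∣t))) ⟩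
    (0ℚ ℚ.+ sumUpTo n once? f) ℚ.+ sumUpTo n prime-to? f
      ≡⟨ cong (ℚ._+ sumUpTo n prime-to? f) (ℚ.+-identityˡ (sumUpTo n once? f)) ⟩
    sumUpTo n once? f ℚ.+ sumUpTo n prime-to? f
      ≡⟨ cong (ℚ._+ sumUpTo n prime-to? f) (sumUpTo-transfer n n once? prime-to? {f} {λ t → ℚ.- f t} (p *_) (_quot p) fwd bwd) ⟩
    sumUpTo n prime-to? (λ t → ℚ.- f t) ℚ.+ sumUpTo n prime-to? f
      ≡⟨ cong (ℚ._+ sumUpTo n prime-to? f) (sumUpTo-neg n prime-to? f) ⟩
    ℚ.- sumUpTo n prime-to? f ℚ.+ sumUpTo n prime-to? f
      ≡⟨ ℚ.+-inverseˡ (sumUpTo n prime-to? f) ⟩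
    0ℚ ∎
    where
    open ≡-Reasoning
    instance _ = ℕ.>-nonZero 1≤n
    f : ℕ → ℚ
    f = fromℤ ∘ μ
    prime-to? : ∀ t → Dec (t ∣ n × p ∤ t)
    prime-to? t = (t ∣? n) ×-dec ¬? (p ∣? t)
    once? : ∀ t → Dec ((t ∣ n × p ∣ t) × (p * p ∤ t))
    once? t = ((t ∣? n) ×-dec (p ∣? t)) ×-dec ¬? (p * p ∣? t)
    quot-p : ∀ d → (d * p) quot p ≡ d
    quot-p d = quot-cancel d p
    fwd : ∀ t → 1 ≤ t → (t ∣ n × p ∣ t) × (p * p ∤ t) →
          ((t quot p) ∣ n × p ∤ (t quot p)) × 1 ≤ t quot p × t quot p ≤ n × p * (t quot p) ≡ t
    fwd _ 1≤t ((t∣n , divides d refl) , pp∤t) rewrite quot-p d =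
      (d∣n , λ p∣d → pp∤t (subst (p * p ∣_) (ℕ.*-comm p d) (*-monoʳ-∣ p p∣d)))
      , ℕ.n≢0⇒n>0 (λ { refl → ℕ.<⇒≢ 1≤t refl }) , ∣⇒≤ d∣n , ℕ.*-comm p d
      where
      d∣n : d ∣ n
      d∣n = ∣-trans (m∣m*n p) t∣n
    bwd : ∀ d → 1 ≤ d → d ∣ n × p ∤ d →
          ((p * d ∣ n × p ∣ p * d) × (p * p ∤ p * d)) × 1 ≤ p * d × p * d ≤ n × (p * d) quot p ≡ d × f (p * d) ≡ ℚ.- f d
    bwd d 1≤d (divides e n≡ , p∤d) = ((pd∣n , m∣m*n d) , p∤d ∘ *-cancelˡ-∣ p) , ℕ.*-mono-≤ (ℕ.<⇒≤ 1<p) 1≤d , ∣⇒≤ pd∣n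
      , trans (cong (_quot p) (ℕ.*-comm p d)) (quot-p d) , trans (cong fromℤ (μ-prime-* 1≤d p∤d)) (fromℤ-neg (μ d))
      where
      p∣e : p ∣ e
      p∣e with euclidsLemma e d pr (subst (p ∣_) n≡ p∣n)
      ... | inj₁ p∣e = p∣e
      ... | inj₂ p∣d = contradiction p∣d p∤d
      pd∣n : p * d ∣ n
      pd∣n = subst (p * d ∣_) (trans (ℕ.*-comm d e) (sym n≡)) (subst (_∣ d * e) (ℕ.*-comm d p) (*-monoʳ-∣ d p∣e))

prime-divisor : ∀ {n} → 1 < n → ∃[ p ] Prime p × p ∣ n
prime-divisor {n} 1<n = go (factorise n {{ℕ.>-nonZero (ℕ.<-trans (s≤s z≤n) 1<n)}})
  where
  go : PrimeFactorisation n → ∃[ p ] Prime p × p ∣ n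
  go record { factors = [] ; isFactorisation = n≡1 } = contradiction n≡1 (ℕ.<⇒≢ 1<n ∘ sym)
  go record { factors = p ∷ ps ; isFactorisation = n≡ ; factorsPrime = pr ∷ᴬ _ } = p , pr , subst (p ∣_) (sym n≡) (m∣m*n (product ps))

μ-sum : ∀ {n} → 1 ≤ n → sumUpTo n (_∣? n) (fromℤ ∘ μ) ≡ fromℕ (ind (n ℕ.≟ 1))
μ-sum {suc zero} _ = trans (sym (sumUpTo-∑ 1 (_∣? 1) (fromℤ ∘ μ))) refl
μ-sum {n@(suc (suc _))} 1≤n = let p , pr , p∣n = prime-divisor {n} (s≤s (s≤s z≤n)) in μ-sum-vanishes pr 1≤n p∣n

-- The indicator restricts the sum to the `t` between `u` and `s` in the divisor order. If `u` does
-- not divide `s` there are none; otherwise t = d·u turns it into the sum of μ over the divisors of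
-- s/u, which detects s/u = 1.
μ-sum-between : ∀ {g s u} → 1 ≤ g → 1 ≤ u → u ∣ g → s ∣ g →
  ∑ (filter (u ∣?_) (divisors g)) (λ t → fromℤ (μ (t quot u)) ℚ.* fromℕ (ind (t ∣? s))) ≡ fromℕ (ind (s ℕ.≟ u))
μ-sum-between {g} {s} {u} 1≤g 1≤u u∣g s∣g = trans (∑-filter (u ∣?_) (divisors g) f) (trans
  (sumUpTo-∑ g (_∣? g) (λ t → Σℚ.when (u ∣? t) (f t))) (trans
  (Σℚ.total-cong (λ i → merge (suc (toℕ i)))) (main (u ∣? s))))
  where
  instance
    _ = ℕ.>-nonZero 1≤u
    _ = ℕ.>-nonZero 1≤g
  f : ℕ → ℚ
  f t = fromℤ (μ (t quot u)) ℚ.* fromℕ (ind (t ∣? s))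
  mid? : ∀ t → Dec (u ∣ t × t ∣ s)
  mid? t = (u ∣? t) ×-dec (t ∣? s)
  merge : ∀ t → Σℚ.when (t ∣? g) (Σℚ.when (u ∣? t) (f t)) ≡ Σℚ.when (mid? t) (fromℤ (μ (t quot u)))
  merge t with t ∣? g | u ∣? t | t ∣? s
  ... | yes _  | yes _ | yes _   = ℚ.*-identityʳ _
  ... | yes _  | yes _ | no _    = ℚ.*-zeroʳ (fromℤ (μ (t quot u)))
  ... | yes _  | no _  | _       = refl
  ... | no t∤g | yes _ | yes t∣s = contradiction (∣-trans t∣s s∣g) t∤g
  ... | no _   | yes _ | no _    = refl
  ... | no _   | no _  | _       = refl
  quot-u : ∀ d → (d * u) quot u ≡ d
  quot-u d = quot-cancel d u
  main : Dec (u ∣ s) → sumUpTo g mid? (λ t → fromℤ (μ (t quot u))) ≡ fromℕ (ind (s ℕ.≟ u))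
  main (no u∤s) = trans (sumUpTo-0 g mid? {λ t → fromℤ (μ (t quot u))} (λ t _ (u∣t , t∣s) → contradiction (∣-trans u∣t t∣s) u∤s))
    (cong fromℕ (sym (ind-no (s ℕ.≟ u) (λ { refl → u∤s ∣-refl }))))
  main (yes (divides n refl)) = trans
    (sumUpTo-transfer g n mid? (_∣? n) {λ t → fromℤ (μ (t quot u))} {fromℤ ∘ μ} (_* u) (_quot u) fwd
      (λ d 1≤d d∣n → (n∣m*n d , d*u∣n*u d∣n) , ℕ.*-mono-≤ 1≤d 1≤u , ∣⇒≤ (∣-trans (d*u∣n*u d∣n) s∣g) , quot-u d , cong (fromℤ ∘ μ) (quot-u d)))
    (trans (μ-sum 1≤n) (cong fromℕ (ind-cong (n ℕ.≟ 1) (n * u ℕ.≟ u) (λ { refl → ℕ.*-identityˡ u })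
      (λ eq → ℕ.*-cancelʳ-≡ n 1 u (trans eq (sym (ℕ.*-identityˡ u)))))))
    where
    d*u∣n*u : ∀ {d} → d ∣ n → d * u ∣ n * u
    d*u∣n*u {d} d∣n = subst (_∣ n * u) (ℕ.*-comm u d) (subst (u * d ∣_) (ℕ.*-comm u n) (*-monoʳ-∣ u d∣n))
    1≤n : 1 ≤ n
    1≤n = ℕ.n≢0⇒n>0 (λ { refl → ℕ.<⇒≢ 1≤g (sym (0∣⇒≡0 s∣g)) })
    instance _ = ℕ.>-nonZero 1≤n
    fwd : ∀ t → 1 ≤ t → u ∣ t × t ∣ n * u → (t quot u) ∣ n × 1 ≤ t quot u × t quot u ≤ n × (t quot u) * u ≡ t
    fwd _ 1≤t (divides d refl , t∣s) rewrite quot-u d = d∣n , ℕ.n≢0⇒n>0 (λ { refl → ℕ.<⇒≢ 1≤t refl }) , ∣⇒≤ d∣n , refl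
      where
      d∣n : d ∣ n
      d∣n = *-cancelʳ-∣ u t∣s

-- Products of naturals and the Gaussian binomial coefficient as a count

prod-cong : ∀ {f g : ℕ → ℕ} n → (∀ j → j < n → f j ≡ g j) → prod f n ≡ prod g n
prod-cong zero    eq = refl
prod-cong (suc n) eq = cong₂ _*_ (prod-cong n (λ j j<n → eq j (ℕ.<-trans j<n (ℕ.n<1+n n)))) (eq n (ℕ.n<1+n n))

prod-* : ∀ (f g : ℕ → ℕ) n → prod (λ j → f j * g j) n ≡ prod f n * prod g n
prod-* f g zero    = refl
prod-* f g (suc n) = trans (cong (_* (f n * g n)) (prod-* f g n)) (ℕ.[m*n]*[o*p]≡[m*o]*[n*p] (prod f n) (prod g n) (f n) (g n))

prod-head : ∀ (f : ℕ → ℕ) n → prod f (suc n) ≡ f 0 * prod (f ∘ suc) n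
prod-head f zero    = ℕ.*-comm 1 (f 0)
prod-head f (suc n) = trans (cong (_* f (suc n)) (prod-head f n)) (ℕ.*-assoc (f 0) _ _)

prod-reverse : ∀ (f : ℕ → ℕ) n → prod (λ j → f (n ∸ j)) n ≡ prod (f ∘ suc) n
prod-reverse f zero    = refl
prod-reverse f (suc n) = trans (prod-head (λ j → f (suc n ∸ j)) n) (trans (cong (f (suc n) *_) (prod-reverse f n)) (ℕ.*-comm (f (suc n)) _))

prod-nonZero : ∀ {f : ℕ → ℕ} n → (∀ j → j < n → f j ≢ 0) → prod f n ≢ 0
prod-nonZero zero    f≢0 = λ ()
prod-nonZero {f} (suc n) f≢0 eq with ℕ.m*n≡0⇒m≡0∨n≡0 (prod f n) eq
... | inj₁ z = prod-nonZero n (λ j j<n → f≢0 j (ℕ.<-trans j<n (ℕ.n<1+n n))) z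
... | inj₂ z = f≢0 n (ℕ.n<1+n n) z

prod-applyUpTo : ∀ (f : ℕ → ℕ) h n → product (map f (applyUpTo h n)) ≡ prod (f ∘ h) n
prod-applyUpTo f h zero    = refl
prod-applyUpTo f h (suc n) = trans (cong (f (h 0) *_) (prod-applyUpTo f (h ∘ suc) n)) (sym (prod-head (f ∘ h) n))

^∸1≢0 : ∀ {Q n} → 1 < Q → 1 ≤ n → Q ^ n ∸ 1 ≢ 0
^∸1≢0 {Q} 1<Q 1≤n eq = ℕ.<⇒≱ (ℕ.^-monoʳ-< Q 1<Q 1≤n) (ℕ.m∸n≡0⇒m≤n eq)

^-difference : ∀ Q a j → j ≤ a → Q ^ a ∸ Q ^ j ≡ Q ^ j * (Q ^ (a ∸ j) ∸ 1)
^-difference Q a j j≤a = sym (trans (ℕ.*-distribˡ-∸ (Q ^ j) (Q ^ (a ∸ j)) 1)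
  (cong₂ _∸_ (trans (sym (ℕ.^-distribˡ-+-* Q j (a ∸ j))) (cong (Q ^_) (ℕ.m+[n∸m]≡n j≤a))) (ℕ.*-identityʳ (Q ^ j))))

-- Each factor Q^a - Q^j splits as Q^j (Q^(a - j) - 1). The powers of `Q` are the same on both sides
-- and cancel, and what remains are the numerator and the denominator of `gaussian`, the latter in
-- reverse order.
gaussian-count : ∀ {Q a b c} → 1 < Q → b ≤ a → fall Q (Q ^ b) 0 b * c ≡ fall Q (Q ^ a) 0 b → gaussian Q a b ≡ fromℕ c
gaussian-count {Q} {a} {b} {c} 1<Q b≤a eq = trans (cong₂ _//_ num≡ den≡) (//-unique num den (trans (sym (fromℕ-* c den)) (cong fromℕ cross)))
  where
  instance
    _ = ℕ.>-nonZero (ℕ.<-trans (s≤s z≤n) 1<Q)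
  num = prod (λ j → Q ^ (a ∸ j) ∸ 1) b
  den = prod (λ j → Q ^ (b ∸ j) ∸ 1) b
  num≡ : ∏ℕ (range 1 b) (λ i → Q ^ (suc a ∸ i) ∸ 1) ≡ num
  num≡ = prod-applyUpTo (λ i → Q ^ (suc a ∸ i) ∸ 1) suc b
  den≡ : ∏ℕ (range 1 b) (λ i → Q ^ i ∸ 1) ≡ den
  den≡ = trans (prod-applyUpTo (λ i → Q ^ i ∸ 1) suc b) (sym (prod-reverse (λ i → Q ^ i ∸ 1) b))
  fall≡ : ∀ a → b ≤ a → fall Q (Q ^ a) 0 b ≡ prod (Q ^_) b * prod (λ j → Q ^ (a ∸ j) ∸ 1) b
  fall≡ a b≤a = trans (prod-cong b (λ j j<b → trans (cong (λ k → Q ^ a ∸ Q ^ k) (ℕ.+-identityʳ j))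
    (^-difference Q a j (ℕ.≤-trans (ℕ.<⇒≤ j<b) b≤a)))) (prod-* (Q ^_) (λ j → Q ^ (a ∸ j) ∸ 1) b)
  instance
    _ = ℕ.≢-nonZero (prod-nonZero b (λ j _ → ℕ.≢-nonZero⁻¹ (Q ^ j) {{ℕ.m^n≢0 Q j}}))
    _ = ℕ.≢-nonZero (prod-nonZero b (λ j j<b → ^∸1≢0 1<Q (ℕ.m<n⇒0<n∸m j<b)))
  cross : c * den ≡ num
  cross = ℕ.*-cancelˡ-≡ (c * den) num (prod (Q ^_) b) (begin
    prod (Q ^_) b * (c * den)        ≡⟨ cong (prod (Q ^_) b *_) (ℕ.*-comm c den) ⟩
    prod (Q ^_) b * (den * c)        ≡⟨ sym (ℕ.*-assoc (prod (Q ^_) b) den c) ⟩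
    prod (Q ^_) b * den * c          ≡⟨ cong (_* c) (sym (fall≡ b ℕ.≤-refl)) ⟩
    fall Q (Q ^ b) 0 b * c           ≡⟨ eq ⟩
    fall Q (Q ^ a) 0 b               ≡⟨ fall≡ a b≤a ⟩
    prod (Q ^_) b * num              ∎)
    where open ≡-Reasoning

-- Orbits of the Singer cycle on subspaces

divisor-sum-cong : ∀ {g} {P : ℕ → Set} (P? : ∀ t → Dec (P t)) {f h : ℕ → ℚ} → (∀ t → 1 ≤ t → t ∣ g → f t ≡ h t) →
                   ∑ (filter P? (divisors g)) f ≡ ∑ (filter P? (divisors g)) h
divisor-sum-cong {g} P? {f} {h} eq = trans (∑-filter P? (divisors g) f) (trans (sumUpTo-∑ g (_∣? g) (λ t → Σℚ.when (P? t) (f t)))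
  (trans (Σℚ.total-cong (λ i → Σℚ.when-cong (suc (toℕ i) ∣? g) (suc (toℕ i) ∣? g) id id
    (λ t∣g → Σℚ.when-cong (P? (suc (toℕ i))) (P? (suc (toℕ i))) id id (λ _ → eq (suc (toℕ i)) (s≤s z≤n) t∣g))))
  (trans (sym (sumUpTo-∑ g (_∣? g) (λ t → Σℚ.when (P? t) (h t)))) (sym (∑-filter P? (divisors g) h)))))

module Orbits (E : FiniteField) where
  open FiniteField E
  open Spaces E
  open FieldTheory E
  open Subfields E
  open Subfield using (order)

  dilate? : ∀ a (W : Powerset Carrierᴱ) x → Dec (∃[ y ] y ∈ᴾ W × a *ᴱ y ≡ x)
  dilate? a W x = ∃? (λ y → (y ∈ᴾ? W) ×-dec (a *ᴱ y ≟ x))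

  dilate : Carrierᴱ → Powerset Carrierᴱ → Powerset Carrierᴱ
  dilate a W = ⟦ dilate? a W ⟧ᴾ

  dilate⁺ : ∀ {a W x} → x ∈ᴾ W → (a *ᴱ x) ∈ᴾ dilate a W
  dilate⁺ {a} {W} {x} x∈ = ∈-⟦⟧ᴾ⁺ (dilate? a W) (x , x∈ , refl)

  dilate⁻ : ∀ {a W x} → x ∈ᴾ dilate a W → ∃[ y ] y ∈ᴾ W × a *ᴱ y ≡ x
  dilate⁻ {a} {W} = ∈-⟦⟧ᴾ⁻ (dilate? a W)

  dilate-dilate : ∀ a b W → dilate a (dilate b W) ≡ dilate (a *ᴱ b) W
  dilate-dilate a b W = Powerset-ext fwd bwd
    where
    fwd : ∀ x → x ∈ᴾ dilate a (dilate b W) → x ∈ᴾ dilate (a *ᴱ b) W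
    fwd x x∈ with dilate⁻ x∈
    ... | y , y∈ , refl with dilate⁻ y∈
    ...   | z , z∈ , refl = subst (_∈ᴾ dilate (a *ᴱ b) W) (R.*-assoc a b z) (dilate⁺ z∈)
    bwd : ∀ x → x ∈ᴾ dilate (a *ᴱ b) W → x ∈ᴾ dilate a (dilate b W)
    bwd x x∈ with dilate⁻ x∈
    ... | z , z∈ , refl = subst (_∈ᴾ dilate a (dilate b W)) (sym (R.*-assoc a b z)) (dilate⁺ (dilate⁺ z∈))

  dilate-1 : ∀ W → dilate 1ᴱ W ≡ W
  dilate-1 W = Powerset-ext (λ x x∈ → let y , y∈ , eq = dilate⁻ x∈ in subst (_∈ᴾ W) (trans (sym (R.*-identityˡ y)) eq) y∈)
                            (λ x x∈ → subst (_∈ᴾ dilate 1ᴱ W) (R.*-identityˡ x) (dilate⁺ x∈))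

  recip-nonzero : ∀ {a b} → a *ᴱ b ≡ 1ᴱ → b ≢ 0ᴱ
  recip-nonzero {a} ab≡1 refl = 0≢1 (trans (sym (R.zeroʳ a)) ab≡1)

  dilate-inverse : ∀ {a b} W → a *ᴱ b ≡ 1ᴱ → dilate b (dilate a W) ≡ W
  dilate-inverse {a} {b} W ab≡1 = trans (dilate-dilate b a W) (trans (cong (λ c → dilate c W) (trans (R.*-comm b a) ab≡1)) (dilate-1 W))

  *-cancel-recip : ∀ {a b} → a *ᴱ b ≡ 1ᴱ → ∀ x → a *ᴱ (b *ᴱ x) ≡ x
  *-cancel-recip {a} {b} ab≡1 x = trans (sym (R.*-assoc a b x)) (trans (cong (_*ᴱ x) ab≡1) (R.*-identityˡ x))

  *-swap : ∀ a b x → a *ᴱ (b *ᴱ x) ≡ b *ᴱ (a *ᴱ x)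
  *-swap a b x = trans (sym (R.*-assoc a b x)) (trans (cong (_*ᴱ x) (R.*-comm a b)) (R.*-assoc b a x))

  count-dilate : ∀ {a} W → a ≢ 0ᴱ → count (_∈ᴾ? dilate a W) ≡ count (_∈ᴾ? W)
  count-dilate {a} W a≢0 = count-bij (_∈ᴾ? dilate a W) (_∈ᴾ? W) (λ x y → (y ∈ᴾ? W) ×-dec (a *ᴱ y ≟ x))
    (λ { x y (y∈ , refl) → dilate⁺ y∈ , y∈ }) (λ x → dilate⁻) (λ { x y z (_ , e) (_ , e′) → *ᴱ-cancelˡ a≢0 (trans e (sym e′)) })
    (λ y y∈ → a *ᴱ y , y∈ , refl) (λ { x x′ y (_ , refl) (_ , refl) → refl })

  dilate-stabilises : ∀ {a c} W → Stabilises W c → Stabilises (dilate a W) c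
  dilate-stabilises {a} {c} W sc x x∈ with dilate⁻ x∈
  ... | y , y∈ , refl = subst (_∈ᴾ dilate a W) (*-swap a c y) (dilate⁺ (sc y y∈))

  dilate-stabilises⁻ : ∀ {a c} W → a ≢ 0ᴱ → Stabilises (dilate a W) c → Stabilises W c
  dilate-stabilises⁻ {a} {c} W a≢0 sc with b , ab≡1 ← recip a a≢0 =
    subst (λ W → Stabilises W c) (dilate-inverse W ab≡1) (dilate-stabilises {b} (dilate a W) sc)

  dilate-subspace : ∀ K a W → Over.IsSubspace K regular (_∈ᴾ W) → Over.IsSubspace K regular (_∈ᴾ dilate a W)
  dilate-subspace K a W (0∈ , +∈ , ·∈) = subst (_∈ᴾ dilate a W) (R.zeroʳ a) (dilate⁺ 0∈) , add-closed , scale-closed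
    where
    add-closed : ∀ x y → x ∈ᴾ dilate a W → y ∈ᴾ dilate a W → (x +ᴱ y) ∈ᴾ dilate a W
    add-closed x y x∈ y∈ with dilate⁻ x∈ | dilate⁻ y∈
    ... | x′ , x′∈ , refl | y′ , y′∈ , refl = subst (_∈ᴾ dilate a W) (R.distribˡ a x′ y′) (dilate⁺ (+∈ x′ y′ x′∈ y′∈))
    scale-closed : ∀ c x → Subfield._∈K K c → x ∈ᴾ dilate a W → (c *ᴱ x) ∈ᴾ dilate a W
    scale-closed c x cK x∈ with dilate⁻ x∈
    ... | x′ , x′∈ , refl = subst (_∈ᴾ dilate a W) (*-swap a c x′) (dilate⁺ (·∈ c x′ cK x′∈))

  module _ (F : Subfield) where

    -- `Stabilises` also holds for 0, so `Y` is the order of a subfield and the stabiliser in the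
    -- Singer cycle has `Y ∸ 1` elements.
    HasType : ℕ → ℕ → Powerset Carrierᴱ → Set
    HasType X Y W = Over.SubspaceOfSize F regular X W × count (Stabilises? W) ≡ Y

    HasType? : ∀ X Y W → Dec (HasType X Y W)
    HasType? X Y W = Over.SubspaceOfSize? F regular X W ×-dec (count (Stabilises? W) ℕ.≟ Y)

    dilate-type : ∀ {X Y a} W → a ≢ 0ᴱ → HasType X Y W → HasType X Y (dilate a W)
    dilate-type {a = a} W a≢0 ((sub , eq) , eq′) = (dilate-subspace F a W sub , trans (count-dilate W a≢0) eq) ,
      trans (count-cong (Stabilises? (dilate a W)) (Stabilises? W) (λ _ → dilate-stabilises⁻ W a≢0) (λ _ → dilate-stabilises W)) eq′

    InOrbit : Powerset Carrierᴱ → Powerset Carrierᴱ → Set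
    InOrbit W V = ∃[ a ] a ≢ 0ᴱ × dilate a W ≡ V

    InOrbit? : ∀ W V → Dec (InOrbit W V)
    InOrbit? W V = ∃? (λ a → ¬? (a ≟ 0ᴱ) ×-dec (dilate a W ≟ V))

    count-nonzero : count (λ (a : Carrierᴱ) → ¬? (a ≟ 0ᴱ)) ≡ size {Carrierᴱ} ∸ 1
    count-nonzero = trans (count-cong (λ a → ¬? (a ≟ 0ᴱ)) (λ a → yes tt ×-dec ¬? (a ≟ 0ᴱ)) (λ _ → tt ,_) (λ _ → proj₂))
      (trans (count-diff (λ a → a ≟ 0ᴱ) (λ _ → yes tt) (λ _ _ → tt))
        (cong₂ _∸_ count-all (count-unique (λ a → a ≟ 0ᴱ) 0ᴱ refl (λ _ p → p))))

    -- The elements a ≠ 0 with aW = a₀W form a coset of the stabiliser of W in the group of units.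
    orbit-size : ∀ {X Y} W → HasType X Y W → (Y ∸ 1) * count (InOrbit? W) ≡ size {Carrierᴱ} ∸ 1
    orbit-size {X} {Y} W ((sub@(0∈ , _ , ·∈) , _) , stab≡) = trans
      (double-count (InOrbit? W) (λ a → ¬? (a ≟ 0ᴱ)) R? (Y ∸ 1) 1 rows cols) (trans (ℕ.+-identityʳ _) count-nonzero)
      where
      R? : ∀ V a → Dec (a ≢ 0ᴱ × dilate a W ≡ V)
      R? V a = ¬? (a ≟ 0ᴱ) ×-dec (dilate a W ≟ V)
      S = stabiliser W F sub
      unit? : ∀ b → Dec (Stabilises W b × b ≢ 0ᴱ)
      unit? b = Stabilises? W b ×-dec ¬? (b ≟ 0ᴱ)
      units : count unit? ≡ Y ∸ 1
      units = cong (_∸ 1) (trans (sym (order-units S)) stab≡)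
      cols : ∀ a → count (λ V → R? V a) ≡ 1 * ind (¬? (a ≟ 0ᴱ))
      cols a = trans (count-ind (λ V → R? V a) (¬? (a ≟ 0ᴱ)) (λ V → proj₁) (λ a≢0 → dilate a W , a≢0 , refl)
        (λ { V V′ (_ , refl) (_ , refl) → refl })) (sym (ℕ.+-identityʳ _))
      stab-dilate : ∀ {b} → Stabilises W b → b ≢ 0ᴱ → dilate b W ≡ W
      stab-dilate {b} sb b≢0 with c , bc≡1 ← recip b b≢0 = Powerset-ext
        (λ x x∈ → let y , y∈ , eq = dilate⁻ x∈ in subst (_∈ᴾ W) eq (sb y y∈))
        (λ x x∈ → subst (_∈ᴾ dilate b W) (*-cancel-recip bc≡1 x) (dilate⁺ (Subfield.recip∈K S sb bc≡1 x x∈)))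
      rows : ∀ V → count (R? V) ≡ (Y ∸ 1) * ind (InOrbit? W V)
      rows V with InOrbit? W V
      ... | no ¬o = trans (count-none (R? V) (λ a r → ¬o (a , r))) (sym (ℕ.*-zeroʳ (Y ∸ 1)))
      ... | yes (a₀ , a₀≢0 , refl) with b₀ , ab≡1 ← recip a₀ a₀≢0 = trans
            (count-bij (R? V) unit? (λ a b → unit? b ×-dec (b *ᴱ a₀ ≟ a))
              (λ { a b ((sb , b≢0) , refl) → ((λ z → b≢0 (zero-product a₀≢0 (trans (R.*-comm a₀ b) z)))
                    , trans (cong (λ c → dilate c W) (R.*-comm b a₀)) (trans (sym (dilate-dilate a₀ b W)) (cong (dilate a₀) (stab-dilate sb b≢0)))) , sb , b≢0 })
              (λ a (a≢0 , eq) → b₀ *ᴱ a , ((λ x x∈ → subst (_∈ᴾ W) (sym (R.*-assoc b₀ a x))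
                    (subst (b₀ *ᴱ (a *ᴱ x) ∈ᴾ_) (dilate-inverse W ab≡1) (dilate⁺ (subst (a *ᴱ x ∈ᴾ_) eq (dilate⁺ x∈)))))
                    , λ z → a≢0 (zero-product (recip-nonzero ab≡1) z))
                  , trans (R.*-comm _ a₀) (*-cancel-recip ab≡1 a))
              (λ { a b b′ (_ , e) (_ , e′) → *ᴱ-cancelˡ a₀≢0 (trans (R.*-comm a₀ b) (trans e (trans (sym e′) (R.*-comm b′ a₀)))) })
              (λ b u → b *ᴱ a₀ , u , refl) (λ { a a′ b (_ , refl) (_ , refl) → refl }))
            (trans units (sym (ℕ.*-identityʳ _)))

    -- A union of `w` orbits. Each has (|E| - 1)/(Y - 1) members, and `number` states the total with
    -- the denominator multiplied out.
    record Selection (X Y w : ℕ) : Set where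
      no-eta-equality
      field
        chosen    : Powerset (Powerset Carrierᴱ)
        type      : ∀ W → W ∈ᴾ chosen → HasType X Y W
        invariant : ∀ a W → a ≢ 0ᴱ → W ∈ᴾ chosen → dilate a W ∈ᴾ chosen
        number    : (Y ∸ 1) * count (_∈ᴾ? chosen) ≡ w * (size {Carrierᴱ} ∸ 1)

    select-none : ∀ X Y → Selection X Y 0
    select-none X Y = record
      { chosen = ⟦ none? ⟧ᴾ ; type = λ W W∈ → ⊥-elim (∈-⟦⟧ᴾ⁻ none? W∈)
      ; invariant = λ a W _ W∈ → ⊥-elim (∈-⟦⟧ᴾ⁻ none? W∈)
      ; number = trans (cong ((Y ∸ 1) *_) (count-none (_∈ᴾ? ⟦ none? ⟧ᴾ) (λ W → ∈-⟦⟧ᴾ⁻ none?))) (ℕ.*-zeroʳ (Y ∸ 1)) }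
      where
      none? : (W : Powerset Carrierᴱ) → Dec ⊥
      none? _ = no id

    add-orbit : ∀ {X Y w} (sel : Selection X Y w) W₀ → HasType X Y W₀ → ¬ W₀ ∈ᴾ Selection.chosen sel → Selection X Y (suc w)
    add-orbit {X} {Y} {w} sel W₀ W₀-type W₀∉ = record
      { chosen = ⟦ union? ⟧ᴾ
      ; type = λ W W∈ → [ type W , (λ { (a , a≢0 , refl) → dilate-type W₀ a≢0 W₀-type }) ]′ (∈⁻ W∈)
      ; invariant = λ a W a≢0 W∈ → ∈⁺ ([ inj₁ ∘ invariant a W a≢0
          , (λ { (b , b≢0 , refl) → inj₂ (a *ᴱ b , (b≢0 ∘ zero-product a≢0) , sym (dilate-dilate a b W₀)) }) ]′ (∈⁻ W∈))
      ; number = begin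
          (Y ∸ 1) * count (_∈ᴾ? ⟦ union? ⟧ᴾ)
            ≡⟨ cong ((Y ∸ 1) *_) (trans (count-cong (_∈ᴾ? ⟦ union? ⟧ᴾ) union? (λ _ → ∈⁻) (λ _ → ∈⁺)) (count-split union? (InOrbit? W₀))) ⟩
          (Y ∸ 1) * (count (λ W → union? W ×-dec InOrbit? W₀ W) + count (λ W → union? W ×-dec ¬? (InOrbit? W₀ W)))
            ≡⟨ cong ((Y ∸ 1) *_) (cong₂ _+_ (count-cong (λ W → union? W ×-dec InOrbit? W₀ W) (InOrbit? W₀) (λ _ → proj₂) (λ _ o → inj₂ o , o))
                 (count-cong (λ W → union? W ×-dec ¬? (InOrbit? W₀ W)) (_∈ᴾ? chosen)
                   (λ { W (inj₁ W∈ , _) → W∈ ; W (inj₂ o , ¬o) → contradiction o ¬o }) (λ W W∈ → inj₁ W∈ , disjoint W W∈))) ⟩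
          (Y ∸ 1) * (count (InOrbit? W₀) + count (_∈ᴾ? chosen))
            ≡⟨ ℕ.*-distribˡ-+ (Y ∸ 1) _ _ ⟩
          (Y ∸ 1) * count (InOrbit? W₀) + (Y ∸ 1) * count (_∈ᴾ? chosen)
            ≡⟨ cong₂ _+_ (orbit-size W₀ W₀-type) number ⟩
          suc w * (size {Carrierᴱ} ∸ 1) ∎ }
      where
      open ≡-Reasoning
      open Selection sel
      union? : ∀ W → Dec (W ∈ᴾ chosen ⊎ InOrbit W₀ W)
      union? W = (W ∈ᴾ? chosen) ⊎-dec InOrbit? W₀ W
      ∈⁺ : ∀ {W} → W ∈ᴾ chosen ⊎ InOrbit W₀ W → W ∈ᴾ ⟦ union? ⟧ᴾ
      ∈⁺ = ∈-⟦⟧ᴾ⁺ union?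
      ∈⁻ : ∀ {W} → W ∈ᴾ ⟦ union? ⟧ᴾ → W ∈ᴾ chosen ⊎ InOrbit W₀ W
      ∈⁻ = ∈-⟦⟧ᴾ⁻ union?
      disjoint : ∀ W → W ∈ᴾ chosen → ¬ InOrbit W₀ W
      disjoint W W∈ (a , a≢0 , refl) with b , ab≡1 ← recip a a≢0 =
        W₀∉ (subst (_∈ᴾ chosen) (dilate-inverse W₀ ab≡1) (invariant b W (recip-nonzero ab≡1) W∈))

    -- By the bound the selected subspaces are fewer than all those of the type, so some subspace of
    -- the type is left over. Its orbit is disjoint from the selection, which is invariant, and can
    -- be added whole.
    select-more : ∀ {X Y w} → suc w * (size {Carrierᴱ} ∸ 1) ≤ (Y ∸ 1) * count (HasType? X Y) → Selection X Y w → Selection X Y (suc w)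
    select-more {X} {Y} {w} le sel = extend (count-⊆-< (_∈ᴾ? chosen) (HasType? X Y) (ℕ.*-cancelˡ-< (Y ∸ 1) (count (_∈ᴾ? chosen)) (count (HasType? X Y))
        (ℕ.<-≤-trans (ℕ.≤-<-trans (ℕ.≤-reflexive number) (ℕ.m<n+m (w * (size {Carrierᴱ} ∸ 1)) N-1>0)) le)))
      where
      open Selection sel
      extend : (∃[ W ] HasType X Y W × ¬ W ∈ᴾ chosen) → Selection X Y (suc w)
      extend (W , W-type , W∉) = add-orbit sel W W-type W∉
      N-1>0 : 0 < size {Carrierᴱ} ∸ 1
      N-1>0 = ℕ.m<n⇒0<n∸m (subst (1 <_) order-everything (Subfield.1<order everything))

    select : ∀ {X Y} w → w * (size {Carrierᴱ} ∸ 1) ≤ (Y ∸ 1) * count (HasType? X Y) → Selection X Y w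
    select {X} {Y} zero    le = select-none X Y
    select         (suc w) le = select-more le (select w (ℕ.≤-trans (ℕ.m≤n+m (w * (size {Carrierᴱ} ∸ 1)) (size {Carrierᴱ} ∸ 1)) le))

  module TypeCount (F : Subfield) (p e l : ℕ) (prime : Prime p) (1≤l : 1 ≤ l)
                   (order-F : order F ≡ p ^ e) (size-E : size {Carrierᴱ} ≡ (p ^ e) ^ l) where
    open Tower F p e l prime 1≤l order-F size-E

    module _ {d : ℕ} (1≤d : 1 ≤ d) (d≤l : d ≤ l) where

      private
        g = gcd d l
        Sub? : ∀ W → Dec (Over.SubspaceOfSize F regular (q ^ d) W)
        Sub? = Over.SubspaceOfSize? F regular (q ^ d)

      ClosedUnder? : ∀ t W → Dec (Over.SubspaceOfSize F regular (q ^ d) W × (∀ a → Subfield._∈K (fixed t) a → Stabilises W a))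
      ClosedUnder? t W = Sub? W ×-dec ∀? (λ a → Subfield._∈K? (fixed t) a →? Stabilises? W a)

      gaussian-closed : ∀ t → 1 ≤ t → t ∣ g → gaussian (q ^ t) (l quot t) (d quot t) ≡ fromℕ (count (ClosedUnder? t))
      gaussian-closed t 1≤t t∣g = go (∣-trans t∣g (gcd[m,n]∣n d l)) (∣-trans t∣g (gcd[m,n]∣m d l))
        where
        instance _ = ℕ.>-nonZero 1≤t
        go : t ∣ l → t ∣ d → gaussian (q ^ t) (l quot t) (d quot t) ≡ fromℕ (count (ClosedUnder? t))
        go t∣l@(divides a l≡) (divides b d≡) = trans (cong₂ (gaussian (q ^ t)) (trans (cong (_quot t) l≡) (quot-cancel a t)) (trans (cong (_quot t) d≡) (quot-cancel b t)))
          (gaussian-count {q ^ t} {a} {b} (ℕ.^-monoʳ-< q 1<q 1≤t) (ℕ.*-cancelʳ-≤ b a t (subst₂ _≤_ d≡ l≡ d≤l))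
            (trans (cong (fall (q ^ t) ((q ^ t) ^ b) 0 b *_) same) subspaces))
          where
          pow : ∀ {n} c → n ≡ c * t → (q ^ t) ^ c ≡ q ^ n
          pow c refl = trans (ℕ.^-*-assoc q t c) (cong (q ^_) (ℕ.*-comm t c))
          K = fixed t
          same : count (ClosedUnder? t) ≡ count (Over.SubspaceOfSize? K regular ((q ^ t) ^ b))
          same = count-cong (ClosedUnder? t) (Over.SubspaceOfSize? K regular ((q ^ t) ^ b))
            (λ { W (((0∈ , +∈ , _) , eq) , st) → (0∈ , +∈ , (λ a x aK x∈ → st a aK x x∈)) , trans eq (sym (pow b d≡)) })
            (λ { W ((0∈ , +∈ , ·∈) , eq) → ((0∈ , +∈ , (λ a x aF x∈ → ·∈ a x (F⊆fixed t a aF) x∈)) , trans eq (pow b d≡)) , (λ a aK x x∈ → ·∈ a x aK x∈) })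
          subspaces : fall (q ^ t) ((q ^ t) ^ b) 0 b * count (Over.SubspaceOfSize? K regular ((q ^ t) ^ b)) ≡ fall (q ^ t) ((q ^ t) ^ a) 0 b
          subspaces = begin
            fall (q ^ t) ((q ^ t) ^ b) 0 b * count (Over.SubspaceOfSize? K regular ((q ^ t) ^ b))
              ≡⟨ cong (λ Q → fall Q (Q ^ b) 0 b * count (Over.SubspaceOfSize? K regular (Q ^ b))) (sym (order-fixed t∣l)) ⟩
            fall (order K) (order K ^ b) 0 b * count (Over.SubspaceOfSize? K regular (order K ^ b))
              ≡⟨ Over.count-subspaces K regular b ⟩
            fall (order K) (size {Carrierᴱ}) 0 b
              ≡⟨ cong₂ (λ Q X → fall Q X 0 b) (order-fixed t∣l) (trans size-E (sym (pow a l≡))) ⟩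
            fall (q ^ t) ((q ^ t) ^ a) 0 b ∎
            where open ≡-Reasoning

      private
        1≤g : 1 ≤ g
        1≤g = ℕ.n≢0⇒n>0 λ z → ℕ.<⇒≢ 1≤d (sym (Data.Nat.GCD.gcd[m,n]≡0⇒m≡0 {d} {l} z))

      -- The sum over `t` is taken separately for each subspace `W`. If its stabiliser has order
      -- q^s, then `W` is closed under `fixed t` exactly when `t ∣ s`, and `s` divides `d` because
      -- `W` is a space over its stabiliser. So `μ-sum-between` leaves the indicator of s = u.
      type-count : ∀ {u} → u ∣ g → fromℕ (count (HasType? F (q ^ d) (q ^ u))) ≡
        ∑ (filter (u ∣?_) (divisors g)) (λ t → fromℤ (μ (t quot u)) ℚ.* gaussian (q ^ t) (l quot t) (d quot t))
      type-count {u} u∣g = sym (begin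
        ∑ L (λ t → μu t ℚ.* gaussian (q ^ t) (l quot t) (d quot t))
          ≡⟨ divisor-sum-cong (u ∣?_) expand ⟩
        ∑ L (λ t → Σℚ.total (λ W → μu t ℚ.* fromℕ (ind (ClosedUnder? t W))))
          ≡⟨ ∑-total L (λ t W → μu t ℚ.* fromℕ (ind (ClosedUnder? t W))) ⟩
        Σℚ.total (λ W → ∑ L (λ t → μu t ℚ.* fromℕ (ind (ClosedUnder? t W))))
          ≡⟨ Σℚ.total-cong each ⟩
        Σℚ.total (λ W → fromℕ (ind (HasType? F (q ^ d) (q ^ u) W)))
          ≡⟨ sym (fromℕ-total (λ W → ind (HasType? F (q ^ d) (q ^ u) W))) ⟩
        fromℕ (count (HasType? F (q ^ d) (q ^ u))) ∎)
        where
        open ≡-Reasoning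
        L = filter (u ∣?_) (divisors g)
        μu : ℕ → ℚ
        μu t = fromℤ (μ (t quot u))
        expand : ∀ t → 1 ≤ t → t ∣ g → μu t ℚ.* gaussian (q ^ t) (l quot t) (d quot t) ≡ Σℚ.total (λ W → μu t ℚ.* fromℕ (ind (ClosedUnder? t W)))
        expand t 1≤t t∣g = trans (cong (μu t ℚ.*_) (trans (gaussian-closed t 1≤t t∣g) (fromℕ-total (λ W → ind (ClosedUnder? t W)))))
                                 (sym (Σℚ-*ˡ (μu t) (λ W → fromℕ (ind (ClosedUnder? t W)))))
        1≤u : 1 ≤ u
        1≤u = ℕ.n≢0⇒n>0 λ { refl → ℕ.<⇒≢ 1≤g (sym (Data.Nat.Divisibility.0∣⇒≡0 u∣g)) }
        each : ∀ W → ∑ L (λ t → μu t ℚ.* fromℕ (ind (ClosedUnder? t W))) ≡ fromℕ (ind (HasType? F (q ^ d) (q ^ u) W))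
        each W = by-cases (Sub? W)
          where
          by-cases : Dec (Over.SubspaceOfSize F regular (q ^ d) W) →
                     ∑ L (λ t → μu t ℚ.* fromℕ (ind (ClosedUnder? t W))) ≡ fromℕ (ind (HasType? F (q ^ d) (q ^ u) W))
          by-cases (no ¬sub) = trans (∑-cong L (λ t → cong (λ n → μu t ℚ.* fromℕ n) (ind-no (ClosedUnder? t W) (¬sub ∘ proj₁))))
            (trans (∑-*ʳ L μu 0ℚ) (trans (ℚ.*-zeroʳ (∑ L μu)) (cong fromℕ (sym (ind-no (HasType? F (q ^ d) (q ^ u) W) (¬sub ∘ proj₁))))))
          by-cases (yes sub@(isSub@(0∈ , +∈ , ·∈) , size-W)) = given (order-power S (λ a aF x x∈ → ·∈ a x aF x∈))
            where
            S = stabiliser W F isSub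
            given : ∃[ s ] order S ≡ q ^ s × s ∣ l →
                    ∑ L (λ t → μu t ℚ.* fromℕ (ind (ClosedUnder? t W))) ≡ fromℕ (ind (HasType? F (q ^ d) (q ^ u) W))
            given (s , order≡ , s∣l) = trans
              (divisor-sum-cong (u ∣?_) (λ t 1≤t t∣g → cong (λ n → μu t ℚ.* fromℕ n) (ind-cong (ClosedUnder? t W) (t ∣? s)
                (λ (_ , f⊆) → fixed⊆⇒∣ S order≡ (∣-trans t∣g (gcd[m,n]∣n d l)) f⊆)
                (λ t∣s → sub , ∣⇒fixed⊆ S order≡ s∣l t∣s))))
              (trans (μ-sum-between 1≤g 1≤u u∣g (gcd-greatest s∣d s∣l))
                (cong fromℕ (ind-cong (s ℕ.≟ u) (HasType? F (q ^ d) (q ^ u) W) (λ { refl → sub , order≡ })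
                  (λ (_ , eq) → ^-injectiveʳ 1<q (trans (sym order≡) eq)))))
              where
              s∣d : s ∣ d
              s∣d = size-power S order≡ (_∈ᴾ? W) (0∈ , +∈ , λ a x sa x∈ → sa x x∈) size-W

      -- The factor (q^u - 1)/(q^l - 1) of `n[_,_,_,_]` is the reciprocal of the orbit length.
      -- Multiplying it away turns the rational bound into the inequality of naturals that `select`
      -- consumes.
      bounded : ∀ {u w} → u ∣ g → fromℕ w ℚ.≤ n[ q , l , d , u ] →
                w * (size {Carrierᴱ} ∸ 1) ≤ (q ^ u ∸ 1) * count (HasType? F (q ^ d) (q ^ u))
      bounded {u} {w} u∣g le = fromℕ-cancel-≤ (begin
        fromℕ (w * (size {Carrierᴱ} ∸ 1))
          ≡⟨ trans (fromℕ-* w _) (cong (λ N → fromℕ w ℚ.* fromℕ (N ∸ 1)) size-E) ⟩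
        fromℕ w ℚ.* fromℕ (q ^ l ∸ 1)
          ≤⟨ ℚ.*-monoʳ-≤-nonNeg (fromℕ (q ^ l ∸ 1)) {{fromℕ-nonNeg (q ^ l ∸ 1)}} le ⟩
        n[ q , l , d , u ] ℚ.* fromℕ (q ^ l ∸ 1)
          ≡⟨ cong (λ x → (c ℚ.* x) ℚ.* fromℕ (q ^ l ∸ 1)) (sym (type-count u∣g)) ⟩
        (c ℚ.* fromℕ X) ℚ.* fromℕ (q ^ l ∸ 1)
          ≡⟨ trans (ℚ.*-assoc c (fromℕ X) _) (trans (cong (c ℚ.*_) (ℚ.*-comm (fromℕ X) _)) (sym (ℚ.*-assoc c _ (fromℕ X)))) ⟩
        (c ℚ.* fromℕ (q ^ l ∸ 1)) ℚ.* fromℕ X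
          ≡⟨ cong (ℚ._* fromℕ X) (//-* (q ^ u ∸ 1) (q ^ l ∸ 1) {{ℕ.≢-nonZero (^∸1≢0 1<q 1≤l)}}) ⟩
        fromℕ (q ^ u ∸ 1) ℚ.* fromℕ X
          ≡⟨ sym (fromℕ-* (q ^ u ∸ 1) X) ⟩
        fromℕ ((q ^ u ∸ 1) * X) ∎)
        where
        open ℚ.≤-Reasoning
        X = count (HasType? F (q ^ d) (q ^ u))
        c = (q ^ u ∸ 1) // (q ^ l ∸ 1)

-- Tuples with a prescribed module of relations

module Relations (E : FiniteField) where
  open FiniteField E
  open Spaces E
  open FieldTheory E
  open Subfield using (order)

  private module Eⁿ {n : ℕ} = Space (regular ^ˢ n)

  module 𝔼 = Over everything

  all-E : ∀ {n} (c : Vec Carrierᴱ n) → 𝔼.AllK c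
  all-E []       = []
  all-E (_ ∷ cs) = tt ∷ all-E cs

  cancel-scale : ∀ {n e e⁻¹} → e *ᴱ e⁻¹ ≡ 1ᴱ → (a : Vec Carrierᴱ n) → scale n e⁻¹ (scale n e a) ≡ a
  cancel-scale {n} {e} {e⁻¹} ee⁻¹≡1 a = trans (sym (Eⁿ.·-assoc e⁻¹ e a)) (trans (cong (λ t → scale n t a) (trans (R.*-comm e⁻¹ e) ee⁻¹≡1)) (Eⁿ.·-identity a))

  zeros-++ : ∀ m n → zeros m ++ zeros n ≡ zeros (m + n)
  zeros-++ zero    n = refl
  zeros-++ (suc m) n = cong (0ᴱ ∷_) (zeros-++ m n)

  scale-injective : ∀ {n e e′} {a : Vec Carrierᴱ n} → a ≢ zeros n → scale n e a ≡ scale n e′ a → e ≡ e′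
  scale-injective {a = []}         a≢0 eq = contradiction refl a≢0
  scale-injective {suc n} {a = x ∷ a} a≢0 eq with x ≟ 0ᴱ
  ... | yes refl = scale-injective (a≢0 ∘ cong (0ᴱ ∷_)) (cong Vec.tail eq)
  ... | no x≢0   = *ᴱ-cancelˡ x≢0 (trans (R.*-comm x _) (trans (cong Vec.head eq) (R.*-comm _ x)))

  module _ (V : Space) where
    open Space V

    comb-add : ∀ {n} c d (vs : Vec Carrierᴹ n) → comb V (add n c d) vs ≡ comb V c vs +ᴹ comb V d vs
    comb-add c d vs = Linear.+-homo (comb-linear V vs) c d

    comb-scale : ∀ {n} e c (vs : Vec Carrierᴹ n) → comb V (scale n e c) vs ≡ e · comb V c vs
    comb-scale e c vs = Linear.·-homo (comb-linear V vs) e c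

    Relation : ∀ {n} → Vec Carrierᴱ n → Vec Carrierᴹ n → Set
    Relation {n} a vs = comb V a vs ≡ 0ᴹ × (∀ c → comb V c vs ≡ 0ᴹ → ∃[ e ] c ≡ scale n e a)

    Relation? : ∀ {n} (a : Vec Carrierᴱ n) vs → Dec (Relation a vs)
    Relation? {n} a vs = (comb V a vs ≟ 0ᴹ) ×-dec ∀? (λ c → (comb V c vs ≟ 0ᴹ) →? ∃? (λ e → c ≟ scale n e a))

    relation-zeros⇒indep : ∀ {n} {vs : Vec Carrierᴹ n} → Relation (zeros n) vs → 𝔼.Indep V vs
    relation-zeros⇒indep {n} (_ , only) c _ eq with e , refl ← only c eq = Eⁿ.·-zeroʳ e

    indep⇒relation-zeros : ∀ {n} {vs : Vec Carrierᴹ n} → 𝔼.Indep V vs → Relation (zeros n) vs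
    indep⇒relation-zeros {n} {vs} ind = comb-0 V vs , λ c eq → 0ᴱ , trans (ind c (all-E c) eq) (sym (Eⁿ.·-zeroˡ (zeros n)))

    relation-unique : ∀ {n} {a a′} {vs : Vec Carrierᴹ n} → Relation a vs → Relation a′ vs → ∃[ e ] a′ ≡ scale n e a
    relation-unique (_ , only) (eq , _) = only _ eq

    relation-scale : ∀ {n} {a} {vs : Vec Carrierᴹ n} {e} → e ≢ 0ᴱ → Relation a vs → Relation (scale n e a) vs
    relation-scale {n} {a} {vs} {e} e≢0 (eq , only) with e⁻¹ , ee⁻¹≡1 ← recip e e≢0 =
      trans (comb-scale e a vs) (trans (cong (e ·_) eq) (·-zeroʳ e)) , λ c eq′ → let f , c≡ = only c eq′ in
        f *ᴱ e⁻¹ , trans c≡ (trans (cong (scale n f) (sym (cancel-scale ee⁻¹≡1 a))) (sym (Eⁿ.·-assoc f e⁻¹ (scale n e a))))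

    -- Two coefficient vectors give the same combination exactly when they differ by a multiple of
    -- `a`, so each element of the span is represented |E| times.
    count-span-relation : ∀ {n} {a} {vs : Vec Carrierᴹ n} → a ≢ zeros n → Relation a vs →
                          size {Carrierᴱ} * count (𝔼.Span? V vs) ≡ size {Carrierᴱ} ^ n
    count-span-relation {n} {a} {vs} a≢0 (rel , only) = trans
      (double-count (𝔼.Span? V vs) (λ (_ : Vec Carrierᴱ n) → yes tt) (λ x c → comb V c vs ≟ x) (size {Carrierᴱ}) 1 rows
        (λ c → trans (count-unique (λ x → comb V c vs ≟ x) (comb V c vs) refl (λ _ → sym)) refl))
      (trans (ℕ.+-identityʳ _) (trans count-all (size-Vec n)))
      where
      rows : ∀ x → count (λ c → comb V c vs ≟ x) ≡ size {Carrierᴱ} * ind (𝔼.Span? V vs x)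
      rows x with 𝔼.Span? V vs x
      ... | no ¬s = trans (count-none (λ c → comb V c vs ≟ x) (λ c eq → ¬s (c , all-E c , eq))) (sym (ℕ.*-zeroʳ (size {Carrierᴱ})))
      ... | yes (c₀ , _ , refl) = trans (count-bij (λ c → comb V c vs ≟ comb V c₀ vs) (λ (_ : Carrierᴱ) → yes tt) (λ c e → c ≟ add n (scale n e a) c₀)
          (λ { c e refl → trans (comb-add (scale n e a) c₀ vs) (trans (cong (_+ᴹ comb V c₀ vs) (trans (comb-scale e a vs) (trans (cong (e ·_) rel) (·-zeroʳ e)))) (A.identityˡ _)) , tt })
          difference
          (λ { c e e′ refl eq → scale-injective a≢0 (Eⁿ.AP.∙-cancelʳ c₀ _ _ eq) })
          (λ e _ → add n (scale n e a) c₀ , refl) (λ { c c′ e refl refl → refl }))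
        (trans count-all (sym (ℕ.*-identityʳ _)))
        where
        difference : ∀ c → comb V c vs ≡ comb V c₀ vs → ∃[ e ] c ≡ add n (scale n e a) c₀
        difference c eq = proj₁ multiple , (begin
          c                                              ≡⟨ sym (Eⁿ.A.identityʳ c) ⟩
          add n c (zeros n)                              ≡⟨ cong (add n c) (sym (trans (cong (λ z → add n z c₀) (Eⁿ.-1·≡- c₀)) (Eⁿ.A.inverseˡ c₀))) ⟩
          add n c (add n (scale n (-ᴱ 1ᴱ) c₀) c₀)        ≡⟨ sym (Eⁿ.A.assoc c _ c₀) ⟩
          add n (add n c (scale n (-ᴱ 1ᴱ) c₀)) c₀        ≡⟨ cong (λ z → add n z c₀) (proj₂ multiple) ⟩
          add n (scale n (proj₁ multiple) a) c₀          ∎)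
          where
          open ≡-Reasoning
          multiple : ∃[ e ] add n c (scale n (-ᴱ 1ᴱ) c₀) ≡ scale n e a
          multiple = only (add n c (scale n (-ᴱ 1ᴱ) c₀)) (trans (comb-add c _ vs) (trans (cong₂ _+ᴹ_ eq (comb-scale (-ᴱ 1ᴱ) c₀ vs))
                       (trans (cong (comb V c₀ vs +ᴹ_) (-1·≡- _)) (A.inverseʳ _))))

    private
      N = size {Carrierᴱ}

    module _ {n : ℕ} {a : Vec Carrierᴱ n} {v : Carrierᴹ} {vs : Vec Carrierᴹ n} where

      -- Prepending a vector `v` with coefficient `b` has two cases. For `b ≢ 0ᴱ` the relation
      -- solves for `v`, and every relation among `vs` alone must be trivial. For `b` zero the
      -- relation already lives on `vs`, and `v` must lie outside their span.
      relation-∷-nonzero⁻ : ∀ {b} → b ≢ 0ᴱ → Relation (b ∷ a) (v ∷ vs) → 𝔼.Indep V vs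
      relation-∷-nonzero⁻ {b} b≢0 (_ , only) d _ eq with e , eq′ ← only (0ᴱ ∷ d) (trans (0·x+y≡y v _) eq)
        with refl ← zero-product b≢0 (trans (R.*-comm b e) (sym (cong Vec.head eq′))) = trans (cong Vec.tail eq′) (Eⁿ.·-zeroˡ a)

      relation-∷-nonzero⁺ : ∀ {b} → b ≢ 0ᴱ → comb V (b ∷ a) (v ∷ vs) ≡ 0ᴹ → 𝔼.Indep V vs → Relation (b ∷ a) (v ∷ vs)
      relation-∷-nonzero⁺ {b} b≢0 rel ind with b⁻¹ , bb⁻¹≡1 ← recip b b≢0 = rel , only
        where
        only : ∀ c → comb V c (v ∷ vs) ≡ 0ᴹ → ∃[ e ] c ≡ scale (suc n) e (b ∷ a)
        only (c ∷ d) eq = e , cong₂ _∷_ (sym eb≡c) d≡ea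
          where
          e = c *ᴱ b⁻¹
          eb≡c : e *ᴱ b ≡ c
          eb≡c = trans (R.*-assoc c b⁻¹ b) (trans (cong (c *ᴱ_) (trans (R.*-comm b⁻¹ b) bb⁻¹≡1)) (R.*-identityʳ c))
          ec+comb≡0 : c · v +ᴹ e · comb V a vs ≡ 0ᴹ
          ec+comb≡0 = trans (cong (λ t → t · v +ᴹ e · comb V a vs) (sym eb≡c)) (trans (cong (_+ᴹ e · comb V a vs) (·-assoc e b v))
                        (trans (sym (·-distribˡ e _ _)) (trans (cong (e ·_) rel) (·-zeroʳ e))))
          combs≡ : comb V d vs ≡ comb V (scale n e a) vs
          combs≡ = AP.∙-cancelˡ (c · v) _ _ (trans eq (trans (sym ec+comb≡0) (cong (c · v +ᴹ_) (sym (comb-scale e a vs)))))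
          d≡ea : d ≡ scale n e a
          d≡ea = 𝔼.indep-unique V ind (all-E d) (all-E (scale n e a)) combs≡

      relation-∷-zero⁻ : Relation (0ᴱ ∷ a) (v ∷ vs) → Relation a vs × ¬ 𝔼.Span V vs v
      relation-∷-zero⁻ (rel , only) = (trans (sym (0·x+y≡y v _)) rel
          , λ d eq → let e , eq′ = only (0ᴱ ∷ d) (trans (0·x+y≡y v _) eq) in e , cong Vec.tail eq′)
        , λ { (d , _ , refl) → let e , eq′ = only (-ᴱ 1ᴱ ∷ d) (trans (cong (_+ᴹ v) (-1·≡- v)) (A.inverseˡ v)) in
              0≢1 (trans (sym RP.-0#≈0#) (trans (cong -ᴱ_ (sym (trans (cong Vec.head eq′) (R.zeroʳ e)))) (RP.-‿involutive 1ᴱ))) }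

      relation-∷-zero⁺ : Relation a vs → ¬ 𝔼.Span V vs v → Relation (0ᴱ ∷ a) (v ∷ vs)
      relation-∷-zero⁺ (rel , only) v∉ = trans (0·x+y≡y v _) rel , λ { (c ∷ d) eq → go c d eq (c ≟ 0ᴱ) }
        where
        go : ∀ c d → comb V (c ∷ d) (v ∷ vs) ≡ 0ᴹ → Dec (c ≡ 0ᴱ) → ∃[ e ] c ∷ d ≡ scale (suc n) e (0ᴱ ∷ a)
        go c d eq (yes refl) = let e , d≡ = only d (trans (sym (0·x+y≡y v _)) eq) in e , cong₂ _∷_ (sym (R.zeroʳ e)) d≡
        go c d eq (no c≢0) with c⁻¹ , cc⁻¹≡1 ← recip c c≢0 = ⊥-elim (v∉ (scale n (-ᴱ c⁻¹) d , all-E (scale n (-ᴱ c⁻¹) d) , (begin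
          comb V (scale n (-ᴱ c⁻¹) d) vs      ≡⟨ comb-scale (-ᴱ c⁻¹) d vs ⟩
          (-ᴱ c⁻¹) · comb V d vs             ≡⟨ -·≡- c⁻¹ _ ⟩
          -ᴹ (c⁻¹ · comb V d vs)             ≡⟨ sym (x+y≡0⇒x≡-y v _ v+≡0) ⟩
          v                                  ∎)))
          where
          open ≡-Reasoning
          v+≡0 : v +ᴹ c⁻¹ · comb V d vs ≡ 0ᴹ
          v+≡0 = trans (cong (_+ᴹ c⁻¹ · comb V d vs) (trans (sym (·-identity v)) (trans (cong (_· v) (sym (trans (R.*-comm c⁻¹ c) cc⁻¹≡1))) (·-assoc c⁻¹ c v))))
                   (trans (sym (·-distribˡ c⁻¹ _ _)) (trans (cong (c⁻¹ ·_) eq) (·-zeroʳ c⁻¹)))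

    count-indep : ∀ {r} {us : Vec Carrierᴹ r} → 𝔼.Indep V us → ∀ n →
                  count (λ (vs : Vec Carrierᴹ n) → 𝔼.Indep? V (vs ++ us)) ≡ fall N (size {Carrierᴹ}) r n
    count-indep {r} {us} indep-us n = trans (count-cong (λ vs → 𝔼.Indep? V (vs ++ us)) (λ vs → All.all? (λ _ → yes tt) vs ×-dec 𝔼.Indep? V (vs ++ us)) (λ vs ind → all-tt vs , ind) (λ _ → proj₂))
        (trans (𝔼.count-extensions V (λ _ → yes tt) (tt , (λ _ _ _ _ → tt) , (λ _ _ _ _ → tt)) indep-us (all-tt us) n)
          (cong₂ (λ Q Y → fall Q Y r n) order-everything count-all))
      where
      all-tt : ∀ {m} (vs : Vec Carrierᴹ m) → All (λ _ → ⊤) vs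
      all-tt []       = []
      all-tt (_ ∷ vs) = tt ∷ all-tt vs

    -- The vector at the first nonzero coordinate of `b` is determined by the later ones, which are
    -- independent. Each vector before it avoids a span which, because of the relation, is smaller
    -- by a factor |E|. So the position of that coordinate does not affect the count, and `n ∸ 1`
    -- factors remain.
    count-relations : ∀ {r} {us : Vec Carrierᴹ r} → 𝔼.Indep V us → ∀ n (b : Vec Carrierᴱ n) (b′ : Vec Carrierᴱ r) → b ≢ zeros n →
                      count (λ (vs : Vec Carrierᴹ n) → Relation? (b ++ b′) (vs ++ us)) ≡ fall N (size {Carrierᴹ}) r (n ∸ 1)
    count-relations indep-us zero [] b′ b≢0 = contradiction refl b≢0
    count-relations {r} {us} indep-us (suc n) (b ∷ bs) b′ b≢0 = trans (total-Vec (λ vs → ind (Relation? ((b ∷ bs) ++ b′) (vs ++ us)))) (trans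
      (total-swap (λ v vs → ind (Relation? ((b ∷ bs) ++ b′) (v ∷ vs ++ us)))) (by-cases (b ≟ 0ᴱ)))
      where
      X = size {Carrierᴹ}
      by-cases : Dec (b ≡ 0ᴱ) → total (λ (vs : Vec Carrierᴹ n) → count (λ v → Relation? (b ∷ bs ++ b′) (v ∷ vs ++ us))) ≡ fall N X r n
      by-cases (no b≠0) = trans (total-cong fibre) (count-indep indep-us n)
        where
        fibre : ∀ vs → count (λ v → Relation? (b ∷ bs ++ b′) (v ∷ vs ++ us)) ≡ ind (𝔼.Indep? V (vs ++ us))
        fibre vs = count-ind (λ v → Relation? (b ∷ bs ++ b′) (v ∷ vs ++ us)) (𝔼.Indep? V (vs ++ us))
          (λ v → relation-∷-nonzero⁻ b≠0)
          (λ ind → let b⁻¹ , bb⁻¹≡1 = recip b b≠0 in -ᴹ (b⁻¹ · w) , relation-∷-nonzero⁺ b≠0 (solves b⁻¹ bb⁻¹≡1) ind)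
          (λ v v′ (e , _) (e′ , _) → solution-unique v v′ (AP.∙-cancelʳ w _ _ (trans e (sym e′))))
          where
          w = comb V (bs ++ b′) (vs ++ us)
          solves : ∀ b⁻¹ → b *ᴱ b⁻¹ ≡ 1ᴱ → b · (-ᴹ (b⁻¹ · w)) +ᴹ w ≡ 0ᴹ
          solves b⁻¹ bb⁻¹≡1 = trans (cong (_+ᴹ w) (trans (cong (b ·_) (sym (-·≡- b⁻¹ w))) (trans (sym (·-assoc b (-ᴱ b⁻¹) w))
            (trans (cong (_· w) (trans (sym (RP.-‿distribʳ-* b b⁻¹)) (cong -ᴱ_ bb⁻¹≡1))) (-1·≡- w))))) (A.inverseˡ w)
          solution-unique : ∀ v v′ → b · v ≡ b · v′ → v ≡ v′
          solution-unique v v′ eq = AP.x∙y⁻¹≈ε⇒x≈y v v′ (·-cancel b≠0 (trans (·-distribˡ b v (-ᴹ v′)) (trans (cong₂ _+ᴹ_ eq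
            (trans (cong (b ·_) (sym (-1·≡- v′))) (trans (sym (·-assoc b (-ᴱ 1ᴱ) v′)) (trans (cong (_· v′) (R.*-comm b _)) (trans (·-assoc (-ᴱ 1ᴱ) b v′) (-1·≡- _))))))
            (A.inverseʳ _))))
      by-cases (yes refl) = go n bs (b≢0 ∘ cong (0ᴱ ∷_)) (count-relations indep-us n bs b′ (b≢0 ∘ cong (0ᴱ ∷_)))
        where
        go : ∀ n (bs : Vec Carrierᴱ n) → bs ≢ zeros n → count (λ (vs : Vec Carrierᴹ n) → Relation? (bs ++ b′) (vs ++ us)) ≡ fall N X r (n ∸ 1) →
             total (λ (vs : Vec Carrierᴹ n) → count (λ v → Relation? (0ᴱ ∷ bs ++ b′) (v ∷ vs ++ us))) ≡ fall N X r n
        go zero [] bs≢0 _ = contradiction refl bs≢0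
        go (suc n) bs bs≢0 IH = trans (total-cong fibre) (trans (total-*ʳ (X ∸ N ^ (n + r)) _) (cong (_* (X ∸ N ^ (n + r))) IH))
          where
          bs++b′≢0 : bs ++ b′ ≢ zeros (suc n + r)
          bs++b′≢0 eq = bs≢0 (Vec.++-injectiveˡ bs (zeros (suc n)) (trans eq (sym (zeros-++ (suc n) r))))
          span : ∀ vs → Relation (bs ++ b′) (vs ++ us) → count (𝔼.Span? V (vs ++ us)) ≡ N ^ (n + r)
          span vs rel = ℕ.*-cancelˡ-≡ _ _ N {{ℕ.>-nonZero (ℕ.<-trans (s≤s z≤n) (subst (1 <_) order-everything (Subfield.1<order everything)))}}
            (count-span-relation bs++b′≢0 rel)
          fibre : ∀ vs → count (λ v → Relation? (0ᴱ ∷ bs ++ b′) (v ∷ vs ++ us)) ≡ ind (Relation? (bs ++ b′) (vs ++ us)) * (X ∸ N ^ (n + r))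
          fibre vs = by-relation (Relation? (bs ++ b′) (vs ++ us))
            where
            by-relation : (d : Dec (Relation (bs ++ b′) (vs ++ us))) → count (λ v → Relation? (0ᴱ ∷ bs ++ b′) (v ∷ vs ++ us)) ≡ ind d * (X ∸ N ^ (n + r))
            by-relation (no ¬rel) = count-none (λ v → Relation? (0ᴱ ∷ bs ++ b′) (v ∷ vs ++ us)) (λ v → ¬rel ∘ proj₁ ∘ relation-∷-zero⁻)
            by-relation (yes rel) = trans (count-cong (λ v → Relation? (0ᴱ ∷ bs ++ b′) (v ∷ vs ++ us)) (λ v → yes tt ×-dec ¬? (𝔼.Span? V (vs ++ us) v))
                (λ v rel′ → tt , proj₂ (relation-∷-zero⁻ rel′)) (λ v (_ , v∉) → relation-∷-zero⁺ rel v∉))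
              (trans (count-diff (𝔼.Span? V (vs ++ us)) (λ _ → yes tt) (λ _ _ → tt)) (trans (cong₂ _∸_ count-all (span vs rel)) (sym (ℕ.+-identityʳ _))))

-- Blocks of dimension k

module Blocks (E : FiniteField) where
  open FiniteField E
  open Spaces E
  open FieldTheory E
  open Relations E
  open Orbits E using (count-nonzero; recip-nonzero)
  open Subfield using (order)

  private module Eⁿ {n : ℕ} = Space (regular ^ˢ n)

  module _ (F : Subfield) where
    open Subfield F using (_∈K; _∈K?; 0∈K; 1∈K; +∈K; *∈K; -∈K; recip∈K)
    open Over F

    dot : ∀ {n} → Vec Carrierᴱ n → Vec Carrierᴱ n → Carrierᴱ
    dot = comb regular

    dot∈K : ∀ {n} {c d : Vec Carrierᴱ n} → AllK c → AllK d → (dot c d) ∈K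
    dot∈K = comb∈ regular (0∈K , (λ _ _ → +∈K) , λ _ _ → *∈K)

    -- Containment of the F-spans of the coordinates inside E. The lengths may differ, so that a
    -- pair of elements can bound a span to dimension 2.
    Dominates : ∀ {m n} → Vec Carrierᴱ m → Vec Carrierᴱ n → Set
    Dominates b a = ∀ x → Span regular a x → Span regular b x

    pair-dominates : ∀ {n α β} {c d : Vec Carrierᴱ n} → AllK c → AllK d → Dominates (α ∷ β ∷ []) (add n (scale n α c) (scale n β d))
    pair-dominates {n} {α} {β} {c} {d} cK dK x (f , fK , refl) = dot f c ∷ dot f d ∷ [] , dot∈K fK cK ∷ dot∈K fK dK ∷ [] , (begin
      dot f c *ᴱ α +ᴱ (dot f d *ᴱ β +ᴱ 0ᴱ)
        ≡⟨ cong₂ _+ᴱ_ (R.*-comm _ α) (trans (R.+-identityʳ _) (R.*-comm _ β)) ⟩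
      α *ᴱ dot f c +ᴱ β *ᴱ dot f d
        ≡⟨ sym (cong₂ _+ᴱ_ (Linear.·-homo (comb-linearʳ regular f) α c) (Linear.·-homo (comb-linearʳ regular f) β d)) ⟩
      dot f (scale n α c) +ᴱ dot f (scale n β d)
        ≡⟨ sym (Linear.+-homo (comb-linearʳ regular f) (scale n α c) (scale n β d)) ⟩
      dot f (add n (scale n α c) (scale n β d)) ∎)
      where open ≡-Reasoning

    ratio∈K : ∀ {n β} {c : Vec Carrierᴱ n} → AllK c → AllK (scale n β c) → c ≢ zeros n → β ∈K
    ratio∈K {c = []} _ _ c≢0 = contradiction refl c≢0
    ratio∈K {suc n} {β} {x ∷ c} (xK ∷ cK) (βxK ∷ βcK) c≢0 with x ≟ 0ᴱ
    ... | yes refl = ratio∈K cK βcK (c≢0 ∘ cong (0ᴱ ∷_))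
    ... | no x≢0 with y , xy≡1 ← recip x x≢0 = subst _∈K (trans (R.*-assoc β x y) (trans (cong (β *ᴱ_) xy≡1) (R.*-identityʳ β))) (*∈K βxK (recip∈K xK xy≡1))

    -- The unit vectors have coordinates in F and span E^n over E. This lifts identities of
    -- base-change maps from F^n to E^n.
    linear-identity : ∀ {n} {f : Vec Carrierᴱ n → Vec Carrierᴱ n} → Linear (regular ^ˢ n) (regular ^ˢ n) f →
                      (∀ c → AllK c → f c ≡ c) → ∀ c → f c ≡ c
    linear-identity {n} {f} lin fixes c = begin
      f c                                                   ≡⟨ cong f (sym (comb-unit c)) ⟩
      f (comb (regular ^ˢ n) c (unit n))                    ≡⟨ sym (comb-map {regular ^ˢ n} {regular ^ˢ n} lin c (unit n)) ⟩
      comb (regular ^ˢ n) c (Vec.map f (unit n))            ≡⟨ cong (comb (regular ^ˢ n) c) (map-fixed (unit∈K n)) ⟩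
      comb (regular ^ˢ n) c (unit n)                        ≡⟨ comb-unit c ⟩
      c                                                     ∎
      where
      open ≡-Reasoning
      map-fixed : ∀ {m} {P : Vec (Vec Carrierᴱ n) m} → All AllK P → Vec.map f P ≡ P
      map-fixed []       = refl
      map-fixed (p ∷ ps) = cong₂ _∷_ (fixes _ p) (map-fixed ps)

    comb∈K : ∀ {m n} {c : Vec Carrierᴱ m} {P : Vec (Vec Carrierᴱ n) m} → AllK c → All AllK P → AllK (comb (regular ^ˢ n) c P)
    comb∈K {n = n} = comb∈ (regular ^ˢ n) (zeros∈K n , (λ _ _ → add∈K) , λ _ _ → scale∈K)

    coefficients : ∀ V {m n} {vs : Vec (Points V) n} {ws : Vec (Points V) m} → All (Span V vs) ws →
                   ∃[ P ] All AllK P × Vec.map (λ p → comb V p vs) P ≡ ws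
    coefficients V []                  = [] , [] , refl
    coefficients V ((c , cK , eq) ∷ ss) = let P , PK , eqs = coefficients V ss in c ∷ P , cK ∷ PK , cong₂ _∷_ eq eqs

    comb-dominates : ∀ {m n} {a : Vec Carrierᴱ m} {P : Vec (Vec Carrierᴱ n) m} → All AllK P → Dominates a (comb (regular ^ˢ n) a P)
    comb-dominates {m} {n} {a} {P} PK x (f , fK , refl) = Vec.map (dot f) P , map∈K PK , (begin
      dot (Vec.map (dot f) P) a               ≡⟨ comb-comm (Vec.map (dot f) P) a ⟩
      dot a (Vec.map (dot f) P)               ≡⟨ comb-map {regular ^ˢ n} {regular} (comb-linearʳ regular f) a P ⟩
      dot f (comb (regular ^ˢ n) a P)         ∎)
      where
      open ≡-Reasoning
      map∈K : ∀ {m} {P : Vec (Vec Carrierᴱ n) m} → All AllK P → AllK (Vec.map (dot f) P)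
      map∈K []       = []
      map∈K (p ∷ ps) = dot∈K fK p ∷ map∈K ps

    module _ (k : ℕ) where

      -- What the construction needs of a set of relation vectors. A relation vector is only
      -- determined up to E-multiples, hence `scale-inv`; a change of F-basis of the block alters it
      -- but keeps the F-span of its coordinates, hence `span-inv`; `zero-or-big` excludes nonzero
      -- spans of dimension at most 2.
      record Admissible (P : Vec Carrierᴱ k → Set) : Set where
        no-eta-equality
        field
          decide      : ∀ a → Dec (P a)
          scale-inv   : ∀ {a e} → e ≢ 0ᴱ → P a → P (scale k e a)
          span-inv    : ∀ {a a′} → Dominates a a′ → Dominates a′ a → P a → P a′
          zero-or-big : ∀ {a} → P a → a ≡ zeros k ⊎ (∀ α β → ¬ Dominates (α ∷ β ∷ []) a)

    module _ {k : ℕ} {P : Vec Carrierᴱ k → Set} (adm : Admissible k P) where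
      open Admissible adm

      -- The coordinates of αc + βd lie in the F-span of α and β, whereas a nonzero multiple of a
      -- nonzero admissible `a` has coordinates whose span two elements cannot contain.
      small-multiple : ∀ {a α β e} {c d : Vec Carrierᴱ k} → P a → AllK c → AllK d →
                       add k (scale k α c) (scale k β d) ≡ scale k e a → scale k e a ≡ zeros k
      small-multiple {a} {α} {β} {e} {c} {d} Pa cK dK eq with zero-or-big Pa
      ... | inj₁ refl = Eⁿ.·-zeroʳ e
      ... | inj₂ big with e ≟ 0ᴱ
      ...   | yes refl = Eⁿ.·-zeroˡ a
      ...   | no e≢0 with e⁻¹ , ee⁻¹≡1 ← recip e e≢0 = ⊥-elim (big (e⁻¹ *ᴱ α) (e⁻¹ *ᴱ β)
                (subst (Dominates (e⁻¹ *ᴱ α ∷ e⁻¹ *ᴱ β ∷ [])) a≡ (pair-dominates cK dK)))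
        where
        a≡ : add k (scale k (e⁻¹ *ᴱ α) c) (scale k (e⁻¹ *ᴱ β) d) ≡ a
        a≡ = trans (cong₂ (add k) (Eⁿ.·-assoc e⁻¹ α c) (Eⁿ.·-assoc e⁻¹ β d)) (trans (sym (Eⁿ.·-distribˡ e⁻¹ _ _))
               (trans (cong (scale k e⁻¹) eq) (cancel-scale ee⁻¹≡1 a)))

      module _ (V : Space) where
        open Space V

        Good : Vec Carrierᴹ k → Set
        Good vs = ∃[ a ] P a × Relation V a vs

        Good? : ∀ vs → Dec (Good vs)
        Good? vs = ∃? (λ a → decide a ×-dec Relation? V a vs)

        good-indep : ∀ {vs} → Good vs → Indep V vs
        -- A vector `c` over F is the combination 1·c + 0·c, so a relation over F falls under
        -- `small-multiple`.
        good-indep (a , Pa , rel , only) c cK eq with e , c≡ ← only c eq =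
          trans c≡ (small-multiple Pa cK cK (trans (cong₂ (add k) (Eⁿ.·-identity c) (Eⁿ.·-zeroˡ c)) (trans (Eⁿ.A.identityʳ c) c≡)))

        -- If `c` and `d` are the F-coordinates of x and βx, then d - βc is an E-linear relation,
        -- and it is zero by `small-multiple`. So d = βc with both vectors over F, which puts β into
        -- F unless `c` is zero.
        good-scattered : ∀ {vs x β} → Good vs → Span V vs x → Span V vs (β · x) → ¬ Indep V (x ∷ β · x ∷ [])
        good-scattered {vs} {x} {β} (a , Pa , rel , only) (c , cK , refl) (d , dK , eq) indep = by-cases (c ≟ zeros k)
          where
          diff = add k (scale k 1ᴱ d) (scale k (-ᴱ β) c)
          vanishes : comb V diff vs ≡ 0ᴹ
          vanishes = trans (comb-add V (scale k 1ᴱ d) (scale k (-ᴱ β) c) vs) (trans (cong₂ _+ᴹ_ (trans (comb-scale V 1ᴱ d vs) (trans (·-identity _) eq)) (comb-scale V (-ᴱ β) c vs)) (-·-inverse β _))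
          d≡βc : d ≡ scale k β c
          d≡βc = let e , diff≡ = only diff vanishes in begin
            d                                           ≡⟨ sym (Eⁿ.·-identity d) ⟩
            scale k 1ᴱ d                                ≡⟨ Eⁿ.x+y≡0⇒x≡-y _ _ (trans diff≡ (small-multiple Pa dK cK diff≡)) ⟩
            Eⁿ.-ᴹ (scale k (-ᴱ β) c)                    ≡⟨ cong Eⁿ.-ᴹ_ (Eⁿ.-·≡- β c) ⟩
            Eⁿ.-ᴹ (Eⁿ.-ᴹ (scale k β c))                 ≡⟨ Eⁿ.AP.⁻¹-involutive _ ⟩
            scale k β c                                 ∎
            where open ≡-Reasoning
          by-cases : Dec (c ≡ zeros k) → ⊥
          by-cases (yes refl) = 0≢1 (sym (cong Vec.head (indep (1ᴱ ∷ 0ᴱ ∷ []) (1∈K ∷ 0∈K ∷ [])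
            (trans (cong₂ _+ᴹ_ (trans (·-identity _) (comb-0 V vs)) (0·x+y≡y _ 0ᴹ)) (A.identityˡ 0ᴹ)))))
          by-cases (no c≢0) = 0≢1 (trans (sym RP.-0#≈0#) (trans (cong -ᴱ_ (sym -1≡0)) (RP.-‿involutive 1ᴱ)))
            where
            -1≡0 : -ᴱ 1ᴱ ≡ 0ᴱ
            -1≡0 = cong (Vec.head ∘ Vec.tail) (indep (β ∷ -ᴱ 1ᴱ ∷ []) (ratio∈K cK (subst AllK d≡βc dK) c≢0 ∷ -∈K 1∈K ∷ [])
              (trans (cong (β · comb V c vs +ᴹ_) (trans (A.identityʳ _) (-1·≡- _))) (A.inverseʳ _)))

        -- `X` and `Y` are the matrices over F of the change of basis and its inverse. The relation
        -- vector `a` of `vs` becomes `ψ a` for `ws`; as each of `a`, `ψ a` arises from the other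
        -- through a matrix over F, their coordinates have the same F-span and `span-inv` applies.
        good-transfer : ∀ {vs ws} → Good vs → Indep V ws → All (Span V vs) ws → All (Span V ws) vs → Good ws
        good-transfer {vs} {ws} (a , Pa , rel , only) ws-indep ws∈ vs∈
          with X , XK , refl ← coefficients V ws∈ | Y , YK , vs≡ ← coefficients V vs∈ =
            ψ a , span-inv (comb-dominates YK) (subst (Dominates (ψ a)) (φψ a) (comb-dominates XK)) Pa
            , trans (ψ-comb a) rel
            , λ c eq → let e , φc≡ = only (φ c) (trans (sym (φ-comb c)) eq) in
                e , trans (sym (ψφ c)) (trans (cong ψ φc≡) (Linear.·-homo (comb-linear (regular ^ˢ k) Y) e a))
          where
          φ ψ : Vec Carrierᴱ k → Vec Carrierᴱ k
          φ c = comb (regular ^ˢ k) c X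
          ψ c = comb (regular ^ˢ k) c Y
          φ-comb : ∀ c → comb V c ws ≡ comb V (φ c) vs
          φ-comb c = comb-comb V c X vs
          ψ-comb : ∀ c → comb V (ψ c) ws ≡ comb V c vs
          ψ-comb c = trans (sym (comb-comb V c Y ws)) (cong (comb V c) vs≡)
          compose : ∀ {f g : Vec Carrierᴱ k → Vec Carrierᴱ k} → Linear (regular ^ˢ k) (regular ^ˢ k) f → Linear (regular ^ˢ k) (regular ^ˢ k) g →
                    Linear (regular ^ˢ k) (regular ^ˢ k) (f ∘ g)
          compose {f} lf lg = record { +-homo = λ x y → trans (cong f (Linear.+-homo lg x y)) (Linear.+-homo lf _ _)
                                     ; ·-homo = λ e x → trans (cong f (Linear.·-homo lg e x)) (Linear.·-homo lf e _) }
          φ-linear = comb-linear (regular ^ˢ k) X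
          ψ-linear = comb-linear (regular ^ˢ k) Y
          -- On F-vectors this follows from the F-independence of `vs`. The relations over E forbid
          -- the same argument for general `c`, so linearity extends it.
          φψ : ∀ c → φ (ψ c) ≡ c
          φψ = linear-identity (compose φ-linear ψ-linear) (λ c cK → indep-unique V (good-indep (a , Pa , rel , only)) (comb∈K (comb∈K cK YK) XK) cK
            (trans (sym (φ-comb (ψ c))) (ψ-comb c)))
          ψφ : ∀ c → ψ (φ c) ≡ c
          ψφ = linear-identity (compose ψ-linear φ-linear) (λ c cK → indep-unique V ws-indep (comb∈K (comb∈K cK XK) YK) cK
            (trans (ψ-comb (φ c)) (sym (φ-comb c))))

        GoodBlock : Powerset Carrierᴹ → Set
        GoodBlock U = ∃[ vs ] Good vs × ⟦ Span? V vs ⟧ᴾ ≡ U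

        GoodBlock? : ∀ U → Dec (GoodBlock U)
        GoodBlock? U = ∃? (λ vs → Good? vs ×-dec (⟦ Span? V vs ⟧ᴾ ≟ U))

        span∈⁺ : ∀ {vs : Vec Carrierᴹ k} {x} → Span V vs x → x ∈ᴾ ⟦ Span? V vs ⟧ᴾ
        span∈⁺ {vs} = ∈-⟦⟧ᴾ⁺ (Span? V vs)

        span∈⁻ : ∀ {vs : Vec Carrierᴹ k} {x} → x ∈ᴾ ⟦ Span? V vs ⟧ᴾ → Span V vs x
        span∈⁻ {vs} = ∈-⟦⟧ᴾ⁻ (Span? V vs)

        goodblock-subspace : ∀ {U} → GoodBlock U → IsSubspace V (_∈ᴾ U)
        goodblock-subspace (vs , _ , refl) = let 0∈ , +∈ , ·∈ = Span-isSubspace V vs in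
          span∈⁺ 0∈ , (λ x y x∈ y∈ → span∈⁺ (+∈ x y (span∈⁻ x∈) (span∈⁻ y∈))) , λ a x aK x∈ → span∈⁺ (·∈ a x aK (span∈⁻ x∈))

        goodblock-basis : ∀ {U} → GoodBlock U → Σ[ vs ∈ Vec Carrierᴹ k ] IsBasis V (_∈ᴾ U) vs
        goodblock-basis (vs , good , refl) = vs , All.map span∈⁺ (All-Span V vs) , good-indep good , λ x → span∈⁻

        goodblock-size : ∀ {U} → GoodBlock U → count (_∈ᴾ? U) ≡ order F ^ k
        goodblock-size {U} g = basis-size V (_∈ᴾ? U) (goodblock-subspace g) (proj₂ (goodblock-basis g))

        goodblock-good : ∀ {U} → GoodBlock U → ∀ {ws} → All (_∈ᴾ U) ws → Indep V ws → Good ws × ⟦ Span? V ws ⟧ᴾ ≡ U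
        goodblock-good {U} g@(vs , good , refl) {ws} ws∈ indep = good-transfer good indep (All.map span∈⁻ ws∈) (All.map (λ {x} → spans x) (All.map span∈⁺ (All-Span V vs)))
          , Powerset-ext (λ x x∈ → Span⊆ V (goodblock-subspace g) ws∈ x (span∈⁻ x∈)) (λ x x∈ → span∈⁺ (spans x x∈))
          where
          spans : ∀ x → x ∈ᴾ U → Span V ws x
          spans = proj₂ (proj₂ (indep⇒basis V (_∈ᴾ? U) (goodblock-subspace g) ws∈ indep (goodblock-size g)))

    module _ (n : ℕ) {P : Vec Carrierᴱ (n + 2) → Set} (adm : Admissible (n + 2) P) (V : Space) where
      open Space V
      open Admissible adm

      private
        k = n + 2
        N = size {Carrierᴱ}
        X = size {Carrierᴹ}

      module _ {x y : Carrierᴹ} (xy-indep : 𝔼.Indep V (x ∷ y ∷ [])) where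

        private
          xy : Vec Carrierᴹ 2
          xy = x ∷ y ∷ []
          xy-indepF : Indep V xy
          xy-indepF c cK = xy-indep c (all-E c)

        Through? : ∀ U → Dec (GoodBlock adm V U × (x ∈ᴾ U × y ∈ᴾ U))
        Through? U = GoodBlock? adm V U ×-dec ((x ∈ᴾ? U) ×-dec (y ∈ᴾ? U))

        -- Counts the pairs of a block `U` through x and y and a tuple that completes them to an
        -- F-basis of `U`. A good tuple ending in x and y belongs to exactly one block, its span.
        count-through-tuples : fall (order F) (order F ^ k) 2 n * count Through? ≡ count (λ (vs : Vec Carrierᴹ n) → Good? adm V (vs ++ xy))
        count-through-tuples = trans (double-count Through? (λ vs → Good? adm V (vs ++ xy)) R? (fall (order F) (order F ^ k) 2 n) 1 rows cols) (ℕ.+-identityʳ _)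
          where
          R? : ∀ U (vs : Vec Carrierᴹ n) → Dec ((GoodBlock adm V U × (x ∈ᴾ U × y ∈ᴾ U)) × (All (_∈ᴾ U) vs × Indep V (vs ++ xy)))
          R? U vs = Through? U ×-dec (All.all? (_∈ᴾ? U) vs ×-dec Indep? V (vs ++ xy))
          rows : ∀ U → count (R? U) ≡ fall (order F) (order F ^ k) 2 n * ind (Through? U)
          rows U = trans (count-scale (λ (vs : Vec Carrierᴹ n) → All.all? (_∈ᴾ? U) vs ×-dec Indep? V (vs ++ xy)) (Through? U)) (trans (ℕ.*-comm (ind (Through? U)) _) (by-cases (Through? U)))
            where
            by-cases : (d : Dec (GoodBlock adm V U × (x ∈ᴾ U × y ∈ᴾ U))) →
                       count (λ (vs : Vec Carrierᴹ n) → All.all? (_∈ᴾ? U) vs ×-dec Indep? V (vs ++ xy)) * ind d ≡ fall (order F) (order F ^ k) 2 n * ind d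
            by-cases (no _) = trans (ℕ.*-zeroʳ (count (λ (vs : Vec Carrierᴹ n) → All.all? (_∈ᴾ? U) vs ×-dec Indep? V (vs ++ xy)))) (sym (ℕ.*-zeroʳ (fall (order F) (order F ^ k) 2 n)))
            by-cases (yes (g , x∈ , y∈)) = cong (_* 1) (trans (count-extensions V (_∈ᴾ? U) (goodblock-subspace adm V g) xy-indepF (x∈ ∷ y∈ ∷ []) n)
              (cong (λ Y → fall (order F) Y 2 n) (goodblock-size adm V g)))
          All-++ : ∀ {m} {Q : Carrierᴹ → Set} {vs : Vec Carrierᴹ m} → All Q vs → Q x → Q y → All Q (vs ++ xy)
          All-++ []       qx qy = qx ∷ qy ∷ []
          All-++ (q ∷ qs) qx qy = q ∷ All-++ qs qx qy
          split : ∀ {m} {Q : Carrierᴹ → Set} (vs : Vec Carrierᴹ m) → All Q (vs ++ xy) → All Q vs × (Q x × Q y)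
          split []       (qx ∷ qy ∷ []) = [] , qx , qy
          split (v ∷ vs) (q ∷ qs)       = let a , b = split vs qs in q ∷ a , b
          cols : ∀ vs → count (λ U → R? U vs) ≡ 1 * ind (Good? adm V (vs ++ xy))
          cols vs = trans (count-ind (λ U → R? U vs) (Good? adm V (vs ++ xy))
            (λ { U ((g , x∈ , y∈) , vs∈ , ind) → proj₁ (goodblock-good adm V g (All-++ vs∈ x∈ y∈) ind) })
            (λ good → let vs∈ , xy∈ = split vs (All.map (span∈⁺ adm V) (All-Span V (vs ++ xy))) in
               ⟦ Span? V (vs ++ xy) ⟧ᴾ , ((vs ++ xy , good , refl) , xy∈) , vs∈ , good-indep adm V good)
            (λ { U U′ ((g , x∈ , y∈) , vs∈ , ind) ((g′ , x∈′ , y∈′) , vs∈′ , _) →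
               trans (sym (proj₂ (goodblock-good adm V g (All-++ vs∈ x∈ y∈) ind))) (proj₂ (goodblock-good adm V g′ (All-++ vs∈′ x∈′ y∈′) ind)) }))
            (sym (ℕ.+-identityʳ _))

        private
          Free? : ∀ (vs : Vec Carrierᴹ n) → Dec (P (zeros k) × 𝔼.Indep V (vs ++ xy))
          Free? vs = decide (zeros k) ×-dec 𝔼.Indep? V (vs ++ xy)
          nonzero? : ∀ a → Dec (P a × a ≢ zeros k)
          nonzero? a = decide a ×-dec ¬? (a ≟ zeros k)
          Bound? : ∀ (vs : Vec Carrierᴹ n) → Dec (∃[ a ] (P a × a ≢ zeros k) × Relation V a (vs ++ xy))
          Bound? vs = ∃? (λ a → nonzero? a ×-dec Relation? V a (vs ++ xy))

          count-free : count Free? ≡ ind (decide (zeros k)) * fall N X 2 n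
          count-free = trans (count-scale (λ (vs : Vec Carrierᴹ n) → 𝔼.Indep? V (vs ++ xy)) (decide (zeros k))) (cong (ind (decide (zeros k)) *_) (count-indep V xy-indep n))

          -- Big spans have dimension at least 3, so a has a nonzero coordinate outside the last two.
          leading≢0 : ∀ (b : Vec Carrierᴱ n) (b′ : Vec Carrierᴱ 2) → P (b ++ b′) → b ++ b′ ≢ zeros k → b ≢ zeros n
          leading≢0 b (β ∷ β′ ∷ []) Pa a≢0 refl = [ a≢0 , (λ big → big β β′ dominated) ]′ (zero-or-big Pa)
            where
            drop : ∀ m (f : Vec Carrierᴱ (m + 2)) → AllK f → Span regular (β ∷ β′ ∷ []) (dot f (zeros m ++ β ∷ β′ ∷ []))
            drop zero    f        fK       = f , fK , refl
            drop (suc m) (f ∷ fs) (_ ∷ fK) = subst (Span regular (β ∷ β′ ∷ [])) (sym (trans (cong (_+ᴱ dot fs (zeros m ++ β ∷ β′ ∷ [])) (R.zeroʳ f)) (R.+-identityˡ _))) (drop m fs fK)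
            dominated : Dominates (β ∷ β′ ∷ []) (zeros n ++ β ∷ β′ ∷ [])
            dominated x (f , fK , refl) = drop n f fK

          -- Counts the pairs of a tuple and a nonzero relation vector of it. For a given tuple
          -- these vectors are the N - 1 nonzero multiples of any one of them, all admissible by
          -- `scale-inv`; for a given vector `count-relations` applies because its leading part is
          -- nonzero.
          count-bound : (N ∸ 1) * count Bound? ≡ count nonzero? * fall N X 2 (n ∸ 1)
          count-bound = trans (double-count Bound? nonzero? R? (N ∸ 1) (fall N X 2 (n ∸ 1)) rows cols) (ℕ.*-comm (fall N X 2 (n ∸ 1)) _)
            where
            R? : ∀ (vs : Vec Carrierᴹ n) a → Dec ((P a × a ≢ zeros k) × Relation V a (vs ++ xy))
            R? vs a = nonzero? a ×-dec Relation? V a (vs ++ xy)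
            cols : ∀ a → count (λ vs → R? vs a) ≡ fall N X 2 (n ∸ 1) * ind (nonzero? a)
            cols a = trans (count-scale (λ vs → Relation? V a (vs ++ xy)) (nonzero? a)) (trans (ℕ.*-comm (ind (nonzero? a)) _) (by-cases (nonzero? a)))
              where
              by-split : (s : Σ[ b ∈ Vec Carrierᴱ n ] Σ[ b′ ∈ Vec Carrierᴱ 2 ] a ≡ b ++ b′) → P a × a ≢ zeros k →
                         count (λ (vs : Vec Carrierᴹ n) → Relation? V a (vs ++ xy)) ≡ fall N X 2 (n ∸ 1)
              by-split (b , b′ , refl) (Pa , a≢0) = count-relations V xy-indep n b b′ (leading≢0 b b′ Pa a≢0)
              by-cases : (d : Dec (P a × a ≢ zeros k)) → count (λ (vs : Vec Carrierᴹ n) → Relation? V a (vs ++ xy)) * ind d ≡ fall N X 2 (n ∸ 1) * ind d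
              by-cases (no _)  = trans (ℕ.*-zeroʳ (count (λ (vs : Vec Carrierᴹ n) → Relation? V a (vs ++ xy)))) (sym (ℕ.*-zeroʳ (fall N X 2 (n ∸ 1))))
              by-cases (yes p) = cong (_* 1) (by-split (Vec.splitAt n a) p)
            rows : ∀ vs → count (R? vs) ≡ (N ∸ 1) * ind (Bound? vs)
            rows vs = by-cases (Bound? vs)
              where
              by-cases : (d : Dec (∃[ a ] (P a × a ≢ zeros k) × Relation V a (vs ++ xy))) → count (R? vs) ≡ (N ∸ 1) * ind d
              by-cases (no ¬b) = trans (count-none (R? vs) (λ a r → ¬b (a , r))) (sym (ℕ.*-zeroʳ (N ∸ 1)))
              by-cases (yes (a₀ , (Pa₀ , a₀≢0) , rel₀)) = trans (count-bij (R? vs) (λ (e : Carrierᴱ) → ¬? (e ≟ 0ᴱ)) (λ a e → (a ≟ scale k e a₀) ×-dec ¬? (e ≟ 0ᴱ))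
                  (λ { a e (refl , e≢0) → ((scale-inv e≢0 Pa₀ , (λ z → a₀≢0 (Eⁿ.·-cancel e≢0 z))) , relation-scale V e≢0 rel₀) , e≢0 })
                  (λ { a ((Pa , a≢0) , rel) → let e , a≡ = relation-unique V rel₀ rel in e , a≡ , λ z → a≢0 (trans a≡ (trans (cong (λ e → scale k e a₀) z) (Eⁿ.·-zeroˡ a₀))) })
                  (λ { a e e′ (refl , _) (eq , _) → scale-injective a₀≢0 eq })
                  (λ e e≢0 → scale k e a₀ , refl , e≢0) (λ { a a′ e (refl , _) (refl , _) → refl }))
                (trans (count-nonzero everything) (sym (ℕ.*-identityʳ _)))

          count-good : count (λ (vs : Vec Carrierᴹ n) → Good? adm V (vs ++ xy)) ≡ count Free? + count Bound?
          count-good = trans (count-split (λ vs → Good? adm V (vs ++ xy)) (λ (vs : Vec Carrierᴹ n) → 𝔼.Indep? V (vs ++ xy))) (cong₂ _+_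
            (count-cong (λ vs → Good? adm V (vs ++ xy) ×-dec 𝔼.Indep? V (vs ++ xy)) Free?
              (λ { vs ((a , Pa , rel) , ind) → subst P (≡0 vs ind a rel) Pa , ind })
              (λ { vs (P0 , ind) → (zeros k , P0 , indep⇒relation-zeros V ind) , ind }))
            (count-cong (λ vs → Good? adm V (vs ++ xy) ×-dec ¬? (𝔼.Indep? V (vs ++ xy))) Bound?
              (λ { vs ((a , Pa , rel) , ¬ind) → a , (Pa , λ { refl → ¬ind (relation-zeros⇒indep V rel) }) , rel })
              (λ { vs (a , (Pa , a≢0) , rel) → (a , Pa , rel) , λ ind → a≢0 (≡0 vs ind a rel) })))
            where
            ≡0 : ∀ vs → 𝔼.Indep V (vs ++ xy) → ∀ a → Relation V a (vs ++ xy) → a ≡ zeros k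
            ≡0 vs ind a (rel , _) = ind a (all-E a) rel

        count-through : (N ∸ 1) * (fall (order F) (order F ^ k) 2 n * count Through?) ≡
          (N ∸ 1) * (ind (decide (zeros k)) * fall N X 2 n) + count (λ a → decide a ×-dec ¬? (a ≟ zeros k)) * fall N X 2 (n ∸ 1)
        count-through = trans (cong ((N ∸ 1) *_) (trans count-through-tuples count-good)) (trans (ℕ.*-distribˡ-+ (N ∸ 1) (count Free?) (count Bound?))
          (cong₂ _+_ (cong ((N ∸ 1) *_) count-free) count-bound))

-- Vectors with a prescribed span

module Duality (E : FiniteField) where
  open FiniteField E
  open Spaces E
  open Blocks E
  open Subfield using (order)

  comb-columns : ∀ {k d} (b : Vec Carrierᴱ d) (X : Vec (Vec Carrierᴱ (suc k)) d) →
                 comb (regular ^ˢ suc k) b X ≡ comb regular b (Vec.map Vec.head X) ∷ comb (regular ^ˢ k) b (Vec.map Vec.tail X)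
  comb-columns []       []            = refl
  comb-columns {k} (b ∷ bs) ((x ∷ xs) ∷ X) = cong (add (suc k) (scale (suc k) b (x ∷ xs))) (comb-columns bs X)

  module _ (F : Subfield) where
    open Subfield F using (_∈K; _∈K?; 0∈K; 1∈K)
    open Over F

    dot-nondegenerate : ∀ {d} (f : Vec Carrierᴱ d) → (∀ y → AllK y → dot F f y ≡ 0ᴱ) → f ≡ zeros d
    dot-nondegenerate []       _ = refl
    dot-nondegenerate {suc d} (x ∷ f) orth = cong₂ _∷_
      (trans (sym (R.*-identityʳ x)) (trans (sym (trans (cong (x *ᴱ 1ᴱ +ᴱ_) (trans (comb-comm f (zeros d)) (comb-0 regular f))) (R.+-identityʳ _)))
        (orth (1ᴱ ∷ zeros d) (1∈K ∷ zeros∈K d))))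
      (dot-nondegenerate f (λ y yK → trans (sym (trans (cong (_+ᴱ dot F f y) (R.zeroʳ x)) (R.+-identityˡ _))) (orth (0ᴱ ∷ y) (0∈K ∷ yK))))

    -- Reads a vector over A as a matrix over F with respect to a basis b of A: the columns X satisfy a = Σ bⱼ Xⱼ.
    columns : ∀ {k d} {b : Vec Carrierᴱ d} {a : Vec Carrierᴱ k} → All (Span regular b) a →
              Σ[ X ∈ Vec (Vec Carrierᴱ k) d ] All AllK X × comb (regular ^ˢ k) b X ≡ a
    columns {d = d} [] = Vec.replicate d [] , nil d , Vec-0 _
      where
      nil : ∀ d → All (AllK {0}) (Vec.replicate d [])
      nil zero    = []
      nil (suc d) = [] ∷ nil d
      Vec-0 : (v : Vec Carrierᴱ 0) → v ≡ []
      Vec-0 [] = refl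
    columns {suc k} {b = b} ((c , cK , refl) ∷ ss) with X , XK , refl ← columns ss =
      Vec.zipWith _∷_ c X , cons∈K cK XK , trans (comb-columns b (Vec.zipWith _∷_ c X))
        (cong₂ _∷_ (trans (cong (comb regular b) (heads c X)) (comb-comm b c)) (cong (comb (regular ^ˢ k) b) (tails c X)))
      where
      cons∈K : ∀ {d} {c : Vec Carrierᴱ d} {X : Vec (Vec Carrierᴱ k) d} → AllK c → All AllK X → All AllK (Vec.zipWith _∷_ c X)
      cons∈K []       []       = []
      cons∈K (p ∷ ps) (q ∷ qs) = (p ∷ q) ∷ cons∈K ps qs
      heads : ∀ {d} (c : Vec Carrierᴱ d) (X : Vec (Vec Carrierᴱ k) d) → Vec.map Vec.head (Vec.zipWith _∷_ c X) ≡ c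
      heads []      []      = refl
      heads (c ∷ cs) (x ∷ X) = cong (c ∷_) (heads cs X)
      tails : ∀ {d} (c : Vec Carrierᴱ d) (X : Vec (Vec Carrierᴱ k) d) → Vec.map Vec.tail (Vec.zipWith _∷_ c X) ≡ X
      tails []      []      = refl
      tails (c ∷ cs) (x ∷ X) = cong (x ∷_) (tails cs X)

    columns-unique : ∀ {k d} {b : Vec Carrierᴱ d} → Indep regular b → (X Y : Vec (Vec Carrierᴱ k) d) → All AllK X → All AllK Y →
                     comb (regular ^ˢ k) b X ≡ comb (regular ^ˢ k) b Y → X ≡ Y
    columns-unique {zero} ind X Y _ _ _ = trans (empty X) (sym (empty Y))
      where
      empty : ∀ {d} (X : Vec (Vec Carrierᴱ 0) d) → X ≡ Vec.replicate d []
      empty []       = refl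
      empty ([] ∷ X) = cong ([] ∷_) (empty X)
    columns-unique {suc k} {b = b} ind X Y XK YK eq = trans (sym (recombine X)) (trans (cong₂ (Vec.zipWith _∷_) heads≡ tails≡) (recombine Y))
      where
      recombine : ∀ {d} (X : Vec (Vec Carrierᴱ (suc k)) d) → Vec.zipWith _∷_ (Vec.map Vec.head X) (Vec.map Vec.tail X) ≡ X
      recombine []            = refl
      recombine ((x ∷ xs) ∷ X) = cong ((x ∷ xs) ∷_) (recombine X)
      head∈K : ∀ {d} {X : Vec (Vec Carrierᴱ (suc k)) d} → All AllK X → AllK (Vec.map Vec.head X)
      head∈K []             = []
      head∈K ((p ∷ _) ∷ ps) = p ∷ head∈K ps
      tail∈K : ∀ {d} {X : Vec (Vec Carrierᴱ (suc k)) d} → All AllK X → All AllK (Vec.map Vec.tail X)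
      tail∈K []             = []
      tail∈K ((_ ∷ p) ∷ ps) = p ∷ tail∈K ps
      eq′ = trans (sym (comb-columns b X)) (trans eq (comb-columns b Y))
      heads≡ : Vec.map Vec.head X ≡ Vec.map Vec.head Y
      heads≡ = indep-unique regular ind (head∈K XK) (head∈K YK) (trans (comb-comm (Vec.map Vec.head X) b) (trans (cong Vec.head eq′) (comb-comm b (Vec.map Vec.head Y))))
      tails≡ : Vec.map Vec.tail X ≡ Vec.map Vec.tail Y
      tails≡ = columns-unique ind (Vec.map Vec.tail X) (Vec.map Vec.tail Y) (tail∈K XK) (tail∈K YK) (cong Vec.tail eq′)

    module _ {k d : ℕ} (X : Vec (Vec Carrierᴱ k) d) where

      rowAction : Vec Carrierᴱ k → Vec Carrierᴱ d
      rowAction g = Vec.map (dot F g) X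

      dot-rowAction : ∀ f g → dot F f (rowAction g) ≡ dot F g (comb (regular ^ˢ k) f X)
      dot-rowAction f g = comb-map {regular ^ˢ k} {regular} (comb-linearʳ regular g) f X

      rowAction-+ : ∀ g h → rowAction (add k g h) ≡ add d (rowAction g) (rowAction h)
      rowAction-+ g h = go X
        where
        go : ∀ {d} (X : Vec (Vec Carrierᴱ k) d) → Vec.map (dot F (add k g h)) X ≡ add d (Vec.map (dot F g) X) (Vec.map (dot F h) X)
        go []      = refl
        go (x ∷ X) = cong₂ _∷_ (Linear.+-homo (comb-linear regular x) g h) (go X)

      rowAction-· : ∀ a g → rowAction (scale k a g) ≡ scale d a (rowAction g)
      rowAction-· a g = go X
        where
        go : ∀ {d} (X : Vec (Vec Carrierᴱ k) d) → Vec.map (dot F (scale k a g)) X ≡ scale d a (Vec.map (dot F g) X)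
        go []      = refl
        go (x ∷ X) = cong₂ _∷_ (Linear.·-homo (comb-linear regular x) a g) (go X)

      rowAction∈K : All AllK X → ∀ {g} → AllK g → AllK (rowAction g)
      rowAction∈K XK {g} gK = go XK
        where
        go : ∀ {d} {X : Vec (Vec Carrierᴱ k) d} → All AllK X → AllK (Vec.map (dot F g) X)
        go []       = []
        go (p ∷ ps) = dot∈K F gK p ∷ go ps

      -- Row rank equals column rank: if the columns are independent, the rows span, since otherwise
      -- there are too few independent rows for f ↦ (f · row) to be injective.
      opaque
        rows-span : All AllK X → Indep (regular ^ˢ k) X → ∀ y → AllK y → ∃[ g ] AllK g × rowAction g ≡ y
        rows-span XK indep = given (basis (regular ^ˢ d) Row? Row-sub)
          where
          Row : Vec Carrierᴱ d → Set
          Row y = ∃[ g ] AllK g × rowAction g ≡ y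
          Row? : ∀ y → Dec (Row y)
          Row? y = ∃? (λ g → allK? g ×-dec (rowAction g ≟ y))
          Row-sub : IsSubspace (regular ^ˢ d) Row
          Row-sub = (zeros k , zeros∈K k , trans (cong rowAction (sym (Space.·-zeroˡ (regular ^ˢ k) (zeros k)))) (trans (rowAction-· 0ᴱ (zeros k)) (Space.·-zeroˡ (regular ^ˢ d) _)))
            , (λ { _ _ (g , gK , refl) (h , hK , refl) → add k g h , add∈K gK hK , rowAction-+ g h })
            , (λ { a _ aK (g , gK , refl) → scale k a g , scale∈K aK gK , rowAction-· a g })
          Row⊆ : ∀ y → Row y → AllK y
          Row⊆ _ (g , gK , refl) = rowAction∈K XK gK
          given : ∃[ j ] Σ[ rs ∈ Vec (Vec Carrierᴱ d) j ] IsBasis (regular ^ˢ d) Row rs → ∀ y → AllK y → Row y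
          given (j , rs , Row-basis) = count-⊇ Row? allK? Row⊆
            (ℕ.≤-trans (count-inj allK? allK? pairing pairing∈K pairing-injective)
              (ℕ.≤-reflexive (trans (count-All _∈K? j) (sym (basis-size (regular ^ˢ d) Row? Row-sub Row-basis)))))
            where
            pairing : Vec Carrierᴱ d → Vec Carrierᴱ j
            pairing f = Vec.map (dot F f) rs
            pairing∈K : ∀ f → AllK f → AllK (pairing f)
            pairing∈K f fK = go (proj₁ Row-basis)
              where
              go : ∀ {j} {rs : Vec (Vec Carrierᴱ d) j} → All Row rs → AllK (Vec.map (dot F f) rs)
              go []                 = []
              go {rs = r ∷ _} (p ∷ ps) = dot∈K F fK (Row⊆ r p) ∷ go ps
            same-dot : ∀ f f′ → pairing f ≡ pairing f′ → ∀ y → Row y → dot F f y ≡ dot F f′ y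
            same-dot f f′ eq y row with c , _ , refl ← proj₂ (proj₂ Row-basis) y row = trans (sym (via f)) (trans (cong (comb regular c) eq) (via f′))
              where
              via : ∀ f → comb regular c (pairing f) ≡ dot F f (comb (regular ^ˢ d) c rs)
              via f = comb-map {regular ^ˢ d} {regular} (comb-linearʳ regular f) c rs
            pairing-injective : ∀ f f′ → AllK f → AllK f′ → pairing f ≡ pairing f′ → f ≡ f′
            pairing-injective f f′ fK f′K eq = indep-unique (regular ^ˢ k) indep fK f′K (V.AP.x∙y⁻¹≈ε⇒x≈y _ _ (dot-nondegenerate _ λ g gK → begin
                dot F (u V.+ᴹ V.-ᴹ u′) g                     ≡⟨ comb-comm _ g ⟩
                dot F g (u V.+ᴹ V.-ᴹ u′)                     ≡⟨ Linear.+-homo (comb-linearʳ regular g) u (V.-ᴹ u′) ⟩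
                dot F g u +ᴱ dot F g (V.-ᴹ u′)               ≡⟨ cong (λ z → dot F g u +ᴱ dot F g z) (sym (V.-1·≡- u′)) ⟩
                dot F g u +ᴱ dot F g (scale k (-ᴱ 1ᴱ) u′)    ≡⟨ cong (dot F g u +ᴱ_) (trans (Linear.·-homo (comb-linearʳ regular g) (-ᴱ 1ᴱ) u′) (RP.-1*x≈-x _)) ⟩
                dot F g u +ᴱ -ᴱ dot F g u′                   ≡⟨ cong (_+ᴱ -ᴱ dot F g u′) (trans (sym (dot-rowAction f g)) (trans (same-dot f f′ eq _ (g , gK , refl)) (dot-rowAction f′ g))) ⟩
                dot F g u′ +ᴱ -ᴱ dot F g u′                  ≡⟨ R.-‿inverseʳ _ ⟩
                0ᴱ                                           ∎))
              where
              open ≡-Reasoning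
              module V = Space (regular ^ˢ k)
              u u′ : Vec Carrierᴱ k
              u  = comb (regular ^ˢ k) f X
              u′ = comb (regular ^ˢ k) f′ X

    SpanSet : ∀ {k} → Vec Carrierᴱ k → Powerset Carrierᴱ
    SpanSet a = ⟦ Span? regular a ⟧ᴾ

    -- In a basis of `A` over F a vector with coordinates in `A` is a matrix with k rows and d
    -- columns over F. Its coordinates correspond to the rows, so they span `A` exactly when the
    -- rows span F^d, that is, when the d columns are independent.
    count-spanning : ∀ k d A → SubspaceOfSize regular (order F ^ d) A →
                     count (λ (a : Vec Carrierᴱ k) → SpanSet a ≟ A) ≡ fall (order F) (order F ^ k) 0 d
    count-spanning k d A (sub , size-A) = given (basis-of-size regular (_∈ᴾ? A) sub d size-A)
      where
      given : Σ[ b ∈ Vec Carrierᴱ d ] IsBasis regular (_∈ᴾ A) b → count (λ (a : Vec Carrierᴱ k) → SpanSet a ≟ A) ≡ fall (order F) (order F ^ k) 0 d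
      given (b , b∈ , b-indep , b-spans) = trans
        (count-bij (λ a → SpanSet a ≟ A) Mat? (λ a X → Mat? X ×-dec (comb (regular ^ˢ k) b X ≟ a))
          (λ { a X ((XK , ind) , refl) → spans X XK ind , XK , ind })
          (λ a span≡A → let X , XK , eq = columns (All.map (λ {x} s → b-spans x (subst (x ∈ᴾ_) span≡A (∈-⟦⟧ᴾ⁺ (Span? regular a) s))) (All-Span regular a)) in
             X , (XK , independent X XK (trans (cong SpanSet eq) span≡A)) , eq)
          (λ { a X Y ((XK , _) , refl) ((YK , _) , eq) → columns-unique b-indep X Y XK YK (sym eq) })
          (λ X m → comb (regular ^ˢ k) b X , m , refl)
          (λ { a a′ X (_ , refl) (_ , refl) → refl }))
        (trans (count-independent (regular ^ˢ k) allK? (zeros∈K k , (λ _ _ → add∈K) , λ _ _ → scale∈K) d) (cong (λ Y → fall (order F) Y 0 d) (count-All _∈K? k)))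
        where
        Mat? : ∀ (X : Vec (Vec Carrierᴱ k) d) → Dec (All AllK X × Indep (regular ^ˢ k) X)
        Mat? X = All.all? allK? X ×-dec Indep? (regular ^ˢ k) X
        dot-columns : ∀ X g → dot F g (comb (regular ^ˢ k) b X) ≡ comb regular (rowAction X g) b
        dot-columns X g = trans (sym (dot-rowAction X b g)) (comb-comm b (rowAction X g))
        spans : ∀ X → All AllK X → Indep (regular ^ˢ k) X → SpanSet (comb (regular ^ˢ k) b X) ≡ A
        spans X XK ind = Powerset-ext
          (λ x x∈ → into x (∈-⟦⟧ᴾ⁻ (Span? regular (comb (regular ^ˢ k) b X)) x∈))
          (λ x x∈ → ∈-⟦⟧ᴾ⁺ (Span? regular (comb (regular ^ˢ k) b X)) (onto x (b-spans x x∈)))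
          where
          into : ∀ x → Span regular (comb (regular ^ˢ k) b X) x → x ∈ᴾ A
          into x (g , gK , refl) = subst (_∈ᴾ A) (sym (dot-columns X g)) (comb∈ regular sub (rowAction∈K X XK gK) b∈)
          onto : ∀ x → Span regular b x → Span regular (comb (regular ^ˢ k) b X) x
          onto x (y , yK , refl) with g , gK , refl ← rows-span X XK ind y yK = g , gK , dot-columns X g
        -- When the coordinates span `A`, every vector of F^d is a combination of the rows. A
        -- relation `f` between the columns is orthogonal to all of these and hence zero.
        independent : ∀ X → All AllK X → SpanSet (comb (regular ^ˢ k) b X) ≡ A → Indep (regular ^ˢ k) X
        independent X XK span≡A f fK eq = dot-nondegenerate f λ y yK →
          let g , gK , g≡ = ∈-⟦⟧ᴾ⁻ (Span? regular (comb (regular ^ˢ k) b X)) (subst (comb regular y b ∈ᴾ_) (sym span≡A) (comb∈ regular sub yK b∈))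
              row≡y = indep-unique regular b-indep (rowAction∈K X XK gK) yK (trans (sym (dot-columns X g)) g≡)
          in trans (cong (dot F f) (sym row≡y)) (trans (dot-rowAction X f g) (trans (cong (dot F g) eq) (trans (comb-comm g (zeros k)) (comb-0 regular g))))

-- Selection of orbits

∑-cong-All : ∀ {xs} {f g : ℕ → ℚ} → Allᴸ (λ x → f x ≡ g x) xs → ∑ xs f ≡ ∑ xs g
∑-cong-All []ᴬ       = refl
∑-cong-All (p ∷ᴬ ps) = cong₂ ℚ._+_ p (∑-cong-All ps)

range-unique : ∀ a b → Unique (range a b)
range-unique a b = Unique.applyUpTo⁺₁ (a +_) (suc b ∸ a) (λ i<j _ eq → ℕ.<⇒≢ i<j (ℕ.+-cancelˡ-≡ a _ _ eq))

divisors-unique : ∀ n → Unique (divisors n)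
divisors-unique n = Unique.filter⁺ (_∣? n) (range-unique 1 n)

range-bounds : ∀ a b → Allᴸ (λ x → a ≤ x × x ≤ b) (range a b)
range-bounds a b = Allᴸ.applyUpTo⁺₁ (a +_) (suc b ∸ a) (λ {i} i< → ℕ.m≤m+n a i ,
  ℕ.s≤s⁻¹ (subst (_≤ suc b) (ℕ.+-suc a i) (ℕ.≤-trans (ℕ.+-monoʳ-≤ a i<) (ℕ.≤-reflexive (ℕ.m+[n∸m]≡n (ℕ.<⇒≤ (ℕ.m∸n≢0⇒n<m {suc b} {a} λ z → ℕ.<⇒≢ (ℕ.≤-<-trans z≤n i<) (sym z))))))))

divisors-divide : ∀ n → Allᴸ (_∣ n) (divisors n)
divisors-divide n = Allᴸ.all-filter (_∣? n) (range 1 n)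

module _ {D : ℕ → Set} (D? : ∀ x → Dec (D x)) (disjoint : ∀ {x y} → D x → D y → x ≡ y) where

  -- `disjoint` and the absence of repetitions in `xs` make at most one summand nonzero. This turns
  -- membership in a union of selections into a sum over r and u.
  ind-Any : ∀ {xs} → Unique xs → (d : Dec (Any D xs)) → fromℕ (ind d) ≡ ∑ xs (λ x → fromℕ (ind (D? x)))
  ind-Any []ᵁ d = cong fromℕ (ind-no d (λ ()))
  ind-Any {x ∷ xs} (x∉ ∷ᵁ uniq) d = by-cases (D? x)
    where
    by-cases : (e : Dec (D x)) → fromℕ (ind d) ≡ fromℕ (ind e) ℚ.+ ∑ xs (λ x → fromℕ (ind (D? x)))
    by-cases (yes p) = trans (cong fromℕ (ind-yes d (here p))) (trans (sym (ℚ.+-identityʳ 1ℚ))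
      (cong (1ℚ ℚ.+_) (trans (cong fromℕ (sym (ind-no (any? D? xs) (λ a → Allᴸ.lookupAny x∉ a .proj₁ (disjoint p (Allᴸ.lookupAny x∉ a .proj₂)))))) (ind-Any uniq (any? D? xs)))))
    by-cases (no ¬p) = trans (cong fromℕ (ind-cong d (any? D? xs) (λ { (here p) → contradiction p ¬p ; (there a) → a }) there))
      (trans (ind-Any uniq (any? D? xs)) (sym (ℚ.+-identityˡ _)))

module Families (E : FiniteField) where
  open FiniteField E
  open Spaces E
  open FieldTheory E
  open Orbits E
  open Blocks E
  open Duality E
  open Subfields E using (Stabilises?)
  open Subfield using (order)

  -- By number, chosen r u consists of w r u orbits of the Singer cycle.
  record Family (F : Subfield) (k l : ℕ) (w : ℕ → ℕ → ℕ) : Set where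
    no-eta-equality
    private q = order F
    field
      chosen    : ℕ → ℕ → Powerset (Powerset Carrierᴱ)
      type      : ∀ r u W → W ∈ᴾ chosen r u → HasType F (q ^ suc r) (q ^ u) W
      bounds    : ∀ r u W → W ∈ᴾ chosen r u → 2 ≤ r
      invariant : ∀ r u a W → a ≢ 0ᴱ → W ∈ᴾ chosen r u → dilate a W ∈ᴾ chosen r u
      number    : ∀ r u → 2 ≤ r → r ≤ k ∸ 1 → u ∣ gcd (suc r) l → (q ^ u ∸ 1) * count (_∈ᴾ? chosen r u) ≡ w r u * (size {Carrierᴱ} ∸ 1)

  family : (F : Subfield) (p e l k : ℕ) → Prime p → 1 ≤ l → order F ≡ p ^ e → size {Carrierᴱ} ≡ (p ^ e) ^ l →
           3 ≤ k → k ≤ l → (w : ℕ → ℕ → ℕ) →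
           (∀ r u → 2 ≤ r → r ≤ k ∸ 1 → u ∣ gcd (suc r) l → fromℕ (w r u) ℚ.≤ n[ p ^ e , l , suc r , u ]) → Family F k l w
  family F p e l k pr 1≤l order-F size-E 3≤k k≤l w bound = record
    { chosen = λ r u → pick r u (valid? r u)
    ; type = λ r u W → pick-type r u W (valid? r u)
    ; bounds = λ r u W → pick-bounds r u W (valid? r u)
    ; invariant = λ r u a W → pick-invariant r u a W (valid? r u)
    ; number = λ r u 2≤r r≤ u∣ → pick-number r u (valid? r u) (2≤r , r≤ , u∣) }
    where
    open TypeCount F p e l pr 1≤l order-F size-E
    q = order F
    Valid : ℕ → ℕ → Set
    Valid r u = 2 ≤ r × r ≤ k ∸ 1 × u ∣ gcd (suc r) l
    valid? : ∀ r u → Dec (Valid r u)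
    valid? r u = (2 ℕ.≤? r) ×-dec ((r ℕ.≤? k ∸ 1) ×-dec (u ∣? gcd (suc r) l))
    selection : ∀ r u → Valid r u → Selection F (q ^ suc r) (q ^ u) (w r u)
    selection r u (2≤r , r≤ , u∣) = select F (w r u) (subst (λ q → w r u * (size {Carrierᴱ} ∸ 1) ≤ (q ^ u ∸ 1) * count (HasType? F (q ^ suc r) (q ^ u))) (sym order-F)
      (bounded {suc r} (s≤s z≤n) (ℕ.≤-trans (ℕ.≤-trans (s≤s r≤) (ℕ.≤-reflexive (ℕ.m+[n∸m]≡n (ℕ.≤-trans (s≤s z≤n) 3≤k)))) k≤l) {u} {w r u} u∣ (bound r u 2≤r r≤ u∣)))
    none? : (W : Powerset Carrierᴱ) → Dec ⊥
    none? _ = no id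
    pick : ∀ r u → Dec (Valid r u) → Powerset (Powerset Carrierᴱ)
    pick r u (yes v) = Selection.chosen (selection r u v)
    -- Outside the range of the parameters nothing is chosen, which makes `chosen` a total function
    -- of r and u.
    pick r u (no _)  = ⟦ none? ⟧ᴾ
    pick-type : ∀ r u W d → W ∈ᴾ pick r u d → HasType F (q ^ suc r) (q ^ u) W
    pick-type r u W (yes v) = Selection.type (selection r u v) W
    pick-type r u W (no _)  = ⊥-elim ∘ ∈-⟦⟧ᴾ⁻ none?
    pick-bounds : ∀ r u W d → W ∈ᴾ pick r u d → 2 ≤ r
    pick-bounds r u W (yes (2≤r , _)) _ = 2≤r
    pick-bounds r u W (no _)            = ⊥-elim ∘ ∈-⟦⟧ᴾ⁻ none?
    pick-invariant : ∀ r u a W d → a ≢ 0ᴱ → W ∈ᴾ pick r u d → dilate a W ∈ᴾ pick r u d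
    pick-invariant r u a W (yes v) a≢0 = Selection.invariant (selection r u v) a W a≢0
    pick-invariant r u a W (no _)  _   = ⊥-elim ∘ ∈-⟦⟧ᴾ⁻ none?
    pick-number : ∀ r u d → Valid r u → (q ^ u ∸ 1) * count (_∈ᴾ? pick r u d) ≡ w r u * (size {Carrierᴱ} ∸ 1)
    pick-number r u (yes v) _ = Selection.number (selection r u v)
    pick-number r u (no ¬v) v = contradiction v ¬v

  module _ {F : Subfield} {k l : ℕ} {w : ℕ → ℕ → ℕ} (ε : ℕ) (fam : Family F k l w) where
    open Family fam
    open Over F
    private
      q = order F
      1<q = Subfield.1<order F
      us : ℕ → List ℕ
      us r = divisors (gcd (suc r) l)
      rs : List ℕ
      rs = range 2 (k ∸ 1)

    Chosenᵣ : ℕ → Powerset Carrierᴱ → Set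
    Chosenᵣ r A = Any (λ u → A ∈ᴾ chosen r u) (us r)

    Chosenᵣ? : ∀ r A → Dec (Chosenᵣ r A)
    Chosenᵣ? r A = any? (λ u → A ∈ᴾ? chosen r u) (us r)

    Chosen : Powerset Carrierᴱ → Set
    Chosen A = Any (λ r → Chosenᵣ r A) rs

    Chosen? : ∀ A → Dec (Chosen A)
    Chosen? A = any? (λ r → Chosenᵣ? r A) rs

    chosenᵣ-member : ∀ {r A} → Chosenᵣ r A → ∃[ u ] A ∈ᴾ chosen r u
    chosenᵣ-member a = Any.satisfied a

    chosen-size : ∀ {A} → Chosen A → ∃[ r ] 2 ≤ r × count (_∈ᴾ? A) ≡ q ^ suc r
    chosen-size {A} a with r , b ← Any.satisfied a with u , A∈ ← chosenᵣ-member b =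
      r , bounds r u A A∈ , proj₂ (proj₁ (type r u A A∈))

    chosen-dilate : ∀ {a A} → a ≢ 0ᴱ → Chosen A → Chosen (dilate a A)
    chosen-dilate {a} {A} a≢0 = Any.map (λ {r} → Any.map (λ {u} → invariant r u a A a≢0))

    -- The relation vectors of the blocks of dimension k: the orbits are chosen through the spans of
    -- their coordinates, and ε = 1 adds the zero vector, that is, the tuples independent over E.
    Coefficients : Vec Carrierᴱ k → Set
    Coefficients a = (ε ≡ 1 × a ≡ zeros k) ⊎ Chosen (SpanSet F a)

    span-scale : ∀ {n} e (a : Vec Carrierᴱ n) → SpanSet F (scale n e a) ≡ dilate e (SpanSet F a)
    span-scale {n} e a = Powerset-ext
      (λ x x∈ → to x (∈-⟦⟧ᴾ⁻ (Span? regular (scale n e a)) x∈))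
      (λ x x∈ → ∈-⟦⟧ᴾ⁺ (Span? regular (scale n e a)) (from x (dilate⁻ x∈)))
      where
      dot-scale : ∀ c → dot F c (scale n e a) ≡ e *ᴱ dot F c a
      dot-scale c = Linear.·-homo (comb-linearʳ regular c) e a
      to : ∀ x → Span regular (scale n e a) x → x ∈ᴾ dilate e (SpanSet F a)
      to x (c , cK , refl) = subst (_∈ᴾ dilate e (SpanSet F a)) (sym (dot-scale c)) (dilate⁺ (∈-⟦⟧ᴾ⁺ (Span? regular a) (c , cK , refl)))
      from : ∀ x → ∃[ y ] y ∈ᴾ SpanSet F a × e *ᴱ y ≡ x → Span regular (scale n e a) x
      from x (y , y∈ , refl) with c , cK , refl ← ∈-⟦⟧ᴾ⁻ (Span? regular a) y∈ = c , cK , dot-scale c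

    dominates-ext : ∀ {m n} {a : Vec Carrierᴱ m} {b : Vec Carrierᴱ n} → Dominates F a b → Dominates F b a → SpanSet F a ≡ SpanSet F b
    dominates-ext {a = a} {b} ab ba = Powerset-ext (λ x x∈ → ∈-⟦⟧ᴾ⁺ (Span? regular b) (ba x (∈-⟦⟧ᴾ⁻ (Span? regular a) x∈)))
                                           (λ x x∈ → ∈-⟦⟧ᴾ⁺ (Span? regular a) (ab x (∈-⟦⟧ᴾ⁻ (Span? regular b) x∈)))

    -- A chosen subspace has q^(r + 1) elements with r ≥ 2, more than the q^2 that two generators
    -- can reach.
    chosen-big : ∀ {n} {a : Vec Carrierᴱ n} → Chosen (SpanSet F a) → ∀ α β → ¬ Dominates F (α ∷ β ∷ []) a
    chosen-big {a = a} c α β dom with chosen-size c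
    ... | r , 2≤r , size≡ = ℕ.<⇒≱ (ℕ.^-monoʳ-< q 1<q (s≤s 2≤r)) (begin
      q ^ suc r                                   ≡⟨ sym size≡ ⟩
      count (_∈ᴾ? SpanSet F a)                    ≤⟨ count-mono (_∈ᴾ? SpanSet F a) (Span? regular (α ∷ β ∷ [])) (λ x x∈ → dom x (∈-⟦⟧ᴾ⁻ (Span? regular a) x∈)) ⟩
      count (Span? regular (α ∷ β ∷ []))          ≤⟨ count-Span-≤ regular (α ∷ β ∷ []) ⟩
      q ^ 2                                       ∎)
      where open ℕ.≤-Reasoning

    dominated-by-zeros : ∀ {m n} {a : Vec Carrierᴱ n} → Dominates F (zeros m) a → a ≡ zeros n
    dominated-by-zeros {m} {a = a} dom = go (All.map (λ {x} s → zero-span (dom x s)) (All-Span regular a))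
      where
      zero-span : ∀ {x} → Span regular (zeros m) x → x ≡ 0ᴱ
      zero-span (c , _ , refl) = trans (comb-comm c (zeros m)) (comb-0 regular c)
      go : ∀ {n} {a : Vec Carrierᴱ n} → All (_≡ 0ᴱ) a → a ≡ zeros n
      go []          = refl
      go (refl ∷ ps) = cong (0ᴱ ∷_) (go ps)

    chosen-nonzero : ∀ {n} {a : Vec Carrierᴱ n} → Chosen (SpanSet F a) → a ≢ zeros n
    chosen-nonzero {n} c refl = chosen-big c 0ᴱ 0ᴱ (λ { x (f , fK , refl) → 0ᴱ ∷ 0ᴱ ∷ [] , Subfield.0∈K F ∷ Subfield.0∈K F ∷ [] ,
      trans (comb-0 regular (0ᴱ ∷ 0ᴱ ∷ [])) (sym (trans (comb-comm f (zeros n)) (comb-0 regular f))) })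

    admissible : Admissible F k Coefficients
    admissible = record
      { decide = λ a → ((ε ℕ.≟ 1) ×-dec (a ≟ zeros k)) ⊎-dec Chosen? (SpanSet F a)
      ; scale-inv = λ {a} {e} e≢0 → Sum.map (λ { (ε≡1 , refl) → ε≡1 , Space.·-zeroʳ (regular ^ˢ k) e }) (subst Chosen (sym (span-scale e a)) ∘ chosen-dilate e≢0)
      ; span-inv = λ ab ba → Sum.map (λ { (ε≡1 , refl) → ε≡1 , dominated-by-zeros ab }) (subst Chosen (dominates-ext ab ba))
      ; zero-or-big = Sum.map proj₂ chosen-big }

    open Admissible admissible using (decide)

    ind-zeros : ε ≡ 0 ⊎ ε ≡ 1 → ind (decide (zeros k)) ≡ ε
    ind-zeros (inj₁ refl) = ind-no (decide (zeros k)) [ (λ { (() , _) }) , (λ c → chosen-nonzero c refl) ]′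
    ind-zeros (inj₂ refl) = ind-yes (decide (zeros k)) (inj₁ (refl , refl))

    count-chosen-span : ∀ r u → count (λ (a : Vec Carrierᴱ k) → SpanSet F a ∈ᴾ? chosen r u) ≡ count (_∈ᴾ? chosen r u) * fall q (q ^ k) 0 (suc r)
    count-chosen-span r u = trans (sym (ℕ.*-identityˡ _)) (trans
      (double-count (λ (a : Vec Carrierᴱ k) → SpanSet F a ∈ᴾ? chosen r u) (_∈ᴾ? chosen r u) (λ a A → (A ∈ᴾ? chosen r u) ×-dec (SpanSet F a ≟ A)) 1 (fall q (q ^ k) 0 (suc r))
        (λ a → trans (count-ind (λ A → (A ∈ᴾ? chosen r u) ×-dec (SpanSet F a ≟ A)) (SpanSet F a ∈ᴾ? chosen r u)
            (λ { A (A∈ , eq) → subst (_∈ᴾ chosen r u) (sym eq) A∈ }) (λ S∈ → SpanSet F a , S∈ , refl) (λ { A A′ (_ , eq) (_ , eq′) → trans (sym eq) eq′ }))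
          (sym (ℕ.*-identityˡ _)))
        (λ A → trans (count-scale (λ (a : Vec Carrierᴱ k) → SpanSet F a ≟ A) (A ∈ᴾ? chosen r u)) (trans (ℕ.*-comm (ind (A ∈ᴾ? chosen r u)) _) (cols A (A ∈ᴾ? chosen r u)))))
      (ℕ.*-comm (fall q (q ^ k) 0 (suc r)) _))
      where
      cols : ∀ A → (d : Dec (A ∈ᴾ chosen r u)) → count (λ (a : Vec Carrierᴱ k) → SpanSet F a ≟ A) * ind d ≡ fall q (q ^ k) 0 (suc r) * ind d
      cols A (no _)   = trans (ℕ.*-zeroʳ (count (λ (a : Vec Carrierᴱ k) → SpanSet F a ≟ A))) (sym (ℕ.*-zeroʳ (fall q (q ^ k) 0 (suc r))))
      cols A (yes A∈) = cong (_* 1) (count-spanning F k (suc r) A (proj₁ (type r u A A∈)))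

    count-coefficients : fromℕ (count (λ a → decide a ×-dec ¬? (a ≟ zeros k))) ≡
                         ∑ rs (λ r → ∑ (us r) (λ u → fromℕ (count (_∈ᴾ? chosen r u) * fall q (q ^ k) 0 (suc r))))
    count-coefficients = begin
      fromℕ (count (λ a → decide a ×-dec ¬? (a ≟ zeros k)))
        ≡⟨ cong fromℕ (count-cong (λ a → decide a ×-dec ¬? (a ≟ zeros k)) (λ a → Chosen? (SpanSet F a))
             (λ { a (inj₁ (_ , a≡0) , a≢0) → contradiction a≡0 a≢0 ; a (inj₂ c , _) → c }) (λ a c → inj₂ c , chosen-nonzero c)) ⟩
      fromℕ (count (λ (a : Vec Carrierᴱ k) → Chosen? (SpanSet F a)))
        ≡⟨ fromℕ-total (λ (a : Vec Carrierᴱ k) → ind (Chosen? (SpanSet F a))) ⟩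
      Σℚ.total (λ (a : Vec Carrierᴱ k) → fromℕ (ind (Chosen? (SpanSet F a))))
        ≡⟨ Σℚ.total-cong (λ a → expand (SpanSet F a)) ⟩
      Σℚ.total (λ (a : Vec Carrierᴱ k) → ∑ rs (λ r → ∑ (us r) (λ u → fromℕ (ind (SpanSet F a ∈ᴾ? chosen r u)))))
        ≡⟨ sym (∑-total rs (λ r (a : Vec Carrierᴱ k) → ∑ (us r) (λ u → fromℕ (ind (SpanSet F a ∈ᴾ? chosen r u))))) ⟩
      ∑ rs (λ r → Σℚ.total (λ (a : Vec Carrierᴱ k) → ∑ (us r) (λ u → fromℕ (ind (SpanSet F a ∈ᴾ? chosen r u)))))
        ≡⟨ ∑-cong rs (λ r → sym (∑-total (us r) (λ u (a : Vec Carrierᴱ k) → fromℕ (ind (SpanSet F a ∈ᴾ? chosen r u))))) ⟩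
      ∑ rs (λ r → ∑ (us r) (λ u → Σℚ.total (λ (a : Vec Carrierᴱ k) → fromℕ (ind (SpanSet F a ∈ᴾ? chosen r u)))))
        ≡⟨ ∑-cong rs (λ r → ∑-cong (us r) (λ u → trans (sym (fromℕ-total (λ (a : Vec Carrierᴱ k) → ind (SpanSet F a ∈ᴾ? chosen r u)))) (cong fromℕ (count-chosen-span r u)))) ⟩
      ∑ rs (λ r → ∑ (us r) (λ u → fromℕ (count (_∈ᴾ? chosen r u) * fall q (q ^ k) 0 (suc r)))) ∎
      where
      open ≡-Reasoning
      -- The size of a subspace determines r and the size of its stabiliser determines u, so the
      -- selections for different pairs are disjoint.
      same-r : ∀ {A r r′} → Chosenᵣ r A → Chosenᵣ r′ A → r ≡ r′
      same-r {A} {r} {r′} c c′ = let u , A∈ = chosenᵣ-member c ; u′ , A∈′ = chosenᵣ-member c′ in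
        ℕ.suc-injective (^-injectiveʳ 1<q (trans (sym (proj₂ (proj₁ (type r u A A∈)))) (proj₂ (proj₁ (type r′ u′ A A∈′)))))
      same-u : ∀ {A r u u′} → A ∈ᴾ chosen r u → A ∈ᴾ chosen r u′ → u ≡ u′
      same-u {A} {r} {u} {u′} A∈ A∈′ = ^-injectiveʳ 1<q (trans (sym (proj₂ (type r u A A∈))) (proj₂ (type r u′ A A∈′)))
      expand : ∀ A → fromℕ (ind (Chosen? A)) ≡ ∑ rs (λ r → ∑ (us r) (λ u → fromℕ (ind (A ∈ᴾ? chosen r u))))
      expand A = trans (ind-Any (λ r → Chosenᵣ? r A) same-r (range-unique 2 (k ∸ 1)) (Chosen? A))
        (∑-cong rs (λ r → ind-Any (λ u → A ∈ᴾ? chosen r u) same-u (divisors-unique (gcd (suc r) l)) (Chosenᵣ? r A)))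

-- The value of λ

prod-+ : ∀ (f : ℕ → ℕ) a b → prod f (a + b) ≡ prod f a * prod (λ j → f (a + j)) b
prod-+ f a zero    = trans (cong (prod f) (ℕ.+-identityʳ a)) (sym (ℕ.*-identityʳ _))
prod-+ f a (suc b) = trans (cong (prod f) (ℕ.+-suc a b)) (trans (cong (_* f (a + b)) (prod-+ f a b)) (ℕ.*-assoc (prod f a) _ _))

∏-applyUpTo : ∀ (g : ℕ → ℚ) (h f f′ : ℕ → ℕ) n → (∀ j → j < n → g (h j) ℚ.* fromℕ (f j) ≡ fromℕ (f′ j)) →
              ∏ (applyUpTo h n) g ℚ.* fromℕ (prod f n) ≡ fromℕ (prod f′ n)
∏-applyUpTo g h f f′ zero    eq = refl
∏-applyUpTo g h f f′ (suc n) eq = begin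
  (g (h 0) ℚ.* rest) ℚ.* fromℕ (prod f (suc n))
    ≡⟨ cong ((g (h 0) ℚ.* rest) ℚ.*_) (trans (cong fromℕ (prod-head f n)) (fromℕ-* (f 0) (prod (f ∘ suc) n))) ⟩
  (g (h 0) ℚ.* rest) ℚ.* (fromℕ (f 0) ℚ.* fromℕ (prod (f ∘ suc) n))
    ≡⟨ ℚ-interchange (g (h 0)) rest (fromℕ (f 0)) (fromℕ (prod (f ∘ suc) n)) ⟩
  (g (h 0) ℚ.* fromℕ (f 0)) ℚ.* (rest ℚ.* fromℕ (prod (f ∘ suc) n))
    ≡⟨ cong₂ ℚ._*_ (eq 0 (s≤s z≤n)) (∏-applyUpTo g (h ∘ suc) (f ∘ suc) (f′ ∘ suc) n (λ j j<n → eq (suc j) (s≤s j<n))) ⟩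
  fromℕ (f′ 0) ℚ.* fromℕ (prod (f′ ∘ suc) n)
    ≡⟨ sym (trans (cong fromℕ (prod-head f′ n)) (fromℕ-* (f′ 0) (prod (f′ ∘ suc) n))) ⟩
  fromℕ (prod f′ (suc n)) ∎
  where
  open ≡-Reasoning
  rest = ∏ (applyUpTo (h ∘ suc) n) g
  ℚ-interchange : ∀ a b c d → (a ℚ.* b) ℚ.* (c ℚ.* d) ≡ (a ℚ.* c) ℚ.* (b ℚ.* d)
  ℚ-interchange a b c d = trans (ℚ.*-assoc a b (c ℚ.* d)) (trans (cong (a ℚ.*_) (trans (sym (ℚ.*-assoc b c d))
    (trans (cong (ℚ._* d) (ℚ.*-comm b c)) (ℚ.*-assoc c b d)))) (sym (ℚ.*-assoc a c (b ℚ.* d))))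

choose₂ : ∀ n → (3 + n) C 2 ∸ 1 ≡ (2 + n) C 2 ∸ 1 + (2 + n)
choose₂ n = trans (cong (_∸ 1) (step (2 + n))) (trans (ℕ.+-∸-assoc (2 + n) (1≤ n)) (ℕ.+-comm (2 + n) _))
  where
  step : ∀ m → suc m C 2 ≡ m + m C 2
  step m = trans (sym (nCk+nC[k+1]≡[n+1]C[k+1] m 1)) (cong (_+ m C 2) (nC1≡n m))
  1≤ : ∀ n → 1 ≤ (2 + n) C 2
  1≤ n = ℕ.≤-trans (s≤s z≤n) (ℕ.≤-trans (ℕ.m≤m+n (1 + n) ((1 + n) C 2)) (ℕ.≤-reflexive (sym (step (1 + n)))))

-- The exponents 2, ..., n + 1 add up to `(2 + n) C 2 ∸ 1`, so the factor in front raises each of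
-- them by a further factor l - 1. This is the origin of the power of q in the last term of λ.
prod-powers : ∀ q l n → 1 ≤ l → q ^ ((l ∸ 1) * ((2 + n) C 2 ∸ 1)) * prod (λ i → q ^ (2 + i)) n ≡ prod (λ i → q ^ ((2 + i) * l)) n
prod-powers q l zero    1≤l = trans (ℕ.*-identityʳ _) (cong (q ^_) (ℕ.*-zeroʳ (l ∸ 1)))
prod-powers q l@(suc l-1) (suc n) 1≤l = begin
  q ^ (l-1 * ((3 + n) C 2 ∸ 1)) * (P * q ^ (2 + n))
    ≡⟨ cong (λ s → q ^ s * (P * q ^ (2 + n))) (trans (cong (l-1 *_) (choose₂ n)) (ℕ.*-distribˡ-+ l-1 s (2 + n))) ⟩
  q ^ (l-1 * s + l-1 * (2 + n)) * (P * q ^ (2 + n))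
    ≡⟨ cong (_* (P * q ^ (2 + n))) (ℕ.^-distribˡ-+-* q (l-1 * s) (l-1 * (2 + n))) ⟩
  (q ^ (l-1 * s) * q ^ (l-1 * (2 + n))) * (P * q ^ (2 + n))
    ≡⟨ ℕ.[m*n]*[o*p]≡[m*o]*[n*p] (q ^ (l-1 * s)) (q ^ (l-1 * (2 + n))) P (q ^ (2 + n)) ⟩
  (q ^ (l-1 * s) * P) * (q ^ (l-1 * (2 + n)) * q ^ (2 + n))
    ≡⟨ cong₂ _*_ (prod-powers q l n 1≤l) (trans (sym (ℕ.^-distribˡ-+-* q (l-1 * (2 + n)) (2 + n)))
         (cong (q ^_) (trans (ℕ.+-comm _ (2 + n)) (ℕ.*-comm l (2 + n))))) ⟩
  prod (λ i → q ^ ((2 + i) * l)) n * q ^ ((2 + n) * l) ∎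
  where
  open ≡-Reasoning
  s = (2 + n) C 2 ∸ 1
  P = prod (λ i → q ^ (2 + i)) n

module _ {q m l : ℕ} (n : ℕ) (1<q : 1 < q) (1≤l : 1 ≤ l) (k≤m+1 : 2 + n ≤ m + 1) where

  private
    k N : ℕ
    k = 2 + n
    N = q ^ l
    G : ℕ → ℕ
    G j = q ^ k ∸ q ^ j
    -- `D` counts the completions of a given pair to an F-basis of a block, `FN` the tuples
    -- completing the pair to an E-independent one, `FH` those with a given nonzero relation vector;
    -- `P₁` is the part j < 2 of the product of the q^k - q^j.
    D FN FH P₁ : ℕ
    D  = fall q (q ^ k) 2 n
    FN = fall N (q ^ (m * l)) 2 n
    FH = fall N (q ^ (m * l)) 2 (n ∸ 1)
    P₁ = (q ^ k ∸ 1) * (q ^ k ∸ q)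
    N-1≢0 : N ∸ 1 ≢ 0
    N-1≢0 = ^∸1≢0 1<q 1≤l
    G≢0 : ∀ j → j < k → G j ≢ 0
    G≢0 j j<k eq = ℕ.<⇒≱ (ℕ.^-monoʳ-< q 1<q j<k) (ℕ.m∸n≡0⇒m≤n eq)
    D≡ : D ≡ prod (λ j → G (2 + j)) n
    D≡ = prod-cong n (λ j _ → cong G (ℕ.+-comm j 2))
    D≢0 : D ≢ 0
    D≢0 = prod-nonZero n (λ j j<n → G≢0 (j + 2) (ℕ.≤-trans (ℕ.+-monoˡ-< 2 j<n) (ℕ.≤-reflexive (ℕ.+-comm n 2))))
    prod-G : prod G k ≡ P₁ * D
    prod-G = trans (prod-+ G 2 n) (cong₂ _*_ (cong₂ _*_ (ℕ.*-identityˡ (q ^ k ∸ 1)) (cong (q ^ k ∸_) (ℕ.*-identityʳ q))) (sym D≡))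

  module _ {r u w #𝒜 : ℕ} (r≤ : r ≤ k ∸ 1) (u∣ : u ∣ gcd (suc r) l) (number : (q ^ u ∸ 1) * #𝒜 ≡ w * (N ∸ 1)) where

    private
      A = (q ^ k ∸ 1) * (q ^ k ∸ q) * ∏ℕ (range 2 (k ∸ 2)) (λ j → q ^ (m * l) ∸ q ^ (j * l))
      J = ∏ℕ (range (suc r) (k ∸ 1)) (λ j → q ^ k ∸ q ^ j)
      F₀ = fall q (q ^ k) 0 (suc r)
      A≡ : A ≡ P₁ * FH
      A≡ = cong (P₁ *_) (trans (prod-applyUpTo (λ j → q ^ (m * l) ∸ q ^ (j * l)) (2 +_) (n ∸ 1))
        (prod-cong (n ∸ 1) (λ j _ → cong (q ^ (m * l) ∸_) (trans (cong (λ i → q ^ (i * l)) (ℕ.+-comm 2 j)) (trans (cong (q ^_) (ℕ.*-comm (j + 2) l)) (sym (ℕ.^-*-assoc q l (j + 2))))))))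
      J≡ : J ≡ prod (λ j → G (suc r + j)) (suc n ∸ r)
      J≡ = prod-applyUpTo G (suc r +_) (suc n ∸ r)
      -- Both sides are the product of all q^k - q^j with j < k, cut after j = r on the left and
      -- after j = 1 on the right. It converts the fraction in λ into (number of vectors with a
      -- given span)/(number of completions of a pair).
      F₀*J : F₀ * J ≡ P₁ * D
      F₀*J = begin
        F₀ * J                                                       ≡⟨ cong₂ _*_ (prod-cong (suc r) (λ j _ → cong G (ℕ.+-identityʳ j))) J≡ ⟩
        prod G (suc r) * prod (λ j → G (suc r + j)) (suc n ∸ r)      ≡⟨ sym (prod-+ G (suc r) (suc n ∸ r)) ⟩
        prod G (suc r + (suc n ∸ r))                                 ≡⟨ cong (prod G ∘ suc) (ℕ.m+[n∸m]≡n r≤) ⟩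
        prod G k                                                     ≡⟨ prod-G ⟩
        P₁ * D                                                       ∎
        where open ≡-Reasoning
      1≤u : 1 ≤ u
      1≤u = ℕ.n≢0⇒n>0 λ { refl → ℕ.1+n≢0 (gcd[m,n]≡0⇒m≡0 {suc r} {l} (0∣⇒≡0 u∣)) }
      J≢0 : J ≢ 0
      J≢0 eq = prod-nonZero (suc n ∸ r) (λ j j< → G≢0 (suc r + j) (s≤s (ℕ.≤-trans (ℕ.≤-reflexive (sym (ℕ.+-suc r j)))
        (ℕ.≤-trans (ℕ.+-monoʳ-≤ r j<) (ℕ.≤-reflexive (ℕ.m+[n∸m]≡n r≤)))))) (trans (sym J≡) eq)
      B = (q ^ u ∸ 1) * J
      instance
        _ = ℕ.m*n≢0 (q ^ u ∸ 1) J {{ℕ.≢-nonZero (^∸1≢0 1<q 1≤u)}} {{ℕ.≢-nonZero J≢0}}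
      rearrange₁ : ∀ #𝒜 F₀ H Y J → #𝒜 * F₀ * H * (Y * J) ≡ (Y * #𝒜) * (F₀ * J) * H
      rearrange₁ = solve-∀
      rearrange₂ : ∀ w N′ P D H → (w * N′) * (P * D) * H ≡ w * (P * H) * (N′ * D)
      rearrange₂ = solve-∀

    -- After multiplication by the denominator `B` only naturals remain: `number` trades w (N - 1)
    -- for (q^u - 1) times the number of chosen subspaces, and `F₀*J` trades `P₁ * D` for `F₀ * J`.
    summand : (fromℕ w ℚ.* (A // B)) ℚ.* fromℕ ((N ∸ 1) * D) ≡ fromℕ (#𝒜 * F₀) ℚ.* fromℕ FH
    summand = fromℕ-*-cancelʳ B (begin
      ((fromℕ w ℚ.* (A // B)) ℚ.* fromℕ Z) ℚ.* fromℕ B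
        ≡⟨ trans (ℚ.*-assoc (fromℕ w ℚ.* (A // B)) (fromℕ Z) (fromℕ B)) (trans (cong ((fromℕ w ℚ.* (A // B)) ℚ.*_) (ℚ.*-comm (fromℕ Z) (fromℕ B)))
             (sym (ℚ.*-assoc (fromℕ w ℚ.* (A // B)) (fromℕ B) (fromℕ Z)))) ⟩
      ((fromℕ w ℚ.* (A // B)) ℚ.* fromℕ B) ℚ.* fromℕ Z
        ≡⟨ cong (ℚ._* fromℕ Z) (trans (ℚ.*-assoc (fromℕ w) (A // B) (fromℕ B)) (cong (fromℕ w ℚ.*_) (//-* A B))) ⟩
      (fromℕ w ℚ.* fromℕ A) ℚ.* fromℕ Z
        ≡⟨ sym (trans (fromℕ-* (w * A) Z) (cong (ℚ._* fromℕ Z) (fromℕ-* w A))) ⟩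
      fromℕ (w * A * Z)
        ≡⟨ cong fromℕ (trans (cong (λ A → w * A * Z) A≡) (trans (sym (rearrange₂ w (N ∸ 1) P₁ D FH))
             (trans (cong₂ (λ x y → x * y * FH) (sym number) (sym F₀*J)) (sym (rearrange₁ #𝒜 F₀ FH (q ^ u ∸ 1) J))))) ⟩
      fromℕ (#𝒜 * F₀ * FH * B)
        ≡⟨ trans (fromℕ-* (#𝒜 * F₀ * FH) B) (cong (ℚ._* fromℕ B) (fromℕ-* (#𝒜 * F₀) FH)) ⟩
      (fromℕ (#𝒜 * F₀) ℚ.* fromℕ FH) ℚ.* fromℕ B ∎)
      where
      open ≡-Reasoning
      Z = (N ∸ 1) * D

  private
    Π : ℚ
    Π = ∏ (range 2 (k ∸ 1)) (λ j → (q ^ ((m ∸ j) * l) ∸ 1) // (q ^ (k ∸ j) ∸ 1))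
    e : ℕ
    e = (l ∸ 1) * ((k C 2) ∸ 1)
    R : ℕ → ℕ
    R i = q ^ ((m ∸ (2 + i)) * l) ∸ 1

    Π*D : Π ℚ.* fromℕ D ≡ fromℕ (prod (λ i → q ^ (2 + i) * R i) n)
    Π*D = trans (cong (λ D → Π ℚ.* fromℕ D) D≡) (∏-applyUpTo _ (2 +_) (λ j → G (2 + j)) (λ i → q ^ (2 + i) * R i) n factor)
      where
      factor : ∀ j → j < n → (R j // (q ^ (k ∸ (2 + j)) ∸ 1)) ℚ.* fromℕ (G (2 + j)) ≡ fromℕ (q ^ (2 + j) * R j)
      factor j j<n = begin
        (R j // S) ℚ.* fromℕ (G (2 + j))                     ≡⟨ cong (λ g → (R j // S) ℚ.* fromℕ g) (trans (^-difference q k (2 + j) (ℕ.<⇒≤ 2+j<k)) (ℕ.*-comm (q ^ (2 + j)) S)) ⟩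
        (R j // S) ℚ.* fromℕ (S * q ^ (2 + j))               ≡⟨ cong ((R j // S) ℚ.*_) (fromℕ-* S (q ^ (2 + j))) ⟩
        (R j // S) ℚ.* (fromℕ S ℚ.* fromℕ (q ^ (2 + j)))     ≡⟨ sym (ℚ.*-assoc (R j // S) (fromℕ S) _) ⟩
        ((R j // S) ℚ.* fromℕ S) ℚ.* fromℕ (q ^ (2 + j))     ≡⟨ cong (ℚ._* fromℕ (q ^ (2 + j))) (//-* (R j) S {{ℕ.≢-nonZero (^∸1≢0 1<q (ℕ.m<n⇒0<n∸m j<n))}}) ⟩
        fromℕ (R j) ℚ.* fromℕ (q ^ (2 + j))                  ≡⟨ trans (ℚ.*-comm (fromℕ (R j)) _) (sym (fromℕ-* (q ^ (2 + j)) (R j))) ⟩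
        fromℕ (q ^ (2 + j) * R j)                            ∎
        where
        open ≡-Reasoning
        S = q ^ (k ∸ (2 + j)) ∸ 1
        2+j<k : 2 + j < k
        2+j<k = ℕ.+-monoʳ-< 2 j<n

    FN≡ : FN ≡ q ^ e * prod (λ i → q ^ (2 + i) * R i) n
    FN≡ = begin
      FN
        ≡⟨ prod-cong n (λ i i<n → trans (cong (q ^ (m * l) ∸_) (trans (ℕ.^-*-assoc q l (i + 2)) (cong (q ^_) (trans (ℕ.*-comm l (i + 2)) (cong (_* l) (ℕ.+-comm i 2))))))
             (trans (^-difference q (m * l) ((2 + i) * l) (ℕ.*-monoˡ-≤ l (2+i≤m i<n))) (cong (λ t → q ^ ((2 + i) * l) * (q ^ t ∸ 1)) (sym (ℕ.*-distribʳ-∸ l m (2 + i)))))) ⟩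
      prod (λ i → q ^ ((2 + i) * l) * R i) n
        ≡⟨ prod-* (λ i → q ^ ((2 + i) * l)) R n ⟩
      prod (λ i → q ^ ((2 + i) * l)) n * prod R n
        ≡⟨ cong (_* prod R n) (sym (prod-powers q l n 1≤l)) ⟩
      q ^ e * prod (λ i → q ^ (2 + i)) n * prod R n
        ≡⟨ ℕ.*-assoc (q ^ e) _ _ ⟩
      q ^ e * (prod (λ i → q ^ (2 + i)) n * prod R n)
        ≡⟨ cong (q ^ e *_) (sym (prod-* (λ i → q ^ (2 + i)) R n)) ⟩
      q ^ e * prod (λ i → q ^ (2 + i) * R i) n ∎
      where
      open ≡-Reasoning
      -- The bound k ≤ m + 1 makes every m ∸ (2 + i) a true difference. For k = m + 1 the last of
      -- them is 0, and the product vanishes on both sides.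
      2+i≤m : ∀ {i} → i < n → 2 + i ≤ m
      2+i≤m i<n = ℕ.s≤s⁻¹ (ℕ.≤-trans (ℕ.+-monoʳ-≤ 2 i<n) (ℕ.≤-trans k≤m+1 (ℕ.≤-reflexive (ℕ.+-comm m 1))))

  free-term : ∀ ε → (fromℕ ε ℚ.* fromℕ (q ^ e) ℚ.* Π) ℚ.* fromℕ ((N ∸ 1) * D) ≡ fromℕ ((N ∸ 1) * (ε * FN))
  free-term ε = begin
    (fromℕ ε ℚ.* fromℕ (q ^ e) ℚ.* Π) ℚ.* fromℕ ((N ∸ 1) * D)
      ≡⟨ cong₂ (λ x y → x ℚ.* Π ℚ.* y) (sym (fromℕ-* ε (q ^ e))) (trans (cong fromℕ (ℕ.*-comm (N ∸ 1) D)) (fromℕ-* D (N ∸ 1))) ⟩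
    (fromℕ (ε * q ^ e) ℚ.* Π) ℚ.* (fromℕ D ℚ.* fromℕ (N ∸ 1))
      ≡⟨ trans (sym (ℚ.*-assoc (fromℕ (ε * q ^ e) ℚ.* Π) (fromℕ D) (fromℕ (N ∸ 1)))) (cong (ℚ._* fromℕ (N ∸ 1)) (ℚ.*-assoc (fromℕ (ε * q ^ e)) Π (fromℕ D))) ⟩
    (fromℕ (ε * q ^ e) ℚ.* (Π ℚ.* fromℕ D)) ℚ.* fromℕ (N ∸ 1)
      ≡⟨ cong (λ x → (fromℕ (ε * q ^ e) ℚ.* x) ℚ.* fromℕ (N ∸ 1)) Π*D ⟩
    (fromℕ (ε * q ^ e) ℚ.* fromℕ Y) ℚ.* fromℕ (N ∸ 1)
      ≡⟨ trans (cong (ℚ._* fromℕ (N ∸ 1)) (sym (fromℕ-* (ε * q ^ e) Y))) (sym (fromℕ-* (ε * q ^ e * Y) (N ∸ 1))) ⟩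
    fromℕ (ε * q ^ e * Y * (N ∸ 1))
      ≡⟨ cong fromℕ (trans (ℕ.*-comm (ε * q ^ e * Y) (N ∸ 1)) (cong ((N ∸ 1) *_) (trans (ℕ.*-assoc ε (q ^ e) Y) (cong (ε *_) (sym FN≡))))) ⟩
    fromℕ ((N ∸ 1) * (ε * FN)) ∎
    where
    open ≡-Reasoning
    Y = prod (λ i → q ^ (2 + i) * R i) n

  -- Multiplication by (N - 1)·D, which is nonzero, clears all denominators of λ and yields the
  -- double count on the right-hand side of the last hypothesis. No divisibility has to be shown:
  -- that λ is a natural number is part of the outcome.
  λ-count : ∀ {w #𝒜 : ℕ → ℕ → ℕ} {ε M c} →
    (∀ r u → 2 ≤ r → r ≤ k ∸ 1 → u ∣ gcd (suc r) l → (q ^ u ∸ 1) * #𝒜 r u ≡ w r u * (N ∸ 1)) →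
    fromℕ M ≡ ∑ (range 2 (k ∸ 1)) (λ r → ∑ (divisors (gcd (suc r) l)) (λ u → fromℕ (#𝒜 r u * fall q (q ^ k) 0 (suc r)))) →
    (N ∸ 1) * (D * c) ≡ (N ∸ 1) * (ε * FN) + M * FH →
    λ-value q m l k w ε ≡ fromℕ c
  λ-count {w} {#𝒜} {ε} {M} {c} number M≡ eq = fromℕ-*-cancelʳ Z (begin
    λ-value q m l k w ε ℚ.* fromℕ Z
      ≡⟨ ℚ.*-distribʳ-+ (fromℕ Z) S (fromℕ ε ℚ.* fromℕ (q ^ e) ℚ.* Π) ⟩
    S ℚ.* fromℕ Z ℚ.+ (fromℕ ε ℚ.* fromℕ (q ^ e) ℚ.* Π) ℚ.* fromℕ Z
      ≡⟨ cong₂ ℚ._+_ S*Z (free-term ε) ⟩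
    fromℕ (M * FH) ℚ.+ fromℕ ((N ∸ 1) * (ε * FN))
      ≡⟨ sym (fromℕ-+ (M * FH) ((N ∸ 1) * (ε * FN))) ⟩
    fromℕ (M * FH + (N ∸ 1) * (ε * FN))
      ≡⟨ cong fromℕ (trans (ℕ.+-comm (M * FH) _) (trans (sym eq) (trans (sym (ℕ.*-assoc (N ∸ 1) D c)) (ℕ.*-comm Z c)))) ⟩
    fromℕ (c * Z)
      ≡⟨ fromℕ-* c Z ⟩
    fromℕ c ℚ.* fromℕ Z ∎)
    where
    open ≡-Reasoning
    Z = (N ∸ 1) * D
    instance
      _ = ℕ.m*n≢0 (N ∸ 1) D {{ℕ.≢-nonZero N-1≢0}} {{ℕ.≢-nonZero D≢0}}
    term : ℕ → ℕ → ℚ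
    term r u = fromℕ (w r u) ℚ.*
      (((q ^ k ∸ 1) * (q ^ k ∸ q) * ∏ℕ (range 2 (k ∸ 2)) (λ j → q ^ (m * l) ∸ q ^ (j * l)))
       // ((q ^ u ∸ 1) * ∏ℕ (range (suc r) (k ∸ 1)) (λ j → q ^ k ∸ q ^ j)))
    us : ℕ → List ℕ
    us r = divisors (gcd (suc r) l)
    S : ℚ
    S = ∑ (range 2 (k ∸ 1)) (λ r → ∑ (us r) (term r))
    S*Z : S ℚ.* fromℕ Z ≡ fromℕ (M * FH)
    S*Z = begin
      S ℚ.* fromℕ Z
        ≡⟨ sym (∑-*ʳ (range 2 (k ∸ 1)) (λ r → ∑ (us r) (term r)) (fromℕ Z)) ⟩
      ∑ (range 2 (k ∸ 1)) (λ r → ∑ (us r) (term r) ℚ.* fromℕ Z)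
        ≡⟨ ∑-cong-All (Allᴸ.map (λ {r} (2≤r , r≤) → trans (sym (∑-*ʳ (us r) (term r) (fromℕ Z))) (trans
             (∑-cong-All (Allᴸ.map (λ {u} u∣ → summand {r} {u} {w r u} {#𝒜 r u} r≤ u∣ (number r u 2≤r r≤ u∣)) (divisors-divide (gcd (suc r) l))))
             (∑-*ʳ (us r) (λ u → fromℕ (#𝒜 r u * fall q (q ^ k) 0 (suc r))) (fromℕ FH)))) (range-bounds 2 (k ∸ 1))) ⟩
      ∑ (range 2 (k ∸ 1)) (λ r → ∑ (us r) (λ u → fromℕ (#𝒜 r u * fall q (q ^ k) 0 (suc r))) ℚ.* fromℕ FH)
        ≡⟨ ∑-*ʳ (range 2 (k ∸ 1)) (λ r → ∑ (us r) (λ u → fromℕ (#𝒜 r u * fall q (q ^ k) 0 (suc r)))) (fromℕ FH) ⟩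
      ∑ (range 2 (k ∸ 1)) (λ r → ∑ (us r) (λ u → fromℕ (#𝒜 r u * fall q (q ^ k) 0 (suc r)))) ℚ.* fromℕ FH
        ≡⟨ trans (cong (ℚ._* fromℕ FH) (sym M≡)) (sym (fromℕ-* M FH)) ⟩
      fromℕ (M * FH) ∎

-- Assembly of the design

count-⊎ : {A B : Set} ⦃ _ : Finite A ⦄ ⦃ _ : Finite B ⦄ {P : A ⊎ B → Set} (P? : ∀ x → Dec (P x)) →
          count P? ≡ count (P? ∘ inj₁) + count (P? ∘ inj₂)
count-⊎ {A} {B} {P} P? = trans (count-split P? left?) (cong₂ _+_
  (count-bij (λ x → P? x ×-dec left? x) (P? ∘ inj₁) (λ x a → P? (inj₁ a) ×-dec (inj₁ a ≟ x))
    (λ { x a (p , refl) → (p , (a , refl)) , p }) (λ { x (p , (a , refl)) → a , p , refl })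
    (λ { x a a′ (_ , refl) (_ , refl) → refl }) (λ a p → inj₁ a , p , refl) (λ { x x′ a (_ , refl) (_ , refl) → refl }))
  (count-bij (λ x → P? x ×-dec ¬? (left? x)) (P? ∘ inj₂) (λ x b → P? (inj₂ b) ×-dec (inj₂ b ≟ x))
    (λ { x b (p , refl) → (p , λ { (_ , ()) }) , p })
    (λ { (inj₁ a) (p , ¬l) → contradiction (a , refl) ¬l ; (inj₂ b) (p , _) → b , p , refl })
    (λ { x b b′ (_ , refl) (_ , refl) → refl }) (λ b p → inj₂ b , p , refl) (λ { x x′ b (_ , refl) (_ , refl) → refl })))
  where
  left? : ∀ x → Dec (∃[ a ] inj₁ a ≡ x)
  left? x = ∃? (λ a → inj₁ a ≟ x)

module Assembly (E : FiniteField) where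
  open FiniteField E
  open Spaces E
  open FieldTheory E
  open Relations E
  open Blocks E
  open Orbits E using (recip-nonzero; *-cancel-recip)

  inv : Carrierᴱ → Carrierᴱ
  inv x with x ≟ 0ᴱ
  ... | yes _  = 0ᴱ
  ... | no x≢0 = proj₁ (recip x x≢0)

  inv-inverse : ∀ {x} → x ≢ 0ᴱ → x *ᴱ inv x ≡ 1ᴱ
  inv-inverse {x} x≢0 with x ≟ 0ᴱ
  ... | yes x≡0 = contradiction x≡0 x≢0
  ... | no x≢0′ = proj₂ (recip x x≢0′)

  -- The first nonzero coordinate; 1 for the zero vector.
  leading : ∀ {m} → Vec Carrierᴱ m → Carrierᴱ
  leading []       = 1ᴱ
  leading (x ∷ xs) with x ≟ 0ᴱ
  ... | yes _ = leading xs
  ... | no _  = x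

  leading≢0 : ∀ {m} (v : Vec Carrierᴱ m) → leading v ≢ 0ᴱ
  leading≢0 []       = 0≢1 ∘ sym
  leading≢0 (x ∷ xs) with x ≟ 0ᴱ
  ... | yes _  = leading≢0 xs
  ... | no x≢0 = x≢0

  leading-scale : ∀ {m} a (v : Vec Carrierᴱ m) → v ≢ zeros m → a ≢ 0ᴱ → leading (scale m a v) ≡ a *ᴱ leading v
  leading-scale a []       v≢0 _ = contradiction refl v≢0
  leading-scale a (x ∷ xs) v≢0 a≢0 with x ≟ 0ᴱ | (a *ᴱ x) ≟ 0ᴱ
  ... | yes refl | yes _    = leading-scale a xs (v≢0 ∘ cong (0ᴱ ∷_)) a≢0
  ... | yes refl | no ax≢0  = contradiction (R.zeroʳ a) ax≢0
  ... | no x≢0   | yes ax≡0 = contradiction (zero-product a≢0 ax≡0) x≢0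
  ... | no _     | no _     = refl

  -- Every E-line contains exactly one normal vector.
  Normal : ∀ {m} → Vec Carrierᴱ m → Set
  Normal {m} v = v ≢ zeros m × leading v ≡ 1ᴱ

  Normal? : ∀ {m} (v : Vec Carrierᴱ m) → Dec (Normal v)
  Normal? {m} v = ¬? (v ≟ zeros m) ×-dec (leading v ≟ 1ᴱ)

  normalise : ∀ {m} → Vec Carrierᴱ m → Vec Carrierᴱ m
  normalise {m} v = scale m (inv (leading v)) v

  normalise-scale : ∀ {m} (v : Vec Carrierᴱ m) → scale m (leading v) (normalise v) ≡ v
  normalise-scale {m} v = trans (sym (S.·-assoc (leading v) (inv (leading v)) v)) (trans (cong (λ a → scale m a v) (inv-inverse (leading≢0 v))) (S.·-identity v))
    where module S = Space (regular ^ˢ m)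

  normalise-normal : ∀ {m} {v : Vec Carrierᴱ m} → v ≢ zeros m → Normal (normalise v)
  normalise-normal {m} {v} v≢0 = (λ z → v≢0 (trans (sym (normalise-scale v)) (trans (cong (scale m (leading v)) z) (S.·-zeroʳ (leading v)))))
    , trans (leading-scale _ v v≢0 (recip-nonzero (inv-inverse (leading≢0 v)))) (trans (R.*-comm _ _) (inv-inverse (leading≢0 v)))
    where module S = Space (regular ^ˢ m)

  normal-coefficient : ∀ {m a} {e : Vec Carrierᴱ m} → Normal e → a ≢ 0ᴱ → leading (scale m a e) ≡ a
  normal-coefficient {a = a} {e} (e≢0 , lead≡1) a≢0 = trans (leading-scale a e e≢0 a≢0) (trans (cong (a *ᴱ_) lead≡1) (R.*-identityʳ a))

  normal-unique : ∀ {m a a′} {e e′ : Vec Carrierᴱ m} → Normal e → Normal e′ → a ≢ 0ᴱ → a′ ≢ 0ᴱ → scale m a e ≡ scale m a′ e′ → a ≡ a′ × e ≡ e′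
  normal-unique {m} {a} {a′} {e} {e′} ne ne′ a≢0 a′≢0 eq = a≡a′ , (begin
    e                                 ≡⟨ sym (cancel-scale (inv-inverse a≢0) e) ⟩
    scale m (inv a) (scale m a e)     ≡⟨ cong (scale m (inv a)) (trans eq (cong (λ a → scale m a e′) (sym a≡a′))) ⟩
    scale m (inv a) (scale m a e′)    ≡⟨ cancel-scale (inv-inverse a≢0) e′ ⟩
    e′                                ∎)
    where
    open ≡-Reasoning
    a≡a′ : a ≡ a′
    a≡a′ = trans (sym (normal-coefficient ne a≢0)) (trans (cong leading eq) (normal-coefficient ne′ a′≢0))

  -- The given design on E with decidable blocks. Multiplication by a nonzero `a` is recorded as the
  -- map `shift` on block indices, so that repeated blocks keep their multiplicity.
  record Design (F : Subfield) (K : ℕ → Set) (Λ : ℕ) : Set₁ where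
    no-eta-equality
    open Over F
    field
      #blocks  : ℕ
      B        : Fin #blocks → Carrierᴱ → Set
      B?       : ∀ i x → Dec (B i x)
      B-sub    : ∀ i → IsSubspace regular (B i)
      B-basis  : ∀ i → ∃[ d ] K d × Σ[ bs ∈ Vec Carrierᴱ d ] IsBasis regular (B i) bs
      balanced : ∀ {α β} → Indep regular (α ∷ β ∷ []) → count (λ i → B? i α ×-dec B? i β) ≡ Λ
      shift    : ∀ {a} → a ≢ 0ᴱ → Fin #blocks → Fin #blocks
      shift-injective : ∀ {a} (a≢0 : a ≢ 0ᴱ) {i j} → shift a≢0 i ≡ shift a≢0 j → i ≡ j
      shift⁺   : ∀ {a} (a≢0 : a ≢ 0ᴱ) {i x} → B i x → B (shift a≢0 i) (a *ᴱ x)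
      shift⁻   : ∀ {a} (a≢0 : a ≢ 0ᴱ) {i x} → B (shift a≢0 i) (a *ᴱ x) → B i x

  module _ {F : Subfield} {K : ℕ → Set} {Λ : ℕ} (D : Design F K Λ) (m n : ℕ)
           {P : Vec Carrierᴱ (n + 2) → Set} (adm : Admissible F (n + 2) P) where
    open Design D
    open Over F
    private
      V : Space
      V = regular ^ˢ m
    open Space V

    record Through-number : Set where
      no-eta-equality
      field
        through : ∀ (x y : Carrierᴹ) → 𝔼.Indep V (x ∷ y ∷ []) → count (λ U → GoodBlock? F adm V U ×-dec ((x ∈ᴾ? U) ×-dec (y ∈ᴾ? U))) ≡ Λ

    -- A block of the given design on the line spanned by the first component, or a good subspace.
    Index : Set
    Index = (Carrierᴹ × Fin #blocks) ⊎ Powerset Carrierᴹ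

    -- The zero subspace is excluded: its copies on the various lines would coincide.
    Nonzero : Fin #blocks → Set
    Nonzero i = ∃[ x ] B i x × x ≢ 0ᴱ

    Nonzero? : ∀ i → Dec (Nonzero i)
    Nonzero? i = ∃? (λ x → B? i x ×-dec ¬? (x ≟ 0ᴱ))

    Live : Index → Set
    Live (inj₁ (e , i)) = Normal e × Nonzero i
    Live (inj₂ U)       = GoodBlock F adm V U

    Live? : ∀ y → Dec (Live y)
    Live? (inj₁ (e , i)) = Normal? e ×-dec Nonzero? i
    Live? (inj₂ U)       = GoodBlock? F adm V U

    On : Index → Carrierᴹ → Set
    On (inj₁ (e , i)) v = ∃[ α ] B i α × scale m α e ≡ v
    On (inj₂ U)       v = v ∈ᴾ U

    On? : ∀ y v → Dec (On y v)
    On? (inj₁ (e , i)) v = ∃? (λ α → B? i α ×-dec (scale m α e ≟ v))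
    On? (inj₂ U)       v = v ∈ᴾ? U

    on-line : ∀ {e i α} → Normal e → On (inj₁ (e , i)) (scale m α e) → B i α
    on-line {e} {i} ne (β , Bβ , eq) = subst (B i) (scale-injective (proj₁ ne) eq) Bβ

    on-subspace : ∀ {y} → Live y → IsSubspace V (On y)
    on-subspace {inj₁ (e , i)} _ = let 0∈ , +∈ , ·∈ = B-sub i in
      (0ᴱ , 0∈ , ·-zeroˡ e)
      , (λ { _ _ (α , Bα , refl) (β , Bβ , refl) → α +ᴱ β , +∈ α β Bα Bβ , ·-distribʳ α β e })
      , (λ { a _ aK (α , Bα , refl) → a *ᴱ α , ·∈ a α aK Bα , ·-assoc a α e })
    on-subspace {inj₂ U} g = goodblock-subspace F adm V g

    scale-linear : ∀ e → Linear regular V (λ α → scale m α e)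
    scale-linear e = record { +-homo = λ α β → ·-distribʳ α β e ; ·-homo = λ a α → ·-assoc a α e }

    scale-indep : ∀ {d e} {bs : Vec Carrierᴱ d} → e ≢ zeros m → Indep regular bs → Indep V (Vec.map (λ α → scale m α e) bs)
    scale-indep {e = e} {bs} e≢0 ind c cK eq = ind c cK (scale-injective e≢0 (trans (sym (comb-map {regular} {V} (scale-linear e) c bs)) (trans eq (sym (·-zeroˡ e)))))

    scale-indep⁻ : ∀ {d e} {bs : Vec Carrierᴱ d} → Indep V (Vec.map (λ α → scale m α e) bs) → Indep regular bs
    scale-indep⁻ {e = e} {bs} ind c cK eq = ind c cK (trans (comb-map {regular} {V} (scale-linear e) c bs) (trans (cong (λ α → scale m α e) eq) (·-zeroˡ e)))

    on-basis : ∀ {y} → Live y → ∃[ d ] (K d ⊎ n + 2 ≡ d) × Σ[ vs ∈ Vec Carrierᴹ d ] IsBasis V (On y) vs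
    on-basis {inj₁ (e , i)} (ne , _) with d , Kd , bs , bs∈ , ind , spans ← B-basis i =
      d , inj₁ Kd , Vec.map (λ α → scale m α e) bs , members bs∈ , scale-indep (proj₁ ne) ind
      , λ { _ (α , Bα , refl) → let c , cK , eq = spans α Bα in c , cK , trans (comb-map {regular} {V} (scale-linear e) c bs) (cong (λ α → scale m α e) eq) }
      where
      members : ∀ {d} {bs : Vec Carrierᴱ d} → All (B i) bs → All (On (inj₁ (e , i))) (Vec.map (λ α → scale m α e) bs)
      members []       = []
      members (p ∷ ps) = (_ , p , refl) ∷ members ps
    on-basis {inj₂ U} g = n + 2 , inj₂ refl , goodblock-basis F adm V g

    module _ {x y : Carrierᴹ} (indep : Indep V (x ∷ y ∷ [])) where

      x≢0 : x ≢ 0ᴹ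
      x≢0 refl = 0≢1 (sym (cong Vec.head (indep (1ᴱ ∷ 0ᴱ ∷ []) (Subfield.1∈K F ∷ Subfield.0∈K F ∷ [])
        (trans (cong₂ _+ᴹ_ (·-identity 0ᴹ) (0·x+y≡y y 0ᴹ)) (A.identityˡ 0ᴹ)))))

      y≢0 : y ≢ 0ᴹ
      y≢0 refl = 0≢1 (sym (cong (Vec.head ∘ Vec.tail) (indep (0ᴱ ∷ 1ᴱ ∷ []) (Subfield.0∈K F ∷ Subfield.1∈K F ∷ [])
        (trans (0·x+y≡y x _) (trans (cong (_+ᴹ 0ᴹ) (·-identity 0ᴹ)) (A.identityˡ 0ᴹ))))))

      Covers? : ∀ z → Dec (Live z × (On z x × On z y))
      Covers? z = Live? z ×-dec (On? z x ×-dec On? z y)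

      private
        proportional? : Dec (∃[ β ] scale m β x ≡ y)
        proportional? = ∃? (λ β → scale m β x ≟ y)

        line-proportional : ∀ {e i} → On (inj₁ (e , i)) x → On (inj₁ (e , i)) y → ∃[ β ] scale m β x ≡ y
        line-proportional {e} (α , _ , refl) (α′ , _ , refl) with α ≟ 0ᴱ
        ... | yes refl = contradiction (·-zeroˡ e) x≢0
        ... | no α≢0   = α′ *ᴱ inv α , trans (sym (·-assoc (α′ *ᴱ inv α) α e)) (cong (λ β → scale m β e)
              (trans (R.*-assoc α′ (inv α) α) (trans (cong (α′ *ᴱ_) (trans (R.*-comm (inv α) α) (inv-inverse α≢0))) (R.*-identityʳ α′))))

        E-indep : ¬ (∃[ β ] scale m β x ≡ y) → 𝔼.Indep V (x ∷ y ∷ [])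
        E-indep ¬prop = 𝔼.indep-∷ V (𝔼.indep-∷ V (𝔼.indep-[] V) (λ { ([] , _ , eq) → y≢0 (sym eq) })) x∉
          where
          x∉ : ¬ 𝔼.Span V (y ∷ []) x
          x∉ (c ∷ [] , _ , eq) with c ≟ 0ᴱ
          ... | yes refl = x≢0 (trans (sym eq) (trans (0·x+y≡y y 0ᴹ) refl))
          ... | no c≢0   = ¬prop (inv c , trans (cong (scale m (inv c)) (trans (sym eq) (A.identityʳ _))) (cancel-scale (inv-inverse c≢0) y))

      -- If y = βx, the only line through both is that of `normalise x`, by uniqueness of the normal
      -- vector. There x and y have the coordinates `leading x` and β times this, an F-independent
      -- pair of elements of E to which `balanced` applies. If x and y are E-independent, the count
      -- is the one supplied by `Through-number`.
      count-covers : Through-number → count Covers? ≡ Λ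
      count-covers thr = trans (count-⊎ Covers?) (by-cases proportional?)
        where
        lines = count (Covers? ∘ inj₁)
        goods = count (Covers? ∘ inj₂)
        by-cases : Dec (∃[ β ] scale m β x ≡ y) → lines + goods ≡ Λ
        by-cases (no ¬prop) = cong₂ _+_ (count-none (Covers? ∘ inj₁) (λ { _ (_ , ox , oy) → ¬prop (line-proportional ox oy) })) (Through-number.through thr _ _ (E-indep ¬prop))
        by-cases (yes (β , refl)) = trans (cong₂ _+_ on-lines (count-none (Covers? ∘ inj₂)
            (λ { U ((vs , good , refl) , x∈ , y∈) → good-scattered F adm V good (span∈⁻ F adm V x∈) (span∈⁻ F adm V y∈) indep })))
          (ℕ.+-identityʳ Λ)
          where
          a = leading x
          e = normalise x
          ne : Normal e
          ne = normalise-normal x≢0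
          ae≡x : scale m a e ≡ x
          ae≡x = normalise-scale x
          βae≡y : scale m (β *ᴱ a) e ≡ scale m β x
          βae≡y = trans (·-assoc β a e) (cong (scale m β) ae≡x)
          pair-indep : Indep regular (a ∷ β *ᴱ a ∷ [])
          pair-indep = scale-indep⁻ {e = e} (subst (Indep V) (cong₂ (λ x y → x ∷ y ∷ []) (sym ae≡x) (sym βae≡y)) indep)
          on-lines : lines ≡ Λ
          on-lines = trans (count-bij (Covers? ∘ inj₁) (λ i → B? i a ×-dec B? i (β *ᴱ a)) (λ z i → (z ≟ (e , i)) ×-dec (B? i a ×-dec B? i (β *ᴱ a)))
            -- A block containing the coordinate of x is nonzero since `leading x` is, so leaving
            -- out the zero blocks loses none of those counted.
            (λ { (_ , i) _ (refl , Ba , Bβa) → ((ne , (a , Ba , leading≢0 x)) , (a , Ba , ae≡x) , (β *ᴱ a , Bβa , βae≡y)) , Ba , Bβa })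
            exists
            (λ { z i i′ (refl , _) (refl , _) → refl })
            (λ i p → (e , i) , refl , p) (λ { z z′ i (refl , _) (refl , _) → refl }))
            (balanced pair-indep)
            where
            exists : ∀ z → Live (inj₁ z) × (On (inj₁ z) x × On (inj₁ z) (scale m β x)) → ∃[ i ] z ≡ (e , i) × (B i a × B i (β *ᴱ a))
            exists (e′ , i) ((ne′ , _) , ox@(α , Bα , αe′≡x) , oy) with normal-unique ne′ ne (λ { refl → x≢0 (trans (sym αe′≡x) (·-zeroˡ e′)) }) (leading≢0 x) (trans αe′≡x (sym ae≡x))
            ... | refl , refl = i , refl , Bα , on-line ne (subst (On (inj₁ (e , i))) (sym βae≡y) oy)

    module _ {g : Carrierᴹ → Carrierᴹ} (g-linear : Linear V V g) (g-injective : ∀ {x y} → g x ≡ g y → x ≡ y) where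

      private
        g≡0 : ∀ {x} → g x ≡ 0ᴹ → x ≡ 0ᴹ
        g≡0 eq = g-injective (trans eq (sym (Linear.0-homo g-linear)))

      image? : ∀ U v → Dec (∃[ u ] u ∈ᴾ U × g u ≡ v)
      image? U v = ∃? (λ u → (u ∈ᴾ? U) ×-dec (g u ≟ v))

      -- The line of `e` goes to the line of `g e`, where the coordinate α with respect to `e`
      -- becomes `leading (g e) *ᴱ α` with respect to the normal vector. The copy of block `i` thus
      -- becomes the copy of a dilated block, which Singer invariance provides as `shift`.
      move : Index → Index
      move (inj₁ (e , i)) = inj₁ (normalise (g e) , shift (leading≢0 (g e)) i)
      move (inj₂ U)       = inj₂ ⟦ image? U ⟧ᴾ

      move-on⁺ : ∀ {y v} → On y v → On (move y) (g v)
      move-on⁺ {inj₁ (e , i)} (α , Bα , refl) = leading (g e) *ᴱ α , shift⁺ (leading≢0 (g e)) Bα , (begin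
        scale m (leading (g e) *ᴱ α) (normalise (g e))           ≡⟨ trans (cong (λ a → scale m a (normalise (g e))) (R.*-comm _ α)) (·-assoc α _ _) ⟩
        scale m α (scale m (leading (g e)) (normalise (g e)))    ≡⟨ cong (scale m α) (normalise-scale (g e)) ⟩
        scale m α (g e)                                          ≡⟨ sym (Linear.·-homo g-linear α e) ⟩
        g (scale m α e)                                          ∎)
        where open ≡-Reasoning
      move-on⁺ {inj₂ U} {v} v∈ = ∈-⟦⟧ᴾ⁺ (image? U) (v , v∈ , refl)

      move-on⁻ : ∀ {y v} → On (move y) v → ∃[ u ] On y u × g u ≡ v
      move-on⁻ {inj₁ (e , i)} (α′ , Bα′ , refl) = scale m α e , (α , shift⁻ (leading≢0 (g e)) (subst (B (shift (leading≢0 (g e)) i)) (sym aα≡α′) Bα′) , refl) , (begin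
        g (scale m α e)                                          ≡⟨ Linear.·-homo g-linear α e ⟩
        scale m α (g e)                                          ≡⟨ cong (scale m α) (sym (normalise-scale (g e))) ⟩
        scale m α (scale m a (normalise (g e)))                  ≡⟨ sym (·-assoc α a _) ⟩
        scale m (α *ᴱ a) (normalise (g e))                       ≡⟨ cong (λ c → scale m c (normalise (g e))) (trans (R.*-comm α a) aα≡α′) ⟩
        scale m α′ (normalise (g e))                             ∎)
        where
        open ≡-Reasoning
        a = leading (g e)
        α = inv a *ᴱ α′
        aα≡α′ : a *ᴱ α ≡ α′
        aα≡α′ = *-cancel-recip (inv-inverse (leading≢0 (g e))) α′
      move-on⁻ {inj₂ U} v∈ = ∈-⟦⟧ᴾ⁻ (image? U) v∈

      move-live : ∀ {y} → Live y → Live (move y)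
      move-live {inj₁ (e , i)} (ne , (x , Bx , x≢0)) = normalise-normal (proj₁ ne ∘ g≡0) , (leading (g e) *ᴱ x , shift⁺ (leading≢0 (g e)) Bx , x≢0 ∘ zero-product (leading≢0 (g e)))
      -- As `g` is E-linear and injective, `vs` and its image satisfy the same E-linear relations,
      -- so the relation vector `a` is unchanged.
      move-live {inj₂ U} (vs , (a , Pa , rel , only) , refl) = Vec.map g vs
        , (a , Pa , trans (comb-map {V} {V} g-linear a vs) (trans (cong g rel) (Linear.0-homo g-linear)) , λ c eq → only c (g≡0 (trans (sym (comb-map {V} {V} g-linear c vs)) eq)))
        , Powerset-ext (λ v v∈ → into (∈-⟦⟧ᴾ⁻ (Span? V (Vec.map g vs)) v∈)) (λ v v∈ → onto (∈-⟦⟧ᴾ⁻ (image? ⟦ Span? V vs ⟧ᴾ) v∈))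
        where
        into : ∀ {v} → Span V (Vec.map g vs) v → v ∈ᴾ ⟦ image? ⟦ Span? V vs ⟧ᴾ ⟧ᴾ
        into (c , cK , refl) = ∈-⟦⟧ᴾ⁺ (image? ⟦ Span? V vs ⟧ᴾ) (comb V c vs , ∈-⟦⟧ᴾ⁺ (Span? V vs) (c , cK , refl) , sym (comb-map {V} {V} g-linear c vs))
        onto : ∀ {v} → ∃[ u ] u ∈ᴾ ⟦ Span? V vs ⟧ᴾ × g u ≡ v → v ∈ᴾ ⟦ Span? V (Vec.map g vs) ⟧ᴾ
        onto (u , u∈ , refl) with c , cK , refl ← ∈-⟦⟧ᴾ⁻ (Span? V vs) u∈ = ∈-⟦⟧ᴾ⁺ (Span? V (Vec.map g vs)) (c , cK , comb-map {V} {V} g-linear c vs)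

      move-injective : ∀ {y z} → Live y → Live z → move y ≡ move z → y ≡ z
      move-injective {inj₁ (e , i)} {inj₁ (f , j)} (ne , _) (nf , _) eq = lemma (proj₂ (normal-unique ne nf (leading≢0 (g f)) (leading≢0 (g e)) (g-injective scaled))) (cong proj₂ (inj₁-injective eq))
        where
        open ≡-Reasoning
        a = leading (g e)
        b = leading (g f)
        -- Since `g e` and `g f` have a common normal vector, each becomes the same multiple of it
        -- when scaled by the leading coordinate of the other. Injectivity of `g` then makes `e` and
        -- `f` proportional, hence equal as normal vectors.
        scaled : g (scale m b e) ≡ g (scale m a f)
        scaled = begin
          g (scale m b e)                                ≡⟨ Linear.·-homo g-linear b e ⟩
          scale m b (g e)                                ≡⟨ cong (scale m b) (sym (normalise-scale (g e))) ⟩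
          scale m b (scale m a (normalise (g e)))        ≡⟨ trans (sym (·-assoc b a _)) (trans (cong (λ c → scale m c (normalise (g e))) (R.*-comm b a)) (·-assoc a b _)) ⟩
          scale m a (scale m b (normalise (g e)))        ≡⟨ cong (λ v → scale m a (scale m b v)) (cong proj₁ (inj₁-injective eq)) ⟩
          scale m a (scale m b (normalise (g f)))        ≡⟨ cong (scale m a) (normalise-scale (g f)) ⟩
          scale m a (g f)                                ≡⟨ sym (Linear.·-homo g-linear a f) ⟩
          g (scale m a f)                                ∎
        lemma : e ≡ f → shift (leading≢0 (g e)) i ≡ shift (leading≢0 (g f)) j → inj₁ (e , i) ≡ inj₁ (f , j)
        lemma refl eq = cong (λ i → inj₁ (e , i)) (shift-injective (leading≢0 (g e)) eq)
      move-injective {inj₂ U} {inj₂ U′} _ _ eq = cong inj₂ (Powerset-ext (sub (inj₂-injective eq)) (sub (sym (inj₂-injective eq))))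
        where
        sub : ∀ {U U′} → ⟦ image? U ⟧ᴾ ≡ ⟦ image? U′ ⟧ᴾ → ∀ v → v ∈ᴾ U → v ∈ᴾ U′
        sub {U} {U′} eq v v∈ with u , u∈ , gu≡gv ← ∈-⟦⟧ᴾ⁻ (image? U′) (subst (g v ∈ᴾ_) eq (∈-⟦⟧ᴾ⁺ (image? U) (v , v∈ , refl))) = subst (_∈ᴾ U′) (g-injective gu≡gv) u∈


    -- A basis of the block has at least two vectors. On a single E-line they would be F-independent
    -- and proportional over E, against `good-scattered`. This keeps the two kinds of blocks apart
    -- in the proof of simplicity.
    good-not-line : ∀ {e U} → GoodBlock F adm V U → ¬ (∀ v → v ∈ᴾ U → ∃[ α ] scale m α e ≡ v)
    good-not-line {e} {U} good on-line = go (goodblock-basis F adm V good)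
      where
      go : Σ[ vs ∈ Vec Carrierᴹ (n + 2) ] IsBasis V (_∈ᴾ U) vs → ⊥
      go (vs , vs∈ , ind , _) = split n vs vs∈ ind
        where
        split : ∀ n (vs : Vec Carrierᴹ (n + 2)) → All (_∈ᴾ U) vs → Indep V vs → ⊥
        split zero (x ∷ y ∷ []) (x∈ ∷ y∈ ∷ []) ind = both x∈ y∈ (on-line x x∈) (on-line y y∈) ind
          where
          both : ∀ {x y} → x ∈ᴾ U → y ∈ᴾ U → ∃[ α ] scale m α e ≡ x → ∃[ β ] scale m β e ≡ y → ¬ Indep V (x ∷ y ∷ [])
          both x∈ y∈ (α , refl) (β , refl) ind with α ≟ 0ᴱ
          ... | yes refl = x≢0 ind (·-zeroˡ e)
          ... | no α≢0   = proportional good x∈ y∈ ind (β *ᴱ inv α , trans (sym (·-assoc (β *ᴱ inv α) α e)) (cong (λ β → scale m β e)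
                (trans (R.*-assoc β (inv α) α) (trans (cong (β *ᴱ_) (trans (R.*-comm (inv α) α) (inv-inverse α≢0))) (R.*-identityʳ β)))))
            where
            proportional : GoodBlock F adm V U → ∀ {x y} → x ∈ᴾ U → y ∈ᴾ U → Indep V (x ∷ y ∷ []) → ¬ (∃[ γ ] scale m γ x ≡ y)
            proportional (vs , good , refl) x∈ y∈ ind (γ , refl) = good-scattered F adm V good (span∈⁻ F adm V x∈) (span∈⁻ F adm V y∈) ind
        split (suc n) (v ∷ vs) (_ ∷ vs∈) ind = split n vs vs∈ (indep-tail V ind)

    on-injective : (∀ i j → (∀ x → B i x → B j x) → (∀ x → B j x → B i x) → i ≡ j) →
                   ∀ {y z} → Live y → Live z → (∀ v → On y v → On z v) → (∀ v → On z v → On y v) → y ≡ z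
    -- The nonzero point `x` of block `i` gives a nonzero vector on both lines, so their normal
    -- vectors agree and the question reduces to the given design.
    on-injective simple {inj₁ (e , i)} {inj₁ (f , j)} (ne , (x , Bx , x≢0)) (nf , _) yz zy with yz (scale m x e) (x , Bx , refl)
    ... | α , Bα , eq with normal-unique nf ne (λ { refl → x≢0 (scale-injective (proj₁ ne) (trans (sym eq) (trans (·-zeroˡ f) (sym (·-zeroˡ e))))) }) x≢0 eq
    ...   | _ , refl = cong (λ i → inj₁ (e , i)) (simple i j (λ x Bx → on-line nf (yz _ (x , Bx , refl))) (λ x Bx → on-line ne (zy _ (x , Bx , refl))))
    on-injective simple {inj₁ (e , i)} {inj₂ U} _ good yz zy = ⊥-elim (good-not-line {e} good (λ v v∈ → let α , _ , eq = zy v v∈ in α , eq))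
    on-injective simple {inj₂ U} {inj₁ (f , j)} good _ yz zy = ⊥-elim (good-not-line {f} good (λ v v∈ → let α , _ , eq = yz v v∈ in α , eq))
    on-injective simple {inj₂ U} {inj₂ U′} _ _ yz zy = cong inj₂ (Powerset-ext yz zy)

-- Passage from the given fields to propositional equality

-- A finite field carried by Fin N, in which equality is propositional.
module Tabulated (E : Field) {N : ℕ} (order-E : HasOrder E N) where
  private module E = Field E
  open Inverse order-E public using (to; from; to-cong; from-cong)

  to-from : ∀ x → to (from x) ≡ x
  to-from = Inverse.strictlyInverseˡ order-E

  from-to : ∀ a → from (to a) E.≈ a
  from-to = Inverse.strictlyInverseʳ order-E

  from-injective : ∀ {x y} → from x E.≈ from y → x ≡ y
  from-injective {x} {y} eq = trans (sym (to-from x)) (trans (to-cong eq) (to-from y))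

  to-injective : ∀ {a b} → to a ≡ to b → a E.≈ b
  to-injective {a} {b} eq = E.trans (E.sym (from-to a)) (E.trans (from-cong eq) (from-to b))

  rawRing : RawRing 0ℓ 0ℓ
  rawRing = record
    { Carrier = Fin N ; _≈_ = _≡_
    ; _+_ = λ x y → to (from x E.+ from y) ; _*_ = λ x y → to (from x E.* from y)
    ; -_ = λ x → to (E.- from x) ; 0# = to E.0# ; 1# = to E.1# }

  private
    from-monomorphism : RingMorphisms.IsRingMonomorphism rawRing E.rawRing from
    from-monomorphism = record
      { isRingHomomorphism = record
        { isSemiringHomomorphism = record
          { isNearSemiringHomomorphism = record
            { +-isMonoidHomomorphism = record
              { isMagmaHomomorphism = record { isRelHomomorphism = record { cong = from-cong } ; homo = λ _ _ → from-to _ }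
              ; ε-homo = from-to _ }
            ; *-homo = λ _ _ → from-to _ }
          ; 1#-homo = from-to _ }
        ; -‿homo = λ _ → from-to _ }
      ; injective = from-injective }

  finiteField : FiniteField
  finiteField = record
    { Carrierᴱ = Fin N
    ; isCommutativeRing = RingMonomorphism.isCommutativeRing from-monomorphism E.isCommutativeRing
    ; 0≢1 = λ eq → E.0≉1 (to-injective eq)
    ; recip = λ x x≢0 → let y , eq = E.inverse (from x) (λ z → x≢0 (trans (sym (to-from x)) (to-cong z)))
                        in to y , to-cong (E.trans (E.*-congˡ (from-to y)) eq)
    ; finiteᴱ = finite-Fin }

  open FiniteField finiteField

  to-+ : ∀ a b → to (a E.+ b) ≡ to a +ᴱ to b
  to-+ a b = to-cong (E.sym (E.+-cong (from-to a) (from-to b)))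

  to-* : ∀ a b → to (a E.* b) ≡ to a *ᴱ to b
  to-* a b = to-cong (E.sym (E.*-cong (from-to a) (from-to b)))

  to-neg : ∀ a → to (E.- a) ≡ -ᴱ to a
  to-neg a = to-cong (E.sym (E.-‿cong (from-to a)))

module Bridge {F E : Field} {q N : ℕ} (order-F : HasOrder F q) (order-E : HasOrder E N) (ι : FieldHom F E) where
  private
    module F = Field F
    module E = Field E
    module ι = FieldHom ι
    module TF = Tabulated F order-F
  open Tabulated E order-E public
  open FiniteField finiteField
  open Spaces finiteField

  scalar : F.Carrier → Fin N
  scalar a = to ι.⟦ a ⟧

  scalar-cong : ∀ {a b} → a F.≈ b → scalar a ≡ scalar b
  scalar-cong = to-cong ∘ ι.⟦⟧-cong

  -- A nonzero difference a - b would have an inverse in F, while its image in E is 0, and then 1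
  -- would be mapped to 0.
  scalar-injective : ∀ {a b} → scalar a ≡ scalar b → a F.≈ b
  scalar-injective {a} {b} eq with TF.to (a F.+ F.- b) ≟ TF.to F.0#
  ... | yes z = F-cancel (TF.to-injective z)
    where
    F-cancel : a F.+ F.- b F.≈ F.0# → a F.≈ b
    F-cancel = x∙y⁻¹≈ε⇒x≈y a b
      where open import Algebra.Properties.Group F.+-group using (x∙y⁻¹≈ε⇒x≈y)
  ... | no nz with y , inverse ← F.inverse (a F.+ F.- b) (nz ∘ TF.to-cong) = ⊥-elim (E.0≉1 (E.trans (E.sym zero-image) (E.trans (ι.⟦⟧-cong inverse) ι.1#-homo)))
    where
    difference : ι.⟦ a F.+ F.- b ⟧ E.≈ E.0#
    difference = E.trans (ι.+-homo a (F.- b)) (E.trans (E.+-cong (to-injective eq) (ι.-‿homo b)) (E.-‿inverseʳ ι.⟦ b ⟧))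
    zero-image : ι.⟦ (a F.+ F.- b) F.* y ⟧ E.≈ E.0#
    zero-image = E.trans (ι.*-homo _ y) (E.trans (E.*-congʳ difference) (E.zeroˡ _))

  subfield : Subfield
  subfield = record
    { _∈K  = λ x → ∃[ a ] scalar a ≡ x
    ; _∈K? = λ x → map′ (λ (i , p) → TF.from i , p) (λ (a , p) → TF.to a , trans (scalar-cong (TF.from-to a)) p) (∃? (λ i → scalar (TF.from i) ≟ x))
    ; 0∈K  = F.0# , to-cong ι.0#-homo
    ; 1∈K  = F.1# , to-cong ι.1#-homo
    ; +∈K  = λ { (a , refl) (b , refl) → a F.+ b , trans (to-cong (ι.+-homo a b)) (to-+ _ _) }
    ; *∈K  = λ { (a , refl) (b , refl) → a F.* b , trans (to-cong (ι.*-homo a b)) (to-* _ _) }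
    ; -∈K  = λ { (a , refl) → F.- a , trans (to-cong (ι.-‿homo a)) (to-neg _) }
    ; recip∈K = recip∈ }
    where
    open FieldTheory finiteField using (*ᴱ-cancelˡ)
    recip∈ : ∀ {x y} → ∃[ a ] scalar a ≡ x → x *ᴱ y ≡ 1ᴱ → ∃[ b ] scalar b ≡ y
    recip∈ {y = y} (a , refl) xy≡1 with TF.to a ≟ TF.to F.0#
    ... | yes z = ⊥-elim (0≢1 (trans (sym (R.zeroˡ y)) (trans (cong (_*ᴱ y) (sym (trans (scalar-cong (TF.to-injective z)) (to-cong ι.0#-homo)))) xy≡1)))
    ... | no nz with b , ab≈1 ← F.inverse a (nz ∘ TF.to-cong) = b , *ᴱ-cancelˡ {scalar a} (λ z → nz (TF.to-cong (scalar-injective (trans z (sym (to-cong ι.0#-homo))))))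
          (trans (sym (to-* _ _)) (trans (to-cong (E.trans (E.sym (ι.*-homo a b)) (E.trans (ι.⟦⟧-cong ab≈1) ι.1#-homo))) (sym xy≡1)))

  order-subfield : Subfield.order subfield ≡ q
  order-subfield = trans (count-bij (Subfield._∈K? subfield) (λ (_ : Fin q) → yes tt) (λ x i → scalar (TF.from i) ≟ x)
    (λ { x i refl → (TF.from i , refl) , tt }) (λ { x (a , refl) → TF.to a , scalar-cong (TF.from-to a) })
    (λ { x i j refl eq → TF.from-injective (scalar-injective (sym eq)) })
    (λ i _ → scalar (TF.from i) , refl) (λ { x y i refl refl → refl })) count-all

  open Over subfield

  -- An F-linear isomorphism from a setoid space to one with propositional equality. F acts on the
  -- latter through its image in E, so subspaces and bases over `subfield` correspond to those over
  -- F.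
  record Encoding (W : VectorSpace F) (V : Space) : Set where
    private
      module W = LeftModule W
      module V = Space V
    field
      enc     : W.Carrierᴹ → Points V
      dec     : Points V → W.Carrierᴹ
      enc-cong : ∀ {w w′} → w W.≈ᴹ w′ → enc w ≡ enc w′
      enc-dec : ∀ v → enc (dec v) ≡ v
      dec-enc : ∀ w → dec (enc w) W.≈ᴹ w
      enc-0   : enc W.0ᴹ ≡ V.0ᴹ
      enc-+   : ∀ w w′ → enc (w W.+ᴹ w′) ≡ enc w V.+ᴹ enc w′
      enc-·   : ∀ a w → enc (a W.*ₗ w) ≡ scalar a V.· enc w

    enc-injective : ∀ {w w′} → enc w ≡ enc w′ → w W.≈ᴹ w′
    enc-injective {w} {w′} eq = W.≈ᴹ-trans (W.≈ᴹ-sym (dec-enc w)) (W.≈ᴹ-trans (W.≈ᴹ-reflexive (cong dec eq)) (dec-enc w′))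

    dec-0 : dec V.0ᴹ W.≈ᴹ W.0ᴹ
    dec-0 = enc-injective (trans (enc-dec _) (sym enc-0))

    dec-+ : ∀ v v′ → dec (v V.+ᴹ v′) W.≈ᴹ dec v W.+ᴹ dec v′
    dec-+ v v′ = enc-injective (trans (enc-dec _) (sym (trans (enc-+ _ _) (cong₂ V._+ᴹ_ (enc-dec v) (enc-dec v′)))))

    dec-· : ∀ a v → dec (scalar a V.· v) W.≈ᴹ a W.*ₗ dec v
    dec-· a v = enc-injective (trans (enc-dec _) (sym (trans (enc-· a _) (cong (scalar a V.·_) (enc-dec v)))))

    enc-combination : ∀ {n} (c : Vector F.Carrier n) (b : Vector W.Carrierᴹ n) →
                      enc (combination F W c b) ≡ comb V (Vec.tabulate (scalar ∘ c)) (Vec.tabulate (enc ∘ b))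
    enc-combination {zero}  c b = enc-0
    enc-combination {suc n} c b = trans (enc-+ _ _) (cong₂ V._+ᴹ_ (enc-· _ _) (enc-combination (c ∘ suc) (b ∘ suc)))

    subspace : {U : Points V → Set} → IsSubspace V U → Subspace F W
    subspace {U} (0∈ , +∈ , ·∈) = record
      { carrier  = U ∘ enc
      ; resp     = λ eq → subst U (enc-cong eq)
      ; 0-closed = subst U (sym enc-0) 0∈
      ; +-closed = λ x∈ y∈ → subst U (sym (enc-+ _ _)) (+∈ _ _ x∈ y∈)
      ; *-closed = λ a x∈ → subst U (sym (enc-· a _)) (·∈ _ _ (a , refl) x∈) }

    subspace⁻ : (S : Subspace F W) → IsSubspace V (Subspace.carrier S ∘ dec)
    subspace⁻ S = resp (W.≈ᴹ-sym dec-0) 0-closed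
      , (λ x y x∈ y∈ → resp (W.≈ᴹ-sym (dec-+ x y)) (+-closed x∈ y∈))
      , (λ { _ x (a , refl) x∈ → resp (W.≈ᴹ-sym (dec-· a x)) (*-closed a x∈) })
      where open Subspace S

    scalars : ∀ {n} {c : Vec (Fin N) n} → AllK c → ∃[ c′ ] Vec.tabulate (scalar ∘ c′) ≡ c
    scalars []              = (λ ()) , refl
    scalars ((a , eq) ∷ ps) = let c′ , eqs = scalars ps in (λ { zero → a ; (suc i) → c′ i }) , cong₂ _∷_ eq eqs

    scalars∈K : ∀ {n} (c : Vector F.Carrier n) → AllK (Vec.tabulate (scalar ∘ c))
    scalars∈K c = All.tabulate⁺ (λ i → c i , refl)

    private
      tabulate-zeros : ∀ {n} {c : Vector (Fin N) n} → (∀ i → c i ≡ 0ᴱ) → Vec.tabulate c ≡ zeros n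
      tabulate-zeros {zero}  eq = refl
      tabulate-zeros {suc n} eq = cong₂ _∷_ (eq zero) (tabulate-zeros (eq ∘ suc))

      tabulate-zeros⁻ : ∀ {n} {c : Vector (Fin N) n} → Vec.tabulate c ≡ zeros n → ∀ i → c i ≡ 0ᴱ
      tabulate-zeros⁻ eq zero    = cong Vec.head eq
      tabulate-zeros⁻ eq (suc i) = tabulate-zeros⁻ (cong Vec.tail eq) i

    dimension : ∀ {U : Points V → Set} {d} {vs : Vec (Points V) d} → IsBasis V U vs → HasDimension F W (U ∘ enc) d
    dimension {U} {d} {vs} (vs∈ , ind , spans) = dec ∘ Vec.lookup vs , record
      { members = λ i → subst U (sym (enc-dec _)) (All.lookup⁺ vs∈ i)
      ; independent = λ c eq i → scalar-injective (trans (tabulate-zeros⁻ (ind _ (scalars∈K c) (trans (sym (encode c)) (trans (enc-cong eq) enc-0))) i) (sym (to-cong ι.0#-homo)))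
      ; spanning = λ x x∈ → let c , cK , eq = spans (enc x) x∈ ; c′ , c≡ = scalars cK in
          c′ , enc-injective (trans (sym eq) (trans (cong (λ c → comb V c vs) (sym c≡)) (sym (encode c′)))) }
      where
      encode : ∀ c → enc (combination F W c (dec ∘ Vec.lookup vs)) ≡ comb V (Vec.tabulate (scalar ∘ c)) vs
      encode c = trans (enc-combination c _) (cong (comb V (Vec.tabulate (scalar ∘ c)))
        (trans (Vec.tabulate-cong (λ i → enc-dec _)) (Vec.tabulate∘lookup vs)))

    dimension⁻ : ∀ {P : Pred W.Carrierᴹ 0ℓ} {d} {b : Vector W.Carrierᴹ d} → (∀ {x y} → x W.≈ᴹ y → P x → P y) →
                 IsBasisOf F W P b → IsBasis V (P ∘ dec) (Vec.tabulate (enc ∘ b))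
    dimension⁻ {P} {d} {b} resp basis = All.tabulate⁺ (λ i → resp (W.≈ᴹ-sym (dec-enc _)) (members i)) , indep
      , λ x x∈ → let c , eq = spanning (dec x) x∈ in _ , scalars∈K c , trans (sym (enc-combination c b)) (trans (sym (enc-cong eq)) (enc-dec x))
      where
      open IsBasisOf basis
      indep : Indep V (Vec.tabulate (enc ∘ b))
      indep c cK eq with c′ , refl ← scalars cK = tabulate-zeros (λ i → trans (scalar-cong (independent c′ (enc-injective (trans (enc-combination c′ b) (trans eq (sym enc-0)))) i)) (to-cong ι.0#-homo))

  line : Encoding (extension ι) regular
  line = record
    { enc = to ; dec = from ; enc-cong = to-cong ; enc-dec = to-from ; dec-enc = from-to ; enc-0 = refl
    ; enc-+ = to-+ ; enc-· = λ a w → to-* ι.⟦ a ⟧ w }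

  tabulate-scale : ∀ {m} a (w : Vector E.Carrier m) → Vec.tabulate (λ i → to (a E.* w i)) ≡ scale m (to a) (Vec.tabulate (to ∘ w))
  tabulate-scale {zero}  a w = refl
  tabulate-scale {suc m} a w = cong₂ _∷_ (to-* _ _) (tabulate-scale a (w ∘ suc))

  space : ∀ m → Encoding (extensionPower ι m) (regular ^ˢ m)
  space m = record
    { enc = λ w → Vec.tabulate (to ∘ w) ; dec = λ v → from ∘ Vec.lookup v
    ; enc-cong = λ eq → Vec.tabulate-cong (to-cong ∘ eq)
    ; enc-dec = λ v → trans (Vec.tabulate-cong (λ i → to-from _)) (Vec.tabulate∘lookup v)
    ; dec-enc = λ w i → E.trans (from-cong (Vec.lookup∘tabulate (to ∘ w) i)) (from-to (w i))
    ; enc-0 = zeros≡ m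
    ; enc-+ = λ w w′ → add≡ w w′
    ; enc-· = λ a w → tabulate-scale ι.⟦ a ⟧ w }
    where
    zeros≡ : ∀ m → Vec.tabulate {n = m} (λ _ → to E.0#) ≡ zeros m
    zeros≡ zero    = refl
    zeros≡ (suc m) = cong (0ᴱ ∷_) (zeros≡ m)
    add≡ : ∀ {m} (w w′ : Vector E.Carrier m) → Vec.tabulate (λ i → to (w i E.+ w′ i)) ≡ add m (Vec.tabulate (to ∘ w)) (Vec.tabulate (to ∘ w′))
    add≡ {zero}  w w′ = refl
    add≡ {suc m} w w′ = cong₂ _∷_ (to-+ _ _) (add≡ (w ∘ suc) (w′ ∘ suc))

-- The extended design

opaque
  unfolding Summation.total

  cardinality : ∀ {n} (I : Subset n) → card I ≡ count (λ i → i ∈ˢ? I)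
  cardinality []          = refl
  cardinality (true ∷ I)  = cong suc (trans (cardinality I) (sum-cong-≗ (λ i → ind-cong (i ∈ˢ? I) (suc i ∈ˢ? (true ∷ I)) there (λ { (there p) → p }))))
    where open CMSum ℕ.+-0-commutativeMonoid using (sum-cong-≗)
  cardinality (false ∷ I) = trans (cardinality I) (sum-cong-≗ (λ i → ind-cong (i ∈ˢ? I) (suc i ∈ˢ? (false ∷ I)) there (λ { (there p) → p })))
    where open CMSum ℕ.+-0-commutativeMonoid using (sum-cong-≗)

module _ {n : ℕ} {P : Fin n → Set} (P? : ∀ i → Dec (P i)) where

  subset : Subset n
  subset = Vec.tabulate (does ∘ P?)

  ∈-subset⁺ : ∀ i → P i → i ∈ˢ subset
  ∈-subset⁺ i p = Vec.lookup⇒[]= i subset (trans (Vec.lookup∘tabulate (does ∘ P?) i) (dec-true (P? i) p))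

  ∈-subset⁻ : ∀ i → i ∈ˢ subset → P i
  ∈-subset⁻ i i∈ = proof (P? i) (trans (sym (Vec.lookup∘tabulate (does ∘ P?) i)) (Vec.[]=⇒lookup i∈))
    where
    proof : (d : Dec (P i)) → does d ≡ true → P i
    proof (yes p) _ = p

  card-subset : card subset ≡ count P?
  card-subset = trans (cardinality subset) (count-cong (λ i → i ∈ˢ? subset) P? ∈-subset⁻ ∈-subset⁺)

module Construction {F E : Field} {q l : ℕ} (order-F : HasOrder F q) (order-E : HasOrder E (q ^ l)) (ι : FieldHom F E) where
  open Bridge {F} {E} order-F order-E ι
  open FiniteField finiteField
  open Spaces finiteField
  open Over subfield
  open Assembly finiteField
  open Blocks finiteField using (Admissible)
  private
    module E = Field E
    module line = Encoding line

  module _ {K : Pred ℕ 0ℓ} {Λ : ℕ} (D : qPBD F (extension ι) l K Λ) (admits : Admits F (extension ι) D (SingerCycle ι)) where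
    open qPBD D
    private
      module Blk i = Subspace (block i)

      multiplication : ∀ a → ¬ a E.≈ E.0# → GL F (extension ι)
      multiplication a a≉0 = record
        { apply = a E.*_
        ; isIsomorphism = record
          { isLeftModuleMonomorphism = record
            { isLeftModuleHomomorphism = record
              { +ᴹ-isGroupHomomorphism = record
                { isMonoidHomomorphism = record
                  { isMagmaHomomorphism = record { isRelHomomorphism = record { cong = E.*-congˡ } ; homo = E.distribˡ a }
                  ; ε-homo = E.zeroʳ a }
                ; ⁻¹-homo = λ x → E.sym (-‿distribʳ-* a x) }
              ; *ₗ-homo = λ c x → E.trans (E.sym (E.*-assoc a _ x)) (E.trans (E.*-congʳ (E.*-comm a _)) (E.*-assoc _ a x)) }
            ; injective = λ {x} {y} eq → E.trans (E.sym (cancel x)) (E.trans (E.*-congˡ eq) (cancel y)) }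
          ; surjective = λ y → a⁻¹ E.* y , λ z≈ → E.trans (E.*-congˡ z≈) (E.trans (E.sym (E.*-assoc a a⁻¹ y)) (E.trans (E.*-congʳ aa⁻¹≈1) (E.*-identityˡ y))) } }
        where
        open import Algebra.Properties.Ring E.ring using (-‿distribʳ-*)
        a⁻¹ : E.Carrier
        a⁻¹ = proj₁ (E.inverse a a≉0)
        aa⁻¹≈1 : a E.* a⁻¹ E.≈ E.1#
        aa⁻¹≈1 = proj₂ (E.inverse a a≉0)
        cancel : ∀ x → a⁻¹ E.* (a E.* x) E.≈ x
        cancel x = E.trans (E.sym (E.*-assoc a⁻¹ a x)) (E.trans (E.*-congʳ (E.trans (E.*-comm a⁻¹ a) aa⁻¹≈1)) (E.*-identityˡ x))

      from≉0 : ∀ {a} → a ≢ 0ᴱ → ¬ from a E.≈ E.0#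
      from≉0 {a} a≢0 z = a≢0 (trans (sym (to-from a)) (to-cong z))

      preserved : ∀ {a} (a≢0 : a ≢ 0ᴱ) → Preserves F (extension ι) D (multiplication (from a) (from≉0 a≢0))
      preserved {a} a≢0 = admits (multiplication (from a) (from≉0 a≢0)) (from a , from≉0 a≢0 , λ _ → E.refl)

    design : Design subfield K Λ
    design = record
      { #blocks = #blocks
      ; B = λ i x → blockSet i (from x)
      -- Block membership is given only as a predicate. It becomes decidable through the basis that
      -- `block-dimension` provides, as membership in a span in a finite space.
      ; B? = λ i x → map′ (Span⊆ regular (line.subspace⁻ (block i)) (proj₁ (basisOf i)) x) (proj₂ (proj₂ (basisOf i)) x) (Span? regular _ x)
      ; B-sub = λ i → line.subspace⁻ (block i)
      ; B-basis = λ i → let d , Kd , _ = block-dimension i in d , Kd , _ , basisOf i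
      -- The span of α and β is the 2-dimensional subspace to which the given balance condition is
      -- applied; a block contains it exactly when it contains α and β.
      ; balanced = λ {α} {β} indep → let I , card≡ , ⇔ = balanced (line.subspace (Span-isSubspace regular (α ∷ β ∷ [])))
                                                          (line.dimension (All-Span regular (α ∷ β ∷ []) , indep , λ _ → id)) in
          trans (count-cong _ (λ i → i ∈ˢ? I)
            (λ i (Bα , Bβ) → Equivalence.from (⇔ i) (λ {x} x∈ → Blk.resp i (from-to x) (Span⊆ regular (line.subspace⁻ (block i)) (Bα ∷ Bβ ∷ []) (to x) x∈)))
            (λ i i∈ → let ⊆ = Equivalence.to (⇔ i) i∈ in ⊆ (subst (Span regular (α ∷ β ∷ [])) (sym (to-from α)) (Span-head regular)) , ⊆ (subst (Span regular (α ∷ β ∷ [])) (sym (to-from β)) (Span-∷ regular (Span-head regular)))))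
            (trans (sym (cardinality I)) card≡)
      ; shift = λ a≢0 i → proj₁ (preserved a≢0) ⟨$⟩ʳ i
      ; shift-injective = λ a≢0 eq → let π = proj₁ (preserved a≢0) in trans (sym (Inverse.strictlyInverseʳ π _)) (trans (cong (Inverse.from π) eq) (Inverse.strictlyInverseʳ π _))
      ; shift⁺ = λ {a} a≢0 {i} {x} Bx → Blk.resp _ (E.sym (from-to _)) (proj₁ (proj₂ (preserved a≢0) i) (from x , Bx , E.refl))
      ; shift⁻ = λ {a} a≢0 {i} {x} Bax → let y , By , eq = proj₂ (proj₂ (preserved a≢0) i) Bax in
          Blk.resp i (cancel a≢0 (E.trans eq (from-to _))) By }
      where
      basisOf : ∀ i → IsBasis regular (λ x → blockSet i (from x)) (Vec.tabulate (to ∘ proj₁ (proj₂ (proj₂ (block-dimension i)))))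
      basisOf i = line.dimension⁻ (Blk.resp i) (proj₂ (proj₂ (proj₂ (block-dimension i))))
      cancel : ∀ {a x y} → a ≢ 0ᴱ → from a E.* y E.≈ from a E.* x → y E.≈ x
      cancel {a} {x} {y} a≢0 eq with a⁻¹ , aa⁻¹≈1 ← E.inverse (from a) (from≉0 a≢0) = E.trans (E.sym (undo y)) (E.trans (E.*-congˡ eq) (undo x))
        where
        undo : ∀ z → a⁻¹ E.* (from a E.* z) E.≈ z
        undo z = E.trans (E.sym (E.*-assoc a⁻¹ (from a) z)) (E.trans (E.*-congʳ (E.trans (E.*-comm a⁻¹ (from a)) aa⁻¹≈1)) (E.*-identityˡ z))

    simple-design : IsSimple F (extension ι) D → ∀ i j → (∀ x → blockSet i (from x) → blockSet j (from x)) →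
                    (∀ x → blockSet j (from x) → blockSet i (from x)) → i ≡ j
    simple-design simple i j ij ji = simple i j (include i j ij , include j i ji)
      where
      include : ∀ i j → (∀ x → blockSet i (from x) → blockSet j (from x)) → ∀ {x} → blockSet i x → blockSet j x
      include i j ij {x} x∈ = Blk.resp j (from-to x) (ij (to x) (Blk.resp i (E.sym (from-to x)) x∈))

    module _ (m n : ℕ) {P : Vec Carrierᴱ (n + 2) → Set} (adm : Admissible subfield (n + 2) P) (through : Through-number design m n adm) where

      private
        module space = Encoding (space m)
        V : Space
        V = regular ^ˢ m
        open Space V using (Carrierᴹ)
        W = extensionPower ι m
        module W = LeftModule W
        module Live = Enumeration (enumerate (Live? design m n adm))

      extended : qPBD F W (m * l) (K ∪ ｛ n + 2 ｝) Λ
      extended = record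
        { dimension = let vs , basis = basis-of-size V {λ _ → ⊤} (λ _ → yes tt) (tt , (λ _ _ _ _ → tt) , λ _ _ _ _ → tt) (m * l) size-V
                          b , isBasis = space.dimension basis
                          open IsBasisOf isBasis
                      in b , record { members = λ _ → tt ; independent = independent ; spanning = λ x _ → spanning x tt }
        ; #blocks = count (Live? design m n adm)
        ; block = λ j → space.subspace (on-subspace design m n adm (Live.at-sound j))
        ; block-dimension = λ j → let d , Kd , vs , basis = on-basis design m n adm (Live.at-sound j) in d , Kd , space.dimension basis
        ; balanced = balanced′ }
        where
        size-V : count (λ (_ : Carrierᴹ) → yes tt) ≡ Subfield.order subfield ^ (m * l)
        size-V = begin
          count (λ (_ : Carrierᴹ) → yes tt)        ≡⟨ count-all ⟩
          size {Carrierᴹ}                          ≡⟨ size-Vec m ⟩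
          (q ^ l) ^ m                              ≡⟨ trans (ℕ.^-*-assoc q l m) (cong (q ^_) (ℕ.*-comm l m)) ⟩
          q ^ (m * l)                              ≡⟨ cong (_^ (m * l)) (sym order-subfield) ⟩
          Subfield.order subfield ^ (m * l)        ∎
          where open ≡-Reasoning
        balanced′ : ∀ S → HasDimension F W (Subspace.carrier S) 2 →
                    ∃[ I ] card I ≡ Λ × (∀ j → j ∈ˢ I ⇔ Subspace.carrier S ⊆ (On design m n adm (Live.at j) ∘ space.enc))
        balanced′ S (b , isBasis) = subset covers? , trans (card-subset covers?) (trans enumerated (count-covers design m n adm indep through))
          , λ j → mk⇔ {B = Subspace.carrier S ⊆ (On′ (Live.at j) ∘ space.enc)} (λ j∈ → contains j (∈-subset⁻ covers? j j∈)) (λ S⊆ → ∈-subset⁺ covers? j (basis-on j S⊆))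
          where
          open IsBasisOf isBasis
          x y : Carrierᴹ
          x = space.enc (b zero)
          y = space.enc (b (suc zero))
          encoded : IsBasis V (Subspace.carrier S ∘ space.dec) (x ∷ y ∷ [])
          encoded = space.dimension⁻ (Subspace.resp S) isBasis
          indep : Indep V (x ∷ y ∷ [])
          indep = proj₁ (proj₂ encoded)
          On′ = On design m n adm
          covers? : ∀ j → Dec (On′ (Live.at j) x × On′ (Live.at j) y)
          covers? j = On? design m n adm (Live.at j) x ×-dec On? design m n adm (Live.at j) y
          enumerated : count covers? ≡ count (Covers? design m n adm indep)
          enumerated = count-bij covers? (Covers? design m n adm indep) (λ j z → covers? j ×-dec (Live.at j ≟ z))
            (λ { j z (c , refl) → c , (Live.at-sound j , c) }) (λ j c → Live.at j , c , refl) (λ { j z z′ (_ , refl) (_ , refl) → refl })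
            (λ { z (live , c) → let j , eq = Live.at-complete z live in j , subst (λ z → On′ z x × On′ z y) (sym eq) c , eq })
            (λ { j j′ z (_ , eq) (_ , eq′) → Live.at-injective j j′ (trans eq (sym eq′)) })
          basis-on : ∀ j → Subspace.carrier S ⊆ (On′ (Live.at j) ∘ space.enc) → On′ (Live.at j) x × On′ (Live.at j) y
          basis-on j S⊆ = S⊆ {b zero} (members zero) , S⊆ {b (suc zero)} (members (suc zero))
          contains : ∀ j → On′ (Live.at j) x × On′ (Live.at j) y → ∀ {s} → Subspace.carrier S s → On′ (Live.at j) (space.enc s)
          contains j (ox , oy) {s} s∈ = Span⊆ V (on-subspace design m n adm (Live.at-sound j)) (ox ∷ oy ∷ []) (space.enc s)
            (proj₂ (proj₂ encoded) (space.enc s) (Subspace.resp S (W.≈ᴹ-sym (space.dec-enc s)) s∈))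

      extended-admits : Admits F W extended (GLₘ ι m)
      extended-admits g g∈ = proj₁ permuted , λ j → forward j , backward j
        where
        open GL g using (apply)
        open LeftModuleMorphisms.IsLeftModuleIsomorphism g∈ using (+ᴹ-homo; *ₗ-homo; injective; ⟦⟧-cong)
        On′ = On design m n adm
        g′ : Carrierᴹ → Carrierᴹ
        g′ v = space.enc (apply (space.dec v))
        g′-linear : Linear V V g′
        g′-linear = record
          { +-homo = λ v v′ → trans (space.enc-cong (W.≈ᴹ-trans (⟦⟧-cong (space.dec-+ v v′)) (+ᴹ-homo _ _))) (space.enc-+ _ _)
          ; ·-homo = λ a v → trans (space.enc-cong (W.≈ᴹ-trans (⟦⟧-cong (dec-scale a v)) (*ₗ-homo (from a) _)))
                              (trans (tabulate-scale (from a) _) (cong (λ c → scale m c (g′ v)) (to-from a))) }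
          where
          dec-scale : ∀ a v i → from (Vec.lookup (scale m a v) i) E.≈ from a E.* from (Vec.lookup v i)
          dec-scale a v i = E.trans (from-cong (Vec.lookup-map i (a *ᴱ_) v)) (from-to _)
        g′-injective : ∀ {v v′} → g′ v ≡ g′ v′ → v ≡ v′
        g′-injective {v} {v′} eq = trans (sym (space.enc-dec v)) (trans (space.enc-cong (injective (space.enc-injective eq))) (space.enc-dec v′))
        move′ = move design m n adm g′-linear g′-injective
        moved : ∀ j → ∃[ j′ ] Live.at j′ ≡ move′ (Live.at j)
        moved j = Live.at-complete (move′ (Live.at j)) (move-live design m n adm g′-linear g′-injective (Live.at-sound j))
        -- `move` is injective on the finite set of live indices and so permutes them. Working with
        -- indices instead of point sets preserves multiplicities.
        permuted : Σ[ π ∈ Permutation′ (count (Live? design m n adm)) ] (∀ j → π ⟨$⟩ʳ j ≡ proj₁ (moved j))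
        permuted = injective⇒permutation (proj₁ ∘ moved) (λ i j eq → Live.at-injective i j
          (move-injective design m n adm g′-linear g′-injective (Live.at-sound i) (Live.at-sound j)
            (trans (sym (proj₂ (moved i))) (trans (cong Live.at eq) (proj₂ (moved j))))))
        at-π : ∀ j → Live.at (proj₁ permuted ⟨$⟩ʳ j) ≡ move′ (Live.at j)
        at-π j = trans (cong Live.at (proj₂ permuted j)) (proj₂ (moved j))
        forward : ∀ j {y} → image F W apply (On′ (Live.at j) ∘ space.enc) y → On′ (Live.at (proj₁ permuted ⟨$⟩ʳ j)) (space.enc y)
        forward j {y} (x , x∈ , gx≈y) = subst₂ On′ (sym (at-π j)) (space.enc-cong (W.≈ᴹ-trans (⟦⟧-cong (space.dec-enc x)) gx≈y))
          (move-on⁺ design m n adm g′-linear g′-injective {Live.at j} x∈)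
        backward : ∀ j {y} → On′ (Live.at (proj₁ permuted ⟨$⟩ʳ j)) (space.enc y) → image F W apply (On′ (Live.at j) ∘ space.enc) y
        backward j {y} y∈ = let u , u∈ , eq = move-on⁻ design m n adm g′-linear g′-injective {Live.at j} (subst (λ z → On′ z (space.enc y)) (at-π j) y∈) in
          space.dec u , subst (On′ (Live.at j)) (sym (space.enc-dec u)) u∈ , space.enc-injective eq

      extended-simple : IsSimple F (extension ι) D → IsSimple F W extended
      extended-simple simple i j (ij , ji) = Live.at-injective i j (on-injective design m n adm (simple-design simple) (Live.at-sound i) (Live.at-sound j)
        (λ v v∈ → transport i j ij v v∈) (λ v v∈ → transport j i ji v v∈))
        where
        On′ = On design m n adm
        transport : ∀ i j → (∀ {w} → On′ (Live.at i) (space.enc w) → On′ (Live.at j) (space.enc w)) → ∀ v → On′ (Live.at i) v → On′ (Live.at j) v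
        transport i j ij v v∈ = subst (On′ (Live.at j)) (space.enc-dec v) (ij (subst (On′ (Live.at i)) (sym (space.enc-dec v)) v∈))

      extension-theorem : Σ[ D′ ∈ qPBD F W (m * l) (K ∪ ｛ n + 2 ｝) Λ ] (Admits F W D′ (GLₘ ι m) × (IsSimple F (extension ι) D → IsSimple F W D′))
      extension-theorem = extended , extended-admits , extended-simple

-- The number of blocks through a pair of rank 2, and the theorem

module Conclusion {F E : Field} {q l : ℕ} (order-F : HasOrder F q) (order-E : HasOrder E (q ^ l)) (ι : FieldHom F E) where
  open Bridge {F} {E} order-F order-E ι
  open FiniteField finiteField
  open Spaces finiteField
  open Families finiteField
  open Blocks finiteField
  open Relations finiteField
  open Assembly finiteField

  1<q : 1 < q
  1<q = subst (1 <_) order-subfield (Subfield.1<order subfield)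

  module _ {n m : ℕ} (1≤l : 1 ≤ l) (k≤ : n + 2 ≤ m + 1) {ε : ℕ} (ε≡ : ε ≡ 0 ⊎ ε ≡ 1)
           {w : ℕ → ℕ → ℕ} (fam : Family subfield (n + 2) l w) {K : Pred ℕ 0ℓ} {Λ : ℕ} (D : Design subfield K Λ) where
    open Family fam using (chosen; number)
    private
      k : ℕ
      k = n + 2
      adm : Admissible subfield k (Coefficients ε fam)
      adm = admissible ε fam
      V : Space
      V = regular ^ˢ m

    through-number : fromℕ Λ ≡ λ-value q m l k w ε → Through-number D m n adm
    through-number Λ≡ = record { through = λ x y indep → through-pair indep }
      where
      through-pair : ∀ {x y} → 𝔼.Indep V (x ∷ y ∷ []) → count (λ U → GoodBlock? subfield adm V U ×-dec ((x ∈ᴾ? U) ×-dec (y ∈ᴾ? U))) ≡ Λ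
      through-pair {x} {y} indep = fromℕ-injective {c} {Λ} (trans (sym (λ-count′ (ℕ.+-comm n 2) {λ r u → count (_∈ᴾ? chosen r u)} number′ M≡ counted)) (sym Λ≡))
        where
        M c : ℕ
        M = count (λ a → Admissible.decide adm a ×-dec ¬? (a ≟ zeros k))
        c = count (Through? subfield n adm V indep)
        -- The tuples have length `n + 2`, with the given pair at the end, whereas the arithmetic of
        -- λ is done for `2 + n`. Only numbers occur here, so the equation can be matched without
        -- touching the vectors.
        λ-count′ : ∀ {k} → k ≡ 2 + n → ∀ {#𝒜 : ℕ → ℕ → ℕ} → 
          (∀ r u → 2 ≤ r → r ≤ k ∸ 1 → u ∣ gcd (suc r) l → (q ^ u ∸ 1) * #𝒜 r u ≡ w r u * (q ^ l ∸ 1)) →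
          fromℕ M ≡ ∑ (range 2 (k ∸ 1)) (λ r → ∑ (divisors (gcd (suc r) l)) (λ u → fromℕ (#𝒜 r u * fall q (q ^ k) 0 (suc r)))) →
          (q ^ l ∸ 1) * (fall q (q ^ k) 2 n * c) ≡ (q ^ l ∸ 1) * (ε * fall (q ^ l) (q ^ (m * l)) 2 n) + M * fall (q ^ l) (q ^ (m * l)) 2 (n ∸ 1) →
          λ-value q m l k w ε ≡ fromℕ c
        λ-count′ refl {#𝒜} = λ-count n 1<q 1≤l (ℕ.≤-trans (ℕ.≤-reflexive (ℕ.+-comm 2 n)) k≤) {w} {#𝒜} {ε} {M} {c}
        number′ : ∀ r u → 2 ≤ r → r ≤ k ∸ 1 → u ∣ gcd (suc r) l → (q ^ u ∸ 1) * count (_∈ᴾ? chosen r u) ≡ w r u * (q ^ l ∸ 1)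
        number′ r u 2≤r r≤ u∣ = subst (λ Q → (Q ^ u ∸ 1) * count (_∈ᴾ? chosen r u) ≡ w r u * (q ^ l ∸ 1)) order-subfield (number r u 2≤r r≤ u∣)
        M≡ : fromℕ M ≡ ∑ (range 2 (k ∸ 1)) (λ r → ∑ (divisors (gcd (suc r) l)) (λ u → fromℕ (count (_∈ᴾ? chosen r u) * fall q (q ^ k) 0 (suc r))))
        M≡ = subst (λ Q → fromℕ M ≡ ∑ (range 2 (k ∸ 1)) (λ r → ∑ (divisors (gcd (suc r) l)) (λ u → fromℕ (count (_∈ᴾ? chosen r u) * fall Q (Q ^ k) 0 (suc r)))))
               order-subfield (count-coefficients ε fam)
        size-V : Finite.size (Space.finiteᴹ V) ≡ q ^ (m * l)
        size-V = trans (size-Vec m) (trans (ℕ.^-*-assoc q l m) (cong (q ^_) (ℕ.*-comm l m)))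
        counted : (q ^ l ∸ 1) * (fall q (q ^ k) 2 n * c) ≡ (q ^ l ∸ 1) * (ε * fall (q ^ l) (q ^ (m * l)) 2 n) + M * fall (q ^ l) (q ^ (m * l)) 2 (n ∸ 1)
        counted = begin
          (q ^ l ∸ 1) * (fall q (q ^ k) 2 n * c)
            ≡⟨ cong (λ Q → (q ^ l ∸ 1) * (fall Q (Q ^ k) 2 n * c)) (sym order-subfield) ⟩
          (q ^ l ∸ 1) * (fall (Subfield.order subfield) (Subfield.order subfield ^ k) 2 n * c)
            ≡⟨ count-through subfield n adm V indep ⟩
          (q ^ l ∸ 1) * (ind (Admissible.decide adm (zeros k)) * fall (q ^ l) X 2 n) + M * fall (q ^ l) X 2 (n ∸ 1)
            ≡⟨ cong₂ (λ i X → (q ^ l ∸ 1) * (i * fall (q ^ l) X 2 n) + M * fall (q ^ l) X 2 (n ∸ 1)) (ind-zeros ε fam ε≡) size-V ⟩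
          (q ^ l ∸ 1) * (ε * fall (q ^ l) (q ^ (m * l)) 2 n) + M * fall (q ^ l) (q ^ (m * l)) 2 (n ∸ 1) ∎
          where
          open ≡-Reasoning
          X = Finite.size (Space.finiteᴹ V)

theorem5p4 : (q m l k : ℕ) →
    IsPrimePower q →
    1 ≤ m → 1 ≤ l → 1 ≤ k →
    3 ≤ k → k ≤ (m + 1) ⊓ l →
    (F E : Field) → HasOrder F q → HasOrder E (q ^ l) →
    (ι : FieldHom F E) →
    (ε : ℕ) → ε ≡ 0 ⊎ ε ≡ 1 →
    (w : ℕ → ℕ → ℕ) →
    (∀ r u → 2 ≤ r → r ≤ k ∸ 1 → u ∣ gcd (suc r) l →
    fromℕ (w r u) ≤ℚ n[ q , l , suc r , u ]) →
    (K : Pred ℕ 0ℓ) (Λ : ℕ) →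
    fromℕ Λ ≡ λ-value q m l k w ε →
    (D : qPBD F (extension ι) l K Λ) → Admits F (extension ι) D (SingerCycle ι) →
    Σ[ D′ ∈ qPBD F (extensionPower ι m) (m * l) (K ∪ ｛ k ｝) Λ ]
    (Admits F (extensionPower ι m) D′ (GLₘ ι m) ×
    (IsSimple F (extension ι) D → IsSimple F (extensionPower ι m) D′))
theorem5p4 q m l k (p , e , prime-p , 1≤e , refl) 1≤m 1≤l 1≤k 3≤k k≤ F E order-F order-E ι ε ε≡ w bound K Λ Λ≡ D admits =
  -- Two of the k basis vectors of a block are spent on a basis of the subspace to be covered;
  -- `k ∸ 2` vectors are left to count.
  with-family fam (k ∸ 2) (trans (sym (ℕ.m+[n∸m]≡n (ℕ.<⇒≤ 3≤k))) (ℕ.+-comm 2 (k ∸ 2)))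
  where
  open Bridge {F} {E} order-F order-E ι using (subfield; order-subfield; finiteField)
  fam : Families.Family finiteField subfield k l w
  fam = Families.family finiteField subfield p e l k prime-p 1≤l order-subfield refl 3≤k (ℕ.≤-trans k≤ (ℕ.m⊓n≤n (m + 1) l)) w bound
  with-family : Families.Family finiteField subfield k l w → ∀ n → k ≡ n + 2 →
    Σ[ D′ ∈ qPBD F (extensionPower ι m) (m * l) (K ∪ ｛ k ｝) Λ ]
    (Admits F (extensionPower ι m) D′ (GLₘ ι m) ×
    (IsSimple F (extension ι) D → IsSimple F (extensionPower ι m) D′))
  with-family fam n refl = Construction.extension-theorem {F} {E} {q} {l} order-F order-E ι D admits m n {Families.Coefficients finiteField {subfield} {n + 2} {l} {w} ε fam} (Families.admissible finiteField {subfield} {n + 2} {l} {w} ε fam)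
    (Conclusion.through-number {F} {E} {q} {l} order-F order-E ι {n} {m} 1≤l (ℕ.≤-trans k≤ (ℕ.m⊓n≤m (m + 1) l)) {ε} ε≡ {w} fam {K} {Λ} (Construction.design {F} {E} {q} {l} order-F order-E ι D admits) Λ≡)
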